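{- Let $n,m,b\in\mathbb{Z}$ with $n\ge 3$, $|m|\ge 2$ and $b\ge 2$. Assume that $\gcd(b,m)=1$ and that $b$ is squarefree. Let $$\mathcal{D}:=\frac{n^n(1-bm^{2n})^{n+1}+bm^{2n}(n+1)^{n+1}}{(1+bm^{2n}n)^2}\in\mathbb{Z},$$ and assume that $$d:=\frac{|\mathcal{D}|}{\prod_{p\text{ prime},\ p\mid bm}p^{\nu_p(\mathcal{D})}}$$ is squarefree. Then the polynomial $$\mathcal{F}_{n,b,m,1}(x)=x^n+b\sum_{j=1}^{n}(m^2x)^{n-j}$$ is monogenic if and only if both of the following hold: (1) no odd prime divisor of $\gcd(n,m)$ is a base-$b$ Wieferich prime; and (2) if $\gcd(n,m)\equiv 0\pmod 2$, then $b\equiv 1\pmod 4$ (equivalently, $2$ is a base-$b$ Wieferich prime).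
   Context: For an integer $b\ge 2$, a prime $p\ge 2$ is called a base-$b$ Wieferich prime if $b^{p-1}\equiv 1\pmod{p^2}$. A monic polynomial $f(x)\in\mathbb{Z}[x]$ is called monogenic if $f(x)$ is irreducible over $\mathbb{Q}$ and $\{1,\theta,\theta^2,\ldots,\theta^{\deg(f)-1}\}$ is a basis (over $\mathbb{Z}$) for the ring of integers of $\mathbb{Q}(\theta)$, where $f(\theta)=0$. Here $\nu_p(z)$ denotes the $p$-adic valuation of the integer $z$. The quantity $\mathcal{D}$ is always an integer. In the sum, the term $j=n$ is $(m^2x)^0=1$. -}

module Defs where

open import Algebra.Bundles.Raw using (RawRing)
import Algebra.Definitions.RawSemiring as RawSemiringDefs
open import Data.Fin.Base using (Fin; toℕ)
open import Data.Integer.Base as ℤ using (ℤ; +_; -[1+_]; 0ℤ; 1ℤ)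
import Data.Integer.Divisibility as ℤ
import Data.Integer.Divisibility.Signed as Signed
import Data.Integer.DivMod as ℤ
import Data.Integer.Properties as ℤ
open import Data.Integer.Tactic.RingSolver using (solve-∀)
open import Data.List.Base using (List; []; _∷_; map; filter; upTo)
open import Data.List.Relation.Unary.All as All using (All)
open import Data.List.Relation.Unary.All.Properties using (all-filter; map⁺)
open import Data.Nat.Base as ℕ using (ℕ; zero; suc; NonZero; _∸_)
open import Data.Nat.Divisibility using (_∣_; _∣?_; >⇒∤)
open import Data.Nat.ListAction using (product)
open import Data.Nat.ListAction.Properties using (product≢0)
open import Data.Nat.Primality using (Prime; prime?; prime⇒nonZero)
import Data.Nat.Properties as ℕ
open import Data.Product.Base using (_×_; _,_; ∃-syntax; proj₁)
open import Data.Rational.Base as ℚ using (ℚ)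
open import Data.Vec.Functional using (Vector)
open import Level using (Level; 0ℓ; _⊔_)
open import Relation.Binary.PropositionalEquality
open import Relation.Nullary.Negation using (contradiction)
open import Relation.Nullary.Decidable using (yes; no; _×-dec_)
open import Relation.Unary using (Pred; Decidable)

private
  variable
    c ℓ p : Level

------------------------------------------------------------------------
-- Polynomials

-- The list a₀ ∷ a₁ ∷ … ∷ [] stands for a₀ + a₁x + …; trailing zeros are
-- allowed, so equality compares coefficients.

module Polynomial (R : RawRing c ℓ) where
  open RawRing R

  coeff : List Carrier → ℕ → Carrier
  coeff []       _       = 0#
  coeff (a ∷ _)  zero    = a
  coeff (_ ∷ as) (suc i) = coeff as i

  _≈ᴾ_ : List Carrier → List Carrier → Set ℓ
  f ≈ᴾ g = ∀ i → coeff f i ≈ coeff g i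

  _+ᴾ_ : List Carrier → List Carrier → List Carrier
  []       +ᴾ g        = g
  (a ∷ f)  +ᴾ []       = a ∷ f
  (a ∷ f)  +ᴾ (b ∷ g)  = (a + b) ∷ (f +ᴾ g)

  _*ᴾ_ : List Carrier → List Carrier → List Carrier
  []      *ᴾ g = []
  (a ∷ f) *ᴾ g = map (a *_) g +ᴾ (0# ∷ (f *ᴾ g))

  rawRing : RawRing c ℓ
  rawRing = record
    { Carrier = List Carrier
    ; _≈_     = _≈ᴾ_
    ; _+_     = _+ᴾ_
    ; _*_     = _*ᴾ_
    ; -_      = map (-_)
    ; 0#      = []
    ; 1#      = 1# ∷ []
    }

  C : Carrier → List Carrier
  C a = a ∷ []

  X : List Carrier
  X = 0# ∷ 1# ∷ []

  MonicOfDegree : ℕ → List Carrier → Set ℓ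
  MonicOfDegree n f = coeff f n ≈ 1# × (∀ i → n ℕ.< i → coeff f i ≈ 0#)

ℤ[X] ℚ[X] : RawRing 0ℓ 0ℓ
ℤ[X] = Polynomial.rawRing ℤ.+-*-rawRing
ℚ[X] = Polynomial.rawRing ℚ.+-*-rawRing

module ℤ[X] where
  open Polynomial ℤ.+-*-rawRing public using (C; X; MonicOfDegree)
  open RawRing ℤ[X] public
  open RawSemiringDefs rawSemiring public using (_^_; sum)

module ℚ[X] where
  open Polynomial ℚ.+-*-rawRing public using (X)
  open RawRing ℚ[X] public
  open RawSemiringDefs rawSemiring public using (_∣_; Irreducible)

toℚ[X] : ℤ[X].Carrier → ℚ[X].Carrier
toℚ[X] = map (ℚ._/ 1)

------------------------------------------------------------------------
-- Integral elements and ℤ-bases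

module Integrality (K : RawRing c ℓ) where
  open RawRing K
  open RawSemiringDefs rawSemiring using (sum) renaming (_×_ to _·_)

  ι : ℤ → Carrier
  ι (+ k)    = k · 1#
  ι -[1+ k ] = - (suc k · 1#)

  eval : ℤ[X].Carrier → Carrier → Carrier
  eval []      α = 0#
  eval (a ∷ g) α = ι a + α * eval g α

  Integral : Pred Carrier ℓ
  Integral α = ∃[ d ] ∃[ g ] ℤ[X].MonicOfDegree d g × eval g α ≈ 0#

  combination : ∀ {n} → Vector ℤ n → Vector Carrier n → Carrier
  combination a v = sum (λ i → ι (a i) * v i)

  record IsℤBasis (S : Pred Carrier p) {n} (v : Vector Carrier n) : Set (c ⊔ ℓ ⊔ p) where
    field
      members     : ∀ i → S (v i)
      spanning    : ∀ α → S α → ∃[ a ] α ≈ combination a v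
      independent : ∀ a → combination a v ≈ 0# → ∀ i → a i ≡ 0ℤ

------------------------------------------------------------------------
-- Monogenic polynomials

-- The ring ℚ[x]/(f). For irreducible f this is the field ℚ(θ) with
-- f(θ) = 0, where θ is the class of x.

ℚ[X]/_ : ℚ[X].Carrier → RawRing 0ℓ 0ℓ
ℚ[X]/ f = record
  { Carrier = ℚ[X].Carrier
  ; _≈_     = λ α β → f ℚ[X].∣ (α ℚ[X].+ (ℚ[X].- β))
  ; _+_     = ℚ[X]._+_
  ; _*_     = ℚ[X]._*_
  ; -_      = ℚ[X].-_
  ; 0#      = ℚ[X].0#
  ; 1#      = ℚ[X].1#
  }

record Monogenic (f : ℤ[X].Carrier) : Set where
  private
    K = ℚ[X]/ (toℚ[X] f)
    θ = ℚ[X].X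
  open RawSemiringDefs (RawRing.rawSemiring K) using (_^_)
  open Integrality K using (Integral; IsℤBasis)
  field
    degree      : ℕ
    monic       : ℤ[X].MonicOfDegree degree f
    irreducible : ℚ[X].Irreducible (toℚ[X] f)
    powerBasis  : IsℤBasis Integral {degree} (λ i → θ ^ toℕ i)

------------------------------------------------------------------------
-- Arithmetic

infix 4 _≡_[mod_]

_≡_[mod_] : ℤ → ℤ → ℕ → Set
x ≡ y [mod k ] = + k ℤ.∣ x ℤ.- y

Squarefree : ℕ → Set
Squarefree n = ∀ k → k ℕ.* k ∣ n → k ≡ 1

WieferichPrime : ℕ → ℕ → Set
WieferichPrime b p = Prime p × (+ b) ℤ.^ (p ∸ 1) ≡ 1ℤ [mod p ℕ.^ 2 ]

-- The largest k ≤ bound with pᵏ ∣ z.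
maxExponent : (bound p z : ℕ) → ℕ
maxExponent zero    p z = 0
maxExponent (suc k) p z with p ℕ.^ suc k ∣? z
... | yes _ = suc k
... | no  _ = maxExponent k p z

-- The p-adic valuation of z, for p ≥ 2 and z ≠ 0: the bound ∣ z ∣ is large
-- enough since k < pᵏ.
ν : ℕ → ℤ → ℕ
ν p z = maxExponent ℤ.∣ z ∣ p ℤ.∣ z ∣

PrimeDivisor : ℤ → Pred ℕ 0ℓ
PrimeDivisor z p = Prime p × p ∣ ℤ.∣ z ∣

primeDivisor? : ∀ z → Decidable (PrimeDivisor z)
primeDivisor? z p = prime? p ×-dec (p ∣? ℤ.∣ z ∣)

-- The prime divisors of z ≠ 0, each listed once.
primeDivisors : ℤ → List ℕ
primeDivisors z = filter (primeDivisor? z) (upTo (suc ℤ.∣ z ∣))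

-- ∏ p^ν_p(w) over the primes p dividing z.
part : (z w : ℤ) → ℕ
part z w = product (map (λ p → p ℕ.^ ν p w) (primeDivisors z))

part-nonZero : ∀ z w → NonZero (part z w)
part-nonZero z w = product≢0 (map⁺ (All.map power-nonZero (all-filter (primeDivisor? z) (upTo (suc ℤ.∣ z ∣)))))
  where
  power-nonZero : ∀ {p} → PrimeDivisor z p → NonZero (p ℕ.^ ν p w)
  power-nonZero {p} (p-prime , _) = ℕ.m^n≢0 p (ν p w) {{prime⇒nonZero p-prime}}

------------------------------------------------------------------------
-- Exactness of the division defining 𝒟

module _ where
  open import Data.Integer.Base using (_+_; _*_; _-_; _^_; _/_; _%_; ∣_∣)

  /-exact : ∀ i j .{{_ : ℤ.NonZero j}} → j Signed.∣ i → (i / j) * j ≡ i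
  /-exact i j (Signed.divides q i≡qj) = sym (begin
    i                          ≡⟨ ℤ.a≡a%n+[a/n]*n i j ⟩
    + (i % j) + (i / j) * j    ≡⟨ cong (λ r → + r + (i / j) * j) i%j≡0 ⟩
    0ℤ + (i / j) * j           ≡⟨ ℤ.+-identityˡ _ ⟩
    (i / j) * j                ∎)
    where
    open ≡-Reasoning

    cancel : ∀ r s t → r ≡ r + s * t - s * t
    cancel = solve-∀

    factor : ∀ s t q → q * t - s * t ≡ (q - s) * t
    factor = solve-∀

    remainder : + (i % j) ≡ (q - i / j) * j
    remainder = begin
      + (i % j)                                ≡⟨ cancel _ (i / j) j ⟩
      + (i % j) + (i / j) * j - (i / j) * j    ≡⟨ cong (_- (i / j) * j) (ℤ.a≡a%n+[a/n]*n i j) ⟨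
      i - (i / j) * j                          ≡⟨ cong (_- (i / j) * j) i≡qj ⟩
      q * j - (i / j) * j                      ≡⟨ factor (i / j) j q ⟩
      (q - i / j) * j                          ∎

    small-multiple : ∀ r → r ℕ.< ∣ j ∣ → ∣ j ∣ ∣ r → r ≡ 0
    small-multiple zero    _   _   = refl
    small-multiple (suc r) r<j j∣r = contradiction j∣r (>⇒∤ r<j)

    i%j≡0 : i % j ≡ 0
    i%j≡0 = small-multiple _ (ℤ.n%d<d i j)
      (Signed.∣⇒∣ᵤ (Signed.divides (q - i / j) remainder))

  module _ (N y : ℤ) where
    private
      A = N + 1ℤ
      u = 1ℤ + y * N

    -- N(1 - y) = A - u, expanded to first order in u.
    power-expansion : ∀ k → ∃[ K ]
      N ^ suc k * (1ℤ - y) ^ suc k ≡ A ^ suc k - + suc k * A ^ k * u + K * u ^ 2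
    power-expansion zero = 0ℤ , base N y
      where
      base : ∀ N y → (N * 1ℤ) * ((1ℤ - y) * 1ℤ)
        ≡ (N + 1ℤ) * 1ℤ - 1ℤ * 1ℤ * (1ℤ + y * N) + 0ℤ * ((1ℤ + y * N) * ((1ℤ + y * N) * 1ℤ))
      base = solve-∀
    power-expansion (suc k) with K , eq ← power-expansion k =
        A * K + + suc k * A ^ k - u * K , (begin
      (N * N ^ suc k) * ((1ℤ - y) * (1ℤ - y) ^ suc k)
        ≡⟨ regroup N (N ^ suc k) (1ℤ - y) ((1ℤ - y) ^ suc k) ⟩
      N * (1ℤ - y) * (N ^ suc k * (1ℤ - y) ^ suc k)
        ≡⟨ cong (N * (1ℤ - y) *_) eq ⟩
      N * (1ℤ - y) * (A ^ suc k - + suc k * A ^ k * u + K * u ^ 2)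
        ≡⟨ step N y (A ^ k) (+ suc k) K ⟩
      A ^ suc (suc k) - + suc (suc k) * A ^ suc k * u
        + (A * K + + suc k * A ^ k - u * K) * u ^ 2 ∎)
      where
      open ≡-Reasoning

      regroup : ∀ a b c d → (a * b) * (c * d) ≡ a * c * (b * d)
      regroup = solve-∀

      step : ∀ N y P c K →
        N * (1ℤ - y) * ((N + 1ℤ) * P - c * P * (1ℤ + y * N) + K * ((1ℤ + y * N) * ((1ℤ + y * N) * 1ℤ)))
        ≡ (N + 1ℤ) * ((N + 1ℤ) * P) - (1ℤ + c) * ((N + 1ℤ) * P) * (1ℤ + y * N)
          + ((N + 1ℤ) * K + c * P - (1ℤ + y * N) * K) * ((1ℤ + y * N) * ((1ℤ + y * N) * 1ℤ))
      step = solve-∀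

  numerator-divisible : ∀ n y → let N = + n; A = N + 1ℤ; u = 1ℤ + y * N in
    (u ^ 2) Signed.∣ (N ^ n * (1ℤ - y) ^ suc n + y * A ^ suc n)
  numerator-divisible n y with K , eq ← power-expansion (+ n) y n =
    Signed.divides (T - + 2 * y * u * K + y * y * N * K) (begin
      T
        ≡⟨ split N y T ⟩
      T * u ^ 2 + (N * y * y - + 2 * y * u) * (N * T)
        ≡⟨ cong (λ t → T * u ^ 2 + (N * y * y - + 2 * y * u) * t) NT ⟩
      T * u ^ 2 + (N * y * y - + 2 * y * u) * (K * u ^ 2)
        ≡⟨ collect N y T K ⟩
      (T - + 2 * y * u * K + y * y * N * K) * u ^ 2 ∎)
    where
    open ≡-Reasoning
    N = + n
    A = N + 1ℤ
    u = 1ℤ + y * N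
    T = N ^ n * (1ℤ - y) ^ suc n + y * A ^ suc n

    split : ∀ N y T →
      T ≡ T * ((1ℤ + y * N) * ((1ℤ + y * N) * 1ℤ)) + (N * y * y - + 2 * y * (1ℤ + y * N)) * (N * T)
    split = solve-∀

    distribute : ∀ N p q y a → N * (p * q + y * a) ≡ (N * p) * q + y * N * a
    distribute = solve-∀

    cancel : ∀ N y P K →
      (N + 1ℤ) * P - (1ℤ + N) * P * (1ℤ + y * N) + K * ((1ℤ + y * N) * ((1ℤ + y * N) * 1ℤ))
        + y * N * ((N + 1ℤ) * P)
      ≡ K * ((1ℤ + y * N) * ((1ℤ + y * N) * 1ℤ))
    cancel = solve-∀

    collect : ∀ N y T K →
      T * ((1ℤ + y * N) * ((1ℤ + y * N) * 1ℤ)) + (N * y * y - + 2 * y * (1ℤ + y * N)) * (K * ((1ℤ + y * N) * ((1ℤ + y * N) * 1ℤ)))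
      ≡ (T - + 2 * y * (1ℤ + y * N) * K + y * y * N * K) * ((1ℤ + y * N) * ((1ℤ + y * N) * 1ℤ))
    collect = solve-∀

    NT : N * T ≡ K * u ^ 2
    NT = begin
      N * T
        ≡⟨ distribute N (N ^ n) ((1ℤ - y) ^ suc n) y (A ^ suc n) ⟩
      N ^ suc n * (1ℤ - y) ^ suc n + y * N * A ^ suc n
        ≡⟨ cong (_+ y * N * A ^ suc n) eq ⟩
      A ^ suc n - + suc n * A ^ n * u + K * u ^ 2 + y * N * A ^ suc n
        ≡⟨ cancel N y (A ^ n) K ⟩
      K * u ^ 2 ∎

------------------------------------------------------------------------
-- The family of polynomials and the quantities 𝒟 and d

-- The Fin index i corresponds to j = i + 1 in the sum over 1 ≤ j ≤ n.
ℱ : ℕ → ℕ → ℤ → ℤ[X].Carrier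
ℱ n b m = X ^ n + C (+ b) * sum {n} (λ i → (C (m ℤ.^ 2) * X) ^ (n ∸ suc (toℕ i)))
  where open ℤ[X]

module _ (n b : ℕ) (m : ℤ) where
  open import Data.Integer.Base using (_+_; _*_; _-_; _^_; _/_; ∣_∣)

  private
    y = + b * m ^ (2 ℕ.* n)

  𝒟-numerator : ℤ
  𝒟-numerator = (+ n) ^ n * (1ℤ - + b * m ^ (2 ℕ.* n)) ^ (n ℕ.+ 1)
              + + b * m ^ (2 ℕ.* n) * (+ (n ℕ.+ 1)) ^ (n ℕ.+ 1)

  𝒟-denominator : ℤ
  𝒟-denominator = (1ℤ + + b * m ^ (2 ℕ.* n) * + n) ^ 2

  private
    square-nonNeg : ∀ z → ∃[ k ] z * z ≡ + k
    square-nonNeg (+ k)    = k ℕ.* k , sym (ℤ.pos-* k k)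
    square-nonNeg -[1+ k ] = suc k ℕ.* suc k , refl

    m²ⁿ-nonNeg : ∃[ k ] m ^ (2 ℕ.* n) ≡ + k
    m²ⁿ-nonNeg with k , eq ← square-nonNeg (m ^ n) = k , (begin
      m ^ (2 ℕ.* n)            ≡⟨ ℤ.^-distribˡ-+-* m n (n ℕ.+ 0) ⟩
      m ^ n * m ^ (n ℕ.+ 0)    ≡⟨ cong (λ e → m ^ n * m ^ e) (ℕ.+-identityʳ n) ⟩
      m ^ n * m ^ n            ≡⟨ eq ⟩
      + k                      ∎)
      where open ≡-Reasoning

    root-positive : ∃[ k ] 1ℤ + y * + n ≡ + suc k
    root-positive with k , eq ← m²ⁿ-nonNeg = b ℕ.* k ℕ.* n , (begin
      1ℤ + + b * m ^ (2 ℕ.* n) * + n ≡⟨ cong (λ t → 1ℤ + + b * t * + n) eq ⟩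
      1ℤ + + b * + k * + n           ≡⟨ cong (λ t → 1ℤ + t * + n) (ℤ.pos-* b k) ⟨
      1ℤ + + (b ℕ.* k) * + n         ≡⟨ cong (ℤ._+_ 1ℤ) (ℤ.pos-* (b ℕ.* k) n) ⟨
      + suc (b ℕ.* k ℕ.* n)          ∎)
      where open ≡-Reasoning

  instance
    𝒟-denominator-nonZero : ℤ.NonZero 𝒟-denominator
    𝒟-denominator-nonZero with k , eq ← root-positive rewrite eq = _

  -- _/_ on ℤ is floor division; 𝒟-exact shows that nothing is lost.
  𝒟 : ℤ
  𝒟 = 𝒟-numerator / 𝒟-denominator

  𝒟-exact : 𝒟 * 𝒟-denominator ≡ 𝒟-numerator
  𝒟-exact = /-exact 𝒟-numerator 𝒟-denominator divisible
    where
    divisible : 𝒟-denominator Signed.∣ 𝒟-numerator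
    divisible rewrite ℕ.+-comm n 1 = subst
      (λ a → 𝒟-denominator Signed.∣ ((+ n) ^ n * (1ℤ - y) ^ suc n + y * a ^ suc n))
      (ℤ.+-comm (+ n) 1ℤ) (numerator-divisible n y)

  -- Exact as well: the product consists of powers of distinct primes, each
  -- dividing 𝒟.
  d : ℕ
  d = (∣ 𝒟 ∣ ℕ./ part (+ b * m) 𝒟) {{part-nonZero (+ b * m) 𝒟}}

{-# OPTIONS --safe #-}
-- Maximality of ℤ[θ] is tested one prime q at a time by Dedekind's criterion,
-- whose proof is elementwise: if f = g h + q F with g the radical of f modulo q
-- and g, h, F comaximal modulo q, then an element γ / q integral over ℤ already
-- lies in ℤ[θ].  Gaussian elimination over ℤ[t] produces a monic equation for an
-- element stabilising a finitely generated module.  Irreducibility is Eisenstein's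
-- criterion at a prime of b.
--
-- For q ∣ b take g = x.  For q ∣ m one has f ≡ xⁿ + b mod q²; with n = Q n', Q the
-- q-part of n, and g = x^n' + b, the criterion holds iff Q = 1 or q² ∤ (-b)^Q + b, and
-- the latter is the negated Wieferich condition.  For q ∤ b m the identity
-- (z - 1) f = z xⁿ - (1 - y) xⁿ - b with z = m² x and y = b m²ⁿ shows that f modulo q
-- is separable unless q ∣ 𝒟, and that it has exactly one multiple root x₀, a double
-- one, if q divides 𝒟 exactly once; then g is f divided by x - x₀ and f (x₀) is not
-- divisible by q².  Conversely, if q ∣ gcd (n , m) and q² ∣ (-b)^q + b, put n' = n / q
-- and write xⁿ - (-b)^q = g h; then h / q is a root of a monic quadratic over ℤ[θ]
-- but is not in ℤ[θ].
module Submission where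

open import Defs
open import Algebra.Bundles using (CommutativeRing; RawRing)
open import Algebra.Definitions.RawMagma using (_,_; module _∣ʳ_)
import Algebra.Definitions.RawSemiring as RawSemiringDefs
import Algebra.Properties.CommutativeSemiring.Binomial as BinomialTheorem
import Algebra.Properties.CommutativeSemiring.Exp as ExpProperties
import Algebra.Properties.Group as GroupProperties
import Algebra.Properties.Ring as RingProperties
import Algebra.Properties.Semiring.Exp as SemiringExp
import Algebra.Properties.Semiring.Mult as SemiringMult
import Algebra.Properties.Semiring.Sum as SemiringSum
import Algebra.Solver.Ring as RingSolver
open import Algebra.Solver.Ring.AlmostCommutativeRing using (_-Raw-AlmostCommutative⟶_; fromCommutativeRing)
open import Data.Empty using (⊥; ⊥-elim)
open import Data.Fin.Base as Fin using (Fin; zero; suc; toℕ)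
import Data.Fin.Properties as Fin
open import Data.Integer.Base as ℤ using (ℤ; +_; -[1+_]; 0ℤ; 1ℤ; ∣_∣)
import Data.Integer.Divisibility.Signed as ℤ
import Data.Integer.Properties as ℤ
open import Data.List.Base using (List; []; _∷_; map; length; upTo)
open import Data.List.Relation.Unary.All as All using (All; []; _∷_)
open import Data.List.Relation.Unary.All.Properties using (all-filter)
open import Data.List.Relation.Unary.Unique.Propositional using (Unique; []; _∷_)
import Data.List.Relation.Unary.Unique.Propositional.Properties as Unique
open import Data.Maybe.Base using (Maybe; just; nothing)
open import Data.Nat.Base as ℕ using (ℕ; zero; suc; z≤n; s≤s; _≤_; _!)
open import Data.Nat.Combinatorics using (_C_; nCn≡1; k![n∸k]!∣n!; nCk≡n!/k![n-k]!)
open import Data.Nat.Coprimality as Coprimality using (Coprime)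
open import Data.Nat.Divisibility as ℕ using (divides)
import Data.Nat.DivMod as ℕ
open import Data.Nat.GCD as ℕ using (gcd)
open import Data.Nat.Primality using (prime⇒irreducible; prime[2]; Prime; euclidsLemma; prime⇒nonTrivial; prime⇒nonZero)
open import Data.Nat.ListAction using (product)
open import Data.Nat.Primality.Factorisation using (PrimeFactorisation; factorise)
import Data.Nat.Properties as ℕ
open import Data.Product.Base using (_×_; _,_; ∃-syntax; proj₁; proj₂)
open import Data.Rational.Base as ℚ using (ℚ)
import Data.Rational.Properties as ℚ
open import Data.Rational.Unnormalised.Base as ℚᵘ using (mkℚᵘ; *≡*)
import Data.Rational.Unnormalised.Properties as ℚᵘ
open import Data.Sum.Base using (_⊎_; inj₁; inj₂; [_,_]′)
open import Function.Bundles using (_⇔_; mk⇔)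
open import Level using (Level; _⊔_)
open import Relation.Binary.Definitions using (tri<; tri≈; tri>)
import Relation.Binary.Reasoning.Setoid as SetoidReasoning
open import Relation.Binary.PropositionalEquality as ≡ using (_≡_; cong)
open import Relation.Nullary using (Dec; yes; no; ¬_; contradiction)

-- Neither an algebraic closure nor a resultant is used. To show that two polynomials over 𝔽_q are
-- comaximal, the ring 𝔽_q[x] / (f , g) is formed, in which the class of x is a generic common root.
-- The classical argument about a common root, carried out there, ends in 1 = 0, and unwinding the
-- quotients yields the Bézout identity. This is why the family is studied over an arbitrary
-- commutative ring and transported along homomorphisms. It also dictates the form of the
-- discriminant: (1 + y n)² may vanish in such a ring, so 𝒟 is rewritten as a polynomial expression
-- built from divided differences, and the identities are multiplied through by denominators such as
-- the a of the critical point z = w / a. Fractions γ / N are handled without a fraction field: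
-- their integrality is the vanishing of a homogenised monic polynomial in γ and N inside ℤ[θ],
-- where nonzero integers are regular because f is monic. Congruence modulo q is an equality on ℤ
-- itself, so a polynomial and its reduction are the same list.

module Ring {c ℓ : Level} (R : CommutativeRing c ℓ) where
  open CommutativeRing R public
    using ( Carrier; _≈_; _+_; _*_; -_; 0#; 1#; rawRing; setoid; semiring; commutativeSemiring
          ; refl; sym; trans; reflexive; +-cong; +-congˡ; +-congʳ; *-cong; *-congˡ; *-congʳ; -‿cong
          ; +-assoc; +-comm; +-identityˡ; +-identityʳ; -‿inverseˡ; -‿inverseʳ
          ; *-assoc; *-comm; *-identityˡ; *-identityʳ; distribˡ; distribʳ; zeroˡ; zeroʳ)
  open CommutativeRing R using (ring; +-group)
  open SemiringExp semiring public using (_^_; ^-congˡ; ^-congʳ; ^-homo-*; ^-assocʳ)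
  open ExpProperties commutativeSemiring public using (^-distrib-*)
  open RawSemiringDefs (RawRing.rawSemiring rawRing) public using (_∣_) renaming (_×_ to _·_)
  open RingProperties ring public
    using (-‿distribˡ-*; -‿distribʳ-*; -0#≈0#; -‿+-comm; -‿involutive)
  open GroupProperties +-group public using (x∙y⁻¹≈ε⇒x≈y; x≈y⇒x∙y⁻¹≈ε)
  open SemiringMult semiring public using (×-homo-+; ×1-homo-*; ×-assoc-*; ×-congʳ)
  open SetoidReasoning setoid public using (begin_; step-≈-⟩; step-≡-⟩; step-≡-⟨; _∎)
  open Integrality rawRing public using (ι; eval)

  ι-neg : ∀ z → ι (ℤ.- z) ≈ - ι z
  ι-neg (+ zero)    = sym -0#≈0#
  ι-neg (+ (suc n)) = refl
  ι-neg -[1+ n ]    = sym (-‿involutive _)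

  private
    cancel : ∀ x y z → (x + y) + - (x + z) ≈ y + - z
    cancel x y z = begin
      (x + y) + - (x + z)       ≈⟨ +-congˡ (sym (-‿+-comm x z)) ⟩
      (x + y) + (- x + - z)     ≈⟨ +-congʳ (+-comm x y) ⟩
      (y + x) + (- x + - z)     ≈⟨ +-assoc y x _ ⟩
      y + (x + (- x + - z))     ≈⟨ +-congˡ (sym (+-assoc x (- x) (- z))) ⟩
      y + ((x + - x) + - z)     ≈⟨ +-congˡ (+-congʳ (-‿inverseʳ x)) ⟩
      y + (0# + - z)            ≈⟨ +-congˡ (+-identityˡ _) ⟩
      y + - z                   ∎

  ι-⊖ : ∀ m n → ι (m ℤ.⊖ n) ≈ m · 1# + - (n · 1#)
  ι-⊖ m       zero    = begin
    m · 1#            ≈⟨ sym (+-identityʳ _) ⟩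
    m · 1# + 0#       ≈⟨ +-congˡ (sym -0#≈0#) ⟩
    m · 1# + - 0#     ∎
  ι-⊖ zero    (suc n) = sym (+-identityˡ _)
  ι-⊖ (suc m) (suc n) = begin
    ι (suc m ℤ.⊖ suc n)                 ≡⟨ cong ι (ℤ.[1+m]⊖[1+n]≡m⊖n m n) ⟩
    ι (m ℤ.⊖ n)                         ≈⟨ ι-⊖ m n ⟩
    m · 1# + - (n · 1#)                 ≈⟨ sym (cancel 1# _ _) ⟩
    (1# + m · 1#) + - (1# + n · 1#)     ∎

  ι-+ : ∀ x y → ι (x ℤ.+ y) ≈ ι x + ι y
  ι-+ (+ m)    (+ n)    = ×-homo-+ 1# m n
  ι-+ (+ m)    -[1+ n ] = ι-⊖ m (suc n)
  ι-+ -[1+ m ] (+ n)    = trans (ι-⊖ n (suc m)) (+-comm _ _)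
  ι-+ -[1+ m ] -[1+ n ] = begin
    - (suc (suc (m ℕ.+ n)) · 1#)         ≡⟨ cong (λ k → - (suc k · 1#)) (≡.sym (ℕ.+-suc m n)) ⟩
    - ((suc m ℕ.+ suc n) · 1#)           ≈⟨ -‿cong (×-homo-+ 1# (suc m) (suc n)) ⟩
    - (suc m · 1# + suc n · 1#)          ≈⟨ sym (-‿+-comm _ _) ⟩
    - (suc m · 1#) + - (suc n · 1#)      ∎

  ι-* : ∀ x y → ι (x ℤ.* y) ≈ ι x * ι y
  ι-* (+ m)    (+ n)    = begin
    ι (+ m ℤ.* + n)       ≡⟨ cong ι (≡.sym (ℤ.pos-* m n)) ⟩
    (m ℕ.* n) · 1#        ≈⟨ ×1-homo-* m n ⟩
    m · 1# * n · 1#       ∎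
  ι-* (+ m)    -[1+ n ] = begin
    ι (+ m ℤ.* -[1+ n ])           ≡⟨ cong ι (≡.sym (ℤ.neg-distribʳ-* (+ m) (+ suc n))) ⟩
    ι (ℤ.- (+ m ℤ.* + suc n))      ≈⟨ ι-neg (+ m ℤ.* + suc n) ⟩
    - ι (+ m ℤ.* + suc n)          ≈⟨ -‿cong (ι-* (+ m) (+ suc n)) ⟩
    - (m · 1# * suc n · 1#)        ≈⟨ -‿distribʳ-* _ _ ⟩
    m · 1# * - (suc n · 1#)        ∎
  ι-* -[1+ m ] (+ n)    = begin
    ι (-[1+ m ] ℤ.* + n)           ≡⟨ cong ι (≡.sym (ℤ.neg-distribˡ-* (+ suc m) (+ n))) ⟩
    ι (ℤ.- (+ suc m ℤ.* + n))      ≈⟨ ι-neg (+ suc m ℤ.* + n) ⟩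
    - ι (+ suc m ℤ.* + n)          ≈⟨ -‿cong (ι-* (+ suc m) (+ n)) ⟩
    - (suc m · 1# * n · 1#)        ≈⟨ -‿distribˡ-* _ _ ⟩
    - (suc m · 1#) * n · 1#        ∎
  ι-* -[1+ m ] -[1+ n ] = begin
    (suc m ℕ.* suc n) · 1#             ≈⟨ ×1-homo-* (suc m) (suc n) ⟩
    suc m · 1# * suc n · 1#            ≈⟨ sym (-‿involutive _) ⟩
    - - (suc m · 1# * suc n · 1#)      ≈⟨ -‿cong (-‿distribˡ-* _ _) ⟩
    - (- (suc m · 1#) * suc n · 1#)    ≈⟨ -‿distribʳ-* _ _ ⟩
    - (suc m · 1#) * - (suc n · 1#)    ∎

  ι-1 : ι 1ℤ ≈ 1#
  ι-1 = +-identityʳ 1#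

  private
    -- ι with 1ℤ sent to 1# itself, so that con 1ℤ means 1# to the solver.
    κ : ℤ → Carrier
    κ (+ 1) = 1#
    κ z     = ι z

    κ≈ι : ∀ z → κ z ≈ ι z
    κ≈ι (+ zero)        = refl
    κ≈ι (+ 1)           = sym ι-1
    κ≈ι (+ suc (suc _)) = refl
    κ≈ι -[1+ _ ]        = refl

    κ-homo₂ : ∀ z x y (_∙_ : Carrier → Carrier → Carrier) → (∀ {a b c d} → a ≈ b → c ≈ d → (a ∙ c) ≈ (b ∙ d)) →
              ι z ≈ (ι x ∙ ι y) → κ z ≈ (κ x ∙ κ y)
    κ-homo₂ z x y _∙_ ∙-cong e = trans (κ≈ι z) (trans e (sym (∙-cong (κ≈ι x) (κ≈ι y))))

    morphism : ℤ.+-*-rawRing -Raw-AlmostCommutative⟶ fromCommutativeRing R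
    morphism = record
      { ⟦_⟧    = κ
      ; +-homo = λ x y → κ-homo₂ (x ℤ.+ y) x y _+_ +-cong (ι-+ x y)
      ; *-homo = λ x y → κ-homo₂ (x ℤ.* y) x y _*_ *-cong (ι-* x y)
      ; -‿homo = λ x → trans (κ≈ι (ℤ.- x)) (trans (ι-neg x) (-‿cong (sym (κ≈ι x))))
      ; 0-homo = refl
      ; 1-homo = refl
      }

    κ-≟ : ∀ x y → Maybe (κ x ≈ κ y)
    κ-≟ x y with x ℤ.≟ y
    ... | yes x≡y = just (reflexive (cong κ x≡y))
    ... | no  _   = nothing

  open RingSolver ℤ.+-*-rawRing (fromCommutativeRing R) morphism κ-≟ public
    using (solve; con; _:=_; _:+_; _:*_; _:-_; :-_; _:^_)

  1^n≈1 : ∀ n → 1# ^ n ≈ 1#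
  1^n≈1 zero    = refl
  1^n≈1 (suc n) = trans (*-identityˡ _) (1^n≈1 n)

  a-0≈a : ∀ x → x + - 0# ≈ x
  a-0≈a x = trans (+-congˡ -0#≈0#) (+-identityʳ x)

-- Quotient rings and polynomial rings over a commutative ring.

module Quotient {c ℓ : Level} (R : CommutativeRing c ℓ) (f : CommutativeRing.Carrier R) where
  open Ring R
    using (*-assoc; *-comm; *-cong; *-congˡ; *-identityʳ; *-identityˡ; +-assoc; +-comm; +-cong; +-identityʳ
          ; +-identityˡ; -_; -‿+-comm; -‿cong; -‿distribˡ-*; -‿inverseʳ; -‿inverseˡ; 0#; 1#; :-_; Carrier; _*_
          ; _+_; _:*_; _:+_; _:-_; _:=_; _∎; _∣_; _≈_; a-0≈a; begin_; distribʳ; distribˡ; refl; solve; step-≈-⟩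
          ; sym; trans; x≈y⇒x∙y⁻¹≈ε; zeroˡ)

  infix 4 _≋_
  -- A record, so that both sides can be recovered from the type by unification; the bare
  -- divisibility statement computes and forgets them.
  record _≋_ (x y : Carrier) : Set (c ⊔ ℓ) where
    constructor mod
    field difference : f ∣ (x + - y)

  ≈⇒≋ : ∀ {x y} → x ≈ y → x ≋ y
  ≈⇒≋ {x} {y} x≈y = mod (0# , (begin
    0# * f      ≈⟨ zeroˡ f ⟩
    0#          ≈⟨ sym (x≈y⇒x∙y⁻¹≈ε x≈y) ⟩
    x + - y     ∎))

  private
    ≋-sym : ∀ {x y} → x ≋ y → y ≋ x
    ≋-sym {x} {y} (mod (q , e)) = mod (- q , (begin
      - q * f        ≈⟨ sym (-‿distribˡ-* q f) ⟩
      - (q * f)      ≈⟨ -‿cong e ⟩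
      - (x + - y)    ≈⟨ solve 2 (λ x y → :- (x :+ :- y) := y :+ :- x) refl x y ⟩
      y + - x        ∎))

    ≋-trans : ∀ {x y z} → x ≋ y → y ≋ z → x ≋ z
    ≋-trans {x} {y} {z} (mod (q , e)) (mod (r , e')) = mod (q + r , (begin
      (q + r) * f                ≈⟨ distribʳ f q r ⟩
      q * f + r * f              ≈⟨ +-cong e e' ⟩
      (x + - y) + (y + - z)      ≈⟨ solve 3 (λ x y z → (x :+ :- y) :+ (y :+ :- z) := x :+ :- z) refl x y z ⟩
      x + - z                    ∎))

    +-cong′ : ∀ {x y u v} → x ≋ y → u ≋ v → x + u ≋ y + v
    +-cong′ {x} {y} {u} {v} (mod (q , e)) (mod (r , e')) = mod (q + r , (begin
      (q + r) * f                ≈⟨ distribʳ f q r ⟩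
      q * f + r * f              ≈⟨ +-cong e e' ⟩
      (x + - y) + (u + - v)      ≈⟨ solve 4 (λ x y u v → (x :+ :- y) :+ (u :+ :- v) := (x :+ u) :+ :- (y :+ v)) refl x y u v ⟩
      (x + u) + - (y + v)        ∎))

    *-cong′ : ∀ {x y u v} → x ≋ y → u ≋ v → x * u ≋ y * v
    *-cong′ {x} {y} {u} {v} (mod (q , e)) (mod (r , e')) = mod (u * q + y * r , (begin
      (u * q + y * r) * f             ≈⟨ solve 5 (λ u q y r f → (u :* q :+ y :* r) :* f := u :* (q :* f) :+ y :* (r :* f)) refl u q y r f ⟩
      u * (q * f) + y * (r * f)       ≈⟨ +-cong (*-congˡ e) (*-congˡ e') ⟩
      u * (x + - y) + y * (u + - v)   ≈⟨ solve 4 (λ x y u v → u :* (x :+ :- y) :+ y :* (u :+ :- v) := (x :* u) :+ :- (y :* v)) refl x y u v ⟩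
      x * u + - (y * v)               ∎))

    -‿cong′ : ∀ {x y} → x ≋ y → - x ≋ - y
    -‿cong′ {x} {y} (mod (q , e)) = mod (- q , (begin
      - q * f        ≈⟨ sym (-‿distribˡ-* q f) ⟩
      - (q * f)      ≈⟨ -‿cong e ⟩
      - (x + - y)    ≈⟨ sym (-‿+-comm x (- y)) ⟩
      - x + - - y    ∎))

  quotientRing : CommutativeRing c (c ⊔ ℓ)
  quotientRing = record
    { Carrier = Carrier
    ; _≈_ = _≋_
    ; _+_ = _+_
    ; _*_ = _*_
    ; -_ = -_
    ; 0# = 0#
    ; 1# = 1#
    ; isCommutativeRing = record
      { isRing = record
        { +-isAbelianGroup = record
          { isGroup = record
            { isMonoid = record
              { isSemigroup = record
                { isMagma = record
                  { isEquivalence = record { refl = ≈⇒≋ refl ; sym = ≋-sym ; trans = ≋-trans }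
                  ; ∙-cong = +-cong′
                  }
                ; assoc = λ x y z → ≈⇒≋ (+-assoc x y z)
                }
              ; identity = (λ x → ≈⇒≋ (+-identityˡ x)) , (λ x → ≈⇒≋ (+-identityʳ x))
              }
            ; inverse = (λ x → ≈⇒≋ (-‿inverseˡ x)) , (λ x → ≈⇒≋ (-‿inverseʳ x))
            ; ⁻¹-cong = -‿cong′
            }
          ; comm = λ x y → ≈⇒≋ (+-comm x y)
          }
        ; *-cong = *-cong′
        ; *-assoc = λ x y z → ≈⇒≋ (*-assoc x y z)
        ; *-identity = (λ x → ≈⇒≋ (*-identityˡ x)) , (λ x → ≈⇒≋ (*-identityʳ x))
        ; distrib = (λ x y z → ≈⇒≋ (distribˡ x y z)) , (λ x y z → ≈⇒≋ (distribʳ x y z))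
        }
      ; *-comm = λ x y → ≈⇒≋ (*-comm x y)
      }
    }

  ∣⇒≋0 : ∀ {x} → f ∣ x → x ≋ 0#
  ∣⇒≋0 {x} (q , e) = mod (q , trans e (sym (a-0≈a x)))

  ≋0⇒∣ : ∀ {x} → x ≋ 0# → f ∣ x
  ≋0⇒∣ {x} (mod (q , e)) = q , trans e (a-0≈a x)

module Poly {c ℓ : Level} (A : CommutativeRing c ℓ) where
  private module A = Ring A
            using (*-assoc; *-comm; *-cong; *-congʳ; *-congˡ; *-identityˡ; +-assoc; +-comm; +-cong; +-congʳ
                  ; +-congˡ; +-identityʳ; +-identityˡ; -0#≈0#; -_; -‿cong; -‿inverseʳ; 0#; 1#; Carrier; _*_; _+_
                  ; _:+_; _:=_; _∎; _≈_; begin_; distribʳ; distribˡ; rawRing; refl; solve; step-≈-⟩; sym; trans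
                  ; zeroʳ; zeroˡ)
  open A using () renaming (Carrier to K)
  open Polynomial A.rawRing public hiding (rawRing)

  infix 4 _≅_
  record _≅_ (f g : List K) : Set ℓ where
    constructor coeffwise
    field at : ∀ i → coeff f i A.≈ coeff g i
  open _≅_ public

  private
    P : Set c
    P = List K

    infixl 6 _⊕_
    infixl 7 _⊗_
    _⊕_ _⊗_ : P → P → P
    _⊕_ = _+ᴾ_
    _⊗_ = _*ᴾ_

    infixr 7 _◃_
    _◃_ : K → P → P
    a ◃ f = map (a A.*_) f

    neg : P → P
    neg = map (A.-_)

  coeff-+ : ∀ f g i → coeff (f +ᴾ g) i A.≈ coeff f i A.+ coeff g i
  coeff-+ []      g       i       = A.sym (A.+-identityˡ _)
  coeff-+ (a ∷ f) []      i       = A.sym (A.+-identityʳ _)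
  coeff-+ (a ∷ f) (b ∷ g) zero    = A.refl
  coeff-+ (a ∷ f) (b ∷ g) (suc i) = coeff-+ f g i

  coeff-◃ : ∀ a f i → coeff (map (a A.*_) f) i A.≈ a A.* coeff f i
  coeff-◃ a []      i       = A.sym (A.zeroʳ a)
  coeff-◃ a (b ∷ f) zero    = A.refl
  coeff-◃ a (b ∷ f) (suc i) = coeff-◃ a f i

  coeff-neg : ∀ f i → coeff (map (A.-_) f) i A.≈ A.- coeff f i
  coeff-neg []      i       = A.sym A.-0#≈0#
  coeff-neg (b ∷ f) zero    = A.refl
  coeff-neg (b ∷ f) (suc i) = coeff-neg f i

  private
    ≅-refl : ∀ {f} → f ≅ f
    ≅-refl = coeffwise λ i → A.refl

    ≅-sym : ∀ {f g} → f ≅ g → g ≅ f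
    ≅-sym e = coeffwise λ i → A.sym (at e i)

    ≅-trans : ∀ {f g h} → f ≅ g → g ≅ h → f ≅ h
    ≅-trans e e' = coeffwise λ i → A.trans (at e i) (at e' i)

    ⊕-cong : ∀ {f f' g g'} → f ≅ f' → g ≅ g' → f ⊕ g ≅ f' ⊕ g'
    ⊕-cong {f} {f'} {g} {g'} e e' = coeffwise λ i →
      A.trans (coeff-+ f g i) (A.trans (A.+-cong (at e i) (at e' i)) (A.sym (coeff-+ f' g' i)))

    ⊕-assoc : ∀ f g h → (f ⊕ g) ⊕ h ≅ f ⊕ (g ⊕ h)
    ⊕-assoc f g h = coeffwise λ i → A.begin
      coeff ((f ⊕ g) ⊕ h) i                          A.≈⟨ coeff-+ (f ⊕ g) h i ⟩
      coeff (f ⊕ g) i A.+ coeff h i                  A.≈⟨ A.+-congʳ (coeff-+ f g i) ⟩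
      (coeff f i A.+ coeff g i) A.+ coeff h i        A.≈⟨ A.+-assoc _ _ _ ⟩
      coeff f i A.+ (coeff g i A.+ coeff h i)        A.≈⟨ A.+-congˡ (A.sym (coeff-+ g h i)) ⟩
      coeff f i A.+ coeff (g ⊕ h) i                  A.≈⟨ A.sym (coeff-+ f (g ⊕ h) i) ⟩
      coeff (f ⊕ (g ⊕ h)) i                          A.∎

    ⊕-comm : ∀ f g → f ⊕ g ≅ g ⊕ f
    ⊕-comm f g = coeffwise λ i → A.trans (coeff-+ f g i) (A.trans (A.+-comm _ _) (A.sym (coeff-+ g f i)))

    ⊕-identityʳ : ∀ f → f ⊕ [] ≅ f
    ⊕-identityʳ f = coeffwise λ i → A.trans (coeff-+ f [] i) (A.+-identityʳ _)

    neg-cong : ∀ {f g} → f ≅ g → neg f ≅ neg g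
    neg-cong {f} {g} e = coeffwise λ i → A.trans (coeff-neg f i) (A.trans (A.-‿cong (at e i)) (A.sym (coeff-neg g i)))

    ⊕-inverseʳ : ∀ f → f ⊕ neg f ≅ []
    ⊕-inverseʳ f = coeffwise λ i → A.trans (coeff-+ f (neg f) i) (A.trans (A.+-congˡ (coeff-neg f i)) (A.-‿inverseʳ _))

    ◃-cong : ∀ {a b f g} → a A.≈ b → f ≅ g → a ◃ f ≅ b ◃ g
    ◃-cong {a} {b} {f} {g} e e' = coeffwise λ i →
      A.trans (coeff-◃ a f i) (A.trans (A.*-cong e (at e' i)) (A.sym (coeff-◃ b g i)))

    ◃-⊕ : ∀ a f g → a ◃ (f ⊕ g) ≅ a ◃ f ⊕ a ◃ g
    ◃-⊕ a f g = coeffwise λ i → A.begin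
      coeff (a ◃ (f ⊕ g)) i                          A.≈⟨ coeff-◃ a (f ⊕ g) i ⟩
      a A.* coeff (f ⊕ g) i                          A.≈⟨ A.*-congˡ (coeff-+ f g i) ⟩
      a A.* (coeff f i A.+ coeff g i)                A.≈⟨ A.distribˡ _ _ _ ⟩
      a A.* coeff f i A.+ a A.* coeff g i            A.≈⟨ A.sym (A.+-cong (coeff-◃ a f i) (coeff-◃ a g i)) ⟩
      coeff (a ◃ f) i A.+ coeff (a ◃ g) i            A.≈⟨ A.sym (coeff-+ (a ◃ f) (a ◃ g) i) ⟩
      coeff (a ◃ f ⊕ a ◃ g) i                        A.∎

    +-◃ : ∀ a b f → (a A.+ b) ◃ f ≅ a ◃ f ⊕ b ◃ f
    +-◃ a b f = coeffwise λ i → A.begin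
      coeff ((a A.+ b) ◃ f) i                        A.≈⟨ coeff-◃ (a A.+ b) f i ⟩
      (a A.+ b) A.* coeff f i                        A.≈⟨ A.distribʳ _ _ _ ⟩
      a A.* coeff f i A.+ b A.* coeff f i            A.≈⟨ A.sym (A.+-cong (coeff-◃ a f i) (coeff-◃ b f i)) ⟩
      coeff (a ◃ f) i A.+ coeff (b ◃ f) i            A.≈⟨ A.sym (coeff-+ (a ◃ f) (b ◃ f) i) ⟩
      coeff (a ◃ f ⊕ b ◃ f) i                        A.∎

    *-◃ : ∀ a b f → (a A.* b) ◃ f ≅ a ◃ (b ◃ f)
    *-◃ a b f = coeffwise λ i → A.begin
      coeff ((a A.* b) ◃ f) i        A.≈⟨ coeff-◃ (a A.* b) f i ⟩
      (a A.* b) A.* coeff f i        A.≈⟨ A.*-assoc _ _ _ ⟩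
      a A.* (b A.* coeff f i)        A.≈⟨ A.*-congˡ (A.sym (coeff-◃ b f i)) ⟩
      a A.* coeff (b ◃ f) i          A.≈⟨ A.sym (coeff-◃ a (b ◃ f) i) ⟩
      coeff (a ◃ (b ◃ f)) i          A.∎

    1◃ : ∀ f → A.1# ◃ f ≅ f
    1◃ f = coeffwise λ i → A.trans (coeff-◃ A.1# f i) (A.*-identityˡ _)

    ∷-cong : ∀ {a b f g} → a A.≈ b → f ≅ g → (a ∷ f) ≅ (b ∷ g)
    ∷-cong e e' = coeffwise λ { zero → e ; (suc i) → at e' i }

    0∷[]≅[] : ∀ {a f} → a A.≈ A.0# → f ≅ [] → (a ∷ f) ≅ []
    0∷[]≅[] e e' = coeffwise λ { zero → e ; (suc i) → at e' i }

    0◃≅[] : ∀ {a} f → a A.≈ A.0# → a ◃ f ≅ []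
    0◃≅[] {a} f e = coeffwise λ i → A.trans (coeff-◃ a f i) (A.trans (A.*-congʳ e) (A.zeroˡ _))

    []⊕ : ∀ {f g} → f ≅ [] → f ⊕ g ≅ g
    []⊕ e = ⊕-cong e ≅-refl

    interchange : ∀ f g h k → (f ⊕ g) ⊕ (h ⊕ k) ≅ (f ⊕ h) ⊕ (g ⊕ k)
    interchange f g h k = coeffwise λ i → A.begin
      coeff ((f ⊕ g) ⊕ (h ⊕ k)) i                                             A.≈⟨ split f g h k i ⟩
      (coeff f i A.+ coeff g i) A.+ (coeff h i A.+ coeff k i)
        A.≈⟨ A.solve 4 (λ x y z w → (x A.:+ y) A.:+ (z A.:+ w) A.:= (x A.:+ z) A.:+ (y A.:+ w)) A.refl _ _ _ _ ⟩
      (coeff f i A.+ coeff h i) A.+ (coeff g i A.+ coeff k i)                 A.≈⟨ A.sym (split f h g k i) ⟩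
      coeff ((f ⊕ h) ⊕ (g ⊕ k)) i                                             A.∎
      where
      split : ∀ f g h k i → coeff ((f ⊕ g) ⊕ (h ⊕ k)) i A.≈ (coeff f i A.+ coeff g i) A.+ (coeff h i A.+ coeff k i)
      split f g h k i = A.trans (coeff-+ (f ⊕ g) (h ⊕ k) i) (A.+-cong (coeff-+ f g i) (coeff-+ h k i))

    0∷-⊕ : ∀ f g → (A.0# ∷ (f ⊕ g)) ≅ (A.0# ∷ f) ⊕ (A.0# ∷ g)
    0∷-⊕ f g = ∷-cong (A.sym (A.+-identityˡ _)) ≅-refl

    []⊗ : ∀ f g → f ≅ [] → f ⊗ g ≅ []
    []⊗ []      g e = ≅-refl
    []⊗ (a ∷ f) g e = ≅-trans ([]⊕ (0◃≅[] g (at e 0))) (0∷[]≅[] A.refl ([]⊗ f g (coeffwise λ i → at e (suc i))))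

    ⊗-congˡ : ∀ f {g g'} → g ≅ g' → f ⊗ g ≅ f ⊗ g'
    ⊗-congˡ []      e = ≅-refl
    ⊗-congˡ (a ∷ f) e = ⊕-cong (◃-cong A.refl e) (∷-cong A.refl (⊗-congˡ f e))

    -- The two lists may differ in length through trailing zeros. Once one of them is exhausted the
    -- other represents zero, and both products vanish.
    ⊗-congʳ : ∀ f f' g → f ≅ f' → f ⊗ g ≅ f' ⊗ g
    ⊗-congʳ []      f'       g e = ≅-sym ([]⊗ f' g (≅-sym e))
    ⊗-congʳ (a ∷ f) []       g e = []⊗ (a ∷ f) g e
    ⊗-congʳ (a ∷ f) (b ∷ f') g e =
      ⊕-cong (◃-cong (at e 0) ≅-refl) (∷-cong A.refl (⊗-congʳ f f' g (coeffwise λ i → at e (suc i))))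

    ⊗-distribʳ : ∀ g f f' → (f ⊕ f') ⊗ g ≅ f ⊗ g ⊕ f' ⊗ g
    ⊗-distribʳ g []      f'       = ≅-refl
    ⊗-distribʳ g (a ∷ f) []       = ≅-sym (⊕-identityʳ _)
    ⊗-distribʳ g (a ∷ f) (b ∷ f') = ≅-trans
      (⊕-cong (+-◃ a b g) (≅-trans (∷-cong A.refl (⊗-distribʳ g f f')) (0∷-⊕ (f ⊗ g) (f' ⊗ g))))
      (interchange (a ◃ g) (b ◃ g) (A.0# ∷ f ⊗ g) (A.0# ∷ f' ⊗ g))

    ⊗-distribˡ : ∀ f g h → f ⊗ (g ⊕ h) ≅ f ⊗ g ⊕ f ⊗ h
    ⊗-distribˡ []      g h = ≅-refl
    ⊗-distribˡ (a ∷ f) g h = ≅-trans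
      (⊕-cong (◃-⊕ a g h) (≅-trans (∷-cong A.refl (⊗-distribˡ f g h)) (0∷-⊕ (f ⊗ g) (f ⊗ h))))
      (interchange (a ◃ g) (a ◃ h) (A.0# ∷ f ⊗ g) (A.0# ∷ f ⊗ h))

    ⊗[] : ∀ f → f ⊗ [] ≅ []
    ⊗[] []      = ≅-refl
    ⊗[] (a ∷ f) = 0∷[]≅[] A.refl (⊗[] f)

    -- Multiplication recurses on its left argument; this is the same recursion on the right one,
    -- which is the inductive step of commutativity.
    ⊗-∷ : ∀ g a f → g ⊗ (a ∷ f) ≅ a ◃ g ⊕ (A.0# ∷ g ⊗ f)
    ⊗-∷ []      a f = ≅-sym (0∷[]≅[] A.refl ≅-refl)
    ⊗-∷ (b ∷ g) a f = ∷-cong (A.+-congʳ (A.*-comm b a)) (≅-trans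
      (⊕-cong {f = b ◃ f} ≅-refl (⊗-∷ g a f))
      (≅-trans (≅-sym (⊕-assoc (b ◃ f) (a ◃ g) _))
      (≅-trans (⊕-cong (⊕-comm (b ◃ f) (a ◃ g)) ≅-refl) (⊕-assoc (a ◃ g) (b ◃ f) _))))

    ⊗-comm : ∀ f g → f ⊗ g ≅ g ⊗ f
    ⊗-comm []      g = ≅-sym (⊗[] g)
    ⊗-comm (a ∷ f) g = ≅-trans
      (⊕-cong {f = a ◃ g} ≅-refl (∷-cong A.refl (⊗-comm f g))) (≅-sym (⊗-∷ g a f))

    ◃-⊗ : ∀ a f g → (a ◃ f) ⊗ g ≅ a ◃ (f ⊗ g)
    ◃-⊗ a []      g = ≅-refl
    ◃-⊗ a (b ∷ f) g = ≅-trans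
      (⊕-cong (*-◃ a b g) (∷-cong (A.sym (A.zeroʳ a)) (◃-⊗ a f g)))
      (≅-sym (◃-⊕ a (b ◃ g) (A.0# ∷ f ⊗ g)))

    0∷-⊗ : ∀ f g → (A.0# ∷ f) ⊗ g ≅ (A.0# ∷ f ⊗ g)
    0∷-⊗ f g = []⊕ (0◃≅[] g A.refl)

    ⊗-assoc : ∀ f g h → (f ⊗ g) ⊗ h ≅ f ⊗ (g ⊗ h)
    ⊗-assoc []      g h = ≅-refl
    ⊗-assoc (a ∷ f) g h = ≅-trans (⊗-distribʳ h (a ◃ g) (A.0# ∷ f ⊗ g))
      (⊕-cong (◃-⊗ a g h) (≅-trans (0∷-⊗ (f ⊗ g) h) (∷-cong A.refl (⊗-assoc f g h))))

    ⊗-identityˡ : ∀ f → (A.1# ∷ []) ⊗ f ≅ f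
    ⊗-identityˡ f = ≅-trans (⊕-comm (A.1# ◃ f) _) (≅-trans ([]⊕ (0∷[]≅[] A.refl ≅-refl)) (1◃ f))

  polynomialRing : CommutativeRing c ℓ
  polynomialRing = record
    { Carrier = List K
    ; _≈_ = _≅_
    ; _+_ = _+ᴾ_
    ; _*_ = _*ᴾ_
    ; -_ = map (A.-_)
    ; 0# = []
    ; 1# = A.1# ∷ []
    ; isCommutativeRing = record
      { isRing = record
        { +-isAbelianGroup = record
          { isGroup = record
            { isMonoid = record
              { isSemigroup = record
                { isMagma = record
                  { isEquivalence = record { refl = ≅-refl ; sym = ≅-sym ; trans = ≅-trans }
                  ; ∙-cong = ⊕-cong
                  }
                ; assoc = ⊕-assoc
                }
              ; identity = (λ f → ≅-refl) , ⊕-identityʳ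
              }
            ; inverse = (λ f → ≅-trans (⊕-comm (neg f) f) (⊕-inverseʳ f)) , ⊕-inverseʳ
            ; ⁻¹-cong = neg-cong
            }
          ; comm = ⊕-comm
          }
        ; *-cong = λ {f} {f'} {g} {g'} e e' → ≅-trans (⊗-congʳ f f' g e) (⊗-congˡ f' e')
        ; *-assoc = ⊗-assoc
        ; *-identity = ⊗-identityˡ , (λ f → ≅-trans (⊗-comm f _) (⊗-identityˡ f))
        ; distrib = ⊗-distribˡ , ⊗-distribʳ
        }
      ; *-comm = ⊗-comm
      }
    }

-- Degrees, division by monic polynomials, and derivatives.

module PolyTheory {c ℓ : Level} (A : CommutativeRing c ℓ) where
  private module A = Ring A
            using (*-congʳ; *-congˡ; *-identityʳ; *-identityˡ; +-cong; +-congˡ; +-identityʳ; +-identityˡ; -0#≈0#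
                  ; -_; -‿cong; -‿inverseʳ; 0#; 1#; 1^n≈1; Carrier; _*_; _+_; _^_; _∎; _≈_; begin_; refl
                  ; step-≈-⟩; sym; trans; zeroʳ; zeroˡ)
  open A using () renaming (Carrier to K)
  open Poly A public
  open Ring polynomialRing public

  ∷-cong : ∀ {a b f g} → a A.≈ b → f ≈ g → (a ∷ f) ≈ (b ∷ g)
  ∷-cong e e' = coeffwise λ { zero → e ; (suc i) → at e' i }

  private
    tail-≈[] : ∀ {a f} → (a ∷ f) ≈ [] → f ≈ []
    tail-≈[] e = coeffwise λ i → at e (suc i)

  coeff-C* : ∀ a f i → coeff (C a * f) i A.≈ a A.* coeff f i
  coeff-C* a f i = A.trans (coeff-+ (map (a A.*_) f) (A.0# ∷ []) i)
    (A.trans (A.+-cong (coeff-◃ a f i) (zeros i)) (A.+-identityʳ _))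
    where
    zeros : ∀ i → coeff (A.0# ∷ []) i A.≈ A.0#
    zeros zero    = A.refl
    zeros (suc i) = A.refl

  C*-map : ∀ a f → C a * f ≈ map (a A.*_) f
  C*-map a f = coeffwise λ i → A.trans (coeff-C* a f i) (A.sym (coeff-◃ a f i))

  0∷-≈[] : (A.0# ∷ []) ≈ []
  0∷-≈[] = coeffwise λ { zero → A.refl ; (suc i) → A.refl }

  ∷-as-sum : ∀ a f → (a ∷ f) ≈ C a + X * f
  ∷-as-sum a f = sym (begin
    C a + X * f                      ≈⟨ +-congˡ {C a} X* ⟩
    C a + (A.0# ∷ f)                 ≈⟨ ∷-cong (A.+-identityʳ a) refl ⟩
    a ∷ f                            ∎)
    where
    X* : X * f ≈ (A.0# ∷ f)
    X* = begin
      map (A.0# A.*_) f + (A.0# ∷ C A.1# * f)    ≈⟨ +-congʳ (sym (C*-map A.0# f)) ⟩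
      C A.0# * f + (A.0# ∷ C A.1# * f)           ≈⟨ +-congʳ {A.0# ∷ C A.1# * f} (trans (*-congʳ 0∷-≈[]) (zeroˡ f)) ⟩
      (A.0# ∷ C A.1# * f)                        ≈⟨ ∷-cong A.refl (*-identityˡ f) ⟩
      (A.0# ∷ f)                                 ∎

  X*-∷ : ∀ f → X * f ≈ (A.0# ∷ f)
  X*-∷ f = sym (begin
    A.0# ∷ f            ≈⟨ ∷-as-sum A.0# f ⟩
    C A.0# + X * f      ≈⟨ +-congʳ {X * f} 0∷-≈[] ⟩
    X * f               ∎)

  C-* : ∀ a b → C (a A.* b) ≈ C a * C b
  C-* a b = ∷-cong (A.sym (A.+-identityʳ _)) refl

  C-cong : ∀ {a b} → a A.≈ b → C a ≈ C b
  C-cong e = ∷-cong e refl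

  C-^ : ∀ a n → C (a A.^ n) ≈ C a ^ n
  C-^ a zero    = refl
  C-^ a (suc n) = trans (C-* a (a A.^ n)) (*-congˡ {C a} (C-^ a n))

  coeff₀-* : ∀ f g → coeff (f * g) 0 A.≈ coeff f 0 A.* coeff g 0
  coeff₀-* []      g = A.sym (A.zeroˡ _)
  coeff₀-* (a ∷ f) g = A.begin
    coeff (map (a A.*_) g + (A.0# ∷ f * g)) 0     A.≈⟨ coeff-+ (map (a A.*_) g) (A.0# ∷ f * g) 0 ⟩
    coeff (map (a A.*_) g) 0 A.+ A.0#             A.≈⟨ A.+-identityʳ _ ⟩
    coeff (map (a A.*_) g) 0                      A.≈⟨ coeff-◃ a g 0 ⟩
    a A.* coeff g 0                               A.∎

  coeff₀-^ : ∀ f n → coeff (f ^ n) 0 A.≈ coeff f 0 A.^ n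
  coeff₀-^ f zero    = A.refl
  coeff₀-^ f (suc n) = A.trans (coeff₀-* f (f ^ n)) (A.*-congˡ (coeff₀-^ f n))

  coeff-X^* : ∀ k f i → coeff (X ^ k * f) (k ℕ.+ i) A.≈ coeff f i
  coeff-X^* zero    f i = at (*-identityˡ f) i
  coeff-X^* (suc k) f i = A.trans
    (at (trans (*-assoc X (X ^ k) f) (X*-∷ (X ^ k * f))) (suc k ℕ.+ i)) (coeff-X^* k f i)

  -- Top n f a says that f has degree at most n and that a is its
  -- coefficient in degree n; in particular Top n f 0# says deg f < n.
  record Top (n : ℕ) (f : List K) (a : K) : Set ℓ where
    constructor _,_
    field
      leading : coeff f n A.≈ a
      above   : ∀ i → n ℕ.< i → coeff f i A.≈ A.0#
  open Top public

  Top-cong : ∀ {n f g a b} → f ≈ g → a A.≈ b → Top n f a → Top n g b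
  Top-cong e e' (t , z) =
    A.trans (A.sym (at e _)) (A.trans t e') , λ i n<i → A.trans (A.sym (at e i)) (z i n<i)

  Top-+ : ∀ {n f g a b} → Top n f a → Top n g b → Top n (f + g) (a A.+ b)
  Top-+ {n} {f} {g} (t , z) (t' , z') =
    A.trans (coeff-+ f g n) (A.+-cong t t') ,
    λ i n<i → A.trans (coeff-+ f g i) (A.trans (A.+-cong (z i n<i) (z' i n<i)) (A.+-identityʳ _))

  Top-neg : ∀ {n f a} → Top n f a → Top n (- f) (A.- a)
  Top-neg {n} {f} (t , z) =
    A.trans (coeff-neg f n) (A.-‿cong t) ,
    λ i n<i → A.trans (coeff-neg f i) (A.trans (A.-‿cong (z i n<i)) A.-0#≈0#)

  Top-◃ : ∀ {n f b} a → Top n f b → Top n (map (a A.*_) f) (a A.* b)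
  Top-◃ {n} {f} a (t , z) =
    A.trans (coeff-◃ a f n) (A.*-congˡ t) ,
    λ i n<i → A.trans (coeff-◃ a f i) (A.trans (A.*-congˡ (z i n<i)) (A.zeroʳ _))

  Top-∷ : ∀ {n f b} a → Top n f b → Top (suc n) (a ∷ f) b
  Top-∷ a (t , z) = t , λ { (suc i) (s≤s n<i) → z i n<i }

  Top-[] : ∀ {n} → Top n [] A.0#
  Top-[] = A.refl , λ i _ → A.refl

  Top-suc : ∀ {n f a} → Top n f a → Top (suc n) f A.0#
  Top-suc {n} (t , z) = z (suc n) ℕ.≤-refl , λ i 1+n<i → z i (ℕ.<-trans (ℕ.n<1+n n) 1+n<i)

  Top-raise : ∀ {m n f a} → m ℕ.< n → Top m f a → Top n f A.0#
  Top-raise m<n (t , z) = z _ m<n , λ i n<i → z i (ℕ.<-trans m<n n<i)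

  Top-C : ∀ a → Top 0 (C a) a
  Top-C a = A.refl , λ { (suc i) _ → A.refl }

  Top-X : Top 1 X A.1#
  Top-X = Top-∷ A.0# (Top-C A.1#)

  private
    ≈[]-from : ∀ {f a} → Top 0 (a ∷ f) a → f ≈ []
    ≈[]-from (_ , z) = coeffwise λ i → z (suc i) (s≤s z≤n)

  Top-* : ∀ {m n} f g {a b} → Top m f a → Top n g b → Top (m ℕ.+ n) (f * g) (a A.* b)
  Top-* {m}     {n} []      g {a} {b} (0≈a , _) _ =
    Top-cong refl (A.trans (A.sym (A.zeroˡ b)) (A.*-congʳ 0≈a)) (Top-[] {m ℕ.+ n})
  Top-* {zero}  {n} (c ∷ f) g {a} {b} (c≈a , z) tg =
    Top-cong (sym (C∷* )) (A.*-congʳ c≈a) (Top-◃ c tg)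
    where
    C∷* : (c ∷ f) * g ≈ map (c A.*_) g
    C∷* = begin
      map (c A.*_) g + (A.0# ∷ f * g)    ≈⟨ +-congˡ {map (c A.*_) g} (trans (∷-cong A.refl (trans (*-congʳ (≈[]-from (A.refl , z))) (zeroˡ g))) 0∷-≈[]) ⟩
      map (c A.*_) g + []                ≈⟨ +-identityʳ _ ⟩
      map (c A.*_) g                     ∎
  Top-* {suc m} {n} (c ∷ f) g {a} {b} (t , z) tg =
    Top-cong refl (A.+-identityˡ _)
      (Top-+ (Top-cong refl (A.zeroʳ c) (Top-◃ c (Top-raise (s≤s (ℕ.m≤n+m n m)) tg)))
             (Top-∷ A.0# (Top-* f g (t , λ i m<i → z (suc i) (s≤s m<i)) tg)))

  Top-^ : ∀ {m} f {a} k → Top m f a → Top (k ℕ.* m) (f ^ k) (a A.^ k)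
  Top-^ f zero    tf = Top-C A.1#
  Top-^ f (suc k) tf = Top-* f (f ^ k) tf (Top-^ f k tf)

  Monic : ℕ → List K → Set ℓ
  Monic n f = Top n f A.1#

  Monic-* : ∀ {m n} f g → Monic m f → Monic n g → Monic (m ℕ.+ n) (f * g)
  Monic-* f g mf mg = Top-cong {f = f * g} refl (A.*-identityˡ A.1#) (Top-* f g mf mg)

  Monic-^ : ∀ {m} f k → Monic m f → Monic (k ℕ.* m) (f ^ k)
  Monic-^ f k mf = Top-cong refl (A.1^n≈1 k) (Top-^ f k mf)

  Monic-X^ : ∀ n → Monic n (X ^ n)
  Monic-X^ n = ≡.subst (λ k → Monic k (X ^ n)) (ℕ.*-identityʳ n) (Monic-^ X n Top-X)

  -- Recursion on the dividend a + x p: the remainder of `p`, shifted by one degree, exceeds the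
  -- allowed bound in at most the coefficient `t` of degree n, which `C t * f` removes because f is
  -- monic.
  divide : ∀ {n f} → Monic n f → ∀ p → ∃[ w ] ∃[ r ] (p ≈ f * w + r × Top n r A.0#)
  divide {n} {f} mf []      = [] , [] , sym (trans (+-identityʳ _) (zeroʳ f)) , Top-[]
  divide {n} {f} mf (a ∷ p) with w , r , e , tr ← divide mf p =
    C t + X * w , (a ∷ r) + - (C t * f) , expansion , Top-cong refl cancel (Top-+ (near-top n tr) (Top-neg (Top-cong (sym (C*-map t f)) A.refl (Top-◃ t mf))))
    where
    t = coeff (a ∷ r) n

    near-top : ∀ n → Top n r A.0# → Top n (a ∷ r) (coeff (a ∷ r) n)
    near-top n (e , z) = A.refl , λ { (suc i) (s≤s n≤i) → beyond i n≤i }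
      where
      beyond : ∀ i → n ℕ.≤ i → coeff r i A.≈ A.0#
      beyond i n≤i with n ℕ.≟ i
      ... | yes ≡.refl = e
      ... | no  n≢i    = z i (ℕ.≤∧≢⇒< n≤i n≢i)

    cancel : t A.+ A.- (t A.* A.1#) A.≈ A.0#
    cancel = A.trans (A.+-congˡ (A.-‿cong (A.*-identityʳ t))) (A.-‿inverseʳ t)

    expansion : (a ∷ p) ≈ f * (C t + X * w) + ((a ∷ r) + - (C t * f))
    expansion = begin
      a ∷ p                                                ≈⟨ ∷-as-sum a p ⟩
      C a + X * p                                          ≈⟨ +-congˡ {C a} (*-congˡ {X} e) ⟩
      C a + X * (f * w + r)
        ≈⟨ solve 6 (λ a x f w r t → a :+ x :* (f :* w :+ r)
             := f :* (t :+ x :* w) :+ ((a :+ x :* r) :- t :* f)) refl (C a) X f w r (C t) ⟩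
      f * (C t + X * w) + ((C a + X * r) + - (C t * f))    ≈⟨ +-congˡ {f * (C t + X * w)} (+-congʳ { - (C t * f)} (sym (∷-as-sum a r))) ⟩
      f * (C t + X * w) + ((a ∷ r) + - (C t * f))          ∎

  private
    length-bound : ∀ f i → length f ℕ.≤ i → coeff f i A.≈ A.0#
    length-bound []      i       _         = A.refl
    length-bound (a ∷ f) (suc i) (s≤s l≤i) = length-bound f i l≤i

  -- The length of the list bounds the degree of `w`. As long as nothing lies above degree l, the
  -- coefficient of `f * w` in degree m + l is that of `w` in degree l, so the bound descends to k.
  monic-cofactor : ∀ {m k a f} → Monic m f → ∀ w → Top (m ℕ.+ k) (f * w) a → Top k w a
  monic-cofactor {m} {k} {a} {f} mf w (t , z) =
    A.trans (A.sym (A.*-identityˡ _)) (A.trans (A.sym (leading (Top-* f w mf (A.refl , above-k)))) t) , above-k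
    where
    go : ∀ l → (∀ i → l ℕ.≤ i → coeff w i A.≈ A.0#) → ∀ i → k ℕ.< i → coeff w i A.≈ A.0#
    go zero    b i _   = b i z≤n
    go (suc l) b i k<i with l ℕ.≤? k
    ... | yes l≤k = b i (ℕ.<-≤-trans (s≤s l≤k) k<i)
    ... | no  l≰k = go l b' i k<i
      where
      b' : ∀ i → l ℕ.≤ i → coeff w i A.≈ A.0#
      b' i l≤i with l ℕ.≟ i
      ... | yes ≡.refl = A.trans (A.sym (A.*-identityˡ _)) (A.trans
        (A.sym (leading (Top-* f w mf (A.refl , b)))) (z (m ℕ.+ l) (ℕ.+-monoʳ-< m (ℕ.≰⇒> l≰k))))
      ... | no  l≢i    = b i (ℕ.≤∧≢⇒< l≤i l≢i)
    above-k : ∀ i → k ℕ.< i → coeff w i A.≈ A.0#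
    above-k = go (length w) (length-bound w)

  monic-multiple-degree : ∀ {n f} → Monic n f → ∀ w → Top n (f * w) A.0# → w ≈ []
  monic-multiple-degree {n} {f} mf w t
    with e , z ← monic-cofactor {k = 0} mf w (≡.subst (λ i → Top i (f * w) A.0#) (≡.sym (ℕ.+-identityʳ n)) t) =
    coeffwise λ { zero → e ; (suc i) → z (suc i) (s≤s z≤n) }

  monic-cancelˡ : ∀ {n f} → Monic n f → ∀ w → f * w ≈ [] → w ≈ []
  monic-cancelˡ mf w e = monic-multiple-degree mf w (Top-cong (sym e) A.refl Top-[])

  remainder-unique : ∀ {n f} → Monic n f → ∀ w r → f * w ≈ r → Top n r A.0# → r ≈ []
  remainder-unique {n} {f} mf w r e tr = trans (sym e)
    (trans (*-congˡ {f} (monic-multiple-degree mf w (Top-cong (sym e) A.refl tr))) (zeroʳ f))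

  -- The formal derivative, by the product rule on a + x f rather than through the multiples i aᵢ;
  -- this matches the recursion of multiplication.
  D : List K → List K
  D []      = []
  D (a ∷ f) = f + (A.0# ∷ D f)

  D-∷ : ∀ a f → D (a ∷ f) ≈ f + X * D f
  D-∷ a f = +-congˡ {f} (sym (X*-∷ (D f)))

  private
    D-zero : ∀ f → f ≈ [] → D f ≈ []
    D-zero []      e = refl
    D-zero (a ∷ f) e = trans (+-cong {f} (tail-≈[] e) (∷-cong A.refl (D-zero f (tail-≈[] e)))) 0∷-≈[]

  D-+ : ∀ f g → D (f + g) ≈ D f + D g
  D-+ []      g       = refl
  D-+ (a ∷ f) []      = sym (+-identityʳ _)
  D-+ (a ∷ f) (b ∷ g) = begin
    D (a A.+ b ∷ f + g)                 ≈⟨ D-∷ (a A.+ b) (f + g) ⟩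
    f + g + X * D (f + g)               ≈⟨ +-congˡ {f + g} (*-congˡ {X} (D-+ f g)) ⟩
    f + g + X * (D f + D g)
      ≈⟨ solve 5 (λ f g x u v → f :+ g :+ x :* (u :+ v) := (f :+ x :* u) :+ (g :+ x :* v)) refl f g X (D f) (D g) ⟩
    (f + X * D f) + (g + X * D g)       ≈⟨ sym (+-cong (D-∷ a f) (D-∷ b g)) ⟩
    D (a ∷ f) + D (b ∷ g)               ∎

  D-neg : ∀ f → D (- f) ≈ - D f
  D-neg []      = refl
  D-neg (a ∷ f) = begin
    D (- (a ∷ f))            ≈⟨ D-∷ (A.- a) (- f) ⟩
    - f + X * D (- f)        ≈⟨ +-congˡ { - f} (*-congˡ {X} (D-neg f)) ⟩
    - f + X * - D f          ≈⟨ solve 3 (λ f x u → :- f :+ x :* :- u := :- (f :+ x :* u)) refl f X (D f) ⟩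
    - (f + X * D f)          ≈⟨ -‿cong (sym (D-∷ a f)) ⟩
    - D (a ∷ f)              ∎

  D-cong : ∀ {f g} → f ≈ g → D f ≈ D g
  D-cong {f} {g} e = x∙y⁻¹≈ε⇒x≈y (D f) (D g) (begin
    D f + - D g         ≈⟨ +-congˡ {D f} (sym (D-neg g)) ⟩
    D f + D (- g)       ≈⟨ sym (D-+ f (- g)) ⟩
    D (f + - g)         ≈⟨ D-zero (f + - g) (x≈y⇒x∙y⁻¹≈ε e) ⟩
    []                  ∎)

  D-C : ∀ a → D (C a) ≈ []
  D-C a = 0∷-≈[]

  D-X : D X ≈ 1#
  D-X = ∷-cong (A.+-identityʳ _) (trans 0∷-≈[] refl)

  private
    D-C* : ∀ a f → D (C a * f) ≈ C a * D f
    D-C* a []      = begin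
      D (C a * [])       ≈⟨ D-cong (zeroʳ (C a)) ⟩
      []                 ≈⟨ sym (zeroʳ (C a)) ⟩
      C a * []           ∎
    D-C* a (b ∷ f) = begin
      D (C a * (b ∷ f))                  ≈⟨ D-cong (*-congˡ {C a} (∷-as-sum b f)) ⟩
      D (C a * (C b + X * f))            ≈⟨ D-cong (solve 4 (λ a b x f → a :* (b :+ x :* f) := (a :* b) :+ x :* (a :* f)) refl (C a) (C b) X f) ⟩
      D (C a * C b + X * (C a * f))      ≈⟨ D-cong (+-congʳ {X * (C a * f)} (sym (C-* a b))) ⟩
      D (C (a A.* b) + X * (C a * f))    ≈⟨ D-cong (sym (∷-as-sum (a A.* b) (C a * f))) ⟩
      D (a A.* b ∷ C a * f)              ≈⟨ D-∷ (a A.* b) (C a * f) ⟩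
      C a * f + X * D (C a * f)          ≈⟨ +-congˡ {C a * f} (*-congˡ {X} (D-C* a f)) ⟩
      C a * f + X * (C a * D f)          ≈⟨ solve 4 (λ a f x u → a :* f :+ x :* (a :* u) := a :* (f :+ x :* u)) refl (C a) f X (D f) ⟩
      C a * (f + X * D f)                ≈⟨ *-congˡ {C a} (sym (D-∷ b f)) ⟩
      C a * D (b ∷ f)                    ∎

  D-* : ∀ f g → D (f * g) ≈ D f * g + f * D g
  D-* []      g = refl
  D-* (a ∷ f) g = begin
    D ((a ∷ f) * g)                              ≈⟨ D-cong (*-congʳ (∷-as-sum a f)) ⟩
    D ((C a + X * f) * g)                        ≈⟨ D-cong (solve 4 (λ a x f g → (a :+ x :* f) :* g := a :* g :+ x :* (f :* g)) refl (C a) X f g) ⟩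
    D (C a * g + X * (f * g))                    ≈⟨ D-+ (C a * g) (X * (f * g)) ⟩
    D (C a * g) + D (X * (f * g))                ≈⟨ +-cong (D-C* a g) (trans (D-cong (X*-∷ (f * g))) (D-∷ A.0# (f * g))) ⟩
    C a * D g + (f * g + X * D (f * g))          ≈⟨ +-congˡ {C a * D g} (+-congˡ {f * g} (*-congˡ {X} (D-* f g))) ⟩
    C a * D g + (f * g + X * (D f * g + f * D g))
      ≈⟨ solve 6 (λ a x f g f' g' → a :* g' :+ (f :* g :+ x :* (f' :* g :+ f :* g'))
           := (f :+ x :* f') :* g :+ (a :+ x :* f) :* g') refl (C a) X f g (D f) (D g) ⟩
    (f + X * D f) * g + (C a + X * f) * D g      ≈⟨ +-cong (*-congʳ (sym (D-∷ a f))) (*-congʳ (sym (∷-as-sum a f))) ⟩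
    D (a ∷ f) * g + (a ∷ f) * D g                ∎

  D-^ : ∀ f n → D (f ^ suc n) ≈ ι (+ suc n) * (f ^ n * D f)
  D-^ f zero    = begin
    D (f * 1#)                         ≈⟨ D-* f 1# ⟩
    D f * 1# + f * D 1#                ≈⟨ +-congˡ {D f * 1#} (*-congˡ {f} (D-C A.1#)) ⟩
    D f * 1# + f * []                  ≈⟨ solve 2 (λ f u → u :* con 1ℤ :+ f :* con 0ℤ := (con 1ℤ :+ con 0ℤ) :* (con 1ℤ :* u)) refl f (D f) ⟩
    ι 1ℤ * (1# * D f)             ∎
  D-^ f (suc n) = begin
    D (f * f ^ suc n)                                     ≈⟨ D-* f (f ^ suc n) ⟩
    D f * f ^ suc n + f * D (f ^ suc n)                   ≈⟨ +-congˡ {D f * f ^ suc n} (*-congˡ {f} (D-^ f n)) ⟩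
    D f * (f * f ^ n) + f * (ι (+ suc n) * (f ^ n * D f))
      ≈⟨ solve 4 (λ f p u k → u :* (f :* p) :+ f :* (k :* (p :* u)) := (con 1ℤ :+ k) :* (f :* p :* u)) refl f (f ^ n) (D f) (ι (+ suc n)) ⟩
    ι (+ suc (suc n)) * (f ^ suc n * D f)               ∎

-- Dedekind's criterion in an arbitrary ring.

module Homogenisation {c ℓ : Level} (R : CommutativeRing c ℓ) where
  open Ring R
    using (1#; Carrier; _*_; _+_; _^_)

  -- γ ^ d + Σ cᵢ * γ ^ i * N ^ (d ∸ i) for the list c₀ ∷ … ∷ c_{d-1} ∷ [];
  -- it vanishes iff γ / N is a root of the monic polynomial with lower
  -- coefficients cᵢ.
  homogeneous : (N γ : Carrier) → List Carrier → Carrier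
  homogeneous N γ []       = 1#
  homogeneous N γ (c ∷ cs) = c * N ^ suc (length cs) + γ * homogeneous N γ cs

module Dedekind {c ℓ : Level} (R : CommutativeRing c ℓ) where
  open Ring R
    using (*-assoc; *-comm; *-cong; *-congʳ; *-congˡ; *-identityʳ; *-identityˡ; +-cong; +-congʳ; +-congˡ; -_
          ; -‿cong; -‿distribˡ-*; 0#; 1#; :-_; Carrier; ^-assocʳ; ^-congʳ; ^-congˡ; ^-distrib-*; ^-homo-*; _*_
          ; _+_; _:*_; _:+_; _:-_; _:=_; _^_; _∎; _∣_; _≈_; begin_; con; distribʳ; refl; solve; step-≈-⟩; sym
          ; trans; x∙y⁻¹≈ε⇒x≈y; x≈y⇒x∙y⁻¹≈ε; zeroˡ)
  open Homogenisation R
  open _∣ʳ_ using (quotient; equality)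

  module _ (q : Carrier) (regular : ∀ x → q * x ≈ 0# → x ≈ 0#) where

    cancel : ∀ x y → q * x ≈ q * y → x ≈ y
    cancel x y e = x∙y⁻¹≈ε⇒x≈y x y (regular (x + - y) (begin
      q * (x + - y)        ≈⟨ solve 3 (λ q x y → q :* (x :- y) := q :* x :- q :* y) refl q x y ⟩
      q * x + - (q * y)    ≈⟨ x≈y⇒x∙y⁻¹≈ε e ⟩
      0#                   ∎))

    cancel-^ : ∀ i x y → x * q ^ i ≈ y * q ^ i → x ≈ y
    cancel-^ zero    x y e = trans (sym (*-identityʳ x)) (trans e (*-identityʳ y))
    cancel-^ (suc i) x y e = cancel-^ i x y (cancel (x * q ^ i) (y * q ^ i) (trans (move x) (trans e (sym (move y)))))
      where
      move : ∀ x → q * (x * q ^ i) ≈ x * (q * q ^ i)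
      move x = solve 3 (λ q x p → q :* (x :* p) := x :* (q :* p)) refl q x (q ^ i)

    module _ (γ : Carrier) where

      -- y · (γ / q)ⁱ lies in R for every i.
      Denominator : Carrier → Set (c ⊔ ℓ)
      Denominator y = ∀ i → (q ^ i) ∣ (y * γ ^ i)

      private
        multiple : ∀ {y z} r → z ≈ r * y → Denominator y → Denominator z
        multiple {y} {z} r e G i with x , ex ← G i = r * x , (begin
          r * x * q ^ i          ≈⟨ *-assoc r x (q ^ i) ⟩
          r * (x * q ^ i)        ≈⟨ *-congˡ ex ⟩
          r * (y * γ ^ i)        ≈⟨ sym (*-assoc r y (γ ^ i)) ⟩
          r * y * γ ^ i          ≈⟨ *-congʳ (sym e) ⟩
          z * γ ^ i              ∎)

        -- One step of the recursion satisfied by the powers of γ / q.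
        recur : ∀ y cs t → (∀ j → j ℕ.< t ℕ.+ length cs → (q ^ j) ∣ (y * γ ^ j)) →
                (q ^ (t ℕ.+ length cs)) ∣ (y * γ ^ t * (homogeneous q γ cs + - (γ ^ length cs)))
        recur y []       t G = 0# , (begin
          0# * q ^ (t ℕ.+ 0)               ≈⟨ zeroˡ _ ⟩
          0#                               ≈⟨ solve 1 (λ u → con 0ℤ := u :* (con 1ℤ :- con 1ℤ)) refl (y * γ ^ t) ⟩
          y * γ ^ t * (1# + - 1#)          ∎)
        recur y (a ∷ cs) t G
          with x , ex ← G t (ℕ.m<m+n t (s≤s z≤n))
             | z , ez ← recur y cs (suc t) (λ j j< → G j (≡.subst (j ℕ.<_) (≡.sym (ℕ.+-suc t (length cs))) j<))
          = a * x + z , (begin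
          (a * x + z) * q ^ (t ℕ.+ suc l)
            ≈⟨ distribʳ _ (a * x) z ⟩
          a * x * q ^ (t ℕ.+ suc l) + z * q ^ (t ℕ.+ suc l)
            ≈⟨ +-cong (*-congˡ (^-homo-* q t (suc l))) (*-congˡ (^-congʳ q (ℕ.+-suc t l))) ⟩
          a * x * (q ^ t * q ^ suc l) + z * q ^ suc (t ℕ.+ l)
            ≈⟨ +-cong (solve 4 (λ a x p s → a :* x :* (p :* s) := a :* s :* (x :* p)) refl a x (q ^ t) (q ^ suc l)) ez ⟩
          a * q ^ suc l * (x * q ^ t) + y * γ ^ suc t * (E + - γ ^ l)
            ≈⟨ +-congʳ (*-congˡ ex) ⟩
          a * q ^ suc l * (y * γ ^ t) + y * γ ^ suc t * (E + - γ ^ l)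
            ≈⟨ solve 6 (λ s y p g e n → s :* (y :* p) :+ y :* (g :* p) :* (e :- n) := y :* p :* ((s :+ g :* e) :- g :* n))
                 refl (a * q ^ suc l) y (γ ^ t) γ E (γ ^ l) ⟩
          y * γ ^ t * ((a * q ^ suc l + γ * E) + - (γ * γ ^ l)) ∎)
          where
          l = length cs
          E = homogeneous q γ cs

        -- With d the degree of the monic relation, (γ / q)ⁿ for n ≥ d is expressed through the d
        -- powers before it, so strong induction needs only the exponents below d as its base.
        extend : ∀ cs → homogeneous q γ cs ≈ 0# → ∀ y →
                 (∀ i → i ℕ.< length cs → (q ^ i) ∣ (y * γ ^ i)) → Denominator y
        extend cs E≈0 y base i = below (suc i) i ℕ.≤-refl
          where
          l = length cs
          next : ∀ n → (∀ j → j ℕ.< n → (q ^ j) ∣ (y * γ ^ j)) → (q ^ n) ∣ (y * γ ^ n)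
          next n G with n ℕ.<? l
          ... | yes n<l = base n n<l
          ... | no  n≮l with z , ez ← recur y cs (n ℕ.∸ l) (λ j j< → G j (≡.subst (j ℕ.<_) (ℕ.m∸n+n≡m (ℕ.≮⇒≥ n≮l)) j<)) =
            ≡.subst (λ k → (q ^ k) ∣ (y * γ ^ k)) (ℕ.m∸n+n≡m (ℕ.≮⇒≥ n≮l)) (- z , (begin
              - z * q ^ (t ℕ.+ l)                       ≈⟨ sym (-‿distribˡ-* z _) ⟩
              - (z * q ^ (t ℕ.+ l))                     ≈⟨ -‿cong ez ⟩
              - (y * γ ^ t * (homogeneous q γ cs + - (γ ^ l)))  ≈⟨ -‿cong (*-congˡ (+-congʳ E≈0)) ⟩
              - (y * γ ^ t * (0# + - (γ ^ l)))          ≈⟨ solve 3 (λ y p s → :- (y :* p :* (con 0ℤ :- s)) := y :* (p :* s)) refl y (γ ^ t) (γ ^ l) ⟩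
              y * (γ ^ t * γ ^ l)                       ≈⟨ *-congˡ (sym (^-homo-* γ t l)) ⟩
              y * γ ^ (t ℕ.+ l)                         ∎))
            where t = n ℕ.∸ l
          below : ∀ n j → j ℕ.< n → (q ^ j) ∣ (y * γ ^ j)
          below (suc n) j (s≤s j≤n) = next j (λ k k<j → below n k (ℕ.<-≤-trans k<j j≤n))

      -- Dedekind's criterion: if the ideal I = (q , g) is the radical of (q)
      -- and (q , g , h , F) = (1), where g h + q F = 0, then I is invertible
      -- with inverse (q , h) / q, and γ / q can be integral only inside R.
      module _ (g h F : Carrier) (gh≈-qF : g * h ≈ - (q * F))
               (a b c' k : Carrier) (comaximal : 1# ≈ a * q + b * g + c' * h + k * F)
               (radical : ∀ x n → q ∣ (x ^ n) → ∃[ α ] ∃[ β ] x ≈ α * q + β * g)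
               (e : ℕ) (q∣gᵉ : q ∣ (g ^ e)) where

        private
          -- Raise x qⁱ = s y γⁱ to the power n + 1. One factor s y absorbs all of γ^(i (n + 1)),
          -- since it is a denominator, and returns q^(i (n + 1)); the n remaining factors s supply
          -- the extra q.
          nilpotent : ∀ s n → q ∣ (s ^ n) → ∀ y → Denominator (s * y) →
                      ∀ i x → x * q ^ i ≈ s * y * γ ^ i → q ∣ (x ^ suc n)
          nilpotent s n (r , er) y G i x ex with z , ez ← G (i ℕ.* suc n) =
            z * r * y ^ n , sym (cancel-^ (i ℕ.* suc n) _ _ (begin
              x ^ suc n * q ^ (i ℕ.* suc n)              ≈⟨ *-congˡ (sym (^-assocʳ q i (suc n))) ⟩
              x ^ suc n * (q ^ i) ^ suc n                ≈⟨ sym (^-distrib-* x (q ^ i) (suc n)) ⟩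
              (x * q ^ i) ^ suc n                        ≈⟨ ^-congˡ (suc n) ex ⟩
              (s * y * γ ^ i) ^ suc n                    ≈⟨ ^-distrib-* (s * y) (γ ^ i) (suc n) ⟩
              (s * y) * (s * y) ^ n * (γ ^ i) ^ suc n    ≈⟨ *-cong (*-congˡ (^-distrib-* s y n)) (^-assocʳ γ i (suc n)) ⟩
              (s * y) * (s ^ n * y ^ n) * γ ^ (i ℕ.* suc n)
                ≈⟨ solve 4 (λ u s y v → u :* (s :* y) :* v := (u :* v) :* s :* y) refl (s * y) (s ^ n) (y ^ n) (γ ^ (i ℕ.* suc n)) ⟩
              (s * y) * γ ^ (i ℕ.* suc n) * s ^ n * y ^ n
                ≈⟨ *-congʳ (*-cong (sym ez) (sym er)) ⟩
              z * q ^ (i ℕ.* suc n) * (r * q) * y ^ n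
                ≈⟨ solve 5 (λ z p r q y → z :* p :* (r :* q) :* y := (z :* r :* y) :* q :* p) refl z (q ^ (i ℕ.* suc n)) r q (y ^ n) ⟩
              z * r * y ^ n * q * q ^ (i ℕ.* suc n)      ∎))

          -- Multiplication by h / q maps I into R because g h = - q F. Applied to x = q t / qⁱ it
          -- returns h t / qⁱ.
          h-part : ∀ α β x i t → x ≈ α * q + β * g → x * q ^ i ≈ q * t → h * t ≈ (α * h + - (β * F)) * q ^ i
          h-part α β x i t ex et = cancel _ _ (begin
            q * (h * t)                               ≈⟨ solve 3 (λ q h t → q :* (h :* t) := h :* (q :* t)) refl q h t ⟩
            h * (q * t)                               ≈⟨ *-congˡ (sym et) ⟩
            h * (x * q ^ i)                           ≈⟨ *-congˡ (*-congʳ ex) ⟩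
            h * ((α * q + β * g) * q ^ i)             ≈⟨ solve 6 (λ h α q β g p → h :* ((α :* q :+ β :* g) :* p) := (q :* (α :* h) :+ β :* (g :* h)) :* p) refl h α q β g (q ^ i) ⟩
            (q * (α * h) + β * (g * h)) * q ^ i       ≈⟨ *-congʳ (+-congˡ (*-congˡ gh≈-qF)) ⟩
            (q * (α * h) + β * - (q * F)) * q ^ i     ≈⟨ solve 6 (λ q α h β F p → (q :* (α :* h) :+ β :* :- (q :* F)) :* p := q :* ((α :* h :- β :* F) :* p)) refl q α h β F (q ^ i) ⟩
            q * ((α * h + - (β * F)) * q ^ i)         ∎)

          -- The same multiplication by h / q, now of x = g t / qⁱ: as (h / q) g = - F, it returns -
          -- F t / qⁱ.
          F-part : ∀ α β x i t → x ≈ α * q + β * g → x * q ^ i ≈ g * t → F * t ≈ - (α * h + - (β * F)) * q ^ i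
          F-part α β x i t ex et = cancel _ _ (begin
            q * (F * t)                               ≈⟨ solve 3 (λ q F t → q :* (F :* t) := :- (:- (q :* F) :* t)) refl q F t ⟩
            - (- (q * F) * t)                         ≈⟨ -‿cong (*-congʳ (sym gh≈-qF)) ⟩
            - (g * h * t)                             ≈⟨ solve 3 (λ g h t → :- (g :* h :* t) := :- (h :* (g :* t))) refl g h t ⟩
            - (h * (g * t))                           ≈⟨ -‿cong (*-congˡ (sym et)) ⟩
            - (h * (x * q ^ i))                       ≈⟨ -‿cong (*-congˡ (*-congʳ ex)) ⟩
            - (h * ((α * q + β * g) * q ^ i))         ≈⟨ solve 6 (λ h α q β g p → :- (h :* ((α :* q :+ β :* g) :* p)) := :- ((q :* (α :* h) :+ β :* (g :* h)) :* p)) refl h α q β g (q ^ i) ⟩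
            - ((q * (α * h) + β * (g * h)) * q ^ i)   ≈⟨ -‿cong (*-congʳ (+-congˡ (*-congˡ gh≈-qF))) ⟩
            - ((q * (α * h) + β * - (q * F)) * q ^ i) ≈⟨ solve 6 (λ q α h β F p → :- ((q :* (α :* h) :+ β :* :- (q :* F)) :* p) := q :* (:- (α :* h :- β :* F) :* p)) refl q α h β F (q ^ i) ⟩
            q * (- (α * h + - (β * F)) * q ^ i)       ∎)

          distribute : ∀ x y z w t → (x + y + z + w) * t ≈ x * t + y * t + z * t + w * t
          distribute x y z w t =
            solve 5 (λ x y z w t → (x :+ y :+ z :+ w) :* t := x :* t :+ y :* t :+ z :* t :+ w :* t) refl x y z w t

          -- Since 1 is a combination of q, g, h and F, it suffices that these four multiples of y
          -- (γ / q)ⁱ lie in R. The hypotheses give q and g; the resulting elements x and x' are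
          -- nilpotent modulo q, hence lie in I, and multiplying them by h / q gives h and F.
          divideByI : ∀ y → Denominator (q * y) → Denominator (g * y) → Denominator y
          divideByI y Gq Gg i = a * x + b * x' + c' * u + k * - u' , sym (begin
            t                                                       ≈⟨ sym (*-identityˡ t) ⟩
            1# * t                                                  ≈⟨ *-congʳ comaximal ⟩
            (a * q + b * g + c' * h + k * F) * t                    ≈⟨ distribute (a * q) (b * g) (c' * h) (k * F) t ⟩
            a * q * t + b * g * t + c' * h * t + k * F * t
              ≈⟨ +-cong (+-cong (+-cong (*-assoc a q t) (*-assoc b g t)) (*-assoc c' h t)) (*-assoc k F t) ⟩
            a * (q * t) + b * (g * t) + c' * (h * t) + k * (F * t)
              ≈⟨ +-cong (+-cong (+-cong (*-congˡ (sym et)) (*-congˡ (sym et'))) (*-congˡ (h-part α β x i t eα et))) (*-congˡ (F-part α' β' x' i t eα' et')) ⟩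
            a * (x * p) + b * (x' * p) + c' * (u * p) + k * (- u' * p)
              ≈⟨ sym (+-cong (+-cong (+-cong (*-assoc a x p) (*-assoc b x' p)) (*-assoc c' u p)) (*-assoc k (- u') p)) ⟩
            a * x * p + b * x' * p + c' * u * p + k * - u' * p      ≈⟨ sym (distribute (a * x) (b * x') (c' * u) (k * - u') p) ⟩
            (a * x + b * x' + c' * u + k * - u') * p                ∎)
            where
            x = quotient (Gq i)
            x' = quotient (Gg i)
            t = y * γ ^ i
            p = q ^ i
            et : x * p ≈ q * t
            et = trans (equality (Gq i)) (*-assoc q y _)
            et' : x' * p ≈ g * t
            et' = trans (equality (Gg i)) (*-assoc g y _)
            -- `nilpotent` turns q ∣ q¹ and q ∣ gᵉ into the exponents 2 and e + 1.
            x∈I = radical x 2 (nilpotent q 1 (1# , *-comm 1# q) y Gq i x (equality (Gq i)))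
            x'∈I = radical x' (suc e) (nilpotent g e q∣gᵉ y Gg i x' (equality (Gg i)))
            α = proj₁ x∈I
            β = proj₁ (proj₂ x∈I)
            eα = proj₂ (proj₂ x∈I)
            α' = proj₁ x'∈I
            β' = proj₁ (proj₂ x'∈I)
            eα' = proj₂ (proj₂ x'∈I)
            u = α * h + - (β * F)
            u' = α' * h + - (β' * F)

          -- `g ^ e * q ^ i` is a multiple of `q ^ suc i`, hence a denominator. The factors g are
          -- then removed one at a time by `divideByI`, whose other hypothesis holds because q times
          -- a multiple of `q ^ i` is a multiple of `q ^ suc i`.
          descend : ∀ i → Denominator (q ^ suc i) → Denominator (q ^ i)
          descend i G = multiple 1# (sym (trans (*-identityˡ _) (*-identityˡ _))) (down e top)
            where
            down : ∀ j → Denominator (g ^ j * q ^ i) → Denominator (g ^ 0 * q ^ i)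
            down zero    H = H
            down (suc j) H = down j (divideByI (g ^ j * q ^ i)
              (multiple (g ^ j) (solve 3 (λ q u v → q :* (u :* v) := u :* (q :* v)) refl q (g ^ j) (q ^ i)) G)
              (multiple 1# (trans (sym (*-assoc g (g ^ j) (q ^ i))) (sym (*-identityˡ _))) H))
            top : Denominator (g ^ e * q ^ i)
            top = multiple r (begin
              g ^ e * q ^ i        ≈⟨ *-congʳ (sym (equality q∣gᵉ)) ⟩
              r * q * q ^ i        ≈⟨ *-assoc r q (q ^ i) ⟩
              r * (q * q ^ i)      ∎) G
              where r = quotient q∣gᵉ

          denominator-1 : ∀ d → Denominator (q ^ d) → Denominator 1#
          denominator-1 zero    G = G
          denominator-1 (suc d) G = denominator-1 d (descend d G)

        private
          low-powers : ∀ d i → i ℕ.< d → (q ^ i) ∣ (q ^ d * γ ^ i)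
          low-powers d i i<d = q ^ (d ℕ.∸ i) * γ ^ i , (begin
              q ^ (d ℕ.∸ i) * γ ^ i * q ^ i      ≈⟨ solve 3 (λ u v w → u :* v :* w := u :* w :* v) refl (q ^ (d ℕ.∸ i)) (γ ^ i) (q ^ i) ⟩
              q ^ (d ℕ.∸ i) * q ^ i * γ ^ i      ≈⟨ *-congʳ (sym (^-homo-* q (d ℕ.∸ i) i)) ⟩
              q ^ (d ℕ.∸ i ℕ.+ i) * γ ^ i        ≈⟨ *-congʳ (^-congʳ q (ℕ.m∸n+n≡m (ℕ.<⇒≤ i<d))) ⟩
              q ^ d * γ ^ i                      ∎)

        -- The integral equation, of degree d, makes q^d a denominator. Descent reaches the
        -- denominator 1, and the exponent 1 in its definition is the claim.
        divides-integral : ∀ cs → homogeneous q γ cs ≈ 0# → q ∣ γ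
        divides-integral cs E≈0 = quotient q∣γ , (begin
          quotient q∣γ * q      ≈⟨ *-congˡ (sym (*-identityʳ q)) ⟩
          quotient q∣γ * q ^ 1  ≈⟨ equality q∣γ ⟩
          1# * (γ * 1#)         ≈⟨ trans (*-identityˡ _) (*-identityʳ γ) ⟩
          γ                     ∎)
          where
          q∣γ : (q ^ 1) ∣ (1# * γ ^ 1)
          q∣γ = denominator-1 (length cs) (extend cs E≈0 (q ^ length cs) (low-powers (length cs))) 1

-- Binomial coefficients and the Frobenius map modulo a prime.

prime∣!⇒≤ : ∀ {p} → Prime p → ∀ m → p ℕ.∣ m ! → p ℕ.≤ m
prime∣!⇒≤ p-prime zero    p∣1 = contradiction (ℕ.∣⇒≤ p∣1) (ℕ.<⇒≱ (ℕ.nonTrivial⇒n>1 _ {{prime⇒nonTrivial p-prime}}))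
prime∣!⇒≤ p-prime (suc m) p∣ with euclidsLemma (suc m) (m !) p-prime p∣
... | inj₁ p∣1+m = ℕ.∣⇒≤ p∣1+m
... | inj₂ p∣m!  = ℕ.m≤n⇒m≤1+n (prime∣!⇒≤ p-prime m p∣m!)

prime∣C : ∀ {p k} → Prime p → 0 ℕ.< k → k ℕ.< p → p ℕ.∣ p C k
prime∣C {p} {k} p-prime 0<k k<p with euclidsLemma (p C k) (k ! ℕ.* (p ℕ.∸ k) !) p-prime p∣product
  where
  instance
    nz : ℕ.NonZero (k ! ℕ.* (p ℕ.∸ k) !)
    nz = k ℕ.!* (p ℕ.∸ k) !≢0
  p∣p! : ∀ {p} → 0 ℕ.< p → p ℕ.∣ p !
  p∣p! {suc p} _ = ℕ.m∣m*n (p !)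
  p∣product : p ℕ.∣ (p C k) ℕ.* (k ! ℕ.* (p ℕ.∸ k) !)
  p∣product = ≡.subst (p ℕ.∣_) (≡.sym (≡.trans
    (cong (ℕ._* (k ! ℕ.* (p ℕ.∸ k) !)) (nCk≡n!/k![n-k]! (ℕ.<⇒≤ k<p)))
    (ℕ.m/n*n≡m (k![n∸k]!∣n! (ℕ.<⇒≤ k<p))))) (p∣p! (ℕ.<-trans 0<k k<p))
... | inj₁ p∣C = p∣C
... | inj₂ p∣k![p-k]! with euclidsLemma (k !) _ p-prime p∣k![p-k]!
...   | inj₁ p∣k!     = contradiction (prime∣!⇒≤ p-prime k p∣k!) (ℕ.<⇒≱ k<p)
...   | inj₂ p∣[p-k]! = contradiction (prime∣!⇒≤ p-prime (p ℕ.∸ k) p∣[p-k]!) (ℕ.<⇒≱ (ℕ.∸-monoʳ-< 0<k (ℕ.<⇒≤ k<p)))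

module Frobenius {c ℓ : Level} (R : CommutativeRing c ℓ) where
  open Ring R
    using (*-congʳ; *-congˡ; *-identityʳ; *-identityˡ; +-cong; +-congʳ; +-congˡ; +-identityʳ; 0#; 1#; Carrier
          ; ^-assocʳ; ^-congʳ; ^-congˡ; _*_; _+_; _:*_; _:+_; _:=_; _^_; _·_; _∎; _≈_; begin_
          ; commutativeSemiring; con; refl; semiring; solve; step-≈-⟩; step-≡-⟨; step-≡-⟩; sym; trans; ×-assoc-*
          ; ×-congʳ; ×1-homo-*; ι)
  open SemiringSum semiring using (sum; sum-init-last; sum-cong-≋)
  open BinomialTheorem commutativeSemiring using (theorem; binomialTerm)

  ·≈ι* : ∀ n x → n · x ≈ ι (+ n) * x
  ·≈ι* n x = sym (trans (×-assoc-* n 1# x) (×-congʳ n (*-identityˡ x)))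

  ι-*ℕ : ∀ m n → ι (+ (m ℕ.* n)) ≈ ι (+ m) * ι (+ n)
  ι-*ℕ = ×1-homo-*

  private
    sum-multiple : ∀ k z {n} (f : Fin n → Carrier) → (∀ i → ∃[ s ] f i ≈ k * (z * s)) →
                   ∃[ s ] sum f ≈ k * (z * s)
    sum-multiple k z {zero}  f h = 0# , solve 2 (λ k z → con 0ℤ := k :* (z :* con 0ℤ)) refl k z
    sum-multiple k z {suc n} f h with s , e ← h zero | t , e' ← sum-multiple k z (λ i → f (suc i)) (λ i → h (suc i)) =
      s + t , trans (+-cong e e') (solve 4 (λ k z s t → k :* (z :* s) :+ k :* (z :* t) := k :* (z :* (s :+ t))) refl k z s t)

  -- The correction term is recorded as a multiple of x, not only of p.
  frobenius : ∀ {p} → Prime p → ∀ x y → ∃[ s ] (x + y) ^ p ≈ x ^ p + y ^ p + ι (+ p) * (x * s)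
  frobenius {zero}        p-prime x y = contradiction (prime⇒nonTrivial p-prime) λ ()
  frobenius {p@(suc p-1)} p-prime x y = s , (begin
      (x + y) ^ p                                       ≈⟨ theorem p x y ⟩
      term zero + sum (λ i → term (suc i))              ≈⟨ +-congˡ (sum-init-last (λ i → term (suc i))) ⟩
      term zero + (sum middle + term (suc (Fin.fromℕ p-1)))  ≈⟨ +-cong first (+-cong e last) ⟩
      y ^ p + (ι (+ p) * (x * s) + x ^ p)               ≈⟨ solve 3 (λ u v w → u :+ (v :+ w) := w :+ u :+ v) refl (y ^ p) (ι (+ p) * (x * s)) (x ^ p) ⟩
      x ^ p + y ^ p + ι (+ p) * (x * s)                 ∎)
    where
    term : Fin (suc p) → Carrier
    term = binomialTerm x y p
    middle : Fin p-1 → Carrier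
    middle i = term (suc (Fin.inject₁ i))

    first : term zero ≈ y ^ p
    first = trans (+-identityʳ _) (*-identityˡ _)

    last : term (suc (Fin.fromℕ p-1)) ≈ x ^ p
    last = begin
      (p C suc (toℕ (Fin.fromℕ p-1))) · (x ^ suc (toℕ (Fin.fromℕ p-1)) * y ^ (p-1 ℕ.∸ toℕ (Fin.fromℕ p-1)))
        ≡⟨ cong (λ k → (p C suc k) · (x ^ suc k * y ^ (p-1 ℕ.∸ k))) (Fin.toℕ-fromℕ p-1) ⟩
      (p C p) · (x ^ p * y ^ (p-1 ℕ.∸ p-1))
        ≡⟨ ≡.cong₂ (λ k l → k · (x ^ p * y ^ l)) (nCn≡1 p) (ℕ.n∸n≡0 p-1) ⟩
      1 · (x ^ p * 1#)                            ≈⟨ trans (+-identityʳ _) (*-identityʳ _) ⟩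
      x ^ p                                       ∎

    middle-multiple : ∀ i → ∃[ s ] middle i ≈ ι (+ p) * (x * s)
    middle-multiple i with prime∣C {p} {suc (toℕ (Fin.inject₁ i))} p-prime (s≤s z≤n)
                             (s≤s (≡.subst (ℕ._< p-1) (≡.sym (Fin.toℕ-inject₁ i)) (Fin.toℕ<n i)))
    ... | divides u eq = ι (+ u) * (x ^ k * w) , (begin
      (p C suc k) · (x ^ suc k * w)               ≈⟨ ·≈ι* (p C suc k) _ ⟩
      ι (+ (p C suc k)) * (x ^ suc k * w)         ≡⟨ cong (λ n → ι (+ n) * (x ^ suc k * w)) eq ⟩
      ι (+ (u ℕ.* p)) * (x ^ suc k * w)           ≈⟨ *-congʳ (ι-*ℕ u p) ⟩
      ι (+ u) * ι (+ p) * (x * x ^ k * w)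
        ≈⟨ solve 5 (λ u p x v w → u :* p :* (x :* v :* w) := p :* (x :* (u :* (v :* w)))) refl (ι (+ u)) (ι (+ p)) x (x ^ k) w ⟩
      ι (+ p) * (x * (ι (+ u) * (x ^ k * w)))     ∎)
      where
      k = toℕ (Fin.inject₁ i)
      w = y ^ (p-1 ℕ.∸ k)

    middle-sum : ∃[ s ] sum middle ≈ ι (+ p) * (x * s)
    middle-sum = sum-multiple (ι (+ p)) x middle middle-multiple
    s = proj₁ middle-sum
    e = proj₂ middle-sum

  private
    ^-pred : ∀ x n → 0 ℕ.< n → x ^ n ≈ x * x ^ ℕ.pred n
    ^-pred x (suc n) _ = refl

  -- `frobenius` is applied twice: by the induction hypothesis the base is (B + A) + y^P with A =
  -- x^P and B = p x s₁. Every new term keeps the factor p x, because B contains it and A contains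
  -- x.
  frobenius-^ : ∀ {p} → Prime p → ∀ k x y → ∃[ s ] (x + y) ^ (p ℕ.^ k) ≈ x ^ (p ℕ.^ k) + y ^ (p ℕ.^ k) + ι (+ p) * (x * s)
  frobenius-^ {p} p-prime zero    x y = 0# , solve 3 (λ x y p → (x :+ y) :* con 1ℤ := x :* con 1ℤ :+ y :* con 1ℤ :+ p :* (x :* con 0ℤ)) refl x y (ι (+ p))
  frobenius-^ {p} p-prime (suc k) x y = s₁ * B₁ + q * s₁ * s₃ + (x₁ + q * s₁) * s₂ , (begin
      (x + y) ^ (p ℕ.* P)                                  ≈⟨ power (x + y) ⟩
      ((x + y) ^ P) ^ p                                    ≈⟨ ^-congˡ p (trans (proj₂ ih) (solve 3 (λ x y z → x :+ y :+ z := (z :+ x) :+ y) refl A (y ^ P) B)) ⟩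
      ((B + A) + y ^ P) ^ p                                ≈⟨ proj₂ (frobenius p-prime (B + A) (y ^ P)) ⟩
      (B + A) ^ p + (y ^ P) ^ p + q * ((B + A) * s₂)       ≈⟨ +-congʳ (+-congʳ (proj₂ (frobenius p-prime B A))) ⟩
      (B ^ p + A ^ p + q * (B * s₃)) + (y ^ P) ^ p + q * ((B + A) * s₂)
        ≈⟨ +-cong (+-congʳ (+-congʳ (+-congʳ (^-pred B p p>0)))) (*-congˡ (*-congʳ (+-congˡ (^-pred x P P>0)))) ⟩
      (B * B₁ + A ^ p + q * (B * s₃)) + (y ^ P) ^ p + q * ((B + x * x₁) * s₂)
        ≈⟨ rearrange (A ^ p) ((y ^ P) ^ p) B₁ ⟩
      A ^ p + (y ^ P) ^ p + q * (x * (s₁ * B₁ + q * s₁ * s₃ + (x₁ + q * s₁) * s₂))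
        ≈⟨ +-congʳ (sym (+-cong (power x) (power y))) ⟩
      x ^ (p ℕ.* P) + y ^ (p ℕ.* P) + q * (x * (s₁ * B₁ + q * s₁ * s₃ + (x₁ + q * s₁) * s₂)) ∎)
    where
    q = ι (+ p)
    P = p ℕ.^ k
    p>0 : 0 ℕ.< p
    p>0 = ℕ.>-nonZero⁻¹ p {{prime⇒nonZero p-prime}}
    P>0 : 0 ℕ.< P
    P>0 = ℕ.m^n>0 p {{prime⇒nonZero p-prime}} k
    ih = frobenius-^ p-prime k x y
    s₁ = proj₁ ih
    A = x ^ P
    B = q * (x * s₁)
    s₂ = proj₁ (frobenius p-prime (B + A) (y ^ P))
    s₃ = proj₁ (frobenius p-prime B A)
    B₁ = B ^ ℕ.pred p
    x₁ = x ^ ℕ.pred P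
    power : ∀ z → z ^ (p ℕ.* P) ≈ (z ^ P) ^ p
    power z = trans (^-congʳ z (ℕ.*-comm p P)) (sym (^-assocʳ z P p))
    rearrange : ∀ Aᵖ Y B₁ → (B * B₁ + Aᵖ + q * (B * s₃)) + Y + q * ((B + x * x₁) * s₂) ≈
                Aᵖ + Y + q * (x * (s₁ * B₁ + q * s₁ * s₃ + (x₁ + q * s₁) * s₂))
    rearrange Aᵖ Y B₁ = begin
      (B * B₁ + Aᵖ + q * (B * s₃)) + Y + q * ((B + x * x₁) * s₂)
        ≈⟨ solve 6 (λ u v a Y q t → (u :+ a :+ q :* v) :+ Y :+ q :* t := a :+ Y :+ (u :+ q :* (v :+ t))) refl (B * B₁) (B * s₃) Aᵖ Y q ((B + x * x₁) * s₂) ⟩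
      Aᵖ + Y + (B * B₁ + q * (B * s₃ + (B + x * x₁) * s₂))
        ≈⟨ +-congˡ (solve 7 (λ q x s₁ b s₃ x₁ s₂ → q :* (x :* s₁) :* b :+ q :* (q :* (x :* s₁) :* s₃ :+ (q :* (x :* s₁) :+ x :* x₁) :* s₂)
             := q :* (x :* (s₁ :* b :+ q :* s₁ :* s₃ :+ (x₁ :+ q :* s₁) :* s₂))) refl q x s₁ B₁ s₃ x₁ s₂) ⟩
      Aᵖ + Y + q * (x * (s₁ * B₁ + q * s₁ * s₃ + (x₁ + q * s₁) * s₂)) ∎

-- Integrality by elimination over ℤ[t].

module Z = PolyTheory ℤ.+-*-commutativeRing
  using (*-assoc; *-comm; *-congʳ; *-congˡ; *-identityˡ; +-cong; +-congʳ; +-congˡ; +-identityʳ; -_; -‿cong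
        ; -‿distribˡ-*; 0∷-≈[]; 1#; :-_; C; C*-map; C-*; C-^; C-cong; D; Monic; Monic-*; Monic-X^; Top; Top-*
        ; Top-+; Top-C; Top-[]; Top-cong; Top-neg; Top-raise; Top-∷; Top-◃; X; ^-assocʳ; ^-congˡ; _*_; _+_; _,_
        ; _:*_; _:+_; _:-_; _:=_; _^_; _∎; _∣_; _≈_; above; at; begin_; coeff; coeff-+; coeff-C*; coeff-neg
        ; coeffwise; coeff₀-*; con; divide; leading; monic-cofactor; polynomialRing; refl; reflexive
        ; remainder-unique; solve; step-≈-⟩; step-≡-⟨; step-≡-⟩; sym; trans; x≈y⇒x∙y⁻¹≈ε; zeroʳ; zeroˡ; ι
        ; ∷-as-sum; ∷-cong)

module Integral {c ℓ : Level} (K : CommutativeRing c ℓ) where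
  open Ring K
    using (*-congʳ; *-congˡ; *-identityˡ; +-cong; +-congʳ; +-congˡ; +-identityʳ; +-identityˡ; -0#≈0#; -_; -‿cong
          ; -‿distribˡ-*; -‿inverseʳ; 0#; :-_; Carrier; _*_; _+_; _:*_; _:+_; _:-_; _:=_; _∎; _≈_; begin_; con
          ; eval; refl; reflexive; semiring; solve; step-≈-⟩; sym; trans; x∙y⁻¹≈ε⇒x≈y; zeroʳ; zeroˡ; ι; ι-*; ι-+
          ; ι-1; ι-neg)
  open SemiringSum semiring using (sum; *-distribˡ-sum; sum-cong-≋)

  module _ (α : Carrier) where
    private
      ⟦_⟧ : List ℤ → Carrier
      ⟦ f ⟧ = eval f α

    eval-+ : ∀ f g → ⟦ f Z.+ g ⟧ ≈ ⟦ f ⟧ + ⟦ g ⟧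
    eval-+ []      g       = sym (+-identityˡ _)
    eval-+ (a ∷ f) []      = sym (+-identityʳ _)
    eval-+ (a ∷ f) (b ∷ g) = begin
      ι (a ℤ.+ b) + α * ⟦ f Z.+ g ⟧               ≈⟨ +-cong (ι-+ a b) (*-congˡ (eval-+ f g)) ⟩
      (ι a + ι b) + α * (⟦ f ⟧ + ⟦ g ⟧)
        ≈⟨ solve 5 (λ a b x f g → (a :+ b) :+ x :* (f :+ g) := (a :+ x :* f) :+ (b :+ x :* g)) refl (ι a) (ι b) α ⟦ f ⟧ ⟦ g ⟧ ⟩
      (ι a + α * ⟦ f ⟧) + (ι b + α * ⟦ g ⟧)       ∎

    eval-map : ∀ a f → ⟦ map (a ℤ.*_) f ⟧ ≈ ι a * ⟦ f ⟧
    eval-map a []      = sym (zeroʳ _)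
    eval-map a (b ∷ f) = begin
      ι (a ℤ.* b) + α * ⟦ map (a ℤ.*_) f ⟧        ≈⟨ +-cong (ι-* a b) (*-congˡ (eval-map a f)) ⟩
      ι a * ι b + α * (ι a * ⟦ f ⟧)
        ≈⟨ solve 4 (λ a b x f → a :* b :+ x :* (a :* f) := a :* (b :+ x :* f)) refl (ι a) (ι b) α ⟦ f ⟧ ⟩
      ι a * (ι b + α * ⟦ f ⟧)                     ∎

    eval-neg : ∀ f → ⟦ Z.- f ⟧ ≈ - ⟦ f ⟧
    eval-neg []      = sym -0#≈0#
    eval-neg (a ∷ f) = begin
      ι (ℤ.- a) + α * ⟦ Z.- f ⟧                   ≈⟨ +-cong (ι-neg a) (*-congˡ (eval-neg f)) ⟩
      - ι a + α * - ⟦ f ⟧                         ≈⟨ solve 3 (λ a x f → :- a :+ x :* :- f := :- (a :+ x :* f)) refl (ι a) α ⟦ f ⟧ ⟩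
      - (ι a + α * ⟦ f ⟧)                         ∎

    eval-* : ∀ f g → ⟦ f Z.* g ⟧ ≈ ⟦ f ⟧ * ⟦ g ⟧
    eval-* []      g = sym (zeroˡ _)
    eval-* (a ∷ f) g = begin
      ⟦ map (a ℤ.*_) g Z.+ (0ℤ ∷ f Z.* g) ⟧       ≈⟨ eval-+ (map (a ℤ.*_) g) (0ℤ ∷ f Z.* g) ⟩
      ⟦ map (a ℤ.*_) g ⟧ + (0# + α * ⟦ f Z.* g ⟧) ≈⟨ +-cong (eval-map a g) (+-congˡ (*-congˡ (eval-* f g))) ⟩
      ι a * ⟦ g ⟧ + (0# + α * (⟦ f ⟧ * ⟦ g ⟧))
        ≈⟨ solve 4 (λ a x f g → a :* g :+ (con 0ℤ :+ x :* (f :* g)) := (a :+ x :* f) :* g) refl (ι a) α ⟦ f ⟧ ⟦ g ⟧ ⟩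
      (ι a + α * ⟦ f ⟧) * ⟦ g ⟧                   ∎

    private
      eval-zero : ∀ f → f Z.≈ [] → ⟦ f ⟧ ≈ 0#
      eval-zero []      e = refl
      eval-zero (a ∷ f) e = begin
        ι a + α * ⟦ f ⟧      ≈⟨ +-cong (reflexive (cong ι (Z.at e 0))) (*-congˡ (eval-zero f (Z.coeffwise λ i → Z.at e (suc i)))) ⟩
        0# + α * 0#          ≈⟨ trans (+-identityˡ _) (zeroʳ α) ⟩
        0#                   ∎

    eval-cong : ∀ f g → f Z.≈ g → ⟦ f ⟧ ≈ ⟦ g ⟧
    eval-cong f g e = x∙y⁻¹≈ε⇒x≈y _ _ (begin
      ⟦ f ⟧ + - ⟦ g ⟧        ≈⟨ +-congˡ (sym (eval-neg g)) ⟩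
      ⟦ f ⟧ + ⟦ Z.- g ⟧      ≈⟨ sym (eval-+ f (Z.- g)) ⟩
      ⟦ f Z.+ Z.- g ⟧        ≈⟨ eval-zero _ (Z.x≈y⇒x∙y⁻¹≈ε e) ⟩
      0#                     ∎)

    δ : ∀ {n} → Fin n → Fin n → ℤ
    δ zero    zero    = 1ℤ
    δ zero    (suc j) = 0ℤ
    δ (suc i) zero    = 0ℤ
    δ (suc i) (suc j) = δ i j

    -- Gaussian elimination over ℤ[t] acting on K through t ↦ α. The pivots
    -- stay monic because the off-diagonal entries have smaller degree.
    eliminate : ∀ n d (P : Fin n → Fin n → List ℤ) → (∀ i j → Z.Top d (P i j) (δ i j)) →
                (v : Fin n → Carrier) → (∀ i → sum (λ j → ⟦ P i j ⟧ * v j) ≈ 0#) →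
                ∃[ e ] ∃[ G ] Z.Monic e G × (∀ j → ⟦ G ⟧ * v j ≈ 0#)
    eliminate zero    d P top v rel = 0 , Z.C 1ℤ , Z.Top-C 1ℤ , λ ()
    eliminate (suc n) d P top v rel = e ℕ.+ d , G Z.* p , Z.Monic-* G p monic (top zero zero) , kills'
      where
      p = P zero zero
      P' : Fin n → Fin n → List ℤ
      P' i j = p Z.* P (suc i) (suc j) Z.+ Z.- (P (suc i) zero Z.* P zero (suc j))

      -- Off the diagonal δ is 0, so the subtracted product contributes 0 · 0 in degree d + d and
      -- leaves the pivots monic.
      top' : ∀ i j → Z.Top (d ℕ.+ d) (P' i j) (δ i j)
      top' i j = Z.Top-cong Z.refl (≡.trans (ℤ.+-identityʳ _) (ℤ.*-identityˡ (δ i j)))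
        (Z.Top-+ (Z.Top-* p (P (suc i) (suc j)) (top zero zero) (top (suc i) (suc j)))
                 (Z.Top-neg (Z.Top-* (P (suc i) zero) (P zero (suc j)) (top (suc i) zero) (top zero (suc j)))))

      row : Fin (suc n) → Carrier
      row i = sum (λ j → ⟦ P i (suc j) ⟧ * v (suc j))

      row-≈ : ∀ i → row i ≈ - (⟦ P i zero ⟧ * v zero)
      row-≈ i = begin
        row i                                ≈⟨ solve 2 (λ r u → r := (u :+ r) :- u) refl (row i) u ⟩
        (u + row i) + - u                    ≈⟨ +-congʳ (rel i) ⟩
        0# + - u                             ≈⟨ +-identityˡ _ ⟩
        - u                                  ∎
        where u = ⟦ P i zero ⟧ * v zero

      entry : ∀ i j → ⟦ P' i j ⟧ ≈ ⟦ p ⟧ * ⟦ P (suc i) (suc j) ⟧ + - ⟦ P (suc i) zero ⟧ * ⟦ P zero (suc j) ⟧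
      entry i j = begin
        ⟦ P' i j ⟧
          ≈⟨ eval-+ (p Z.* P (suc i) (suc j)) _ ⟩
        ⟦ p Z.* P (suc i) (suc j) ⟧ + ⟦ Z.- (P (suc i) zero Z.* P zero (suc j)) ⟧
          ≈⟨ +-cong (eval-* p _) (trans (eval-neg (P (suc i) zero Z.* P zero (suc j))) (-‿cong (eval-* (P (suc i) zero) _))) ⟩
        ⟦ p ⟧ * ⟦ P (suc i) (suc j) ⟧ + - (⟦ P (suc i) zero ⟧ * ⟦ P zero (suc j) ⟧)
          ≈⟨ +-congˡ (-‿distribˡ-* _ _) ⟩
        ⟦ p ⟧ * ⟦ P (suc i) (suc j) ⟧ + - ⟦ P (suc i) zero ⟧ * ⟦ P zero (suc j) ⟧ ∎

      sum-linear : ∀ {m} a b (f g w : Fin m → Carrier) →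
        sum (λ j → (a * f j + b * g j) * w j) ≈ a * sum (λ j → f j * w j) + b * sum (λ j → g j * w j)
      sum-linear {zero}  a b f g w = solve 2 (λ a b → con 0ℤ := a :* con 0ℤ :+ b :* con 0ℤ) refl a b
      sum-linear {suc m} a b f g w = begin
        (a * f₀ + b * g₀) * w₀ + sum (λ j → (a * f (suc j) + b * g (suc j)) * w (suc j))
          ≈⟨ +-congˡ (sum-linear a b (λ j → f (suc j)) (λ j → g (suc j)) (λ j → w (suc j))) ⟩
        (a * f₀ + b * g₀) * w₀ + (a * F + b * H)
          ≈⟨ solve 7 (λ a b f g w F H → (a :* f :+ b :* g) :* w :+ (a :* F :+ b :* H) := a :* (f :* w :+ F) :+ b :* (g :* w :+ H)) refl a b f₀ g₀ w₀ F H ⟩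
        a * (f₀ * w₀ + F) + b * (g₀ * w₀ + H) ∎
        where
        f₀ = f zero
        g₀ = g zero
        w₀ = w zero
        F = sum (λ j → f (suc j) * w (suc j))
        H = sum (λ j → g (suc j) * w (suc j))

      rel' : ∀ i → sum (λ j → ⟦ P' i j ⟧ * v (suc j)) ≈ 0#
      rel' i = begin
        sum (λ j → ⟦ P' i j ⟧ * v (suc j))
          ≈⟨ sum-cong-≋ (λ j → *-congʳ (entry i j)) ⟩
        sum (λ j → (⟦ p ⟧ * ⟦ P (suc i) (suc j) ⟧ + - ⟦ P (suc i) zero ⟧ * ⟦ P zero (suc j) ⟧) * v (suc j))
          ≈⟨ sum-linear ⟦ p ⟧ (- ⟦ P (suc i) zero ⟧) (λ j → ⟦ P (suc i) (suc j) ⟧) (λ j → ⟦ P zero (suc j) ⟧) (λ j → v (suc j)) ⟩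
        ⟦ p ⟧ * row (suc i) + - ⟦ P (suc i) zero ⟧ * row zero
          ≈⟨ +-cong (*-congˡ (row-≈ (suc i))) (*-congˡ (row-≈ zero)) ⟩
        ⟦ p ⟧ * - (⟦ P (suc i) zero ⟧ * v zero) + - ⟦ P (suc i) zero ⟧ * - (⟦ p ⟧ * v zero)
          ≈⟨ solve 3 (λ p r v → p :* :- (r :* v) :+ :- r :* :- (p :* v) := con 0ℤ) refl ⟦ p ⟧ ⟦ P (suc i) zero ⟧ (v zero) ⟩
        0# ∎

      reduced = eliminate n (d ℕ.+ d) P' top' (λ j → v (suc j)) rel'
      e = proj₁ reduced
      G = proj₁ (proj₂ reduced)
      monic = proj₁ (proj₂ (proj₂ reduced))
      kills = proj₂ (proj₂ (proj₂ reduced))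

      zero-sum : ∀ {m} (f : Fin m → Carrier) → (∀ j → f j ≈ 0#) → sum f ≈ 0#
      zero-sum {zero}  f z = refl
      zero-sum {suc m} f z = trans (+-cong (z zero) (zero-sum (λ j → f (suc j)) (λ j → z (suc j)))) (+-identityˡ _)

      kills' : ∀ j → ⟦ G Z.* p ⟧ * v j ≈ 0#
      kills' (suc j) = begin
        ⟦ G Z.* p ⟧ * v (suc j)              ≈⟨ *-congʳ (eval-* G p) ⟩
        ⟦ G ⟧ * ⟦ p ⟧ * v (suc j)            ≈⟨ solve 3 (λ g p v → g :* p :* v := p :* (g :* v)) refl ⟦ G ⟧ ⟦ p ⟧ (v (suc j)) ⟩
        ⟦ p ⟧ * (⟦ G ⟧ * v (suc j))          ≈⟨ trans (*-congˡ (kills j)) (zeroʳ _) ⟩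
        0#                                   ∎
      -- Row zero gives p v₀ = - row zero, a combination of the remaining v's, each of which G
      -- annihilates.
      kills' zero = begin
        ⟦ G Z.* p ⟧ * v zero                 ≈⟨ *-congʳ (eval-* G p) ⟩
        ⟦ G ⟧ * ⟦ p ⟧ * v zero               ≈⟨ solve 3 (λ g p v → g :* p :* v := :- (g :* :- (p :* v))) refl ⟦ G ⟧ ⟦ p ⟧ (v zero) ⟩
        - (⟦ G ⟧ * - (⟦ p ⟧ * v zero))       ≈⟨ -‿cong (*-congˡ (sym (row-≈ zero))) ⟩
        - (⟦ G ⟧ * row zero)                 ≈⟨ -‿cong (*-distribˡ-sum ⟦ G ⟧ (λ j → ⟦ P zero (suc j) ⟧ * v (suc j))) ⟩
        - sum (λ j → ⟦ G ⟧ * (⟦ P zero (suc j) ⟧ * v (suc j)))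
          ≈⟨ -‿cong (zero-sum _ (λ j → begin
               ⟦ G ⟧ * (⟦ P zero (suc j) ⟧ * v (suc j))    ≈⟨ solve 3 (λ g p v → g :* (p :* v) := p :* (g :* v)) refl ⟦ G ⟧ ⟦ P zero (suc j) ⟧ (v (suc j)) ⟩
               ⟦ P zero (suc j) ⟧ * (⟦ G ⟧ * v (suc j))    ≈⟨ trans (*-congˡ (kills j)) (zeroʳ _) ⟩
               0#                                          ∎)) ⟩
        - 0#                                 ≈⟨ -0#≈0# ⟩
        0#                                   ∎

    δ-sum : ∀ {m} (i : Fin m) (w : Fin m → Carrier) → sum (λ j → ι (δ i j) * w j) ≈ w i
    δ-sum {suc m} zero w = begin
      ι 1ℤ * w zero + sum (λ j → ι 0ℤ * w (suc j))     ≈⟨ +-cong (trans (*-congʳ ι-1) (*-identityˡ _)) (all-zero (λ j → w (suc j))) ⟩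
      w zero + 0#                                      ≈⟨ +-identityʳ _ ⟩
      w zero                                           ∎
      where
      all-zero : ∀ {m} (w : Fin m → Carrier) → sum (λ j → ι 0ℤ * w j) ≈ 0#
      all-zero {zero}  w = refl
      all-zero {suc m} w = trans (+-cong (zeroˡ _) (all-zero (λ j → w (suc j)))) (+-identityˡ _)
    δ-sum {suc m} (suc i) w = trans (+-cong (zeroˡ _) (δ-sum i (λ j → w (suc j)))) (+-identityˡ _)

    -- The determinant trick: v lies in the kernel of the matrix t I - a at t = α. Elimination on
    -- that matrix, whose entries have degree at most 1 in t, replaces determinant and adjugate.
    finite⇒annihilated : ∀ {n} (v : Fin n → Carrier) (a : Fin n → Fin n → ℤ) →
                         (∀ i → α * v i ≈ sum (λ j → ι (a i j) * v j)) →
                         ∃[ e ] ∃[ G ] Z.Monic e G × (∀ j → ⟦ G ⟧ * v j ≈ 0#)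
    finite⇒annihilated {n} v a rel = eliminate n 1 P top v relP
      where
      P : Fin n → Fin n → List ℤ
      P i j = (ℤ.- a i j) ∷ δ i j ∷ []

      top : ∀ i j → Z.Top 1 (P i j) (δ i j)
      top i j = Z.Top-∷ (ℤ.- a i j) (Z.Top-C (δ i j))

      split : ∀ {m} (b d w : Fin m → Carrier) →
              sum (λ j → (- b j + α * (d j + α * 0#)) * w j) ≈ α * sum (λ j → d j * w j) + - sum (λ j → b j * w j)
      split {zero}  b d w = solve 1 (λ x → con 0ℤ := x :* con 0ℤ :- con 0ℤ) refl α
      split {suc m} b d w = trans (+-congˡ (split (λ j → b (suc j)) (λ j → d (suc j)) (λ j → w (suc j))))
        (solve 6 (λ b d w x D B → (:- b :+ x :* (d :+ x :* con 0ℤ)) :* w :+ (x :* D :- B) := x :* (d :* w :+ D) :- (b :* w :+ B))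
          refl (b zero) (d zero) (w zero) α _ _)

      relP : ∀ i → sum (λ j → ⟦ P i j ⟧ * v j) ≈ 0#
      relP i = begin
        sum (λ j → ⟦ P i j ⟧ * v j)
          ≈⟨ sum-cong-≋ (λ j → *-congʳ (+-congʳ (ι-neg (a i j)))) ⟩
        sum (λ j → (- ι (a i j) + α * (ι (δ i j) + α * 0#)) * v j)
          ≈⟨ split (λ j → ι (a i j)) (λ j → ι (δ i j)) v ⟩
        α * sum (λ j → ι (δ i j) * v j) + - sum (λ j → ι (a i j) * v j)
          ≈⟨ +-cong (trans (*-congˡ (δ-sum i v)) (rel i)) refl ⟩
        sum (λ j → ι (a i j) * v j) + - sum (λ j → ι (a i j) * v j)
          ≈⟨ -‿inverseʳ _ ⟩
        0# ∎

-- Integers and polynomials modulo a prime.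

module ℤ' = Ring ℤ.+-*-commutativeRing
  using (1^n≈1; :-_; ^-assocʳ; ^-distrib-*; _:*_; _:+_; _:-_; _:=_; _^_; con; solve; ι)

module _ {q : ℕ} (q-prime : Prime q) where

  prime>1 : 1 ℕ.< q
  prime>1 = ℕ.nonTrivial⇒n>1 q {{prime⇒nonTrivial q-prime}}

  prime∤1 : ¬ (+ q ℤ.∣ 1ℤ)
  prime∤1 q∣1 = ℕ.<⇒≱ prime>1 (ℕ.∣⇒≤ (ℤ.∣⇒∣ᵤ q∣1))

  prime∣* : ∀ x y → + q ℤ.∣ x ℤ.* y → + q ℤ.∣ x ⊎ + q ℤ.∣ y
  prime∣* x y q∣xy with euclidsLemma ∣ x ∣ ∣ y ∣ q-prime (≡.subst (q ℕ.∣_) (ℤ.abs-* x y) (ℤ.∣⇒∣ᵤ q∣xy))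
  ... | inj₁ q∣x = inj₁ (ℤ.∣ᵤ⇒∣ q∣x)
  ... | inj₂ q∣y = inj₂ (ℤ.∣ᵤ⇒∣ q∣y)

  prime∣^ : ∀ x n → + q ℤ.∣ x ℤ.^ n → + q ℤ.∣ x
  prime∣^ x zero    q∣1 = contradiction q∣1 prime∤1
  prime∣^ x (suc n) q∣  with prime∣* x (x ℤ.^ n) q∣
  ... | inj₁ q∣x  = q∣x
  ... | inj₂ q∣xⁿ = prime∣^ x n q∣xⁿ

  prime∤⇒coprime : ∀ m → ¬ q ℕ.∣ m → Coprime q m
  prime∤⇒coprime m q∤m (d∣q , d∣m) with prime⇒irreducible q-prime d∣q
  ... | inj₁ d≡1    = d≡1
  ... | inj₂ ≡.refl = contradiction d∣m q∤m

  private
    bézout : ∀ m → ¬ q ℕ.∣ m → ∃[ y ] + q ℤ.∣ + m ℤ.* y ℤ.- 1ℤ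
    bézout m q∤m with Coprimality.coprime-Bézout (prime∤⇒coprime m q∤m)
    ... | ℕ.Bézout.+- x y eq = ℤ.- + y , ℤ.divides (ℤ.- + x) (begin
      + m ℤ.* (ℤ.- + y) ℤ.- 1ℤ          ≡⟨ ℤ'.solve 2 (λ m y → m ℤ'.:* (ℤ'.:- y) ℤ'.:- ℤ'.con 1ℤ ℤ'.:= ℤ'.:- (ℤ'.con 1ℤ ℤ'.:+ y ℤ'.:* m)) ≡.refl (+ m) (+ y) ⟩
      ℤ.- (1ℤ ℤ.+ + y ℤ.* + m)          ≡⟨ cong (λ z → ℤ.- (1ℤ ℤ.+ z)) (ℤ.pos-* y m) ⟨
      ℤ.- (+ (1 ℕ.+ y ℕ.* m))           ≡⟨ cong (λ z → ℤ.- + z) eq ⟩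
      ℤ.- (+ (x ℕ.* q))                 ≡⟨ cong ℤ.-_ (ℤ.pos-* x q) ⟩
      ℤ.- (+ x ℤ.* + q)                 ≡⟨ ℤ.neg-distribˡ-* (+ x) (+ q) ⟩
      ℤ.- + x ℤ.* + q                   ∎)
      where open ≡.≡-Reasoning
    ... | ℕ.Bézout.-+ x y eq = + y , ℤ.divides (+ x) (begin
      + m ℤ.* + y ℤ.- 1ℤ                ≡⟨ cong (ℤ._- 1ℤ) (ℤ.*-comm (+ m) (+ y)) ⟩
      + y ℤ.* + m ℤ.- 1ℤ                ≡⟨ cong (ℤ._- 1ℤ) (ℤ.pos-* y m) ⟨
      + (y ℕ.* m) ℤ.- 1ℤ                ≡⟨ cong (λ z → + z ℤ.- 1ℤ) eq ⟨
      + (1 ℕ.+ x ℕ.* q) ℤ.- 1ℤ          ≡⟨ ℤ'.solve 1 (λ z → (ℤ'.con 1ℤ ℤ'.:+ z) ℤ'.:- ℤ'.con 1ℤ ℤ'.:= z) ≡.refl (+ (x ℕ.* q)) ⟩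
      + (x ℕ.* q)                       ≡⟨ ℤ.pos-* x q ⟩
      + x ℤ.* + q                       ∎)
      where open ≡.≡-Reasoning

  abstract
    inverse-mod-prime : ∀ x → ¬ (+ q ℤ.∣ x) → ∃[ y ] + q ℤ.∣ x ℤ.* y ℤ.- 1ℤ
    inverse-mod-prime (+ m)    q∤x = bézout m (λ q∣m → q∤x (ℤ.∣ᵤ⇒∣ q∣m))
    inverse-mod-prime -[1+ m ] q∤x with bézout (suc m) (λ q∣m → q∤x (ℤ.∣ᵤ⇒∣ q∣m))
    ... | y , q∣ = ℤ.- y , ≡.subst (λ z → + q ℤ.∣ z ℤ.- 1ℤ)
      (ℤ'.solve 2 (λ m y → m ℤ'.:* y ℤ'.:= (ℤ'.:- m) ℤ'.:* (ℤ'.:- y)) ≡.refl (+ suc m) y) q∣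

module Modular (q : ℕ) where
  open Quotient ℤ.+-*-commutativeRing (+ q) public using (mod) renaming (quotientRing to ℤ/q)
  open PolyTheory ℤ/q public
  private module ℤ/q = Ring ℤ/q
            using (_^_; _≈_; sym; trans; zeroˡ)

  ∣⇒≈0 : ∀ {z} → + q ℤ.∣ z → z ℤ/q.≈ 0ℤ
  ∣⇒≈0 {z} (ℤ.divides r e) = mod (r , ≡.sym (≡.trans (ℤ.+-identityʳ z) e))

  ≈0⇒∣ : ∀ {z} → z ℤ/q.≈ 0ℤ → + q ℤ.∣ z
  ≈0⇒∣ {z} (mod (r , e)) = ℤ.divides r (≡.sym (≡.trans e (ℤ.+-identityʳ z)))

  from-∣ : ∀ {x y} → + q ℤ.∣ x ℤ.- y → x ℤ/q.≈ y
  from-∣ (ℤ.divides r e) = mod (r , ≡.sym e)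

  to-∣ : ∀ {x y} → x ℤ/q.≈ y → + q ℤ.∣ x ℤ.- y
  to-∣ (mod (r , e)) = ℤ.divides r (≡.sym e)

  ℤ/q-^ : ∀ x n → x ℤ/q.^ n ≡ x ℤ.^ n
  ℤ/q-^ x zero    = ≡.refl
  ℤ/q-^ x (suc n) = cong (x ℤ.*_) (ℤ/q-^ x n)

  ι≈C : ∀ z → ι z ≈ C z
  ι≈C (+ n)      = ι+≈C n
    where
    ι+≈C : ∀ n → ι (+ n) ≈ C (+ n)
    ι+≈C zero    = sym 0∷-≈[]
    ι+≈C (suc n) = +-congˡ {1#} (ι+≈C n)
  ι≈C -[1+ n ]   = -‿cong (ι≈C (+ suc n))

  C≈0 : ∀ {z} → + q ℤ.∣ z → C z ≈ 0#
  C≈0 q∣z = trans (C-cong (∣⇒≈0 q∣z)) 0∷-≈[]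

  ιq≈0 : ι (+ q) ≈ 0#
  ιq≈0 = trans (ι≈C (+ q)) (C≈0 ℤ.∣-refl)

  module _ (q-prime : Prime q) where

    unit : ∀ z → ¬ (+ q ℤ.∣ z) → ∃[ y ] C z * C y ≈ 1#
    unit z q∤z = proj₁ y , trans (sym (C-* z (proj₁ y))) (C-cong (from-∣ (proj₂ y)))
      where y = inverse-mod-prime q-prime z q∤z

    private
      X*tail : ∀ a f → a ℤ/q.≈ 0ℤ → (a ∷ f) ≈ X * f
      X*tail a f e = trans (∷-cong e refl) (sym (X*-∷ f))

    -- The constant term of f is nilpotent modulo a prime, hence zero. So f is x times a shorter
    -- polynomial, and the monic factor xⁿ cancels from the n-th power.
    reduced : ∀ f n → f ^ n ≈ [] → f ≈ []
    reduced []      n e = refl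
    reduced (a ∷ f) n e = trans (X*tail a f a≈0) (trans (*-congˡ {X} (reduced f n fⁿ≈0)) (zeroʳ X))
      where
      a≈0 : a ℤ/q.≈ 0ℤ
      a≈0 = ∣⇒≈0 (prime∣^ q-prime a n (≡.subst (+ q ℤ.∣_) (ℤ/q-^ a n)
              (≈0⇒∣ (ℤ/q.trans (ℤ/q.sym (coeff₀-^ (a ∷ f) n)) (at e 0)))))
      fⁿ≈0 : f ^ n ≈ []
      fⁿ≈0 = monic-cancelˡ (Monic-X^ n) (f ^ n) (begin
        X ^ n * f ^ n      ≈⟨ sym (^-distrib-* X f n) ⟩
        (X * f) ^ n        ≈⟨ ^-congˡ n (sym (X*tail a f a≈0)) ⟩
        (a ∷ f) ^ n        ≈⟨ e ⟩
        []                 ∎)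

    -- A separable g has reduced quotient: if γ ^ q = g ^ j w with 0 < j < q
    -- then differentiating gives g ∣ w, so g ^ q ∣ γ ^ q, which is impossible
    -- by degrees once γ is replaced by its nonzero remainder.
    module _ {n : ℕ} {g : List ℤ} (g-monic : Monic n g) (u v : List ℤ) (separable : u * g + v * D g ≈ 1#) where
      private
        module Q = Ring (Quotient.quotientRing polynomialRing g)
          using (^-congˡ; _^_; _∎; _≈_; begin_; step-≈-⟩; step-≡-⟨; step-≡-⟩; sym)

        raise : ∀ r w i → suc i ℕ.< q → r ^ q ≈ g ^ suc i * w → ∃[ w' ] r ^ q ≈ g ^ suc (suc i) * w'
        raise r w i 1+i<q e = w' , (begin
          r ^ q                             ≈⟨ e ⟩
          g ^ suc i * w                     ≈⟨ *-congˡ {g ^ suc i} w≈gw' ⟩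
          g ^ suc i * (g * w')              ≈⟨ solve 3 (λ g p w → (g :* p) :* (g :* w) := (g :* (g :* p)) :* w) refl g (g ^ i) w' ⟩
          g ^ suc (suc i) * w'              ∎)
          where
          q∤1+i : ¬ (+ q ℤ.∣ + suc i)
          q∤1+i q∣ = ℕ.<⇒≱ 1+i<q (ℕ.∣⇒≤ (ℤ.∣⇒∣ᵤ q∣))
          t = proj₁ (unit (+ suc i) q∤1+i)
          t-inverse : ι (+ suc i) * C t ≈ 1#
          t-inverse = trans (*-congʳ (ι≈C (+ suc i))) (proj₂ (unit (+ suc i) q∤1+i))
          k = ι (+ suc i)
          w' = u * w + - (v * (C t * D w))

          Dr^q≈0 : ∀ {q'} → q' ≡ q → D (r ^ q') ≈ []
          Dr^q≈0 {zero}   ≡.refl = 0∷-≈[]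
          Dr^q≈0 {suc q'} ≡.refl = begin
            D (r ^ suc q')                     ≈⟨ D-^ r q' ⟩
            ι (+ suc q') * (r ^ q' * D r)      ≈⟨ *-congʳ ιq≈0 ⟩
            0# * (r ^ q' * D r)                ≈⟨ zeroˡ (r ^ q' * D r) ⟩
            []                                 ∎

          -- In characteristic q the derivative of r^q is 0. Differentiating the right side and
          -- cancelling the monic common factor `g ^ i` leaves this relation.
          cancelled : k * (D g * w) + g * D w ≈ []
          cancelled = monic-cancelˡ (Monic-^ g i g-monic) (k * (D g * w) + g * D w) (begin
            g ^ i * (k * (D g * w) + g * D w)
              ≈⟨ solve 6 (λ p k d w g e → p :* (k :* (d :* w) :+ g :* e) := (k :* (p :* d)) :* w :+ (g :* p) :* e) refl (g ^ i) k (D g) w g (D w) ⟩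
            k * (g ^ i * D g) * w + g ^ suc i * D w     ≈⟨ +-congʳ (*-congʳ (sym (D-^ g i))) ⟩
            D (g ^ suc i) * w + g ^ suc i * D w         ≈⟨ sym (D-* (g ^ suc i) w) ⟩
            D (g ^ suc i * w)                           ≈⟨ D-cong (sym e) ⟩
            D (r ^ q)                                   ≈⟨ Dr^q≈0 ≡.refl ⟩
            []                                          ∎)

          g'w : D g * w ≈ - (C t * (g * D w))
          g'w = begin
            D g * w                                     ≈⟨ sym (*-identityˡ (D g * w)) ⟩
            1# * (D g * w)                              ≈⟨ *-congʳ (sym t-inverse) ⟩
            k * C t * (D g * w)                         ≈⟨ solve 4 (λ k t d e → k :* t :* d := t :* (k :* d :+ e) :- t :* e) refl k (C t) (D g * w) (g * D w) ⟩
            C t * (k * (D g * w) + g * D w) + - (C t * (g * D w))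
                                                        ≈⟨ +-congʳ (trans (*-congˡ {C t} cancelled) (zeroʳ (C t))) ⟩
            - (C t * (g * D w))                         ∎

          w≈gw' : w ≈ g * w'
          w≈gw' = begin
            w                                           ≈⟨ sym (*-identityˡ w) ⟩
            1# * w                                      ≈⟨ *-congʳ (sym separable) ⟩
            (u * g + v * D g) * w                       ≈⟨ solve 5 (λ u g v d w → (u :* g :+ v :* d) :* w := g :* (u :* w) :+ v :* (d :* w)) refl u g v (D g) w ⟩
            g * (u * w) + v * (D g * w)                 ≈⟨ +-congˡ {g * (u * w)} (*-congˡ {v} g'w) ⟩
            g * (u * w) + v * - (C t * (g * D w))
              ≈⟨ solve 6 (λ g u w v t e → g :* (u :* w) :+ v :* :- (t :* (g :* e)) := g :* (u :* w :- v :* (t :* e))) refl g u w v (C t) (D w) ⟩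
            g * w'                                      ∎

        raise-to : ∀ r i → suc i ℕ.≤ q → ∀ w → r ^ q ≈ g * w → ∃[ w' ] r ^ q ≈ g ^ suc i * w'
        raise-to r zero    _     w e = w , trans e (*-congʳ (sym (*-identityʳ g)))
        raise-to r (suc i) 1+i<q w e =
          let w' , e' = raise-to r i (ℕ.<⇒≤ 1+i<q) w e in raise r w' i 1+i<q e'

        frobenius-injective : ∀ γ → g ∣ (γ ^ q) → g ∣ γ
        frobenius-injective γ g∣γ^q = w₀ , (begin
          w₀ * g                ≈⟨ *-comm w₀ g ⟩
          g * w₀                ≈⟨ sym (+-identityʳ _) ⟩
          g * w₀ + []           ≈⟨ +-congˡ {g * w₀} (sym r≈0) ⟩
          g * w₀ + r            ≈⟨ sym e ⟩
          γ                     ∎)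
          where
          division = divide g-monic γ
          w₀ = proj₁ division
          r = proj₁ (proj₂ division)
          e : γ ≈ g * w₀ + r
          e = proj₁ (proj₂ (proj₂ division))
          r-top : Top n r 0ℤ
          r-top = proj₂ (proj₂ (proj₂ division))

          γ≋r : γ Q.≈ r
          γ≋r = Quotient.mod (w₀ , (begin
            w₀ * g                    ≈⟨ solve 3 (λ w g r → w :* g := (g :* w :+ r) :- r) refl w₀ g r ⟩
            (g * w₀ + r) + - r        ≈⟨ +-congʳ (sym e) ⟩
            γ + - r                   ∎))

          Q-^ : ∀ x k → x Q.^ k ≡ x ^ k
          Q-^ x zero    = ≡.refl
          Q-^ x (suc k) = cong (x *_) (Q-^ x k)

          g∣r^q : g ∣ (r ^ q)
          g∣r^q = Quotient.≋0⇒∣ polynomialRing g (≡.subst (Q._≈ 0#) (Q-^ r q) (Q.begin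
            r Q.^ q        Q.≈⟨ Q.^-congˡ q (Q.sym {γ} {r} γ≋r) ⟩
            γ Q.^ q        Q.≡⟨ Q-^ γ q ⟩
            γ ^ q          Q.≈⟨ Quotient.∣⇒≋0 polynomialRing g g∣γ^q ⟩
            0#             Q.∎))

          q-1<q : suc (ℕ.pred q) ≡ q
          q-1<q = ℕ.suc-pred q {{prime⇒nonZero q-prime}}

          r^q : ∃[ w ] r ^ q ≈ g ^ q * w
          r^q = ≡.subst (λ k → ∃[ w ] r ^ q ≈ g ^ k * w) q-1<q
            (raise-to r (ℕ.pred q) (ℕ.≤-reflexive q-1<q) (_∣ʳ_.quotient g∣r^q)
              (trans (sym (_∣ʳ_.equality g∣r^q)) (*-comm (_∣ʳ_.quotient g∣r^q) g)))

          0^ : ∀ k → 0 ℕ.< k → 0ℤ ℤ/q.^ k ℤ/q.≈ 0ℤ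
          0^ (suc k) _ = ℤ/q.zeroˡ (0ℤ ℤ/q.^ k)

          r≈0 : r ≈ []
          -- `r ^ q` has degree below q n, since deg r < n, and it is a multiple of the monic
          -- `g ^ q` of degree q n.
          r≈0 = reduced r q (remainder-unique (Monic-^ g q g-monic) (proj₁ r^q) (r ^ q) (sym (proj₂ r^q))
            (Top-cong refl (0^ q (ℕ.<-trans (s≤s z≤n) (prime>1 q-prime))) (Top-^ r q r-top)))

        iterate : ∀ m γ → g ∣ (γ ^ (q ℕ.^ m)) → g ∣ γ
        iterate zero    γ (w , e) = w , trans e (*-identityʳ γ)
        iterate (suc m) γ (w , e) = iterate m γ (frobenius-injective (γ ^ (q ℕ.^ m)) (w , (begin
          w * g                       ≈⟨ e ⟩
          γ ^ (q ℕ.* q ℕ.^ m)         ≈⟨ ^-congʳ γ (ℕ.*-comm q (q ℕ.^ m)) ⟩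
          γ ^ (q ℕ.^ m ℕ.* q)         ≈⟨ sym (^-assocʳ γ (q ℕ.^ m) q) ⟩
          (γ ^ (q ℕ.^ m)) ^ q         ∎)))

        n≤q^n : ∀ n → n ℕ.≤ q ℕ.^ n
        n≤q^n zero    = z≤n
        n≤q^n (suc n) = ℕ.≤-trans (ℕ.+-mono-≤ 1≤q^n (n≤q^n n)) (ℕ.≤-trans
          (ℕ.≤-reflexive (cong (q ℕ.^ n ℕ.+_) (≡.sym (ℕ.+-identityʳ (q ℕ.^ n)))))
          (ℕ.*-monoˡ-≤ (q ℕ.^ n) (prime>1 q-prime)))
          where
          1≤q^n : 1 ℕ.≤ q ℕ.^ n
          1≤q^n = ℕ.m^n>0 q {{prime⇒nonZero q-prime}} n

      -- Raising the exponent from k to q^k ≥ k reduces the claim to k applications of the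
      -- injectivity of Frobenius modulo g.
      separable⇒radical : ∀ γ k → g ∣ (γ ^ k) → g ∣ γ
      separable⇒radical γ k (w , e) = iterate k γ (γ ^ (q ℕ.^ k ℕ.∸ k) * w , (begin
        γ ^ (q ℕ.^ k ℕ.∸ k) * w * g          ≈⟨ *-assoc (γ ^ (q ℕ.^ k ℕ.∸ k)) w g ⟩
        γ ^ (q ℕ.^ k ℕ.∸ k) * (w * g)        ≈⟨ *-congˡ {γ ^ (q ℕ.^ k ℕ.∸ k)} e ⟩
        γ ^ (q ℕ.^ k ℕ.∸ k) * γ ^ k          ≈⟨ sym (^-homo-* γ (q ℕ.^ k ℕ.∸ k) k) ⟩
        γ ^ (q ℕ.^ k ℕ.∸ k ℕ.+ k)            ≈⟨ ^-congʳ γ (ℕ.m∸n+n≡m (n≤q^n k)) ⟩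
        γ ^ (q ℕ.^ k)                        ∎))

-- Reduction modulo q and the order ℤ[θ].

open PolyTheory using (_,_)

divide-coefficients : ∀ k P → (∀ i → k ℤ.∣ Z.coeff P i) → ∃[ T ] P Z.≈ Z.C k Z.* T
divide-coefficients k []      k∣ = [] , Z.sym (Z.zeroʳ (Z.C k))
divide-coefficients k (a ∷ P) k∣ with k∣ 0 | divide-coefficients k P (λ i → k∣ (suc i))
... | ℤ.divides t e | T , e' = t ∷ T , Z.coeffwise λ i → ≡.trans (go i) (≡.sym (Z.coeff-C* k (t ∷ T) i))
  where
  go : ∀ i → Z.coeff (a ∷ P) i ≡ k ℤ.* Z.coeff (t ∷ T) i
  go zero    = ≡.trans e (ℤ.*-comm t k)
  go (suc i) = ≡.trans (Z.at e' i) (Z.coeff-C* k T i)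

module Reduction (q : ℕ) where
  private module 𝔽 = Modular q
            using (D; Top; _*_; _+_; _^_; _≈_; at; coeff; coeffwise; to-∣; ℤ/q)

  -- ℤ/q has carrier ℤ, so both polynomial rings operate on the same lists. The two recursive
  -- definitions still have to be identified by induction.
  +-agree : ∀ f g → f 𝔽.+ g ≡ f Z.+ g
  +-agree []      g       = ≡.refl
  +-agree (a ∷ f) []      = ≡.refl
  +-agree (a ∷ f) (b ∷ g) = cong (a ℤ.+ b ∷_) (+-agree f g)

  *-agree : ∀ f g → f 𝔽.* g ≡ f Z.* g
  *-agree []      g = ≡.refl
  *-agree (a ∷ f) g = ≡.trans (+-agree (map (a ℤ.*_) g) _) (cong (λ h → map (a ℤ.*_) g Z.+ (0ℤ ∷ h)) (*-agree f g))

  ^-agree : ∀ f n → f 𝔽.^ n ≡ f Z.^ n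
  ^-agree f zero    = ≡.refl
  ^-agree f (suc n) = ≡.trans (*-agree f (f 𝔽.^ n)) (cong (f Z.*_) (^-agree f n))

  coeff-agree : ∀ f i → 𝔽.coeff f i ≡ Z.coeff f i
  coeff-agree []      i       = ≡.refl
  coeff-agree (a ∷ f) zero    = ≡.refl
  coeff-agree (a ∷ f) (suc i) = coeff-agree f i

  D-agree : ∀ f → 𝔽.D f ≡ Z.D f
  D-agree []      = ≡.refl
  D-agree (a ∷ f) = ≡.trans (+-agree f _) (cong (λ h → f Z.+ (0ℤ ∷ h)) (D-agree f))

  reduce : ∀ {f g} → f Z.≈ g → f 𝔽.≈ g
  reduce {f} {g} e = 𝔽.coeffwise λ i → Ring.reflexive 𝔽.ℤ/q
    (≡.trans (coeff-agree f i) (≡.trans (Z.at e i) (≡.sym (coeff-agree g i))))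

  reduce-Top : ∀ {n f a} → Z.Top n f a → 𝔽.Top n f a
  reduce-Top {n} {f} (t , z) =
    Ring.reflexive 𝔽.ℤ/q (≡.trans (coeff-agree f n) t) ,
    λ i n<i → Ring.reflexive 𝔽.ℤ/q (≡.trans (coeff-agree f i) (z i n<i))

  lift : ∀ f g → f 𝔽.≈ g → ∃[ T ] f Z.≈ g Z.+ Z.C (+ q) Z.* T
  lift f g e = proj₁ quotient , Z.trans
    (Z.solve 2 (λ f g → f Z.:= g Z.:+ (f Z.:- g)) Z.refl f g) (Z.+-congˡ {g} (proj₂ quotient))
    where
    q∣coeff : ∀ i → + q ℤ.∣ Z.coeff (f Z.+ Z.- g) i
    q∣coeff i = ≡.subst (+ q ℤ.∣_)
      (≡.trans (≡.cong₂ (λ x y → x ℤ.+ ℤ.- y) (coeff-agree f i) (coeff-agree g i))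
        (≡.sym (≡.trans (Z.coeff-+ f (Z.- g) i) (cong (λ z → Z.coeff f i ℤ.+ z) (Z.coeff-neg g i)))))
      (𝔽.to-∣ (𝔽.at e i))
    quotient = divide-coefficients (+ q) (f Z.+ Z.- g) q∣coeff

module Order {n : ℕ} {f : List ℤ} (f-monic : Z.Monic n f) where
  open Quotient Z.polynomialRing f public using (mod; ≈⇒≋; ∣⇒≋0; ≋0⇒∣) renaming (quotientRing to ℤ[θ])
  private module R = Ring ℤ[θ]
            using (*-comm; *-congˡ; +-congʳ; +-identityˡ; -_; 0#; 1#; :-_; _*_; _+_; _:*_; _:+_; _:-_; _:=_; _^_
                  ; _∎; _∣_; _≈_; begin_; refl; solve; step-≈-⟩; step-≡-⟨; step-≡-⟩; sym; trans; zeroʳ)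
  open Homogenisation ℤ[θ]

  ^-agree : ∀ x k → x R.^ k ≡ x Z.^ k
  ^-agree x zero    = ≡.refl
  ^-agree x (suc k) = cong (x Z.*_) (^-agree x k)

  -- Division by the monic f replaces x by a remainder r of degree below n. Then k r is a multiple
  -- of f of degree below n, hence zero, and ℤ has no zero divisors.
  C-regular : ∀ k → k ≡.≢ 0ℤ → ∀ x → Z.C k R.* x R.≈ R.0# → x R.≈ R.0#
  C-regular k k≢0 x kx≈0 = ∣⇒≋0 (w , (begin
    w * f               ≈⟨ *-comm w f ⟩
    f * w               ≈⟨ sym (+-identityʳ (f * w)) ⟩
    f * w + []          ≈⟨ +-congˡ {f * w} (sym r≈0) ⟩
    f * w + r           ≈⟨ sym e ⟩
    x                   ∎))
    where
    open Z
    division = divide f-monic x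
    w = proj₁ division
    r = proj₁ (proj₂ division)
    e : x ≈ f * w + r
    e = proj₁ (proj₂ (proj₂ division))
    t = _∣ʳ_.quotient (≋0⇒∣ kx≈0)
    te : t * f ≈ C k * x
    te = _∣ʳ_.equality (≋0⇒∣ kx≈0)
    kr-top : Top n (C k * r) 0ℤ
    kr-top = Top-cong (sym (C*-map k r)) (ℤ.*-zeroʳ k) (Top-◃ k (proj₂ (proj₂ (proj₂ division))))
    kr≈0 : C k * r ≈ []
    kr≈0 = remainder-unique f-monic (t + - (C k * w)) (C k * r) (begin
      f * (t + - (C k * w))               ≈⟨ solve 4 (λ f t k w → f :* (t :- k :* w) := t :* f :- k :* (f :* w)) refl f t (C k) w ⟩
      t * f + - (C k * (f * w))           ≈⟨ +-congʳ { - (C k * (f * w))} te ⟩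
      C k * x + - (C k * (f * w))         ≈⟨ +-congʳ { - (C k * (f * w))} (*-congˡ {C k} e) ⟩
      C k * (f * w + r) + - (C k * (f * w))
        ≈⟨ solve 3 (λ k u r → k :* (u :+ r) :- k :* u := k :* r) refl (C k) (f * w) r ⟩
      C k * r                             ∎) kr-top
    r≈0 : r ≈ []
    r≈0 = coeffwise λ i → ℤ.*-cancelˡ-≡ k (coeff r i) 0ℤ {{ℤ.≢-nonZero k≢0}}
      (≡.trans (≡.sym (coeff-C* k r i)) (≡.trans (at kr≈0 i) (≡.sym (ℤ.*-zeroʳ k))))

  -- The vanishing form says that γ / q is integral, over ℤ[θ] itself since `cs` is a list of its
  -- elements; the conclusion places γ / q in ℤ[θ].
  Maximal : ℕ → Set
  Maximal q = ∀ γ cs → homogeneous (Z.C (+ q)) γ cs R.≈ R.0# → Z.C (+ q) R.∣ γ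

  module _ {q : ℕ} (q-prime : Prime q) where
    private
      module 𝔽 = Modular q
        using (*-congʳ; *-congˡ; +-congˡ; +-identityʳ; -_; 0#; 1#; C≈0; D; Monic; _*_; _+_; _:*_; _:=_; _^_; _∎
              ; _∣_; _≈_; begin_; refl; separable⇒radical; solve; step-≈-⟩; step-≡-⟨; step-≡-⟩; sym; trans
              ; zeroˡ)
      open Reduction q using (reduce; lift; +-agree; *-agree) renaming (^-agree to ^-agree-𝔽)

    module _ (g h F : List ℤ) (factorisation : f Z.≈ g Z.* h Z.+ Z.C (+ q) Z.* F)
             {k : ℕ} (g-monic : 𝔽.Monic k g)
             (u v : List ℤ) (separable : u 𝔽.* g 𝔽.+ v 𝔽.* 𝔽.D g 𝔽.≈ 𝔽.1#)
             (b c d : List ℤ) (comaximal : b 𝔽.* g 𝔽.+ c 𝔽.* h 𝔽.+ d 𝔽.* F 𝔽.≈ 𝔽.1#)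
             (e : ℕ) (f∣gᵉ : f 𝔽.∣ (g 𝔽.^ e)) where
      private
        Q : List ℤ
        Q = Z.C (+ q)

        Q𝔽≈0 : ∀ T → Q 𝔽.* T 𝔽.≈ 𝔽.0#
        Q𝔽≈0 T = 𝔽.trans (𝔽.*-congʳ (𝔽.C≈0 ℤ.∣-refl)) (𝔽.zeroˡ T)

        f≈gh : f 𝔽.≈ g 𝔽.* h
        f≈gh = 𝔽.begin
          f                        𝔽.≈⟨ reduce factorisation ⟩
          g Z.* h Z.+ Q Z.* F      𝔽.≡⟨ +-agree (g Z.* h) (Q Z.* F) ⟨
          g Z.* h 𝔽.+ Q Z.* F      𝔽.≡⟨ ≡.cong₂ 𝔽._+_ (*-agree g h) (*-agree Q F) ⟨
          g 𝔽.* h 𝔽.+ Q 𝔽.* F      𝔽.≈⟨ 𝔽.+-congˡ {g 𝔽.* h} (Q𝔽≈0 F) ⟩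
          g 𝔽.* h 𝔽.+ 𝔽.0#         𝔽.≈⟨ 𝔽.+-identityʳ (g 𝔽.* h) ⟩
          g 𝔽.* h                  𝔽.∎

        f≈0 : f R.≈ R.0#
        f≈0 = ∣⇒≋0 (Z.1# , Z.*-identityˡ f)

        gh≈-qF : g R.* h R.≈ R.- (Q R.* F)
        gh≈-qF = R.begin
          g R.* h                                     R.≈⟨ R.solve 2 (λ x y → x R.:= (x R.:+ y) R.:- y) R.refl (g R.* h) (Q R.* F) ⟩
          (g R.* h R.+ Q R.* F) R.+ R.- (Q R.* F)     R.≈⟨ R.+-congʳ (R.trans (≈⇒≋ (Z.sym factorisation)) f≈0) ⟩
          R.0# R.+ R.- (Q R.* F)                      R.≈⟨ R.+-identityˡ _ ⟩
          R.- (Q R.* F)                               R.∎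

        unlift : ∀ x y → x 𝔽.≈ y → ∃[ T ] x R.≈ y R.+ Q R.* T
        unlift x y e = proj₁ (lift x y e) , ≈⇒≋ (proj₂ (lift x y e))

        comaximal-R : ∃[ a ] R.1# R.≈ a R.* Q R.+ b R.* g R.+ c R.* h R.+ d R.* F
        comaximal-R = proj₁ lifted , (R.begin
          R.1#                                                   R.≈⟨ proj₂ lifted ⟩
          (b 𝔽.* g 𝔽.+ c 𝔽.* h 𝔽.+ d 𝔽.* F) R.+ Q R.* T         R.≡⟨ cong (R._+ Q R.* T) agree ⟩
          (b R.* g R.+ c R.* h R.+ d R.* F) R.+ Q R.* T
            R.≈⟨ R.solve 5 (λ x y z Q T → (x R.:+ y R.:+ z) R.:+ Q R.:* T R.:= T R.:* Q R.:+ x R.:+ y R.:+ z) R.refl (b R.* g) (c R.* h) (d R.* F) Q T ⟩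
          T R.* Q R.+ b R.* g R.+ c R.* h R.+ d R.* F            R.∎)
          where
          lifted = unlift 𝔽.1# (b 𝔽.* g 𝔽.+ c 𝔽.* h 𝔽.+ d 𝔽.* F) (𝔽.sym comaximal)
          T = proj₁ lifted
          agree : b 𝔽.* g 𝔽.+ c 𝔽.* h 𝔽.+ d 𝔽.* F ≡ b Z.* g Z.+ c Z.* h Z.+ d Z.* F
          agree = ≡.trans (+-agree (b 𝔽.* g 𝔽.+ c 𝔽.* h) (d 𝔽.* F)) (≡.cong₂ Z._+_
            (≡.trans (+-agree (b 𝔽.* g) (c 𝔽.* h)) (≡.cong₂ Z._+_ (*-agree b g) (*-agree c h))) (*-agree d F))

        q∣gᵉ : Q R.∣ (g R.^ e)
        q∣gᵉ = proj₁ lifted , R.sym (R.begin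
          g R.^ e                             R.≡⟨ ≡.trans (^-agree g e) (≡.sym (^-agree-𝔽 g e)) ⟩
          g 𝔽.^ e                             R.≈⟨ proj₂ lifted ⟩
          w 𝔽.* f R.+ Q R.* proj₁ lifted      R.≡⟨ cong (R._+ Q R.* proj₁ lifted) (*-agree w f) ⟩
          w R.* f R.+ Q R.* proj₁ lifted      R.≈⟨ R.+-congʳ (R.trans (R.*-congˡ {w} f≈0) (R.zeroʳ w)) ⟩
          R.0# R.+ Q R.* proj₁ lifted         R.≈⟨ R.trans (R.+-identityˡ _) (R.*-comm Q (proj₁ lifted)) ⟩
          proj₁ lifted R.* Q                  R.∎)
          where
          w = _∣ʳ_.quotient f∣gᵉ
          lifted = unlift (g 𝔽.^ e) (w 𝔽.* f) (𝔽.sym (_∣ʳ_.equality f∣gᵉ))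

        -- ℤ[θ] / (q) is 𝔽_q[x] / (f) and g divides f modulo q, so q ∣ xᵐ gives g ∣ xᵐ in 𝔽_q[x]. As
        -- g is separable it divides x there, and lifting back costs a multiple of q.
        radical : ∀ x m → Q R.∣ (x R.^ m) → ∃[ α ] ∃[ β ] x R.≈ α R.* Q R.+ β R.* g
        radical x m (t , e) = proj₁ lifted , w , (R.begin
          x                                   R.≈⟨ proj₂ lifted ⟩
          w 𝔽.* g R.+ Q R.* proj₁ lifted      R.≡⟨ cong (R._+ Q R.* proj₁ lifted) (*-agree w g) ⟩
          w R.* g R.+ Q R.* proj₁ lifted      R.≈⟨ R.solve 3 (λ w Q l → w R.:+ Q R.:* l R.:= l R.:* Q R.:+ w) R.refl (w R.* g) Q (proj₁ lifted) ⟩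
          proj₁ lifted R.* Q R.+ w R.* g      R.∎)
          where
          s = _∣ʳ_.quotient (Quotient._≋_.difference e)
          sf : s Z.* f Z.≈ t Z.* Q Z.+ Z.- (x Z.^ m)
          sf = Z.trans (_∣ʳ_.equality (Quotient._≋_.difference e)) (Z.+-congˡ {t Z.* Q} (Z.-‿cong (Z.reflexive (^-agree x m))))
          x^m : x Z.^ m Z.≈ Z.- s Z.* f Z.+ Q Z.* t
          x^m = Z.begin
            x Z.^ m                                     Z.≈⟨ Z.solve 3 (λ t Q p → p Z.:= Z.:- (t Z.:* Q Z.:- p) Z.:+ Q Z.:* t) Z.refl t Q (x Z.^ m) ⟩
            Z.- (t Z.* Q Z.+ Z.- (x Z.^ m)) Z.+ Q Z.* t Z.≈⟨ Z.+-congʳ {Q Z.* t} (Z.-‿cong (Z.sym sf)) ⟩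
            Z.- (s Z.* f) Z.+ Q Z.* t                   Z.≈⟨ Z.+-congʳ {Q Z.* t} (Z.-‿distribˡ-* s f) ⟩
            Z.- s Z.* f Z.+ Q Z.* t                     Z.∎
          g∣x^m : g 𝔽.∣ (x 𝔽.^ m)
          g∣x^m = 𝔽.- s 𝔽.* h , (𝔽.begin
            𝔽.- s 𝔽.* h 𝔽.* g                           𝔽.≈⟨ 𝔽.solve 3 (λ s h g → s 𝔽.:* h 𝔽.:* g 𝔽.:= s 𝔽.:* (g 𝔽.:* h)) 𝔽.refl (𝔽.- s) h g ⟩
            𝔽.- s 𝔽.* (g 𝔽.* h)                         𝔽.≈⟨ 𝔽.*-congˡ {𝔽.- s} (𝔽.sym f≈gh) ⟩
            𝔽.- s 𝔽.* f                                 𝔽.≈⟨ 𝔽.sym (𝔽.+-identityʳ (𝔽.- s 𝔽.* f)) ⟩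
            𝔽.- s 𝔽.* f 𝔽.+ 𝔽.0#                        𝔽.≈⟨ 𝔽.+-congˡ {𝔽.- s 𝔽.* f} (𝔽.sym (Q𝔽≈0 t)) ⟩
            𝔽.- s 𝔽.* f 𝔽.+ Q 𝔽.* t                     𝔽.≡⟨ ≡.cong₂ 𝔽._+_ (*-agree (𝔽.- s) f) (*-agree Q t) ⟩
            Z.- s Z.* f 𝔽.+ Q Z.* t                     𝔽.≡⟨ +-agree (Z.- s Z.* f) (Q Z.* t) ⟩
            Z.- s Z.* f Z.+ Q Z.* t                     𝔽.≈⟨ 𝔽.sym (reduce x^m) ⟩
            x Z.^ m                                     𝔽.≡⟨ ^-agree-𝔽 x m ⟨
            x 𝔽.^ m                                     𝔽.∎)
          g∣x : g 𝔽.∣ x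
          g∣x = 𝔽.separable⇒radical q-prime g-monic u v separable x m g∣x^m
          w = _∣ʳ_.quotient g∣x
          lifted = unlift x (w 𝔽.* g) (𝔽.sym (_∣ʳ_.equality g∣x))

        q≢0 : + q ≡.≢ 0ℤ
        q≢0 q≡0 = ℕ.≢-nonZero⁻¹ q {{prime⇒nonZero q-prime}} (ℤ.+-injective q≡0)

      maximal : Maximal q
      maximal γ cs = Dedekind.divides-integral ℤ[θ] Q (C-regular (+ q) q≢0) γ g h F gh≈-qF
        (proj₁ comaximal-R) b c d (proj₂ comaximal-R) radical e q∣gᵉ cs

-- Ring homomorphisms.

record Hom {c₁ ℓ₁ c₂ ℓ₂ : Level} (R : CommutativeRing c₁ ℓ₁) (S : CommutativeRing c₂ ℓ₂) : Set (c₁ ⊔ ℓ₁ ⊔ c₂ ⊔ ℓ₂) where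
  private
    module R = Ring R
      using (+-identityˡ; -_; -‿inverseʳ; 0#; 1#; Carrier; _*_; _+_; _^_; _≈_; ι)
    module S = Ring S
      using (*-congˡ; +-cong; +-congʳ; +-identityˡ; -_; -‿cong; -‿inverseʳ; 0#; 1#; :-_; Carrier; _*_; _+_; _:+_
            ; _:-_; _:=_; _^_; _∎; _≈_; begin_; refl; solve; step-≈-⟩; sym; trans; ι)
  field
    ⟦_⟧    : R.Carrier → S.Carrier
    ⟦⟧-cong : ∀ {x y} → x R.≈ y → ⟦ x ⟧ S.≈ ⟦ y ⟧
    +-homo : ∀ x y → ⟦ x R.+ y ⟧ S.≈ ⟦ x ⟧ S.+ ⟦ y ⟧
    *-homo : ∀ x y → ⟦ x R.* y ⟧ S.≈ ⟦ x ⟧ S.* ⟦ y ⟧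
    1-homo : ⟦ R.1# ⟧ S.≈ S.1#

  0-homo : ⟦ R.0# ⟧ S.≈ S.0#
  0-homo = S.begin
    z                       S.≈⟨ S.solve 1 (λ z → z S.:= (z S.:+ z) S.:- z) S.refl z ⟩
    (z S.+ z) S.+ S.- z     S.≈⟨ S.+-congʳ (S.trans (S.sym (+-homo R.0# R.0#)) (⟦⟧-cong (R.+-identityˡ R.0#))) ⟩
    z S.+ S.- z             S.≈⟨ S.-‿inverseʳ z ⟩
    S.0#                    S.∎
    where z = ⟦ R.0# ⟧

  neg-homo : ∀ x → ⟦ R.- x ⟧ S.≈ S.- ⟦ x ⟧
  neg-homo x = S.begin
    ⟦ R.- x ⟧                                 S.≈⟨ S.solve 2 (λ x y → y S.:= (x S.:+ y) S.:- x) S.refl ⟦ x ⟧ ⟦ R.- x ⟧ ⟩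
    (⟦ x ⟧ S.+ ⟦ R.- x ⟧) S.+ S.- ⟦ x ⟧       S.≈⟨ S.+-congʳ (S.trans (S.sym (+-homo x (R.- x))) (S.trans (⟦⟧-cong (R.-‿inverseʳ x)) 0-homo)) ⟩
    S.0# S.+ S.- ⟦ x ⟧                        S.≈⟨ S.+-identityˡ _ ⟩
    S.- ⟦ x ⟧                                 S.∎

  ^-homo : ∀ x n → ⟦ x R.^ n ⟧ S.≈ ⟦ x ⟧ S.^ n
  ^-homo x zero    = 1-homo
  ^-homo x (suc n) = S.trans (*-homo x (x R.^ n)) (S.*-congˡ (^-homo x n))

  ι-homo : ∀ z → ⟦ R.ι z ⟧ S.≈ S.ι z
  ι-homo (+ n)    = ·-homo n
    where
    ·-homo : ∀ n → ⟦ R.ι (+ n) ⟧ S.≈ S.ι (+ n)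
    ·-homo zero    = 0-homo
    ·-homo (suc n) = S.trans (+-homo _ _) (S.+-cong 1-homo (·-homo n))
  ι-homo -[1+ n ] = S.trans (neg-homo _) (S.-‿cong (ι-homo (+ suc n)))

_∘ᴴ_ : ∀ {c₁ ℓ₁ c₂ ℓ₂ c₃ ℓ₃} {R : CommutativeRing c₁ ℓ₁} {S : CommutativeRing c₂ ℓ₂} {T : CommutativeRing c₃ ℓ₃} →
       Hom S T → Hom R S → Hom R T
_∘ᴴ_ {T = T} ψ φ = record
  { ⟦_⟧     = λ x → ψ.⟦ φ.⟦ x ⟧ ⟧
  ; ⟦⟧-cong = λ e → ψ.⟦⟧-cong (φ.⟦⟧-cong e)
  ; +-homo  = λ x y → T.trans (ψ.⟦⟧-cong (φ.+-homo x y)) (ψ.+-homo _ _)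
  ; *-homo  = λ x y → T.trans (ψ.⟦⟧-cong (φ.*-homo x y)) (ψ.*-homo _ _)
  ; 1-homo  = T.trans (ψ.⟦⟧-cong φ.1-homo) ψ.1-homo
  }
  where
  module φ = Hom φ
    using (*-homo; +-homo; 1-homo; ⟦_⟧; ⟦⟧-cong)
  module ψ = Hom ψ
    using (*-homo; +-homo; 1-homo; ⟦_⟧; ⟦⟧-cong)
  module T = Ring T
    using (trans)

quotientHom : ∀ {c ℓ} (R : CommutativeRing c ℓ) f → Hom R (Quotient.quotientRing R f)
quotientHom R f = record
  { ⟦_⟧ = λ x → x ; ⟦⟧-cong = ≈⇒≋ ; +-homo = λ x y → ≈⇒≋ refl ; *-homo = λ x y → ≈⇒≋ refl ; 1-homo = ≈⇒≋ refl }
  where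
  open Quotient R f
    using (≈⇒≋)
  open Ring R
    using (_+_; refl)

constantHom : ∀ {c ℓ} (A : CommutativeRing c ℓ) → Hom A (Poly.polynomialRing A)
constantHom A = record
  { ⟦_⟧ = C ; ⟦⟧-cong = C-cong ; +-homo = λ x y → refl ; *-homo = C-* ; 1-homo = refl }
  where open PolyTheory A

reductionHom : ∀ q → Hom Z.polynomialRing (Modular.polynomialRing q)
reductionHom q = record
  { ⟦_⟧ = λ f → f
  ; ⟦⟧-cong = reduce
  ; +-homo = λ f g → reflexive (≡.sym (+-agree f g))
  ; *-homo = λ f g → reflexive (≡.sym (*-agree f g))
  ; 1-homo = refl
  }
  where
  open Reduction q
  open Modular q
    using (C; C-*; C-cong; _+_; refl; reflexive)

ℤ/Hom : ∀ q → Hom ℤ.+-*-commutativeRing (Modular.ℤ/q q)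
ℤ/Hom q = quotientHom ℤ.+-*-commutativeRing (+ q)

ℤ'-ι : ∀ z → ℤ'.ι z ≡ z
ℤ'-ι (+ n)    = ι+ n
  where
  ι+ : ∀ n → ℤ'.ι (+ n) ≡ + n
  ι+ zero    = ≡.refl
  ι+ (suc n) = cong (λ z → 1ℤ ℤ.+ z) (ι+ n)
ℤ'-ι -[1+ n ] = cong ℤ.-_ (ℤ'-ι (+ suc n))

evalHom : ∀ {c ℓ} (K : CommutativeRing c ℓ) → CommutativeRing.Carrier K → Hom Z.polynomialRing K
evalHom K α = record
  { ⟦_⟧ = λ f → eval f α
  ; ⟦⟧-cong = λ {f} {g} → eval-cong α f g
  ; +-homo = eval-+ α
  ; *-homo = eval-* α
  ; 1-homo = trans (+-cong ι-1 (zeroʳ α)) (+-identityʳ 1#)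
  }
  where
  open Integral K
    using (eval-*; eval-+; eval-cong)
  open Ring K
    using (+-cong; +-identityʳ; 1#; _+_; eval; refl; reflexive; trans; zeroʳ; ι-1)

-- Geometric sums and the discriminant of the family.

module Sums {c ℓ : Level} (R : CommutativeRing c ℓ) where
  open Ring R
    using (*-cong; *-congʳ; *-congˡ; *-identityˡ; +-cong; +-congʳ; +-congˡ; +-identityʳ; -_; -‿cong; -‿inverseʳ
          ; 0#; 1#; :-_; Carrier; ^-congˡ; ^-distrib-*; _*_; _+_; _:*_; _:+_; _:-_; _:=_; _^_; _∎; _≈_; begin_
          ; con; distribʳ; refl; solve; step-≈-⟩; sym; trans; zeroʳ; zeroˡ; ι)

  -- U k w a = Σ_{i<k} wⁱ aᵏ⁻¹⁻ⁱ, V k w a = Σ_{i<k} (k - i) wⁱ aᵏ⁻¹⁻ⁱ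
  -- and T k = k (k - 1) / 2.
  U V : ℕ → Carrier → Carrier → Carrier
  U zero    w a = 0#
  U (suc k) w a = w ^ k + a * U k w a
  V zero    w a = 0#
  V (suc k) w a = a * V k w a + U (suc k) w a

  T : ℕ → Carrier
  T zero    = 0#
  T (suc k) = ι (+ k) + T k

  U-cong : ∀ k {w w' a a'} → w ≈ w' → a ≈ a' → U k w a ≈ U k w' a'
  U-cong zero    e e' = refl
  U-cong (suc k) e e' = +-cong (^-congˡ k e) (*-cong e' (U-cong k e e'))

  V-cong : ∀ k {w w' a a'} → w ≈ w' → a ≈ a' → V k w a ≈ V k w' a'
  V-cong zero    e e' = refl
  V-cong (suc k) e e' = +-cong (*-cong e' (V-cong k e e')) (U-cong (suc k) e e')

  U-telescope : ∀ k w a → (w + - a) * U k w a ≈ w ^ k + - (a ^ k)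
  U-telescope zero    w a = trans (zeroʳ _) (sym (-‿inverseʳ 1#))
  U-telescope (suc k) w a = begin
    (w + - a) * (w ^ k + a * U k w a)
      ≈⟨ solve 4 (λ w a p u → (w :- a) :* (p :+ a :* u) := (w :- a) :* p :+ a :* ((w :- a) :* u)) refl w a (w ^ k) (U k w a) ⟩
    (w + - a) * w ^ k + a * ((w + - a) * U k w a)
      ≈⟨ +-congˡ (*-congˡ (U-telescope k w a)) ⟩
    (w + - a) * w ^ k + a * (w ^ k + - (a ^ k))
      ≈⟨ solve 4 (λ w a p r → (w :- a) :* p :+ a :* (p :- r) := w :* p :- a :* r) refl w a (w ^ k) (a ^ k) ⟩
    w * w ^ k + - (a * a ^ k) ∎

  -- At w = a the product w U has the value k aᵏ, so `V` is its divided difference. Two divisions by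
  -- w - a thus become polynomial identities, valid even in rings where w - a vanishes.
  V-telescope : ∀ k w a → (w + - a) * V k w a ≈ w * U k w a + - (ι (+ k) * a ^ k)
  V-telescope zero    w a = solve 2 (λ w a → (w :- a) :* con 0ℤ := w :* con 0ℤ :- con 0ℤ :* con 1ℤ) refl w a
  V-telescope (suc k) w a = begin
    (w + - a) * (a * v + u')
      ≈⟨ solve 4 (λ w a v u → (w :- a) :* (a :* v :+ u) := a :* ((w :- a) :* v) :+ (w :- a) :* u) refl w a v u' ⟩
    a * ((w + - a) * v) + (w + - a) * u'
      ≈⟨ +-congʳ (*-congˡ (V-telescope k w a)) ⟩
    a * (w * u + - (ι (+ k) * a ^ k)) + (w + - a) * (w ^ k + a * u)
      ≈⟨ solve 6 (λ w a u K r p → a :* (w :* u :- K :* r) :+ (w :- a) :* (p :+ a :* u)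
           := w :* (p :+ a :* u) :- (a :* (p :+ a :* u) :- a :* (w :* u) :+ K :* (a :* r))) refl w a u (ι (+ k)) (a ^ k) (w ^ k) ⟩
    w * u' + - (a * u' + - (a * (w * u)) + ι (+ k) * (a * a ^ k))
      ≈⟨ +-congˡ (-‿cong (+-congʳ (begin
           a * u' + - (a * (w * u))                ≈⟨ solve 4 (λ a p u w → a :* (p :+ a :* u) :- a :* (w :* u) := a :* (p :- (w :- a) :* u)) refl a (w ^ k) u w ⟩
           a * (w ^ k + - ((w + - a) * u))         ≈⟨ *-congˡ (+-congˡ (-‿cong (U-telescope k w a))) ⟩
           a * (w ^ k + - (w ^ k + - (a ^ k)))     ≈⟨ solve 3 (λ a p r → a :* (p :- (p :- r)) := a :* r) refl a (w ^ k) (a ^ k) ⟩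
           a * a ^ k                               ∎))) ⟩
    w * u' + - (a * a ^ k + ι (+ k) * (a * a ^ k))
      ≈⟨ +-congˡ (-‿cong (trans (+-congʳ (sym (*-identityˡ _))) (sym (distribʳ _ 1# (ι (+ k)))))) ⟩
    w * u' + - (ι (+ suc k) * a ^ suc k) ∎
    where
    u = U k w a
    u' = U (suc k) w a
    v = V k w a

  U-head : ∀ k z → U (suc k) z 1# ≈ 1# + z * U k z 1#
  U-head zero    z = solve 1 (λ z → con 1ℤ :+ con 1ℤ :* con 0ℤ := con 1ℤ :+ z :* con 0ℤ) refl z
  U-head (suc k) z = begin
    z * z ^ k + 1# * U (suc k) z 1#           ≈⟨ +-congˡ (*-congˡ (U-head k z)) ⟩
    z * z ^ k + 1# * (1# + z * U k z 1#)      ≈⟨ solve 3 (λ z p u → z :* p :+ con 1ℤ :* (con 1ℤ :+ z :* u) := con 1ℤ :+ z :* (p :+ con 1ℤ :* u)) refl z (z ^ k) (U k z 1#) ⟩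
    1# + z * (z ^ k + 1# * U k z 1#)          ∎

  U-at-0 : ∀ k z → z ≈ 0# → U (suc k) z 1# ≈ 1#
  U-at-0 k z z≈0 = trans (U-head k z) (trans (+-congˡ (trans (*-congʳ z≈0) (zeroˡ _))) (+-identityʳ 1#))

  -- U is homogeneous of degree k - 1; the additional factor a on both sides lets k = 0 take part.
  -- It serves to clear the denominator of the critical point z = w / a.
  U-scale : ∀ k z a → a ^ k * U k z 1# ≈ a * U k (a * z) a
  U-scale zero    z a = trans (zeroʳ _) (sym (zeroʳ a))
  U-scale (suc k) z a = begin
    a * a ^ k * (z ^ k + 1# * U k z 1#)            ≈⟨ *-congˡ (+-congˡ (*-identityˡ _)) ⟩
    a * a ^ k * (z ^ k + U k z 1#)                 ≈⟨ solve 4 (λ a p r u → a :* p :* (r :+ u) := a :* (p :* r :+ p :* u)) refl a (a ^ k) (z ^ k) (U k z 1#) ⟩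
    a * (a ^ k * z ^ k + a ^ k * U k z 1#)         ≈⟨ *-congˡ (+-cong (sym (^-distrib-* a z k)) (U-scale k z a)) ⟩
    a * ((a * z) ^ k + a * U k (a * z) a)          ∎

  2T : ∀ k → T k + T k ≈ ι (+ k) * ι (+ k) + - ι (+ k)
  2T zero    = solve 0 (con 0ℤ :+ con 0ℤ := con 0ℤ :* con 0ℤ :- con 0ℤ) refl
  2T (suc k) = begin
    (K + T k) + (K + T k)                     ≈⟨ solve 2 (λ K t → (K :+ t) :+ (K :+ t) := (t :+ t) :+ (K :+ K)) refl K (T k) ⟩
    (T k + T k) + (K + K)                     ≈⟨ +-congʳ (2T k) ⟩
    (K * K + - K) + (K + K)                   ≈⟨ solve 1 (λ K → (K :* K :- K) :+ (K :+ K) := (con 1ℤ :+ K) :* (con 1ℤ :+ K) :- (con 1ℤ :+ K)) refl K ⟩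
    ι (+ suc k) * ι (+ suc k) + - ι (+ suc k) ∎
    where K = ι (+ k)

  aU-diagonal : ∀ k a → a * U k a a ≈ ι (+ k) * a ^ k
  aU-diagonal zero    a = trans (zeroʳ a) (sym (zeroˡ _))
  aU-diagonal (suc k) a = begin
    a * (a ^ k + a * U k a a)                 ≈⟨ *-congˡ (+-congˡ (aU-diagonal k a)) ⟩
    a * (a ^ k + ι (+ k) * a ^ k)             ≈⟨ *-congˡ (+-congʳ (sym (*-identityˡ _))) ⟩
    a * (1# * a ^ k + ι (+ k) * a ^ k)        ≈⟨ solve 4 (λ a p o K → a :* (o :* p :+ K :* p) := (o :+ K) :* (a :* p)) refl a (a ^ k) 1# (ι (+ k)) ⟩
    (1# + ι (+ k)) * (a * a ^ k)              ∎

  -- On the diagonal V is (1 + ... + k) aᵏ⁻¹; the factor 2 a avoids both the halving and the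
  -- exponent k - 1.
  2aV-diagonal : ∀ k a → a * V k a a + a * V k a a ≈ ι (+ k) * ι (+ suc k) * a ^ k
  2aV-diagonal zero    a = solve 2 (λ a o → a :* con 0ℤ :+ a :* con 0ℤ := con 0ℤ :* o :* con 1ℤ) refl a (ι 1ℤ)
  2aV-diagonal (suc k) a = begin
    a * (a * v + u') + a * (a * v + u')           ≈⟨ solve 3 (λ a v u → a :* (a :* v :+ u) :+ a :* (a :* v :+ u) := a :* (a :* v :+ a :* v) :+ (a :* u :+ a :* u)) refl a v u' ⟩
    a * (a * v + a * v) + (a * u' + a * u')       ≈⟨ +-cong (*-congˡ (2aV-diagonal k a)) (+-cong (aU-diagonal (suc k) a) (aU-diagonal (suc k) a)) ⟩
    a * (K * K' * p) + (K' * (a * p) + K' * (a * p))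
      ≈⟨ solve 4 (λ a K K' p → a :* (K :* K' :* p) :+ (K' :* (a :* p) :+ K' :* (a :* p)) := K' :* (con 1ℤ :+ (con 1ℤ :+ K)) :* (a :* p)) refl a K K' p ⟩
    K' * (1# + (1# + K)) * (a * p)                ∎
    where
    K = ι (+ k)
    K' = ι (+ suc k)
    v = V k a a
    u' = U (suc k) a a
    p = a ^ k

module HomSums {c₁ ℓ₁ c₂ ℓ₂ : Level} {R : CommutativeRing c₁ ℓ₁} {S : CommutativeRing c₂ ℓ₂} (φ : Hom R S) where
  private
    module R where
      open Sums R public
        using (U; V)
    module S where
      open Ring S public
        using (*-congˡ; +-cong; _≈_; trans)
      open Sums S public
        using (U; V)
  open Hom φ
    using (*-homo; +-homo; 0-homo; ^-homo; ⟦_⟧)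

  U-homo : ∀ k w a → ⟦ R.U k w a ⟧ S.≈ S.U k ⟦ w ⟧ ⟦ a ⟧
  U-homo zero    w a = 0-homo
  U-homo (suc k) w a = S.trans (+-homo _ _) (S.+-cong (^-homo w k) (S.trans (*-homo _ _) (S.*-congˡ (U-homo k w a))))

  V-homo : ∀ k w a → ⟦ R.V k w a ⟧ S.≈ S.V k ⟦ w ⟧ ⟦ a ⟧
  V-homo zero    w a = 0-homo
  V-homo (suc k) w a = S.trans (+-homo _ _) (S.+-cong (S.trans (*-homo _ _) (S.*-congˡ (V-homo k w a))) (U-homo (suc k) w a))

-- With z = M x and y = b Mⁿ, the polynomial f = xⁿ + b (1 + z + … + zⁿ⁻¹)
-- satisfies (z - 1) f = z xⁿ - (1 - y) xⁿ - b, whose derivative has the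
-- single critical point a z = w away from 0. Discriminant stands for 𝒟.
module Family {c ℓ : Level} (R : CommutativeRing c ℓ) (b M : CommutativeRing.Carrier R) (n-1 : ℕ) where
  open Ring R
    using (*-assoc; *-comm; *-congʳ; *-congˡ; *-identityʳ; *-identityˡ; +-cong; +-congʳ; +-congˡ; +-identityˡ
          ; -_; -‿cong; 0#; 1#; 1^n≈1; :-_; Carrier; ^-congˡ; ^-distrib-*; _*_; _+_; _:*_; _:+_; _:-_; _:=_; _^_
          ; _∎; _≈_; a-0≈a; begin_; con; distribˡ; refl; solve; step-≈-⟩; sym; trans; x∙y⁻¹≈ε⇒x≈y; x≈y⇒x∙y⁻¹≈ε
          ; zeroʳ; zeroˡ; ι)
  open Sums R
    using (2T; 2aV-diagonal; T; U; U-cong; U-scale; U-telescope; V; V-cong; V-telescope)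

  n : ℕ
  n = suc n-1

  N a y s w Discriminant : Carrier
  N = ι (+ n)
  a = 1# + N
  y = b * M ^ n
  s = 1# + - y
  w = N * s
  -- The quotient of s wⁿ + y aⁿ⁺¹ by (a - w)² as a polynomial expression, so that it has a meaning
  -- also where a - w = 1 + y N is zero or a zero divisor.
  Discriminant = a ^ n-1 + s * V n-1 w a

  f : Carrier → Carrier
  f x = x ^ n + b * U n (M * x) 1#

  f-telescope : ∀ x → (M * x + - 1#) * f x ≈ (M * x + - s) * x ^ n + - b
  f-telescope x = begin
    (z + - 1#) * (x ^ n + b * U n z 1#)
      ≈⟨ solve 4 (λ z p b u → (z :- con 1ℤ) :* (p :+ b :* u) := (z :- con 1ℤ) :* p :+ b :* ((z :- con 1ℤ) :* u)) refl z (x ^ n) b (U n z 1#) ⟩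
    (z + - 1#) * x ^ n + b * ((z + - 1#) * U n z 1#)
      ≈⟨ +-congˡ (*-congˡ (trans (U-telescope n z 1#) (+-cong (^-distrib-* M x n) (-‿cong (1^n≈1 n))))) ⟩
    (z + - 1#) * x ^ n + b * (M ^ n * x ^ n + - 1#)
      ≈⟨ solve 4 (λ z p b m → (z :- con 1ℤ) :* p :+ b :* (m :* p :- con 1ℤ) := (z :- (con 1ℤ :- b :* m)) :* p :- b) refl z (x ^ n) b (M ^ n) ⟩
    (z + - s) * x ^ n + - b ∎
    where z = M * x

  -- After multiplication by (c M)ⁿ the variable enters only through c z. With c = a, the critical
  -- point a z = w can be substituted without inverting a.
  f-scale : ∀ c x → (c * M) ^ n * f x ≈ (c * (M * x)) ^ n + y * (c * U n (c * (M * x)) c)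
  f-scale c x = begin
    (c * M) ^ n * (x ^ n + b * U n z 1#)
      ≈⟨ distribˡ _ (x ^ n) _ ⟩
    (c * M) ^ n * x ^ n + (c * M) ^ n * (b * U n z 1#)
      ≈⟨ +-cong (trans (sym (^-distrib-* (c * M) x n)) (^-congˡ n (*-assoc c M x))) (*-congʳ (^-distrib-* c M n)) ⟩
    (c * z) ^ n + (c ^ n * M ^ n) * (b * U n z 1#)
      ≈⟨ +-congˡ (solve 4 (λ p m b u → (p :* m) :* (b :* u) := (b :* m) :* (p :* u)) refl (c ^ n) (M ^ n) b (U n z 1#)) ⟩
    (c * z) ^ n + y * (c ^ n * U n z 1#)
      ≈⟨ +-congˡ (*-congˡ (U-scale n z c)) ⟩
    (c * z) ^ n + y * (c * U n (c * z) c) ∎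
    where z = M * x

  private
    u u' p : Carrier
    u  = U n-1 w a
    u' = U n w a
    p  = a ^ n-1
    N' = ι (+ n-1)

  -- By `f-scale` the right side is (a M)ⁿ f at the critical point a z = w: up to the factor a - w,
  -- the discriminant is the critical value of f.
  discriminant-at-critical : (a + - w) * Discriminant ≈ w ^ n + y * (a * U n w a)
  discriminant-at-critical = begin
    (a + - w) * (p + s * V n-1 w a)
      ≈⟨ solve 5 (λ a w p s v → (a :- w) :* (p :+ s :* v) := (a :- w) :* p :- s :* ((w :- a) :* v)) refl a w p s (V n-1 w a) ⟩
    (a + - w) * p + - (s * ((w + - a) * V n-1 w a))
      ≈⟨ +-congˡ (-‿cong (*-congˡ (V-telescope n-1 w a))) ⟩
    (a + - w) * p + - (s * (w * u + - (N' * p)))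
      ≈⟨ solve 6 (λ a w p s u K → (a :- w) :* p :- s :* (w :* u :- K :* p)
           := (a :- w) :* p :- s :* ((w :- a) :* u :+ a :* u :- K :* p)) refl a w p s u N' ⟩
    (a + - w) * p + - (s * ((w + - a) * u + a * u + - (N' * p)))
      ≈⟨ +-congˡ (-‿cong (*-congˡ (+-congʳ (+-congʳ (U-telescope n-1 w a))))) ⟩
    (a + - w) * p + - (s * ((w ^ n-1 + - p) + a * u + - (N' * p)))
      ≈⟨ solve 6 (λ K p s u q y → ((con 1ℤ :+ (con 1ℤ :+ K)) :- (con 1ℤ :+ K) :* s) :* p :- s :* ((q :- p) :+ (con 1ℤ :+ (con 1ℤ :+ K)) :* u :- K :* p)
           := (con 1ℤ :+ (con 1ℤ :+ K)) :* p :- s :* (q :+ (con 1ℤ :+ (con 1ℤ :+ K)) :* u)) refl N' p s u (w ^ n-1) y ⟩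
    a ^ n + - (s * u')
      ≈⟨ solve 5 (λ N y e g v → e :- (con 1ℤ :- y) :* v
           := (e :+ (N :* (con 1ℤ :- y) :- (con 1ℤ :+ N)) :* v) :+ y :* ((con 1ℤ :+ N) :* v)) refl N y (a ^ n) a u' ⟩
    (a ^ n + (w + - a) * u') + y * (a * u')
      ≈⟨ +-congʳ (+-congˡ (U-telescope n w a)) ⟩
    (a ^ n + (w ^ n + - (a ^ n))) + y * (a * u')
      ≈⟨ +-congʳ (solve 2 (λ e q → e :+ (q :- e) := q) refl (a ^ n) (w ^ n)) ⟩
    w ^ n + y * (a * u') ∎

  -- The second factor a - w telescopes the remaining U. Since w = N s, the right side is the
  -- numerator of 𝒟.
  discriminant-formula : (a + - w) * ((a + - w) * Discriminant) ≈ s * w ^ n + y * (a * a ^ n)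
  discriminant-formula = begin
    (a + - w) * ((a + - w) * Discriminant)           ≈⟨ *-congˡ discriminant-at-critical ⟩
    (a + - w) * (w ^ n + y * (a * u'))
      ≈⟨ solve 5 (λ a w q y v → (a :- w) :* (q :+ y :* (a :* v)) := (a :- w) :* q :- y :* (a :* ((w :- a) :* v))) refl a w (w ^ n) y u' ⟩
    (a + - w) * w ^ n + - (y * (a * ((w + - a) * u'))) ≈⟨ +-congˡ (-‿cong (*-congˡ (*-congˡ (U-telescope n w a)))) ⟩
    (a + - w) * w ^ n + - (y * (a * (w ^ n + - (a ^ n))))
      ≈⟨ solve 4 (λ N y q e → ((con 1ℤ :+ N) :- N :* (con 1ℤ :- y)) :* q :- y :* ((con 1ℤ :+ N) :* (q :- e))
           := (con 1ℤ :- y) :* q :+ y :* ((con 1ℤ :+ N) :* e)) refl N y (w ^ n) (a ^ n) ⟩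
    s * w ^ n + y * (a * a ^ n) ∎

  a-w : a + - w ≈ 1# + y * N
  a-w = solve 2 (λ N y → (con 1ℤ :+ N) :- N :* (con 1ℤ :- y) := con 1ℤ :+ y :* N) refl N y

  -- Covers the degenerate case a = w, in which `discriminant-formula` says nothing about the
  -- discriminant: if the latter vanishes as well, so does aⁿ⁺¹.
  discriminant-diagonal : w ≈ a → a * Discriminant + a * Discriminant ≈ a * a ^ n
  discriminant-diagonal w≈a = begin
    a * (p + s * V n-1 w a) + a * (p + s * V n-1 w a)
      ≈⟨ +-cong (*-congˡ (+-congˡ (*-congˡ V≈))) (*-congˡ (+-congˡ (*-congˡ V≈))) ⟩
    a * (p + s * v) + a * (p + s * v)
      ≈⟨ solve 4 (λ a p s v → a :* (p :+ s :* v) :+ a :* (p :+ s :* v) := (a :+ a) :* p :+ s :* (a :* v :+ a :* v)) refl a p s v ⟩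
    (a + a) * p + s * (a * v + a * v)                ≈⟨ +-congˡ (*-congˡ (2aV-diagonal n-1 a)) ⟩
    (a + a) * p + s * (N' * N * p)                   ≈⟨ solve 5 (λ a p s K N → (a :+ a) :* p :+ s :* (K :* N :* p) := (a :+ a) :* p :+ K :* (N :* s) :* p) refl a p s N' N ⟩
    (a + a) * p + N' * w * p                         ≈⟨ +-congˡ (*-congʳ (*-congˡ w≈a)) ⟩
    (a + a) * p + N' * a * p                         ≈⟨ solve 3 (λ a p K → (a :+ a) :* p :+ K :* a :* p := (con 1ℤ :+ (con 1ℤ :+ K)) :* (a :* p)) refl a p N' ⟩
    a * (a * p)                                      ∎
    where
    v = V n-1 a a
    V≈ : V n-1 w a ≈ v
    V≈ = V-cong n-1 w≈a refl

  cancel-unit : ∀ {u v} t → u * v ≈ 1# → u * t ≈ 0# → t ≈ 0#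
  cancel-unit {u} {v} t uv ut = begin
    t                 ≈⟨ sym (*-identityˡ t) ⟩
    1# * t            ≈⟨ *-congʳ (sym uv) ⟩
    u * v * t         ≈⟨ solve 3 (λ u v t → u :* v :* t := v :* (u :* t)) refl u v t ⟩
    v * (u * t)       ≈⟨ trans (*-congˡ ut) (zeroʳ v) ⟩
    0#                ∎

  module Root (x : Carrier) (fx≈0 : f x ≈ 0#) (b' : Carrier) (b-unit : b * b' ≈ 1#) where
    z : Carrier
    z = M * x

    -- At a root the telescoped identity reads (z - s) xⁿ = b, and b is a unit.
    xⁿ-unit : x ^ n * ((z + - s) * b') ≈ 1#
    xⁿ-unit = begin
      x ^ n * ((z + - s) * b')            ≈⟨ solve 4 (λ p t b b' → p :* (t :* b') := ((t :* p :- b) :+ b) :* b') refl (x ^ n) (z + - s) b b' ⟩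
      (((z + - s) * x ^ n + - b) + b) * b' ≈⟨ *-congʳ (+-congʳ (trans (sym (f-telescope x)) (trans (*-congˡ fx≈0) (zeroʳ _)))) ⟩
      (0# + b) * b'                       ≈⟨ trans (*-congʳ (+-identityˡ b)) b-unit ⟩
      1#                                  ∎

    cancel-x^ : ∀ t → x ^ n-1 * t ≈ 0# → t ≈ 0#
    cancel-x^ t e = cancel-unit t xⁿ-unit (trans (*-assoc x (x ^ n-1) t) (trans (*-congˡ e) (zeroʳ x)))

    critical : x ^ n-1 * (a * z + - w) ≈ 0# → a * z ≈ w
    critical e = x∙y⁻¹≈ε⇒x≈y _ _ (cancel-x^ _ e)

    -- A critical point that is also a root makes the critical value vanish, that is (a - w) times
    -- the discriminant; an invertible discriminant leaves a = w.
    a-w≈0 : a * z ≈ w → ∀ δ → Discriminant * δ ≈ 1# → a + - w ≈ 0#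
    a-w≈0 az≈w δ unit = cancel-unit _ unit (begin
      Discriminant * (a + - w)                 ≈⟨ *-comm _ _ ⟩
      (a + - w) * Discriminant                 ≈⟨ discriminant-at-critical ⟩
      w ^ n + y * (a * U n w a)                ≈⟨ sym (+-cong (^-congˡ n az≈w) (*-congˡ (*-congˡ (U-cong n az≈w refl)))) ⟩
      (a * z) ^ n + y * (a * U n (a * z) a)    ≈⟨ sym (f-scale a x) ⟩
      (a * M) ^ n * f x                        ≈⟨ trans (*-congˡ fx≈0) (zeroʳ _) ⟩
      0#                                       ∎)

    -- At a repeated root with z = 1: N + y T = 0, 2 T = N (N - 1) and
    -- 1 + y N = 0 give N a = 0, hence N = 0 and 1 = 0.
    no-double-root : x ^ n-1 * (a * z + - w) ≈ 0# → (z ≈ 1# → N * x ^ n-1 + b * (M * T n) ≈ 0#) →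
                     ∀ δ → Discriminant * δ ≈ 1# → ∀ a' → a * a' ≈ 1# → 1# ≈ 0#
    no-double-root f'≈0 f'-at-1 δ unit a' a-unit = begin
      1#                                  ≈⟨ solve 2 (λ N y → con 1ℤ := (con 1ℤ :+ y :* N) :- y :* N) refl N y ⟩
      (1# + y * N) + - (y * N)            ≈⟨ +-cong 1+yN≈0 (-‿cong (trans (*-congˡ N≈0) (zeroʳ y))) ⟩
      0# + - 0#                           ≈⟨ a-0≈a 0# ⟩
      0#                                  ∎
      where
      az≈w = critical f'≈0
      a-w≈0' : a + - w ≈ 0#
      a-w≈0' = a-w≈0 az≈w δ unit
      1+yN≈0 : 1# + y * N ≈ 0#
      1+yN≈0 = trans (sym a-w) a-w≈0'
      z≈1 : z ≈ 1#
      z≈1 = x∙y⁻¹≈ε⇒x≈y z 1# (cancel-unit _ a-unit (begin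
        a * (z + - 1#)                    ≈⟨ solve 3 (λ a z w → a :* (z :- con 1ℤ) := (a :* z :- w) :- (a :- w)) refl a z w ⟩
        (a * z + - w) + - (a + - w)       ≈⟨ +-cong (x≈y⇒x∙y⁻¹≈ε az≈w) (-‿cong a-w≈0') ⟩
        0# + - 0#                         ≈⟨ a-0≈a 0# ⟩
        0#                                ∎))
      N+yT≈0 : N + y * T n ≈ 0#
      N+yT≈0 = begin
        N + b * (M * M ^ n-1) * T n
          ≈⟨ +-congʳ (sym (trans (*-congˡ (trans (sym (^-distrib-* M x n-1)) (trans (^-congˡ n-1 z≈1) (1^n≈1 n-1)))) (*-identityʳ N))) ⟩
        N * (M ^ n-1 * x ^ n-1) + b * (M * M ^ n-1) * T n
          ≈⟨ solve 6 (λ N m p b M t → N :* (m :* p) :+ b :* (M :* m) :* t := m :* (N :* p :+ b :* (M :* t))) refl N (M ^ n-1) (x ^ n-1) b M (T n) ⟩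
        M ^ n-1 * (N * x ^ n-1 + b * (M * T n))     ≈⟨ trans (*-congˡ (f'-at-1 z≈1)) (zeroʳ _) ⟩
        0#                                          ∎
      aN≈0 : a * N ≈ 0#
      aN≈0 = begin
        (1# + N) * N
          ≈⟨ solve 2 (λ N y → (con 1ℤ :+ N) :* N := (N :* N :+ N :* N) :+ N :* y :* (N :* N :- N) :- (con 1ℤ :+ y :* N) :* (N :* N :- N)) refl N y ⟩
        (N * N + N * N) + N * y * (N * N + - N) + - ((1# + y * N) * (N * N + - N))
          ≈⟨ +-cong (+-congˡ (*-congˡ (sym (2T n)))) (-‿cong (trans (*-congʳ 1+yN≈0) (zeroˡ _))) ⟩
        (N * N + N * N) + N * y * (T n + T n) + - 0#
          ≈⟨ trans (a-0≈a _) (solve 3 (λ N y t → (N :* N :+ N :* N) :+ N :* y :* (t :+ t) := N :* (N :+ y :* t) :+ N :* (N :+ y :* t)) refl N y (T n)) ⟩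
        N * (N + y * T n) + N * (N + y * T n)
          ≈⟨ +-cong (trans (*-congˡ N+yT≈0) (zeroʳ N)) (trans (*-congˡ N+yT≈0) (zeroʳ N)) ⟩
        0# + 0#                                     ≈⟨ +-identityˡ 0# ⟩
        0#                                          ∎
      N≈0 : N ≈ 0#
      N≈0 = cancel-unit N a-unit aN≈0

module HomFamily {c₁ ℓ₁ c₂ ℓ₂ : Level} {R : CommutativeRing c₁ ℓ₁} {S : CommutativeRing c₂ ℓ₂} (φ : Hom R S)
                 (b M : CommutativeRing.Carrier R) (n-1 : ℕ) where
  open Hom φ
    using (*-homo; +-homo; 1-homo; ^-homo; neg-homo; ι-homo; ⟦_⟧)
  open HomSums φ
  private
    module R where
      open Ring R public
        using (1#; _*_)
    module S where
      open Ring S public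
        using (*-cong; *-congˡ; +-cong; -‿cong; ^-congˡ; _≈_; trans)
      open Sums S public
        using (U-cong; V-cong)
    module FR = Family R b M n-1
      using (Discriminant; N; a; f; n; s; w)
    module FS = Family S ⟦ b ⟧ ⟦ M ⟧ n-1
      using (Discriminant; N; a; f; s; w)

  f-homo : ∀ x → ⟦ FR.f x ⟧ S.≈ FS.f ⟦ x ⟧
  f-homo x = S.trans (+-homo _ _) (S.+-cong (^-homo x FR.n) (S.trans (*-homo _ _) (S.*-congˡ
    (S.trans (U-homo FR.n (M R.* x) R.1#) (S.U-cong FR.n (*-homo M x) 1-homo)))))

  N-homo : ⟦ FR.N ⟧ S.≈ FS.N
  N-homo = ι-homo (+ FR.n)

  a-homo : ⟦ FR.a ⟧ S.≈ FS.a
  a-homo = S.trans (+-homo _ _) (S.+-cong 1-homo N-homo)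

  s-homo : ⟦ FR.s ⟧ S.≈ FS.s
  s-homo = S.trans (+-homo _ _) (S.+-cong 1-homo (S.trans (neg-homo _) (S.-‿cong
    (S.trans (*-homo _ _) (S.*-congˡ (^-homo M FR.n))))))

  w-homo : ⟦ FR.w ⟧ S.≈ FS.w
  w-homo = S.trans (*-homo _ _) (S.*-cong N-homo s-homo)

  Discriminant-homo : ⟦ FR.Discriminant ⟧ S.≈ FS.Discriminant
  Discriminant-homo = S.trans (+-homo _ _) (S.+-cong
    (S.trans (^-homo FR.a n-1) (S.^-congˡ n-1 a-homo))
    (S.trans (*-homo _ _) (S.*-cong s-homo (S.trans (V-homo n-1 FR.w FR.a) (S.V-cong n-1 w-homo a-homo)))))

module FamilyPoly {c ℓ : Level} (A : CommutativeRing c ℓ) (b M : CommutativeRing.Carrier A) (n-1 : ℕ) where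
  open PolyTheory A
    using (*-congʳ; *-congˡ; *-identityʳ; *-identityˡ; +-cong; +-congʳ; +-congˡ; +-identityˡ; -_; -‿cong; 0#; 1#
          ; :-_; C; C-*; C-^; D; D-*; D-+; D-C; D-X; D-^; D-cong; D-neg; Monic; Monic-X^; Top; Top-*; Top-+
          ; Top-C; Top-X; Top-[]; Top-^; Top-cong; Top-suc; X; _*_; _+_; _:*_; _:+_; _:-_; _:=_; _^_; _∎; _≈_
          ; a-0≈a; begin_; con; polynomialRing; refl; solve; step-≈-⟩; sym; trans; zeroˡ; ι)
  open Sums polynomialRing
    using (U)
  private module A = Ring A
            using (*-identityʳ; +-congˡ; +-identityʳ; +-identityˡ; -_; 0#; 1#; Carrier; _*_; _+_; _^_; trans
                  ; zeroʳ)
  open Family polynomialRing (C b) (C M) n-1 public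

  F z : List A.Carrier
  F = f X
  z = C M * X

  private
    z-top : Top 1 z M
    z-top = Top-cong refl (A.*-identityʳ M) (Top-* (C M) X (Top-C M) Top-X)

    U-top : ∀ k → Top k (U k z 1#) A.0#
    U-top zero    = Top-[]
    U-top (suc k) = Top-cong refl (A.+-identityˡ A.0#) (Top-+
      (Top-suc (≡.subst (λ i → Top i (z ^ k) (M A.^ k)) (ℕ.*-identityʳ k) (Top-^ z k z-top)))
      (Top-suc (Top-* 1# (U k z 1#) (Top-C A.1#) (U-top k))))

  F-monic : Monic n F
  F-monic = Top-cong refl (A.trans (A.+-congˡ (A.zeroʳ b)) (A.+-identityʳ A.1#))
    (Top-+ (Monic-X^ n) (Top-* (C b) (U n z 1#) (Top-C b) (U-top n)))

  D-C* : ∀ a g → D (C a * g) ≈ C a * D g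
  D-C* a g = trans (D-* (C a) g) (trans (+-congʳ {C a * D g} (trans (*-congʳ {g} (D-C a)) (zeroˡ g))) (+-identityˡ _))

  D-z : D z ≈ C M
  D-z = trans (D-C* M X) (trans (*-congˡ {C M} D-X) (*-identityʳ (C M)))

  private
    s≈C : s ≈ C (A.1# A.+ A.- (b A.* M A.^ n))
    s≈C = +-congˡ {1#} (-‿cong (sym (trans (C-* b (M A.^ n)) (*-congˡ {C b} (C-^ M n)))))

    D-X^n : D (X ^ n) ≈ N * X ^ n-1
    D-X^n = trans (D-^ X n-1) (*-congˡ {N} (trans (*-congˡ {X ^ n-1} D-X) (*-identityʳ _)))

  -- The derivative of `f-telescope`, whose right side no longer contains the sum; apart from the
  -- factor xⁿ⁻¹ the result is linear in z.
  D-F : C M * F + (z + - 1#) * D F ≈ X ^ n-1 * (a * z + - w)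
  D-F = begin
    C M * F + (z + - 1#) * D F                       ≈⟨ +-congʳ {(z + - 1#) * D F} (*-congʳ {F} (sym (D-z- 1# (D-C A.1#)))) ⟩
    D (z + - 1#) * F + (z + - 1#) * D F              ≈⟨ sym (D-* (z + - 1#) F) ⟩
    D ((z + - 1#) * F)                               ≈⟨ D-cong (f-telescope X) ⟩
    D ((z + - s) * X ^ n + - C b)                    ≈⟨ D-+ ((z + - s) * X ^ n) (- C b) ⟩
    D ((z + - s) * X ^ n) + D (- C b)                ≈⟨ +-cong (D-* (z + - s) (X ^ n)) (trans (D-neg (C b)) (-‿cong (D-C b))) ⟩
    D (z + - s) * X ^ n + (z + - s) * D (X ^ n) + - 0#
      ≈⟨ trans (a-0≈a (D (z + - s) * X ^ n + (z + - s) * D (X ^ n))) (+-cong (*-congʳ {X ^ n} (D-z- s (trans (D-cong s≈C) (D-C (A.1# A.+ A.- (b A.* M A.^ n)))))) (*-congˡ {z + - s} D-X^n)) ⟩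
    C M * (X * X ^ n-1) + (z + - s) * (N * X ^ n-1)
      ≈⟨ solve 5 (λ M x p s N → M :* (x :* p) :+ (M :* x :- s) :* (N :* p) := p :* ((con 1ℤ :+ N) :* (M :* x) :- N :* s)) refl (C M) X (X ^ n-1) s N ⟩
    X ^ n-1 * (a * z + - w)                          ∎
    where
    D-z- : ∀ t → D t ≈ [] → D (z + - t) ≈ C M
    D-z- t Dt≈0 = begin
      D (z + - t)          ≈⟨ D-+ z (- t) ⟩
      D z + D (- t)        ≈⟨ +-cong D-z (trans (D-neg t) (-‿cong Dt≈0)) ⟩
      C M + - []           ≈⟨ a-0≈a (C M) ⟩
      C M                  ∎

  module _ {c' ℓ' : Level} {B : CommutativeRing c' ℓ'} (φ : Hom polynomialRing B) where
    private
      module B where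
        open Ring B public
          using (*-cong; *-congʳ; *-congˡ; +-cong; +-congˡ; 1#; 1^n≈1; ^-congˡ; _*_; _+_; _:*_; _:=_; _∎; _≈_
                ; begin_; con; distribˡ; refl; solve; step-≈-⟩; sym; trans; zeroʳ; ι)
        open Sums B public
          using (T)
    open Hom φ
      using (*-homo; +-homo; 0-homo; ^-homo; ι-homo; ⟦_⟧; ⟦⟧-cong)

    -- Where z = 1 the identity `D-F` carries no information on the derivative, whose coefficient
    -- there is z - 1. So the sum is differentiated term by term, (zᵏ)' being k M when z = 1.
    D-F-at-1 : ⟦ z ⟧ B.≈ B.1# → ⟦ D F ⟧ B.≈ ⟦ N ⟧ B.* ⟦ X ^ n-1 ⟧ B.+ ⟦ C b ⟧ B.* (⟦ C M ⟧ B.* B.T n)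
    D-F-at-1 z≈1 = B.begin
      ⟦ D F ⟧                                                      B.≈⟨ ⟦⟧-cong (trans (D-+ (X ^ n) (C b * U n z 1#)) (+-cong D-X^n (D-C* b (U n z 1#)))) ⟩
      ⟦ N * X ^ n-1 + C b * D (U n z 1#) ⟧                         B.≈⟨ +-homo (N * X ^ n-1) _ ⟩
      ⟦ N * X ^ n-1 ⟧ B.+ ⟦ C b * D (U n z 1#) ⟧                   B.≈⟨ B.+-cong (*-homo N _) (*-homo (C b) _) ⟩
      ⟦ N ⟧ B.* ⟦ X ^ n-1 ⟧ B.+ ⟦ C b ⟧ B.* ⟦ D (U n z 1#) ⟧       B.≈⟨ B.+-congˡ (B.*-congˡ (DU n)) ⟩
      ⟦ N ⟧ B.* ⟦ X ^ n-1 ⟧ B.+ ⟦ C b ⟧ B.* (⟦ C M ⟧ B.* B.T n)    B.∎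
      where
      Dz^ : ∀ k → ⟦ D (z ^ k) ⟧ B.≈ ⟦ C M ⟧ B.* B.ι (+ k)
      Dz^ zero    = B.trans (⟦⟧-cong (D-C A.1#)) (B.trans 0-homo (B.sym (B.zeroʳ _)))
      Dz^ (suc k) = B.begin
        ⟦ D (z ^ suc k) ⟧                                  B.≈⟨ ⟦⟧-cong (trans (D-^ z k) (*-congˡ {ι (+ suc k)} (*-congˡ {z ^ k} D-z))) ⟩
        ⟦ ι (+ suc k) * (z ^ k * C M) ⟧                    B.≈⟨ B.trans (*-homo (ι (+ suc k)) _) (B.*-cong (ι-homo (+ suc k)) (*-homo (z ^ k) (C M))) ⟩
        B.ι (+ suc k) B.* (⟦ z ^ k ⟧ B.* ⟦ C M ⟧)          B.≈⟨ B.*-congˡ (B.*-congʳ (B.trans (^-homo z k) (B.trans (B.^-congˡ k z≈1) (B.1^n≈1 k)))) ⟩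
        B.ι (+ suc k) B.* (B.1# B.* ⟦ C M ⟧)               B.≈⟨ B.solve 2 (λ i m → i B.:* (B.con 1ℤ B.:* m) B.:= m B.:* i) B.refl (B.ι (+ suc k)) ⟦ C M ⟧ ⟩
        ⟦ C M ⟧ B.* B.ι (+ suc k)                          B.∎

      DU : ∀ k → ⟦ D (U k z 1#) ⟧ B.≈ ⟦ C M ⟧ B.* B.T k
      DU zero    = B.trans 0-homo (B.sym (B.zeroʳ _))
      DU (suc k) = B.begin
        ⟦ D (z ^ k + 1# * U k z 1#) ⟧                      B.≈⟨ ⟦⟧-cong (trans (D-cong (+-congˡ {z ^ k} (*-identityˡ (U k z 1#)))) (D-+ (z ^ k) (U k z 1#))) ⟩
        ⟦ D (z ^ k) + D (U k z 1#) ⟧                       B.≈⟨ B.trans (+-homo (D (z ^ k)) _) (B.+-cong (Dz^ k) (DU k)) ⟩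
        ⟦ C M ⟧ B.* B.ι (+ k) B.+ ⟦ C M ⟧ B.* B.T k        B.≈⟨ B.sym (B.distribˡ _ _ _) ⟩
        ⟦ C M ⟧ B.* B.T (suc k)                            B.∎

-- Maximality at primes that do not divide b m.

module PairQuotient {c ℓ : Level} (R : CommutativeRing c ℓ) (f g : CommutativeRing.Carrier R) where
  private
    module R = Ring R
      using (*-identityˡ; +-congʳ; -_; -‿cong; -‿distribˡ-*; 1#; :-_; _*_; _+_; _:+_; _:-_; _:=_; _∎; _≈_
            ; begin_; con; refl; solve; step-≈-⟩; sym)
    Q₁ = Quotient.quotientRing R f

  pairRing : CommutativeRing c (c ⊔ ℓ)
  pairRing = Quotient.quotientRing Q₁ g

  private module B = Ring pairRing
            using (0#; 1#; _≈_)

  pairHom : Hom R pairRing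
  pairHom = quotientHom Q₁ g ∘ᴴ quotientHom R f

  f≈0 : f B.≈ B.0#
  f≈0 = Quotient.≈⇒≋ Q₁ g (Quotient.∣⇒≋0 R f (R.1# , R.*-identityˡ f))

  g≈0 : g B.≈ B.0#
  g≈0 = Quotient.∣⇒≋0 Q₁ g (R.1# , Quotient.≈⇒≋ R f (R.*-identityˡ g))

  trivial⇒comaximal : B.1# B.≈ B.0# → ∃[ u ] ∃[ v ] u R.* f R.+ v R.* g R.≈ R.1#
  trivial⇒comaximal 1≈0 = R.- t , v , (R.begin
    R.- t R.* f R.+ v R.* g                  R.≈⟨ R.+-congʳ (R.sym (R.-‿distribˡ-* t f)) ⟩
    R.- (t R.* f) R.+ v R.* g                R.≈⟨ R.+-congʳ (R.-‿cong (_∣ʳ_.equality f∣vg-1)) ⟩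
    R.- (v R.* g R.+ R.- R.1#) R.+ v R.* g   R.≈⟨ R.solve 1 (λ x → R.:- (x R.:- R.con 1ℤ) R.:+ x R.:= R.con 1ℤ) R.refl (v R.* g) ⟩
    R.1#                                     R.∎)
    where
    g∣1 = Quotient.≋0⇒∣ Q₁ g 1≈0
    v = _∣ʳ_.quotient g∣1
    f∣vg-1 = Quotient._≋_.difference (_∣ʳ_.equality g∣1)
    t = _∣ʳ_.quotient f∣vg-1

ℤ'-^ : ∀ x n → x ℤ'.^ n ≡ x ℤ.^ n
ℤ'-^ x zero    = ≡.refl
ℤ'-^ x (suc n) = cong (x ℤ.*_) (ℤ'-^ x n)

module LocalCases (b M : ℤ) (n-1 : ℕ) where
  module I = Family ℤ.+-*-commutativeRing b M n-1
    using (Discriminant; N; a; a-w; discriminant-at-critical; discriminant-formula; f; f-scale; n; s; w; y)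
  open FamilyPoly ℤ.+-*-commutativeRing b M n-1 public using (F; F-monic)
  open Order F-monic public using (ℤ[θ]; Maximal; maximal; ≈⇒≋; ∣⇒≋0)

  module AtPrime {q : ℕ} (q-prime : Prime q) where
    private
      module 𝔽 = Modular q
        using (*-comm; -_; 1#; C; C≈0; D; D-cong; X; _*_; _+_; _:*_; _:+_; _:=_; _^_; _≈_; con; polynomialRing
              ; refl; solve; sym; unit; ℤ/q)
      module F𝔽 = FamilyPoly 𝔽.ℤ/q b M n-1 using (F; z; a; w; D-F; D-F-at-1)
    open Reduction q using (reduce-Top)

    F≈F𝔽 : F 𝔽.≈ F𝔽.F
    F≈F𝔽 = HomFamily.f-homo (reductionHom q) (Z.C b) (Z.C M) n-1 Z.X

    module AtRoot {c' ℓ' : Level} {B : CommutativeRing c' ℓ'} (φ : Hom 𝔽.polynomialRing B)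
                  (F≈0 : CommutativeRing._≈_ B (Hom.⟦_⟧ φ F) (CommutativeRing.0# B)) (q∤b : ¬ (+ q ℤ.∣ b)) where
      private module B = Ring B
                using (*-cong; +-cong; -_; -‿cong; 0#; 1#; _*_; _+_; _^_; _≈_; sym; trans)
      open Hom φ
        using (*-homo; +-homo; 0-homo; 1-homo; ^-homo; neg-homo; ⟦_⟧; ⟦⟧-cong)
      χ : Hom ℤ.+-*-commutativeRing B
      χ = φ ∘ᴴ (constantHom 𝔽.ℤ/q ∘ᴴ ℤ/Hom q)
      module χ = Hom χ
        using (⟦_⟧)
      module FB = Family B (χ.⟦ b ⟧) (χ.⟦ M ⟧) n-1 using (N; a; w; Discriminant; cancel-unit; module Root)
      module Fχ = HomFamily χ b M n-1 using (a-homo; w-homo; Discriminant-homo)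
      module Fφ = HomFamily φ (𝔽.C b) (𝔽.C M) n-1 using (f-homo; N-homo; a-homo; w-homo)

      χ-zero : ∀ t → + q ℤ.∣ t → χ.⟦ t ⟧ B.≈ B.0#
      χ-zero t q∣t = B.trans (⟦⟧-cong (𝔽.C≈0 q∣t)) 0-homo

      χ-unit : ∀ t → ¬ (+ q ℤ.∣ t) → ∃[ y ] χ.⟦ t ⟧ B.* y B.≈ B.1#
      χ-unit t q∤t = ⟦ 𝔽.C (proj₁ y) ⟧ , B.trans (B.sym (*-homo _ _)) (B.trans (⟦⟧-cong (proj₂ y)) 1-homo)
        where y = 𝔽.unit q-prime t q∤t

      F𝔽≈0 : ⟦ F𝔽.F ⟧ B.≈ B.0#
      F𝔽≈0 = B.trans (⟦⟧-cong (𝔽.sym F≈F𝔽)) F≈0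

      open FB.Root ⟦ 𝔽.X ⟧ (B.trans (B.sym (Fφ.f-homo 𝔽.X)) F𝔽≈0) (proj₁ (χ-unit b q∤b)) (proj₂ (χ-unit b q∤b)) public

      φ-critical : ⟦ 𝔽.X 𝔽.^ n-1 𝔽.* (F𝔽.a 𝔽.* F𝔽.z 𝔽.+ 𝔽.- F𝔽.w) ⟧ B.≈ ⟦ 𝔽.X ⟧ B.^ n-1 B.* (FB.a B.* z B.+ B.- FB.w)
      φ-critical = B.trans (*-homo (𝔽.X 𝔽.^ n-1) _) (B.*-cong (^-homo 𝔽.X n-1) (B.trans (+-homo (F𝔽.a 𝔽.* F𝔽.z) _)
        (B.+-cong (B.trans (*-homo F𝔽.a F𝔽.z) (B.*-cong Fφ.a-homo (*-homo (𝔽.C M) 𝔽.X)))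
          (B.trans (neg-homo F𝔽.w) (B.-‿cong Fφ.w-homo)))))

    module _ (2≤n-1 : 2 ≤ n-1) where
      private
        module S = Sums ℤ.+-*-commutativeRing using (V)

        -- From index 2 on every term of V contains w or a, whereas `V 1` is 1; this is one use of n
        -- ≥ 3.
        q∣V : + q ℤ.∣ I.a → + q ℤ.∣ I.w → + q ℤ.∣ S.V n-1 I.w I.a
        q∣V q∣a q∣w = go 2≤n-1
          where
          go : ∀ {k} → 2 ≤ k → + q ℤ.∣ S.V k I.w I.a
          go {suc (suc k)} (s≤s (s≤s _)) = ℤ.∣m∣n⇒∣m+n (ℤ.∣m⇒∣m*n _ q∣a)
            (ℤ.∣m∣n⇒∣m+n (ℤ.∣m⇒∣m*n _ q∣w) (ℤ.∣m⇒∣m*n _ q∣a))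

        a^n-1 : ∀ {k} → 2 ≤ k → ∃[ r ] I.a ℤ'.^ k ≡ I.a ℤ.* I.a ℤ.* r
        a^n-1 {suc (suc k)} (s≤s (s≤s _)) = I.a ℤ'.^ k , ≡.sym (ℤ.*-assoc I.a I.a _)

      q∣Discriminant : + q ℤ.∣ I.a → + q ℤ.∣ I.w → + q ℤ.∣ I.Discriminant
      q∣Discriminant q∣a q∣w = ℤ.∣m∣n⇒∣m+n
        (≡.subst (+ q ℤ.∣_) (≡.sym (proj₂ (a^n-1 2≤n-1))) (ℤ.∣m⇒∣m*n _ (ℤ.∣m⇒∣m*n _ q∣a)))
        (ℤ.∣n⇒∣m*n I.s (q∣V q∣a q∣w))

      -- Excludes q ∣ a when q divides the discriminant exactly once: aⁿ⁻¹ contains a², and s and V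
      -- contribute one factor q each.
      q²∣Discriminant : + q ℤ.∣ I.a → + q ℤ.∣ I.w → + q ℤ.∣ I.s → + q ℤ.* + q ℤ.∣ I.Discriminant
      q²∣Discriminant q∣a q∣w q∣s = ℤ.∣m∣n⇒∣m+n
        (≡.subst (+ q ℤ.* + q ℤ.∣_) (≡.sym (proj₂ (a^n-1 2≤n-1))) (ℤ.∣m⇒∣m*n _ (product∣ q∣a q∣a)))
        (product∣ q∣s (q∣V q∣a q∣w))
        where
        product∣ : ∀ {x y} → + q ℤ.∣ x → + q ℤ.∣ y → + q ℤ.* + q ℤ.∣ x ℤ.* y
        product∣ {x} {y} q∣x q∣y = ℤ.∣-trans (ℤ.*-monoʳ-∣ (+ q) q∣y) (ℤ.*-monoˡ-∣ y q∣x)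

      module _ (q∤b : ¬ (+ q ℤ.∣ b)) where

        maximal-at-nondivisor : ¬ (+ q ℤ.∣ I.Discriminant) → Maximal q
        maximal-at-nondivisor q∤disc =
          maximal q-prime F Z.1# [] (Z.solve 2 (λ f k → f Z.:= f Z.:* Z.con 1ℤ Z.:+ k Z.:* Z.con 0ℤ) Z.refl F (Z.C (+ q)))
            (reduce-Top F-monic) (proj₁ separable) (proj₁ (proj₂ separable)) (proj₂ (proj₂ separable))
            [] 𝔽.1# [] (𝔽.solve 1 (λ f → 𝔽.con 0ℤ 𝔽.:* f 𝔽.:+ 𝔽.con 1ℤ 𝔽.:* 𝔽.con 1ℤ 𝔽.:+ 𝔽.con 0ℤ 𝔽.:* 𝔽.con 0ℤ 𝔽.:= 𝔽.con 1ℤ) 𝔽.refl F)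
            1 (𝔽.1# , 𝔽.*-comm 𝔽.1# F)
          where
          open PairQuotient 𝔽.polynomialRing F (𝔽.D F)
            using (f≈0; g≈0; pairHom; pairRing; trivial⇒comaximal)
          module B = Ring pairRing
            using (*-comm; *-cong; *-congʳ; *-congˡ; *-identityʳ; *-identityˡ; +-cong; +-congʳ; +-congˡ
                  ; +-identityʳ; +-identityˡ; -_; -‿cong; 0#; 1#; :-_; _*_; _+_; _:*_; _:-_; _:=_; _^_; _∎; _≈_
                  ; begin_; con; refl; solve; step-≈-⟩; sym; trans; zeroʳ; zeroˡ)
          module Sᴮ = Sums pairRing using (T)
          open Hom pairHom
            using (*-homo; +-homo; ^-homo; neg-homo; ⟦_⟧; ⟦⟧-cong)
          open AtRoot pairHom f≈0 q∤b

          DF𝔽≈0 : 𝔽.D F𝔽.F B.≈ B.0#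
          DF𝔽≈0 = B.trans (⟦⟧-cong (𝔽.D-cong (𝔽.sym F≈F𝔽))) g≈0

          f'≈0 : 𝔽.X B.^ n-1 B.* (FB.a B.* z B.+ B.- FB.w) B.≈ B.0#
          f'≈0 = B.trans (B.sym φ-critical) (B.trans (⟦⟧-cong (𝔽.sym F𝔽.D-F))
            (B.trans (B.+-cong (B.trans (B.*-congˡ {𝔽.C M} F𝔽≈0) (B.zeroʳ (𝔽.C M)))
              (B.trans (B.*-congˡ {F𝔽.z 𝔽.+ 𝔽.- 𝔽.1#} DF𝔽≈0) (B.zeroʳ (F𝔽.z 𝔽.+ 𝔽.- 𝔽.1#)))) (B.+-identityˡ B.0#)))

          f'-at-1 : z B.≈ B.1# → FB.N B.* 𝔽.X B.^ n-1 B.+ 𝔽.C b B.* (𝔽.C M B.* Sᴮ.T I.n) B.≈ B.0#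
          f'-at-1 z≈1 = B.trans (B.+-congʳ (B.*-cong (B.sym Fφ.N-homo) (B.sym (^-homo 𝔽.X n-1))))
            (B.trans (B.sym (F𝔽.D-F-at-1 pairHom z≈1)) DF𝔽≈0)

          trivial : Dec (+ q ℤ.∣ I.a) → B.1# B.≈ B.0#
          trivial (no q∤a) = no-double-root f'≈0 f'-at-1
            (proj₁ δ) (B.trans (B.*-congʳ (B.sym Fχ.Discriminant-homo)) (proj₂ δ))
            (proj₁ α) (B.trans (B.*-congʳ (B.sym Fχ.a-homo)) (proj₂ α))
            where
            δ = χ-unit I.Discriminant q∤disc
            α = χ-unit I.a q∤a
          -- If a vanishes modulo q, the critical equation a z = w becomes w = 0. But w is a unit,
          -- since q ∣ w together with q ∣ a would give q ∣ `Discriminant`.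
          trivial (yes q∣a) = FB.cancel-unit {FB.w} {proj₁ ω} B.1# (B.trans (B.*-congʳ (B.sym Fχ.w-homo)) (proj₂ ω))
                            (B.trans (B.*-identityʳ FB.w) (B.trans (B.sym (critical f'≈0))
                              (B.trans (B.*-congʳ (B.trans (B.sym Fχ.a-homo) (χ-zero I.a q∣a))) (B.zeroˡ z))))
            where
            ω = χ-unit I.w (λ q∣w → q∤disc (q∣Discriminant q∣a q∣w))

          separable : ∃[ u ] ∃[ v ] u 𝔽.* F 𝔽.+ v 𝔽.* 𝔽.D F 𝔽.≈ 𝔽.1#
          separable = trivial⇒comaximal (trivial (+ q ℤ.∣? I.a))

module SimpleDivisor (b M : ℤ) (n-1 : ℕ) (2≤n-1 : 2 ≤ n-1) {q : ℕ} (q-prime : Prime q)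
                     (q∤b : ¬ (+ q ℤ.∣ b)) (q∤M : ¬ (+ q ℤ.∣ M)) where
  open LocalCases b M n-1 using (F; F-monic; Maximal; maximal; module I)
  private
    module 𝔽 = Modular q
      using (*-comm; *-cong; *-congʳ; *-congˡ; *-identityʳ; *-identityˡ; +-cong; +-congʳ; +-congˡ; +-identityʳ
            ; -_; -‿cong; 0#; 1#; :-_; C; C-*; C-cong; C≈0; D; D-*; D-cong; X; _*_; _+_; _:*_; _:+_; _:-_; _:=_
            ; _^_; _∎; _∣_; _≈_; begin_; coeffwise; con; from-∣; polynomialRing; refl; reflexive; solve
            ; step-≈-⟩; sym; trans; unit; ℤ/q; ∣⇒≈0; ≈0⇒∣)
    module F𝔽 = FamilyPoly 𝔽.ℤ/q b M n-1 using (F; z; a; w; D-F)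
    module ℤ/q = Ring 𝔽.ℤ/q
      using (*-cong; *-congˡ; +-cong; +-identityʳ; +-identityˡ; ^-congˡ; _*_; _+_; _^_; _∎; _≈_; begin_; refl
            ; reflexive; step-≈-⟩; sym; trans; zeroʳ)
  open I using (n; a; w; s; y; N; Discriminant)

  constant-comaximal : ∀ ρ → ¬ (+ q ℤ.∣ ρ) → ∀ g h → ∃[ e ] 𝔽.0# 𝔽.* g 𝔽.+ 𝔽.0# 𝔽.* h 𝔽.+ e 𝔽.* 𝔽.C ρ 𝔽.≈ 𝔽.1#
  constant-comaximal ρ q∤ρ g h = 𝔽.C (proj₁ ρ') , 𝔽.trans (𝔽.*-comm (𝔽.C (proj₁ ρ')) (𝔽.C ρ)) (proj₂ ρ')
    where ρ' = 𝔽.unit q-prime ρ q∤ρ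

  prime∣^' : ∀ x k → + q ℤ.∣ x ℤ'.^ k → + q ℤ.∣ x
  prime∣^' x k d = prime∣^ q-prime x k (≡.subst (+ q ℤ.∣_) (ℤ'-^ x k) d)

  prime∤* : ∀ x y → ¬ (+ q ℤ.∣ x) → ¬ (+ q ℤ.∣ y) → ¬ (+ q ℤ.∣ x ℤ.* y)
  prime∤* x y q∤x q∤y d with prime∣* q-prime x y d
  ... | inj₁ q∣x = q∤x q∣x
  ... | inj₂ q∣y = q∤y q∣y

  q∤y : ¬ (+ q ℤ.∣ y)
  q∤y = prime∤* b (M ℤ'.^ n) q∤b (λ q∣ → q∤M (prime∣^' M n q∣))

  module _ (q∣disc : + q ℤ.∣ Discriminant) (q²∤disc : ¬ (+ q ℤ.* + q ℤ.∣ Discriminant)) where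
    private
      q∣formula : + q ℤ.∣ s ℤ.* w ℤ'.^ n ℤ.+ y ℤ.* (a ℤ.* a ℤ'.^ n)
      q∣formula = ≡.subst (+ q ℤ.∣_) I.discriminant-formula (ℤ.∣n⇒∣m*n (a ℤ.- w) (ℤ.∣n⇒∣m*n (a ℤ.- w) q∣disc))

    -- If q ∣ a, the discriminant formula gives q ∣ s wⁿ, hence q ∣ w = N s. As a = 1 + N forces q ∤
    -- N, also q ∣ s, and then q² divides the discriminant.
    q∤a : ¬ (+ q ℤ.∣ a)
    q∤a q∣a = q²∤disc (LocalCases.AtPrime.q²∣Discriminant b M n-1 q-prime 2≤n-1 q∣a q∣w q∣s)
      where
      q∣w : + q ℤ.∣ w
      q∣w = [ ℤ.∣n⇒∣m*n N , prime∣^' w n ]′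
        (prime∣* q-prime s (w ℤ'.^ n) (ℤ.∣m+n∣n⇒∣m q∣formula (ℤ.∣n⇒∣m*n y (ℤ.∣m⇒∣m*n (a ℤ'.^ n) q∣a))))
      q∣s : + q ℤ.∣ s
      q∣s = [ (λ q∣N → contradiction (ℤ.∣m+n∣n⇒∣m q∣a q∣N) (prime∤1 q-prime)) , (λ q∣s → q∣s) ]′ (prime∣* q-prime N s q∣w)

    q∤a-w : ¬ (+ q ℤ.∣ a ℤ.- w)
    q∤a-w q∣a-w = q∤a (prime∣^' a (suc n) (𝔽.≈0⇒∣ (ℤ/q.begin
      a ℤ'.^ suc n                                  ℤ/q.≈⟨ Hom.^-homo (ℤ/Hom q) a (suc n) ⟩
      a ℤ/q.* a ℤ/q.^ n                             ℤ/q.≈⟨ ℤ/q.*-cong h.a-homo (ℤ/q.^-congˡ n h.a-homo) ⟩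
      FQ.a ℤ/q.* FQ.a ℤ/q.^ n                       ℤ/q.≈⟨ ℤ/q.sym (FQ.discriminant-diagonal w≈a) ⟩
      FQ.a ℤ/q.* FQ.Discriminant ℤ/q.+ FQ.a ℤ/q.* FQ.Discriminant
        ℤ/q.≈⟨ ℤ/q.+-cong aD≈0 aD≈0 ⟩
      0ℤ ℤ/q.+ 0ℤ                                   ℤ/q.≈⟨ ℤ/q.+-identityˡ 0ℤ ⟩
      0ℤ                                            ℤ/q.∎)))
      where
      module FQ = Family 𝔽.ℤ/q b M n-1 using (a; w; Discriminant; discriminant-diagonal)
      module h = HomFamily (ℤ/Hom q) b M n-1 using (a-homo; w-homo; Discriminant-homo)
      w≈a : FQ.w ℤ/q.≈ FQ.a
      w≈a = ℤ/q.trans (ℤ/q.sym h.w-homo) (ℤ/q.trans (ℤ/q.sym (𝔽.from-∣ q∣a-w)) h.a-homo)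
      aD≈0 : FQ.a ℤ/q.* FQ.Discriminant ℤ/q.≈ 0ℤ
      aD≈0 = ℤ/q.trans (ℤ/q.*-congˡ {FQ.a} (ℤ/q.trans (ℤ/q.sym h.Discriminant-homo) (𝔽.∣⇒≈0 q∣disc))) (ℤ/q.zeroʳ FQ.a)

    private
      q∤aM : ¬ (+ q ℤ.∣ a ℤ.* M)
      q∤aM = prime∤* a M q∤a q∤M

      t k : ℤ
      t = proj₁ (inverse-mod-prime q-prime (a ℤ.* M) q∤aM)
      k = ℤ._∣_.quotient (proj₂ (inverse-mod-prime q-prime (a ℤ.* M) q∤aM))
      aMt-1 : a ℤ.* M ℤ.* t ℤ.- 1ℤ ≡ k ℤ.* + q
      aMt-1 = ℤ._∣_.equality (proj₂ (inverse-mod-prime q-prime (a ℤ.* M) q∤aM))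

    -- One Newton step turns the inverse t of a M modulo q into one modulo q².
    x₀ : ℤ
    x₀ = t ℤ.* (+ 2 ℤ.- a ℤ.* M ℤ.* t) ℤ.* w

    critical-mod-q² : + (q ℕ.* q) ℤ.∣ a ℤ.* (M ℤ.* x₀) ℤ.- w
    critical-mod-q² = ℤ.divides (ℤ.- w ℤ.* (k ℤ.* k)) (begin
      a ℤ.* (M ℤ.* x₀) ℤ.- w
        ≡⟨ ℤ'.solve 4 (λ a M t w → a ℤ'.:* (M ℤ'.:* (t ℤ'.:* (ℤ'.con (+ 2) ℤ'.:- a ℤ'.:* M ℤ'.:* t) ℤ'.:* w)) ℤ'.:- w
             ℤ'.:= ℤ'.:- w ℤ'.:* ((a ℤ'.:* M ℤ'.:* t ℤ'.:- ℤ'.con 1ℤ) ℤ'.:* (a ℤ'.:* M ℤ'.:* t ℤ'.:- ℤ'.con 1ℤ))) ≡.refl a M t w ⟩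
      ℤ.- w ℤ.* ((a ℤ.* M ℤ.* t ℤ.- 1ℤ) ℤ.* (a ℤ.* M ℤ.* t ℤ.- 1ℤ))
        ≡⟨ cong (λ z → ℤ.- w ℤ.* (z ℤ.* z)) aMt-1 ⟩
      ℤ.- w ℤ.* (k ℤ.* + q ℤ.* (k ℤ.* + q))
        ≡⟨ ℤ'.solve 3 (λ w k q → ℤ'.:- w ℤ'.:* (k ℤ'.:* q ℤ'.:* (k ℤ'.:* q)) ℤ'.:= ℤ'.:- w ℤ'.:* (k ℤ'.:* k) ℤ'.:* (q ℤ'.:* q)) ≡.refl w k (+ q) ⟩
      ℤ.- w ℤ.* (k ℤ.* k) ℤ.* (+ q ℤ.* + q)
        ≡⟨ cong (ℤ.- w ℤ.* (k ℤ.* k) ℤ.*_) (ℤ.pos-* q q) ⟨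
      ℤ.- w ℤ.* (k ℤ.* k) ℤ.* + (q ℕ.* q) ∎)
      where open ≡.≡-Reasoning

    c : List ℤ
    c = ℤ.- x₀ ∷ 1ℤ ∷ []

    private
      c-monic : Z.Monic 1 c
      c-monic = Z.Top-∷ (ℤ.- x₀) (Z.Top-C 1ℤ)
      division = Z.divide c-monic F
      r = proj₁ (proj₂ division)
      r-top : Z.Top 1 r 0ℤ
      r-top = proj₂ (proj₂ (proj₂ division))

    g : List ℤ
    g = proj₁ division

    F≈cg+r : F Z.≈ c Z.* g Z.+ r
    F≈cg+r = proj₁ (proj₂ (proj₂ division))

    r₀ : ℤ
    r₀ = Z.coeff r 0

    r≈C : r Z.≈ Z.C r₀
    r≈C = Z.coeffwise λ { zero → ≡.refl ; 1 → Z.leading r-top ; (suc (suc i)) → Z.above r-top (suc (suc i)) (s≤s (s≤s z≤n)) }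

    r₀-value : r₀ ≡ I.f x₀
    r₀-value = ≡.sym (begin
      I.f x₀
        ≡⟨ ≡.cong₂ (λ b M → Family.f ℤ.+-*-commutativeRing b M n-1 x₀) (ε-C b) (ε-C M) ⟨
      Family.f ℤ.+-*-commutativeRing ε.⟦ Z.C b ⟧ ε.⟦ Z.C M ⟧ n-1 x₀
        ≡⟨ cong (Family.f ℤ.+-*-commutativeRing ε.⟦ Z.C b ⟧ ε.⟦ Z.C M ⟧ n-1) ε-X ⟨
      Family.f ℤ.+-*-commutativeRing ε.⟦ Z.C b ⟧ ε.⟦ Z.C M ⟧ n-1 ε.⟦ Z.X ⟧
        ≡⟨ HomFamily.f-homo ε-hom (Z.C b) (Z.C M) n-1 Z.X ⟨
      ε.⟦ F ⟧                                  ≡⟨ ε.⟦⟧-cong F≈cg+r ⟩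
      ε.⟦ c Z.* g Z.+ r ⟧                      ≡⟨ ≡.trans (ε.+-homo (c Z.* g) r) (≡.cong₂ ℤ._+_ (ε.*-homo c g) (≡.trans (ε.⟦⟧-cong r≈C) (ε-C r₀))) ⟩
      ε.⟦ c ⟧ ℤ.* ε.⟦ g ⟧ ℤ.+ r₀               ≡⟨ cong (λ z → z ℤ.* ε.⟦ g ⟧ ℤ.+ r₀) ε-c ⟩
      0ℤ ℤ.* ε.⟦ g ⟧ ℤ.+ r₀                    ≡⟨ ℤ.+-identityˡ r₀ ⟩
      r₀                                       ∎)
      where
      open ≡.≡-Reasoning
      ε-hom = evalHom ℤ.+-*-commutativeRing x₀
      module ε = Hom ε-hom
        using (*-homo; +-homo; ⟦_⟧; ⟦⟧-cong)
      ε-C : ∀ t → ε.⟦ Z.C t ⟧ ≡ t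
      ε-C t = ≡.trans (≡.cong₂ ℤ._+_ (ℤ'-ι t) (ℤ.*-zeroʳ x₀)) (ℤ.+-identityʳ t)
      ε-X : ε.⟦ Z.X ⟧ ≡ x₀
      ε-X = ≡.trans (ℤ.+-identityˡ _) (≡.trans (cong (x₀ ℤ.*_) (ε-C 1ℤ)) (ℤ.*-identityʳ x₀))
      ε-c : ε.⟦ c ⟧ ≡ 0ℤ
      ε-c = ≡.trans (≡.cong₂ ℤ._+_ (ℤ'-ι (ℤ.- x₀)) (≡.trans (cong (x₀ ℤ.*_) (ε-C 1ℤ)) (ℤ.*-identityʳ x₀))) (ℤ.+-inverseˡ x₀)

    -- `E` is (a M)ⁿ f as a function of a z, so only a M x₀ ≡ w modulo q² enters. This precision is
    -- what carries q² ∤ 𝒟 over to the remainder r₀.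
    value-mod-q² : + (q ℕ.* q) ℤ.∣ (a ℤ.* M) ℤ'.^ n ℤ.* r₀ ℤ.- (a ℤ.- w) ℤ.* Discriminant
    value-mod-q² = Q².to-∣ (R².begin
      (a ℤ.* M) ℤ'.^ n ℤ.* r₀                                   R².≡⟨ cong ((a ℤ.* M) ℤ'.^ n ℤ.*_) r₀-value ⟩
      (a ℤ.* M) ℤ'.^ n ℤ.* I.f x₀                               R².≡⟨ I.f-scale a x₀ ⟩
      E (a ℤ.* (M ℤ.* x₀))                                      R².≈⟨ E-homo (a ℤ.* (M ℤ.* x₀)) ⟩
      E² (a ℤ.* (M ℤ.* x₀))                                     R².≈⟨ R².+-cong (R².^-congˡ n t≈w) (R².*-congˡ {y} (R².*-congˡ {a} (S².U-cong n {a ℤ.* (M ℤ.* x₀)} {w} {a} {a} t≈w (R².refl {a})))) ⟩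
      E² w                                                      R².≈⟨ R².sym (E-homo w) ⟩
      E w                                                       R².≡⟨ I.discriminant-at-critical ⟨
      (a ℤ.- w) ℤ.* Discriminant                                R².∎)
      where
      module Q² = Modular (q ℕ.* q) using (ℤ/q; to-∣; from-∣)
      module R² = Ring Q².ℤ/q
        using (*-congˡ; +-cong; ^-congˡ; _*_; _+_; _^_; _∎; _≈_; begin_; refl; step-≈-⟩; step-≡-⟨; step-≡-⟩; sym)
      module S² = Sums Q².ℤ/q using (U; U-cong)
      module S = Sums ℤ.+-*-commutativeRing using (U)
      open Hom (ℤ/Hom (q ℕ.* q))
        using (^-homo)
      E E² : ℤ → ℤ
      E t  = t ℤ'.^ n ℤ.+ y ℤ.* (a ℤ.* S.U n t a)
      E² t = t R².^ n R².+ y R².* (a R².* S².U n t a)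
      E-homo : ∀ t → E t R².≈ E² t
      E-homo t = R².+-cong (^-homo t n) (R².*-congˡ {y} (R².*-congˡ {a} (HomSums.U-homo (ℤ/Hom (q ℕ.* q)) n t a)))
      t≈w : a ℤ.* (M ℤ.* x₀) R².≈ w
      t≈w = Q².from-∣ critical-mod-q²

    private
      q∣q² : + q ℤ.∣ + (q ℕ.* q)
      q∣q² = ℤ.divides (+ q) (ℤ.pos-* q q)

      q∤aMⁿ : ¬ (+ q ℤ.∣ (a ℤ.* M) ℤ'.^ n)
      q∤aMⁿ d = q∤aM (prime∣^' (a ℤ.* M) n d)

      q∣r₀ : + q ℤ.∣ r₀
      q∣r₀ = [ (λ d → contradiction d q∤aMⁿ) , (λ d → d) ]′ (prime∣* q-prime ((a ℤ.* M) ℤ'.^ n) r₀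
        (ℤ.∣m+n∣n⇒∣m (ℤ.∣-trans q∣q² value-mod-q²) (ℤ.∣m⇒∣-m (ℤ.∣n⇒∣m*n (a ℤ.- w) q∣disc))))

    ρ : ℤ
    ρ = ℤ._∣_.quotient q∣r₀

    -- Otherwise q² ∣ r₀, so q² divides (a - w) times the discriminant, and q ∤ a - w passes the
    -- square on to the discriminant itself.
    q∤ρ : ¬ (+ q ℤ.∣ ρ)
    q∤ρ (ℤ.divides ρ' ρ≡) = q²∤disc (≡.subst (+ q ℤ.* + q ℤ.∣_) (≡.sym disc≡) (ℤ.*-monoˡ-∣ (+ q) q∣δ))
      where
      δ = ℤ._∣_.quotient q∣disc
      disc≡ : Discriminant ≡ δ ℤ.* + q
      disc≡ = ℤ._∣_.equality q∣disc
      r₀≡ : r₀ ≡ ρ' ℤ.* + q ℤ.* + q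
      r₀≡ = ≡.trans (ℤ._∣_.equality q∣r₀) (cong (ℤ._* + q) ρ≡)
      q²∣r₀ : + (q ℕ.* q) ℤ.∣ r₀
      q²∣r₀ = ℤ.divides ρ' (≡.trans r₀≡ (≡.trans (ℤ.*-assoc ρ' (+ q) (+ q)) (cong (ρ' ℤ.*_) (≡.sym (ℤ.pos-* q q)))))
      q²∣product : + q ℤ.* + q ℤ.∣ (a ℤ.- w) ℤ.* δ ℤ.* + q
      q²∣product = ≡.subst₂ ℤ._∣_ (ℤ.pos-* q q) (≡.trans (ℤ.neg-involutive _) (≡.trans (cong ((a ℤ.- w) ℤ.*_) disc≡) (≡.sym (ℤ.*-assoc (a ℤ.- w) δ (+ q)))))
        (ℤ.∣m⇒∣-m (ℤ.∣m+n∣m⇒∣n value-mod-q² (ℤ.∣n⇒∣m*n ((a ℤ.* M) ℤ'.^ n) q²∣r₀)))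
      q∣δ : + q ℤ.∣ δ
      q∣δ = [ (λ d → contradiction d q∤a-w) , (λ d → d) ]′ (prime∣* q-prime (a ℤ.- w) δ
        (ℤ.*-cancelʳ-∣ (+ q) {{ℤ.≢-nonZero (λ e → ℕ.≢-nonZero⁻¹ q {{prime⇒nonZero q-prime}} (ℤ.+-injective e))}} q²∣product))

    factorisation : F Z.≈ g Z.* c Z.+ Z.C (+ q) Z.* Z.C ρ
    factorisation = Z.trans F≈cg+r (Z.+-cong (Z.*-comm c g)
      (Z.trans r≈C (Z.trans (Z.C-cong (≡.trans (ℤ._∣_.equality q∣r₀) (ℤ.*-comm ρ (+ q)))) (Z.C-* (+ q) ρ))))

    g-monic : Z.Monic n-1 g
    g-monic = Z.monic-cofactor c-monic g (Z.Top-cong (Z.sym F-r) (ℤ.+-identityʳ 1ℤ)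
      (Z.Top-+ F-monic (Z.Top-neg (Z.Top-raise (s≤s (ℕ.<⇒≤ 2≤n-1)) r-top))))
      where
      F-r : c Z.* g Z.≈ F Z.+ Z.- r
      F-r = Z.trans (Z.solve 2 (λ u r → u Z.:= (u Z.:+ r) Z.:- r) Z.refl (c Z.* g) r) (Z.+-congʳ {Z.- r} (Z.sym F≈cg+r))

    private
      open Reduction q using (reduce; reduce-Top; +-agree; *-agree)

      F≈cg : F 𝔽.≈ c 𝔽.* g
      F≈cg = 𝔽.trans (reduce F≈cg+r) (𝔽.trans (𝔽.reflexive (≡.trans (≡.sym (+-agree (c Z.* g) r)) (cong (𝔽._+ r) (≡.sym (*-agree c g)))))
        (𝔽.trans (𝔽.+-congˡ {c 𝔽.* g} (𝔽.trans (reduce r≈C) (𝔽.C≈0 q∣r₀))) (𝔽.+-identityʳ (c 𝔽.* g))))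

      F𝔽≈cg : F𝔽.F 𝔽.≈ c 𝔽.* g
      F𝔽≈cg = 𝔽.trans (𝔽.sym (LocalCases.AtPrime.F≈F𝔽 b M n-1 q-prime)) F≈cg

      l : ℤ
      l = M ℤ.* x₀ ℤ.- 1ℤ

      -- a - w = (a z - w) - a (z - 1), and at x₀ the first term vanishes modulo q; z = 1 there
      -- would give q ∣ a - w.
      q∤l : ¬ (+ q ℤ.∣ l)
      q∤l q∣l = q∤a-w (≡.subst (+ q ℤ.∣_)
        (ℤ'.solve 4 (λ a M x w → (a ℤ'.:* (M ℤ'.:* x) ℤ'.:- w) ℤ'.:- a ℤ'.:* (M ℤ'.:* x ℤ'.:- ℤ'.con 1ℤ) ℤ'.:= a ℤ'.:- w) ≡.refl a M x₀ w)
        (ℤ.∣m∣n⇒∣m-n (ℤ.∣-trans q∣q² critical-mod-q²) (ℤ.∣n⇒∣m*n a q∣l)))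

      L L' AM p K ĝ : List ℤ
      L  = 𝔽.C l
      L' = 𝔽.C (proj₁ (𝔽.unit q-prime l q∤l))
      AM = 𝔽.C (a ℤ.* M)
      p  = 𝔽.X 𝔽.^ n-1
      -- In `double` every term except L g contains the factor c; K is the cofactor of c when the
      -- equation is solved for L g.
      K  = AM 𝔽.* p 𝔽.+ 𝔽.- (𝔽.C M 𝔽.* g) 𝔽.+ 𝔽.- (𝔽.C M 𝔽.* g) 𝔽.+ 𝔽.- ((𝔽.C M 𝔽.* c 𝔽.+ L) 𝔽.* 𝔽.D g)
      ĝ  = L' 𝔽.* K

      L-unit : L 𝔽.* L' 𝔽.≈ 𝔽.1#
      L-unit = proj₂ (𝔽.unit q-prime l q∤l)

      X≈ : 𝔽.X 𝔽.≈ c 𝔽.+ 𝔽.C x₀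
      X≈ = 𝔽.coeffwise λ { zero → ℤ/q.reflexive (≡.sym (ℤ.+-inverseˡ x₀)) ; 1 → ℤ/q.refl ; (suc (suc i)) → ℤ/q.refl }

      z-1≈ : F𝔽.z 𝔽.+ 𝔽.- 𝔽.1# 𝔽.≈ 𝔽.C M 𝔽.* c 𝔽.+ L
      z-1≈ = 𝔽.begin
        𝔽.C M 𝔽.* 𝔽.X 𝔽.+ 𝔽.- 𝔽.1#                      𝔽.≈⟨ 𝔽.+-congʳ { 𝔽.- 𝔽.1#} (𝔽.*-congˡ {𝔽.C M} X≈) ⟩
        𝔽.C M 𝔽.* (c 𝔽.+ 𝔽.C x₀) 𝔽.+ 𝔽.- 𝔽.1#           𝔽.≈⟨ 𝔽.solve 3 (λ M c x → M 𝔽.:* (c 𝔽.:+ x) 𝔽.:- 𝔽.con 1ℤ 𝔽.:= M 𝔽.:* c 𝔽.:+ (M 𝔽.:* x 𝔽.:- 𝔽.con 1ℤ)) 𝔽.refl (𝔽.C M) c (𝔽.C x₀) ⟩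
        𝔽.C M 𝔽.* c 𝔽.+ (𝔽.C M 𝔽.* 𝔽.C x₀ 𝔽.+ 𝔽.- 𝔽.1#) 𝔽.≈⟨ 𝔽.+-congˡ {𝔽.C M 𝔽.* c} (𝔽.+-congʳ { 𝔽.- 𝔽.1#} (𝔽.sym (𝔽.C-* M x₀))) ⟩
        𝔽.C M 𝔽.* c 𝔽.+ L                               𝔽.∎

      module κ = HomFamily (constantHom 𝔽.ℤ/q ∘ᴴ ℤ/Hom q) b M n-1 using (a-homo; w-homo)

      az-w≈ : F𝔽.a 𝔽.* F𝔽.z 𝔽.+ 𝔽.- F𝔽.w 𝔽.≈ AM 𝔽.* c
      az-w≈ = 𝔽.begin
        F𝔽.a 𝔽.* (𝔽.C M 𝔽.* 𝔽.X) 𝔽.+ 𝔽.- F𝔽.w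
          𝔽.≈⟨ 𝔽.+-cong (𝔽.*-cong (𝔽.sym κ.a-homo) (𝔽.*-congˡ {𝔽.C M} X≈)) (𝔽.-‿cong (𝔽.trans (𝔽.sym κ.w-homo) (𝔽.C-cong (ℤ/q.sym (𝔽.from-∣ (ℤ.∣-trans q∣q² critical-mod-q²)))))) ⟩
        𝔽.C a 𝔽.* (𝔽.C M 𝔽.* (c 𝔽.+ 𝔽.C x₀)) 𝔽.+ 𝔽.- 𝔽.C (a ℤ.* (M ℤ.* x₀))
          𝔽.≈⟨ 𝔽.+-congˡ {𝔽.C a 𝔽.* (𝔽.C M 𝔽.* (c 𝔽.+ 𝔽.C x₀))} (𝔽.-‿cong (𝔽.trans (𝔽.C-* a (M ℤ.* x₀)) (𝔽.*-congˡ {𝔽.C a} (𝔽.C-* M x₀)))) ⟩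
        𝔽.C a 𝔽.* (𝔽.C M 𝔽.* (c 𝔽.+ 𝔽.C x₀)) 𝔽.+ 𝔽.- (𝔽.C a 𝔽.* (𝔽.C M 𝔽.* 𝔽.C x₀))
          𝔽.≈⟨ 𝔽.solve 4 (λ a M c x → a 𝔽.:* (M 𝔽.:* (c 𝔽.:+ x)) 𝔽.:- a 𝔽.:* (M 𝔽.:* x) 𝔽.:= a 𝔽.:* M 𝔽.:* c) 𝔽.refl (𝔽.C a) (𝔽.C M) c (𝔽.C x₀) ⟩
        𝔽.C a 𝔽.* 𝔽.C M 𝔽.* c
          𝔽.≈⟨ 𝔽.*-congʳ {c} (𝔽.sym (𝔽.C-* a M)) ⟩
        AM 𝔽.* c 𝔽.∎

      D-c* : ∀ h → 𝔽.D (c 𝔽.* h) 𝔽.≈ h 𝔽.+ c 𝔽.* 𝔽.D h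
      D-c* h = 𝔽.trans (𝔽.D-* c h) (𝔽.+-congʳ {c 𝔽.* 𝔽.D h} (𝔽.trans (𝔽.*-congʳ {h} D-c) (𝔽.*-identityˡ h)))
        where
        D-c : 𝔽.D c 𝔽.≈ 𝔽.1#
        D-c = 𝔽.coeffwise λ { zero → ℤ/q.+-identityʳ 1ℤ ; 1 → ℤ/q.refl ; (suc (suc i)) → ℤ/q.refl }

      double : 𝔽.C M 𝔽.* (c 𝔽.* g) 𝔽.+ (𝔽.C M 𝔽.* c 𝔽.+ L) 𝔽.* (g 𝔽.+ c 𝔽.* 𝔽.D g) 𝔽.≈ p 𝔽.* (AM 𝔽.* c)
      double = 𝔽.begin
        𝔽.C M 𝔽.* (c 𝔽.* g) 𝔽.+ (𝔽.C M 𝔽.* c 𝔽.+ L) 𝔽.* (g 𝔽.+ c 𝔽.* 𝔽.D g)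
          𝔽.≈⟨ 𝔽.+-cong (𝔽.*-congˡ {𝔽.C M} (𝔽.sym F𝔽≈cg)) (𝔽.*-cong (𝔽.sym z-1≈) (𝔽.trans (𝔽.sym (D-c* g)) (𝔽.D-cong (𝔽.sym F𝔽≈cg)))) ⟩
        𝔽.C M 𝔽.* F𝔽.F 𝔽.+ (F𝔽.z 𝔽.+ 𝔽.- 𝔽.1#) 𝔽.* 𝔽.D F𝔽.F    𝔽.≈⟨ F𝔽.D-F ⟩
        p 𝔽.* (F𝔽.a 𝔽.* F𝔽.z 𝔽.+ 𝔽.- F𝔽.w)                      𝔽.≈⟨ 𝔽.*-congˡ {p} az-w≈ ⟩
        p 𝔽.* (AM 𝔽.* c) 𝔽.∎

      -- x₀ is both a root and a critical point of F modulo q, so a second factor c splits off: F =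
      -- c² ĝ modulo q.
      g≈cĝ : g 𝔽.≈ c 𝔽.* ĝ
      g≈cĝ = 𝔽.begin
        g                                        𝔽.≈⟨ 𝔽.sym (𝔽.*-identityˡ g) ⟩
        𝔽.1# 𝔽.* g                               𝔽.≈⟨ 𝔽.*-congʳ {g} (𝔽.sym L-unit) ⟩
        L 𝔽.* L' 𝔽.* g
          𝔽.≈⟨ 𝔽.solve 6 (λ L L' g M c d → L 𝔽.:* L' 𝔽.:* g 𝔽.:= L' 𝔽.:* ((M 𝔽.:* (c 𝔽.:* g) 𝔽.:+ (M 𝔽.:* c 𝔽.:+ L) 𝔽.:* (g 𝔽.:+ c 𝔽.:* d))
               𝔽.:- c 𝔽.:* (M 𝔽.:* g 𝔽.:+ M 𝔽.:* g 𝔽.:+ (M 𝔽.:* c 𝔽.:+ L) 𝔽.:* d))) 𝔽.refl L L' g (𝔽.C M) c (𝔽.D g) ⟩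
        L' 𝔽.* ((𝔽.C M 𝔽.* (c 𝔽.* g) 𝔽.+ (𝔽.C M 𝔽.* c 𝔽.+ L) 𝔽.* (g 𝔽.+ c 𝔽.* 𝔽.D g)) 𝔽.+ 𝔽.- (c 𝔽.* rest))
          𝔽.≈⟨ 𝔽.*-congˡ {L'} (𝔽.+-congʳ { 𝔽.- (c 𝔽.* rest)} double) ⟩
        L' 𝔽.* (p 𝔽.* (AM 𝔽.* c) 𝔽.+ 𝔽.- (c 𝔽.* rest))
          𝔽.≈⟨ 𝔽.solve 6 (λ L' p A c u v → L' 𝔽.:* (p 𝔽.:* (A 𝔽.:* c) 𝔽.:- c 𝔽.:* (u 𝔽.:+ u 𝔽.:+ v)) 𝔽.:= c 𝔽.:* (L' 𝔽.:* (A 𝔽.:* p 𝔽.:- u 𝔽.:- u 𝔽.:- v)))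
               𝔽.refl L' p AM c (𝔽.C M 𝔽.* g) ((𝔽.C M 𝔽.* c 𝔽.+ L) 𝔽.* 𝔽.D g) ⟩
        c 𝔽.* ĝ 𝔽.∎
        where rest = 𝔽.C M 𝔽.* g 𝔽.+ 𝔽.C M 𝔽.* g 𝔽.+ (𝔽.C M 𝔽.* c 𝔽.+ L) 𝔽.* 𝔽.D g

      open PairQuotient 𝔽.polynomialRing g (𝔽.D g) renaming (f≈0 to g≈0; g≈0 to Dg≈0)
      module B = Ring pairRing
        using (*-comm; *-congʳ; *-congˡ; *-identityˡ; +-cong; +-congˡ; +-identityʳ; -_; -‿cong; 0#; 1#; :-_; _*_
              ; _+_; _:*_; _:-_; _:=_; _^_; _∎; _≈_; begin_; con; refl; solve; step-≈-⟩; sym; trans; zeroʳ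
              ; zeroˡ)
      open Hom pairHom
        using (^-homo; ⟦⟧-cong)

      F≈0 : F B.≈ B.0#
      F≈0 = B.trans (⟦⟧-cong F≈cg) (B.trans (B.*-congˡ {c} g≈0) (B.zeroʳ c))

      open LocalCases.AtPrime.AtRoot b M n-1 q-prime pairHom F≈0 q∤b using (module FB; cancel-x^; χ-unit)

      -- Modulo g and its derivative only the term `AM * p` of K survives. There a M and L' are
      -- units, and so is x because F vanishes; hence ĝ can be cancelled.
      ĝ≈ : ĝ B.≈ L' B.* (AM B.* p)
      ĝ≈ = B.*-congˡ {L'} (B.begin
        K                                         B.≈⟨ B.+-cong (B.+-cong (B.+-congˡ {AM B.* p} (B.-‿cong Mg≈0)) (B.-‿cong Mg≈0))
                                                         (B.-‿cong (B.trans (B.*-congˡ {𝔽.C M B.* c B.+ L} Dg≈0) (B.zeroʳ (𝔽.C M B.* c B.+ L)))) ⟩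
        AM B.* p B.+ B.- B.0# B.+ B.- B.0# B.+ B.- B.0#
          B.≈⟨ B.solve 1 (λ u → u B.:- B.con 0ℤ B.:- B.con 0ℤ B.:- B.con 0ℤ B.:= u) B.refl (AM B.* p) ⟩
        AM B.* p                                  B.∎)
        where
        Mg≈0 : 𝔽.C M B.* g B.≈ B.0#
        Mg≈0 = B.trans (B.*-congˡ {𝔽.C M} g≈0) (B.zeroʳ (𝔽.C M))

      cancel-ĝ : ∀ t → t B.* ĝ B.≈ B.0# → t B.≈ B.0#
      cancel-ĝ t e = cancel-x^ t (FB.cancel-unit {AM} {proj₁ AM-unit} _ (proj₂ AM-unit)
        (FB.cancel-unit {L'} {L} _ (B.trans (B.*-comm L' L) (⟦⟧-cong L-unit)) (B.begin
          L' B.* (AM B.* (𝔽.X B.^ n-1 B.* t))    B.≈⟨ B.*-congˡ {L'} (B.*-congˡ {AM} (B.*-congʳ {t} (B.sym (^-homo 𝔽.X n-1)))) ⟩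
          L' B.* (AM B.* (p B.* t))              B.≈⟨ B.solve 4 (λ l m p t → l B.:* (m B.:* (p B.:* t)) B.:= t B.:* (l B.:* (m B.:* p))) B.refl L' AM p t ⟩
          t B.* (L' B.* (AM B.* p))              B.≈⟨ B.*-congˡ {t} (B.sym ĝ≈) ⟩
          t B.* ĝ                                B.≈⟨ e ⟩
          B.0#                                   B.∎)))
        where AM-unit = χ-unit (a ℤ.* M) q∤aM

      -- As ĝ can be cancelled, g = c ĝ = 0 forces c = 0. Then 0 = D g = ĝ + c D ĝ leaves ĝ = 0, and
      -- cancelling ĝ once more leaves 1 = 0.
      trivial : B.1# B.≈ B.0#
      trivial = cancel-ĝ B.1# (B.begin
        B.1# B.* ĝ                     B.≈⟨ B.*-identityˡ ĝ ⟩
        ĝ                              B.≈⟨ B.sym (B.trans (B.+-congˡ {ĝ} (B.trans (B.*-congʳ {𝔽.D ĝ} c≈0) (B.zeroˡ (𝔽.D ĝ)))) (B.+-identityʳ ĝ)) ⟩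
        ĝ B.+ c B.* 𝔽.D ĝ              B.≈⟨ ⟦⟧-cong (𝔽.sym (D-c* ĝ)) ⟩
        𝔽.D (c 𝔽.* ĝ)                  B.≈⟨ ⟦⟧-cong (𝔽.D-cong (𝔽.sym g≈cĝ)) ⟩
        𝔽.D g                          B.≈⟨ Dg≈0 ⟩
        B.0#                           B.∎)
        where
        c≈0 : c B.≈ B.0#
        c≈0 = cancel-ĝ c (B.trans (⟦⟧-cong (𝔽.sym g≈cĝ)) g≈0)

      abstract
        separable : ∃[ u ] ∃[ v ] u 𝔽.* g 𝔽.+ v 𝔽.* 𝔽.D g 𝔽.≈ 𝔽.1#
        separable = trivial⇒comaximal trivial

      F∣g² : F 𝔽.∣ (g 𝔽.^ 2)
      F∣g² = ĝ , (𝔽.begin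
        ĝ 𝔽.* F                  𝔽.≈⟨ 𝔽.*-congˡ {ĝ} F≈cg ⟩
        ĝ 𝔽.* (c 𝔽.* g)          𝔽.≈⟨ 𝔽.solve 3 (λ h c g → h 𝔽.:* (c 𝔽.:* g) 𝔽.:= (c 𝔽.:* h) 𝔽.:* g) 𝔽.refl ĝ c g ⟩
        c 𝔽.* ĝ 𝔽.* g            𝔽.≈⟨ 𝔽.*-congʳ {g} (𝔽.sym g≈cĝ) ⟩
        g 𝔽.* g                  𝔽.≈⟨ 𝔽.*-congˡ {g} (𝔽.sym (𝔽.*-identityʳ g)) ⟩
        g 𝔽.^ 2                  𝔽.∎)

    maximal-at-simple-divisor : Maximal q
    maximal-at-simple-divisor = maximal q-prime g c (Z.C ρ) factorisation (reduce-Top g-monic)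
      (proj₁ separable) (proj₁ (proj₂ separable)) (proj₂ (proj₂ separable))
      [] [] (proj₁ comaximal) (proj₂ comaximal) 2 F∣g²
      where comaximal = constant-comaximal ρ q∤ρ g c

-- Maximality at primes dividing b or m.

module PrimeDividingB (b M : ℤ) (n-1 : ℕ) {q : ℕ} (q-prime : Prime q) (β : ℤ) (b≡βq : b ≡ β ℤ.* + q) (q∤β : ¬ (+ q ℤ.∣ β)) where
  open LocalCases b M n-1 using (F; Maximal; maximal)
  private
    module 𝔽 = Modular q
      using (*-comm; *-congʳ; *-identityˡ; +-congʳ; +-congˡ; +-identityʳ; -_; -‿cong; -‿distribˡ-*; 0#; 1#; :-_
            ; C; C≈0; D; D-X; Top-X; X; _*_; _+_; _:+_; _:-_; _:=_; _^_; _∎; _≈_; begin_; con; polynomialRing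
            ; refl; solve; step-≈-⟩; sym; trans; unit; zeroˡ; ℤ/q)
    module F𝔽 = FamilyPoly 𝔽.ℤ/q b M n-1 using (z)
    module FZ = FamilyPoly ℤ.+-*-commutativeRing b M n-1 using (z)
    module SZ = Sums Z.polynomialRing using (U; U-head)
    module S𝔽 = Sums 𝔽.polynomialRing using (U)
    Q₀ = Quotient.quotientRing 𝔽.polynomialRing 𝔽.X
    module Q = Ring Q₀
      using (*-congˡ; *-identityʳ; 0#; 1#; _≈_; trans; zeroʳ)
    module SQ = Sums Q₀ using (U-at-0)
    ω : Hom Z.polynomialRing Q₀
    ω = quotientHom 𝔽.polynomialRing 𝔽.X ∘ᴴ reductionHom q
    open Hom ω
      using (*-homo)

    n = suc n-1
    E F' : List ℤ
    E = SZ.U n FZ.z Z.1#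
    F' = Z.C β Z.* E

    factorisation : F Z.≈ Z.X Z.* Z.X Z.^ n-1 Z.+ Z.C (+ q) Z.* F'
    factorisation = Z.+-congˡ {Z.X Z.^ n} (Z.trans (Z.*-congʳ {E} (Z.trans (Z.C-cong b≡βq) (Z.C-* β (+ q))))
      (Z.solve 3 (λ β q E → β Z.:* q Z.:* E Z.:= q Z.:* (β Z.:* E)) Z.refl (Z.C β) (Z.C (+ q)) E))

    E≈1 : E Q.≈ Q.1#
    E≈1 = Q.trans (HomSums.U-homo ω n FZ.z Z.1#) (SQ.U-at-0 n-1 FZ.z z≈0)
      where
      z≈0 : FZ.z Q.≈ Q.0#
      z≈0 = Q.trans (*-homo (Z.C M) Z.X) (Q.trans
        (Q.*-congˡ {Z.C M} (Quotient.∣⇒≋0 𝔽.polynomialRing 𝔽.X (𝔽.1# , 𝔽.*-identityˡ 𝔽.X))) (Q.zeroʳ (Z.C M)))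

    β' : ℤ
    β' = proj₁ (𝔽.unit q-prime β q∤β)

    -- F' is β times the sum, and the sum is 1 modulo x; so modulo x and q it is the unit β. This
    -- makes x and F' comaximal modulo q.
    β'F'≈1 : 𝔽.C β' 𝔽.* F' Q.≈ Q.1#
    β'F'≈1 = Q.trans (Q.*-congˡ {𝔽.C β'} (Q.trans (*-homo (Z.C β) E) (Q.trans (Q.*-congˡ {Z.C β} E≈1) (Q.*-identityʳ (Z.C β)))))
      (Quotient.≈⇒≋ 𝔽.polynomialRing 𝔽.X (𝔽.trans (𝔽.*-comm (𝔽.C β') (𝔽.C β)) (proj₂ (𝔽.unit q-prime β q∤β))))

    X∣β'F'-1 = Quotient._≋_.difference β'F'≈1
    t : List ℤ
    t = _∣ʳ_.quotient X∣β'F'-1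

    comaximal : 𝔽.- t 𝔽.* 𝔽.X 𝔽.+ 𝔽.0# 𝔽.* (Z.X Z.^ n-1) 𝔽.+ 𝔽.C β' 𝔽.* F' 𝔽.≈ 𝔽.1#
    comaximal = 𝔽.begin
      𝔽.- t 𝔽.* 𝔽.X 𝔽.+ 𝔽.0# 𝔽.+ 𝔽.C β' 𝔽.* F'
        𝔽.≈⟨ 𝔽.+-congʳ {𝔽.C β' 𝔽.* F'} (𝔽.trans (𝔽.+-identityʳ (𝔽.- t 𝔽.* 𝔽.X)) (𝔽.sym (𝔽.-‿distribˡ-* t 𝔽.X))) ⟩
      𝔽.- (t 𝔽.* 𝔽.X) 𝔽.+ 𝔽.C β' 𝔽.* F'
        𝔽.≈⟨ 𝔽.+-congʳ {𝔽.C β' 𝔽.* F'} (𝔽.-‿cong (_∣ʳ_.equality X∣β'F'-1)) ⟩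
      𝔽.- (𝔽.C β' 𝔽.* F' 𝔽.+ 𝔽.- 𝔽.1#) 𝔽.+ 𝔽.C β' 𝔽.* F'
        𝔽.≈⟨ 𝔽.solve 1 (λ x → 𝔽.:- (x 𝔽.:- 𝔽.con 1ℤ) 𝔽.:+ x 𝔽.:= 𝔽.con 1ℤ) 𝔽.refl (𝔽.C β' 𝔽.* F') ⟩
      𝔽.1# 𝔽.∎

  F≈Xⁿ : F 𝔽.≈ 𝔽.X 𝔽.^ n
  F≈Xⁿ = 𝔽.begin
    F                                                 𝔽.≈⟨ LocalCases.AtPrime.F≈F𝔽 b M n-1 q-prime ⟩
    𝔽.X 𝔽.^ n 𝔽.+ 𝔽.C b 𝔽.* S𝔽.U n F𝔽.z 𝔽.1#
      𝔽.≈⟨ 𝔽.+-congˡ {𝔽.X 𝔽.^ n} (𝔽.trans (𝔽.*-congʳ {S𝔽.U n F𝔽.z 𝔽.1#} (𝔽.C≈0 (ℤ.divides β b≡βq))) (𝔽.zeroˡ (S𝔽.U n F𝔽.z 𝔽.1#))) ⟩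
    𝔽.X 𝔽.^ n 𝔽.+ 𝔽.0#                               𝔽.≈⟨ 𝔽.+-identityʳ (𝔽.X 𝔽.^ n) ⟩
    𝔽.X 𝔽.^ n                                         𝔽.∎

  maximal-at-divisor-of-b : Maximal q
  maximal-at-divisor-of-b = maximal q-prime Z.X (Z.X Z.^ n-1) F' factorisation 𝔽.Top-X
    [] 𝔽.1# (𝔽.trans (𝔽.*-identityˡ (𝔽.D 𝔽.X)) 𝔽.D-X) (𝔽.- t) [] (𝔽.C β') comaximal n (𝔽.1# , 𝔽.trans (𝔽.*-identityˡ F) F≈Xⁿ)

-- Since M ≡ 0 mod q², f ≡ xⁿ + b mod q²; writing n = Q n' with Q = qᵏ and
-- expanding xⁿ = (g - b)^Q around g = xⁿ' + b isolates (-b)^Q + b.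
module PrimeDividingM (b M : ℤ) (n-1 : ℕ) {q : ℕ} (q-prime : Prime q) (μ : ℤ) (M≡μq² : M ≡ μ ℤ.* + q ℤ.* + q)
                      (k n' : ℕ) (n≡Qn' : suc n-1 ≡ q ℕ.^ k ℕ.* n') where
  open LocalCases b M n-1 using (F; Maximal; maximal)
  private
    module FZ = FamilyPoly ℤ.+-*-commutativeRing b M n-1 using (z)
    module SZ = Sums Z.polynomialRing using (U; U-head)
    open Frobenius Z.polynomialRing using (frobenius-^)
    n = suc n-1
    Q = q ℕ.^ k

    n'>0 : 0 ℕ.< n'
    n'>0 = go n' n≡Qn'
      where
      go : ∀ n' → n ≡ Q ℕ.* n' → 0 ℕ.< n'
      go zero    e = contradiction (≡.trans e (ℕ.*-zeroʳ Q)) λ ()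
      go (suc _) _ = s≤s z≤n

    Q>0 : 0 ℕ.< Q
    Q>0 = ℕ.m^n>0 q {{prime⇒nonZero q-prime}} k

  g : List ℤ
  g = Z.X Z.^ n' Z.+ Z.C b

  g-monic : Z.Monic n' g
  g-monic = Z.Top-cong Z.refl (ℤ.+-identityʳ 1ℤ) (Z.Top-+ (Z.Monic-X^ n') (Z.Top-raise n'>0 (Z.Top-C b)))

  private
    split = frobenius-^ q-prime k g (Z.C (ℤ.- b))

  s : List ℤ
  s = proj₁ split

  -- Frobenius gives xⁿ = (g - b)^Q = g^Q + (-b)^Q + q g s, the correction being known to be a
  -- multiple of g; h collects the cofactors of g.
  h : List ℤ
  h = g Z.^ ℕ.pred Q Z.+ Z.C (+ q) Z.* s

  defect : ℤ
  defect = (ℤ.- b) ℤ'.^ Q ℤ.+ b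

  E : List ℤ
  E = Z.C b Z.* (Z.C μ Z.* (Z.X Z.* SZ.U n-1 FZ.z Z.1#))

  Xⁿ-expansion : Z.X Z.^ n Z.≈ g Z.* h Z.+ Z.C ((ℤ.- b) ℤ'.^ Q)
  Xⁿ-expansion = Z.begin
    Z.X Z.^ n                                       Z.≡⟨ cong (Z.X Z.^_) (≡.trans n≡Qn' (ℕ.*-comm Q n')) ⟩
    Z.X Z.^ (n' ℕ.* Q)                              Z.≈⟨ Z.sym (Z.^-assocʳ Z.X n' Q) ⟩
    (Z.X Z.^ n') Z.^ Q                              Z.≈⟨ Z.^-congˡ Q (Z.solve 2 (λ x b → x Z.:= (x Z.:+ b) Z.:+ Z.:- b) Z.refl (Z.X Z.^ n') (Z.C b)) ⟩
    (g Z.+ Z.C (ℤ.- b)) Z.^ Q                       Z.≈⟨ proj₂ split ⟩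
    g Z.^ Q Z.+ Z.C (ℤ.- b) Z.^ Q Z.+ Z.ι (+ q) Z.* (g Z.* s)
      Z.≈⟨ Z.+-cong (Z.+-cong (g^Q Q Q>0) (Z.sym (Z.C-^ (ℤ.- b) Q))) (Z.*-congʳ {g Z.* s} ι≈C) ⟩
    g Z.* g Z.^ ℕ.pred Q Z.+ Z.C ((ℤ.- b) ℤ'.^ Q) Z.+ Z.C (+ q) Z.* (g Z.* s)
      Z.≈⟨ Z.solve 5 (λ g p c q s → g Z.:* p Z.:+ c Z.:+ q Z.:* (g Z.:* s) Z.:= g Z.:* (p Z.:+ q Z.:* s) Z.:+ c) Z.refl g (g Z.^ ℕ.pred Q) (Z.C ((ℤ.- b) ℤ'.^ Q)) (Z.C (+ q)) s ⟩
    g Z.* h Z.+ Z.C ((ℤ.- b) ℤ'.^ Q) Z.∎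
    where
    g^Q : ∀ Q → 0 ℕ.< Q → g Z.^ Q Z.≈ g Z.* g Z.^ ℕ.pred Q
    g^Q (suc Q) _ = Z.refl
    ι≈C : Z.ι (+ q) Z.≈ Z.C (+ q)
    ι≈C = Z.trans (Z.sym (Hom.ι-homo (constantHom ℤ.+-*-commutativeRing) (+ q))) (Z.C-cong (ℤ'-ι (+ q)))

  expansion : F Z.≈ g Z.* h Z.+ (Z.C defect Z.+ Z.C (+ q) Z.* (Z.C (+ q) Z.* E))
  expansion = Z.begin
    Z.X Z.^ n Z.+ Z.C b Z.* SZ.U n FZ.z Z.1#
      Z.≈⟨ Z.+-cong Xⁿ-expansion (Z.*-congˡ {Z.C b} (Z.trans (SZ.U-head n-1 FZ.z) (Z.+-congˡ {Z.1#} (Z.*-congʳ {U} (Z.*-congʳ {Z.X} M≈))))) ⟩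
    g Z.* h Z.+ B Z.+ Z.C b Z.* (Z.1# Z.+ Z.C μ Z.* Z.C (+ q) Z.* Z.C (+ q) Z.* Z.X Z.* U)
      Z.≈⟨ Z.solve 7 (λ t B b μ q X U → t Z.:+ B Z.:+ b Z.:* (Z.con 1ℤ Z.:+ μ Z.:* q Z.:* q Z.:* X Z.:* U)
           Z.:= t Z.:+ ((B Z.:+ b) Z.:+ q Z.:* (q Z.:* (b Z.:* (μ Z.:* (X Z.:* U)))))) Z.refl (g Z.* h) B (Z.C b) (Z.C μ) (Z.C (+ q)) Z.X U ⟩
    g Z.* h Z.+ (Z.C defect Z.+ Z.C (+ q) Z.* (Z.C (+ q) Z.* E)) Z.∎
    where
    U = SZ.U n-1 FZ.z Z.1#
    B = Z.C ((ℤ.- b) ℤ'.^ Q)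
    M≈ : Z.C M Z.≈ Z.C μ Z.* Z.C (+ q) Z.* Z.C (+ q)
    M≈ = Z.trans (Z.C-cong M≡μq²) (Z.trans (Z.C-* (μ ℤ.* + q) (+ q)) (Z.*-congʳ {Z.C (+ q)} (Z.C-* μ (+ q))))

  module _ (q∤b : ¬ (+ q ℤ.∣ b)) (q∤n' : ¬ q ℕ.∣ n') (c₀ : ℤ) (defect≡c₀q : defect ≡ c₀ ℤ.* + q)
           (good : k ≡ 0 ⊎ ¬ (+ q ℤ.∣ c₀)) where
    private
      module 𝔽 = Modular q
        using (*-assoc; *-comm; *-cong; *-congʳ; *-congˡ; *-identityˡ; +-cong; +-congʳ; +-congˡ; +-identityʳ; -_
              ; 0#; 1#; :-_; C; C-*; C≈0; D; D-+; D-C; D-X; D-^; D-cong; X; ^-congʳ; _*_; _+_; _:*_; _:+_; _:-_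
              ; _:=_; _^_; _∎; _∣_; _≈_; begin_; con; refl; solve; step-≈-⟩; step-≡-⟨; step-≡-⟩; sym; trans
              ; unit; zeroˡ; ι≈C)
      open Reduction q using (reduce; reduce-Top; *-agree)
      Fₕ : List ℤ
      Fₕ = Z.C c₀ Z.+ Z.C (+ q) Z.* E

      factorisation : F Z.≈ g Z.* h Z.+ Z.C (+ q) Z.* Fₕ
      factorisation = Z.trans expansion (Z.+-congˡ {g Z.* h} (Z.trans
        (Z.+-congʳ {Z.C (+ q) Z.* (Z.C (+ q) Z.* E)} (Z.trans (Z.C-cong defect≡c₀q) (Z.C-* c₀ (+ q))))
        (Z.solve 3 (λ c q e → c Z.:* q Z.:+ q Z.:* (q Z.:* e) Z.:= q Z.:* (c Z.:+ q Z.:* e)) Z.refl (Z.C c₀) (Z.C (+ q)) E)))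

      drop-q : ∀ x t → x Z.+ Z.C (+ q) Z.* t 𝔽.≈ x
      drop-q x t = 𝔽.trans (+-homo x (Z.C (+ q) Z.* t)) (𝔽.trans (𝔽.+-congˡ {x} (𝔽.trans (*-homo (Z.C (+ q)) t)
        (𝔽.trans (𝔽.*-congʳ {t} (𝔽.C≈0 ℤ.∣-refl)) (𝔽.zeroˡ t)))) (𝔽.+-identityʳ x))
        where open Hom (reductionHom q)

      h≈ : h 𝔽.≈ g 𝔽.^ ℕ.pred Q
      h≈ = 𝔽.trans (drop-q (g Z.^ ℕ.pred Q) s) (Hom.^-homo (reductionHom q) g (ℕ.pred Q))

      g≈ : g 𝔽.≈ 𝔽.X 𝔽.^ n' 𝔽.+ 𝔽.C b
      g≈ = 𝔽.trans (Hom.+-homo (reductionHom q) (Z.X Z.^ n') (Z.C b)) (𝔽.+-congʳ {𝔽.C b} (Hom.^-homo (reductionHom q) Z.X n'))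

      q∤n'b : ¬ (+ q ℤ.∣ + n' ℤ.* b)
      q∤n'b d with prime∣* q-prime (+ n') b d
      ... | inj₁ q∣n' = q∤n' (ℤ.∣⇒∣ᵤ q∣n')
      ... | inj₂ q∣b  = q∤b q∣b

      e : ℤ
      e = proj₁ (𝔽.unit q-prime (+ n' ℤ.* b) q∤n'b)

      XDg : 𝔽.X 𝔽.* 𝔽.D g 𝔽.≈ 𝔽.C (+ n') 𝔽.* 𝔽.X 𝔽.^ n'
      XDg = go n' n'>0 g≈
        where
        go : ∀ n' → 0 ℕ.< n' → g 𝔽.≈ 𝔽.X 𝔽.^ n' 𝔽.+ 𝔽.C b → 𝔽.X 𝔽.* 𝔽.D g 𝔽.≈ 𝔽.C (+ n') 𝔽.* 𝔽.X 𝔽.^ n'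
        go (suc j) _ g≈ = 𝔽.begin
          𝔽.X 𝔽.* 𝔽.D g                                    𝔽.≈⟨ 𝔽.*-congˡ {𝔽.X} (𝔽.trans (𝔽.D-cong g≈) (𝔽.trans (𝔽.D-+ (𝔽.X 𝔽.^ suc j) (𝔽.C b))
                                                                (𝔽.trans (𝔽.+-congˡ {𝔽.D (𝔽.X 𝔽.^ suc j)} (𝔽.D-C b)) (𝔽.+-identityʳ (𝔽.D (𝔽.X 𝔽.^ suc j)))))) ⟩
          𝔽.X 𝔽.* 𝔽.D (𝔽.X 𝔽.^ suc j)                      𝔽.≈⟨ 𝔽.*-congˡ {𝔽.X} (𝔽.trans (𝔽.D-^ 𝔽.X j) (𝔽.*-cong (𝔽.ι≈C (+ suc j)) (𝔽.*-congˡ {𝔽.X 𝔽.^ j} 𝔽.D-X))) ⟩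
          𝔽.X 𝔽.* (𝔽.C (+ suc j) 𝔽.* (𝔽.X 𝔽.^ j 𝔽.* 𝔽.1#)) 𝔽.≈⟨ 𝔽.solve 3 (λ x c p → x 𝔽.:* (c 𝔽.:* (p 𝔽.:* 𝔽.con 1ℤ)) 𝔽.:= c 𝔽.:* (x 𝔽.:* p)) 𝔽.refl 𝔽.X (𝔽.C (+ suc j)) (𝔽.X 𝔽.^ j) ⟩
          𝔽.C (+ suc j) 𝔽.* 𝔽.X 𝔽.^ suc j                  𝔽.∎

      -- n' g - x g' = n' b, and q divides neither n' nor b; e is the inverse of n' b.
      separable : 𝔽.C e 𝔽.* 𝔽.C (+ n') 𝔽.* g 𝔽.+ (𝔽.- 𝔽.C e 𝔽.* 𝔽.X) 𝔽.* 𝔽.D g 𝔽.≈ 𝔽.1#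
      separable = 𝔽.begin
        𝔽.C e 𝔽.* 𝔽.C (+ n') 𝔽.* g 𝔽.+ (𝔽.- 𝔽.C e 𝔽.* 𝔽.X) 𝔽.* 𝔽.D g
          𝔽.≈⟨ 𝔽.+-cong (𝔽.*-congˡ {𝔽.C e 𝔽.* 𝔽.C (+ n')} g≈) (𝔽.trans (𝔽.*-assoc (𝔽.- 𝔽.C e) 𝔽.X (𝔽.D g)) (𝔽.*-congˡ { 𝔽.- 𝔽.C e} XDg)) ⟩
        𝔽.C e 𝔽.* 𝔽.C (+ n') 𝔽.* (p 𝔽.+ 𝔽.C b) 𝔽.+ 𝔽.- 𝔽.C e 𝔽.* (𝔽.C (+ n') 𝔽.* p)
          𝔽.≈⟨ 𝔽.solve 4 (λ e n p b → e 𝔽.:* n 𝔽.:* (p 𝔽.:+ b) 𝔽.:+ 𝔽.:- e 𝔽.:* (n 𝔽.:* p) 𝔽.:= (n 𝔽.:* b) 𝔽.:* e) 𝔽.refl (𝔽.C e) (𝔽.C (+ n')) p (𝔽.C b) ⟩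
        𝔽.C (+ n') 𝔽.* 𝔽.C b 𝔽.* 𝔽.C e            𝔽.≈⟨ 𝔽.*-congʳ {𝔽.C e} (𝔽.sym (𝔽.C-* (+ n') b)) ⟩
        𝔽.C (+ n' ℤ.* b) 𝔽.* 𝔽.C e                𝔽.≈⟨ proj₂ (𝔽.unit q-prime (+ n' ℤ.* b) q∤n'b) ⟩
        𝔽.1# 𝔽.∎
        where p = 𝔽.X 𝔽.^ n'

      -- For k = 0 the exponent Q is 1, so h is the empty power 1 modulo q. In the other case Fₕ is
      -- c₀ modulo q, a unit.
      comaximal : k ≡ 0 ⊎ ¬ (+ q ℤ.∣ c₀) → ∃[ c ] ∃[ d' ] 𝔽.0# 𝔽.* g 𝔽.+ c 𝔽.* h 𝔽.+ d' 𝔽.* Fₕ 𝔽.≈ 𝔽.1#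
      comaximal (inj₁ k≡0) = 𝔽.1# , 𝔽.0# , 𝔽.trans (𝔽.+-identityʳ (𝔽.1# 𝔽.* h)) (𝔽.trans (𝔽.*-identityˡ h)
        (𝔽.trans h≈ (𝔽.^-congʳ g (cong (λ k → ℕ.pred (q ℕ.^ k)) k≡0))))
      comaximal (inj₂ q∤c₀) = 𝔽.0# , 𝔽.C (proj₁ c₀') , 𝔽.trans (𝔽.*-congˡ {𝔽.C (proj₁ c₀')} (drop-q (Z.C c₀) E))
        (𝔽.trans (𝔽.*-comm (𝔽.C (proj₁ c₀')) (𝔽.C c₀)) (proj₂ c₀'))
        where c₀' = 𝔽.unit q-prime c₀ q∤c₀

      F∣g^Q : F 𝔽.∣ (g 𝔽.^ Q)
      F∣g^Q = 𝔽.1# , (𝔽.begin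
        𝔽.1# 𝔽.* F                      𝔽.≈⟨ 𝔽.*-identityˡ F ⟩
        F                               𝔽.≈⟨ reduce factorisation ⟩
        g Z.* h Z.+ Z.C (+ q) Z.* Fₕ    𝔽.≈⟨ drop-q (g Z.* h) Fₕ ⟩
        g Z.* h                         𝔽.≡⟨ *-agree g h ⟨
        g 𝔽.* h                         𝔽.≈⟨ 𝔽.*-congˡ {g} h≈ ⟩
        g 𝔽.* g 𝔽.^ ℕ.pred Q            𝔽.≡⟨ cong (g 𝔽.^_) (ℕ.suc-pred Q {{ℕ.>-nonZero Q>0}}) ⟩
        g 𝔽.^ Q                         𝔽.∎)

    maximal-at-divisor-of-M : Maximal q
    maximal-at-divisor-of-M = maximal q-prime g h Fₕ factorisation (reduce-Top g-monic)
      (𝔽.C e 𝔽.* 𝔽.C (+ n')) (𝔽.- 𝔽.C e 𝔽.* 𝔽.X) separable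
      [] (proj₁ (comaximal good)) (proj₁ (proj₂ (comaximal good))) (proj₂ (proj₂ (comaximal good))) Q F∣g^Q

-- Rational coefficients and the clearing of denominators.

private
  toℚᵘ-/1 : ∀ a → ℚ.toℚᵘ (a ℚ./ 1) ℚᵘ.≃ mkℚᵘ a 0
  toℚᵘ-/1 a = ℚ.toℚᵘ-fromℚᵘ (mkℚᵘ a 0)

/1-injective : ∀ {a b} → a ℚ./ 1 ≡ b ℚ./ 1 → a ≡ b
/1-injective {a} {b} e with *≡* eq ← ℚᵘ.≃-trans (ℚᵘ.≃-sym (toℚᵘ-/1 a)) (ℚᵘ.≃-trans (ℚ.toℚᵘ-cong e) (toℚᵘ-/1 b)) =
  ≡.trans (≡.sym (ℤ.*-identityʳ a)) (≡.trans eq (ℤ.*-identityʳ b))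

clear-denominator : ∀ p → (+ ℚ.↧ₙ p) ℚ./ 1 ℚ.* p ≡ ℚ.↥ p ℚ./ 1
clear-denominator p@record{} = ℚ.toℚᵘ-injective (ℚᵘ.≃-trans (ℚ.toℚᵘ-homo-* (+ ℚ.↧ₙ p ℚ./ 1) p)
  (ℚᵘ.≃-trans (ℚᵘ.*-congʳ {ℚ.toℚᵘ p} (toℚᵘ-/1 (+ ℚ.↧ₙ p)))
  (ℚᵘ.≃-trans (*≡* (ℤ'.solve 2 (λ n m → (m ℤ'.:* n) ℤ'.:* ℤ'.con 1ℤ ℤ'.:= n ℤ'.:* (ℤ'.con 1ℤ ℤ'.:* m)) ≡.refl (ℚ.↥ p) (+ ℚ.↧ₙ p)))
  (ℚᵘ.≃-sym (toℚᵘ-/1 (ℚ.↥ p))))))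

fractionHom : Hom ℤ.+-*-commutativeRing ℚ.+-*-commutativeRing
fractionHom = record
  { ⟦_⟧ = ℚ._/ 1
  ; ⟦⟧-cong = cong (ℚ._/ 1)
  ; +-homo = λ a b → ℚ.toℚᵘ-injective (ℚᵘ.≃-trans (toℚᵘ-/1 (a ℤ.+ b))
      (ℚᵘ.≃-trans (*≡* (ℤ'.solve 2 (λ a b → (a ℤ'.:+ b) ℤ'.:* ℤ'.con 1ℤ ℤ'.:= (a ℤ'.:* ℤ'.con 1ℤ ℤ'.:+ b ℤ'.:* ℤ'.con 1ℤ) ℤ'.:* ℤ'.con 1ℤ) ≡.refl a b))
      (ℚᵘ.≃-trans (ℚᵘ.≃-sym (ℚᵘ.+-cong (toℚᵘ-/1 a) (toℚᵘ-/1 b))) (ℚᵘ.≃-sym (ℚ.toℚᵘ-homo-+ (a ℚ./ 1) (b ℚ./ 1))))))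
  ; *-homo = λ a b → ℚ.toℚᵘ-injective (ℚᵘ.≃-trans (toℚᵘ-/1 (a ℤ.* b))
      (ℚᵘ.≃-trans (*≡* ≡.refl)
      (ℚᵘ.≃-trans (ℚᵘ.≃-sym (ℚᵘ.*-cong (toℚᵘ-/1 a) (toℚᵘ-/1 b))) (ℚᵘ.≃-sym (ℚ.toℚᵘ-homo-* (a ℚ./ 1) (b ℚ./ 1))))))
  ; 1-homo = ≡.refl
  }

module MapHom {c₁ ℓ₁ c₂ ℓ₂ : Level} {A : CommutativeRing c₁ ℓ₁} {B : CommutativeRing c₂ ℓ₂} (φ : Hom A B) where
  private
    module A = Ring A
      using (0#; _*_)
    module B = Ring B
      using (_*_; _≈_; refl; sym; trans)
    module P = PolyTheory A
      using (Top; _*_; _+_; at; coeff; polynomialRing)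
    module Q = PolyTheory B
      using (+-cong; Top; _*_; _+_; _≈_; coeff; coeffwise; polynomialRing; refl; trans; ∷-cong)
  open Hom φ
    using (*-homo; +-homo; 0-homo; 1-homo; ⟦_⟧; ⟦⟧-cong)

  coeff-map : ∀ f i → Q.coeff (map ⟦_⟧ f) i B.≈ ⟦ P.coeff f i ⟧
  coeff-map []      i       = B.sym 0-homo
  coeff-map (a ∷ f) zero    = B.refl
  coeff-map (a ∷ f) (suc i) = coeff-map f i

  map-+ : ∀ f g → map ⟦_⟧ (f P.+ g) Q.≈ map ⟦_⟧ f Q.+ map ⟦_⟧ g
  map-+ []      g       = Q.refl
  map-+ (a ∷ f) []      = Q.refl
  map-+ (a ∷ f) (b ∷ g) = Q.∷-cong (+-homo a b) (map-+ f g)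

  map-* : ∀ f g → map ⟦_⟧ (f P.* g) Q.≈ map ⟦_⟧ f Q.* map ⟦_⟧ g
  map-* []      g = Q.refl
  map-* (a ∷ f) g = Q.trans (map-+ (map (a A.*_) g) (A.0# ∷ f P.* g)) (Q.+-cong (map-◃ g) (Q.∷-cong 0-homo (map-* f g)))
    where
    map-◃ : ∀ g → map ⟦_⟧ (map (a A.*_) g) Q.≈ map (⟦ a ⟧ B.*_) (map ⟦_⟧ g)
    map-◃ []      = Q.refl
    map-◃ (b ∷ g) = Q.∷-cong (*-homo a b) (map-◃ g)

  mapHom : Hom P.polynomialRing Q.polynomialRing
  mapHom = record
    { ⟦_⟧ = map ⟦_⟧
    ; ⟦⟧-cong = λ {f} {g} e → Q.coeffwise λ i → B.trans (coeff-map f i) (B.trans (⟦⟧-cong (P.at e i)) (B.sym (coeff-map g i)))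
    ; +-homo = map-+
    ; *-homo = map-*
    ; 1-homo = Q.∷-cong 1-homo Q.refl
    }

  map-Top : ∀ {n f a} → P.Top n f a → Q.Top n (map ⟦_⟧ f) ⟦ a ⟧
  map-Top {n} {f} (t , z) = B.trans (coeff-map f n) (⟦⟧-cong t) ,
    λ i n<i → B.trans (coeff-map f i) (B.trans (⟦⟧-cong (z i n<i)) 0-homo)

module ReplaceEquality {c ℓ ℓ' : Level} (R : CommutativeRing c ℓ)
    (_≈'_ : CommutativeRing.Carrier R → CommutativeRing.Carrier R → Set ℓ')
    (to : ∀ {x y} → CommutativeRing._≈_ R x y → x ≈' y) (from : ∀ {x y} → x ≈' y → CommutativeRing._≈_ R x y) where
  open Ring R
    using (*-assoc; *-comm; *-cong; *-identityʳ; *-identityˡ; +-assoc; +-comm; +-cong; +-identityʳ; +-identityˡ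
          ; -_; -‿cong; -‿inverseʳ; -‿inverseˡ; 0#; 1#; Carrier; _*_; _+_; _≈_; distribʳ; distribˡ; refl; sym
          ; trans)

  -- The quotient in the definition of `Monogenic` compares elements by an unwrapped,
  -- coefficientwise divisibility; the ring laws are carried over to exactly that relation.
  replacedRing : CommutativeRing c ℓ'
  replacedRing = record
    { Carrier = Carrier
    ; _≈_ = _≈'_
    ; _+_ = _+_
    ; _*_ = _*_
    ; -_ = -_
    ; 0# = 0#
    ; 1# = 1#
    ; isCommutativeRing = record
      { isRing = record
        { +-isAbelianGroup = record
          { isGroup = record
            { isMonoid = record
              { isSemigroup = record
                { isMagma = record
                  { isEquivalence = record
                    { refl = to refl ; sym = λ e → to (sym (from e)) ; trans = λ e e' → to (trans (from e) (from e')) }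
                  ; ∙-cong = λ e e' → to (+-cong (from e) (from e'))
                  }
                ; assoc = λ x y z → to (+-assoc x y z)
                }
              ; identity = (λ x → to (+-identityˡ x)) , (λ x → to (+-identityʳ x))
              }
            ; inverse = (λ x → to (-‿inverseˡ x)) , (λ x → to (-‿inverseʳ x))
            ; ⁻¹-cong = λ e → to (-‿cong (from e))
            }
          ; comm = λ x y → to (+-comm x y)
          }
        ; *-cong = λ e e' → to (*-cong (from e) (from e'))
        ; *-assoc = λ x y z → to (*-assoc x y z)
        ; *-identity = (λ x → to (*-identityˡ x)) , (λ x → to (*-identityʳ x))
        ; distrib = (λ x y z → to (distribˡ x y z)) , (λ x y z → to (distribʳ x y z))
        }
      ; *-comm = λ x y → to (*-comm x y)
      }
    }

  replaceHom : Hom R replacedRing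
  replaceHom = record
    { ⟦_⟧ = λ x → x ; ⟦⟧-cong = to ; +-homo = λ _ _ → to refl ; *-homo = λ _ _ → to refl ; 1-homo = to refl }

module Q = PolyTheory ℚ.+-*-commutativeRing
  using (*-assoc; *-comm; *-cong; *-congʳ; *-congˡ; *-identityˡ; +-cong; +-congʳ; +-congˡ; -_; -‿cong; 1#; :-_
        ; C; C-*; C-cong; Top; Top-C; Top-raise; X; _*_; _+_; _:*_; _:+_; _:-_; _:=_; _∎; _≈_; at; begin_; coeff
        ; coeffwise; polynomialRing; refl; remainder-unique; solve; step-≈-⟩; sym; trans; zeroʳ; ∷-as-sum
        ; ∷-cong)

module toℚ where
  open MapHom fractionHom public
    using (coeff-map; map-*; map-+; map-Top; mapHom)
  open Hom mapHom public
    using (*-homo; +-homo; 0-homo; 1-homo; ^-homo; neg-homo; ι-homo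
          ; ⟦_⟧; ⟦⟧-cong)

clear-denominators : ∀ α → ∃[ N ] ∃[ γ ] N ≡.≢ 0 × Q.C (+ N ℚ./ 1) Q.* α Q.≈ toℚ.⟦ γ ⟧
clear-denominators []      = 1 , [] , (λ ()) , Q.zeroʳ (Q.C (+ 1 ℚ./ 1))
clear-denominators (p ∷ α) with clear-denominators α
... | N , γ , N≢0 , e = m ℕ.* N , (+ N ℤ.* ℚ.↥ p) ∷ Z.C (+ m) Z.* γ , mN≢0 , (Q.begin
  Q.C (+ (m ℕ.* N) ℚ./ 1) Q.* (p ∷ α)
    Q.≈⟨ Q.*-cong (Q.trans (Q.C-cong (≡.trans (cong (ℚ._/ 1) (ℤ.pos-* m N)) (Hom.*-homo fractionHom (+ m) (+ N)))) (Q.C-* m' N')) (Q.∷-as-sum p α) ⟩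
  Q.C m' Q.* Q.C N' Q.* (Q.C p Q.+ Q.X Q.* α)
    Q.≈⟨ Q.solve 5 (λ m n p x a → m Q.:* n Q.:* (p Q.:+ x Q.:* a) Q.:= n Q.:* (m Q.:* p) Q.:+ x Q.:* (m Q.:* (n Q.:* a))) Q.refl (Q.C m') (Q.C N') (Q.C p) Q.X α ⟩
  Q.C N' Q.* (Q.C m' Q.* Q.C p) Q.+ Q.X Q.* (Q.C m' Q.* (Q.C N' Q.* α))
    Q.≈⟨ Q.+-cong constant (Q.*-congˡ {Q.X} (Q.trans (Q.*-congˡ {Q.C m'} e) (Q.sym (toℚ.*-homo (Z.C (+ m)) γ)))) ⟩
  Q.C ((+ N ℤ.* ℚ.↥ p) ℚ./ 1) Q.+ Q.X Q.* toℚ.⟦ Z.C (+ m) Z.* γ ⟧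
    Q.≈⟨ Q.sym (Q.∷-as-sum ((+ N ℤ.* ℚ.↥ p) ℚ./ 1) toℚ.⟦ Z.C (+ m) Z.* γ ⟧) ⟩
  toℚ.⟦ (+ N ℤ.* ℚ.↥ p) ∷ Z.C (+ m) Z.* γ ⟧ Q.∎)
  where
  m = ℚ.↧ₙ p
  m' = + m ℚ./ 1
  N' = + N ℚ./ 1
  mN≢0 : m ℕ.* N ≡.≢ 0
  mN≢0 mN≡0 with ℕ.m*n≡0⇒m≡0∨n≡0 m mN≡0
  ... | inj₁ ()
  ... | inj₂ N≡0 = N≢0 N≡0
  constant : Q.C N' Q.* (Q.C m' Q.* Q.C p) Q.≈ Q.C ((+ N ℤ.* ℚ.↥ p) ℚ./ 1)
  constant = Q.begin
    Q.C N' Q.* (Q.C m' Q.* Q.C p)          Q.≈⟨ Q.*-congˡ {Q.C N'} (Q.trans (Q.sym (Q.C-* m' p)) (Q.C-cong (clear-denominator p))) ⟩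
    Q.C N' Q.* Q.C (ℚ.↥ p ℚ./ 1)           Q.≈⟨ Q.sym (Q.C-* N' (ℚ.↥ p ℚ./ 1)) ⟩
    Q.C (N' ℚ.* (ℚ.↥ p ℚ./ 1))             Q.≈⟨ Q.C-cong (≡.sym (Hom.*-homo fractionHom (+ N) (ℚ.↥ p))) ⟩
    Q.C ((+ N ℤ.* ℚ.↥ p) ℚ./ 1)            Q.∎

toℚ-injective : ∀ f g → toℚ.⟦ f ⟧ Q.≈ toℚ.⟦ g ⟧ → f Z.≈ g
toℚ-injective f g e = Z.coeffwise λ i → /1-injective
  (≡.trans (≡.sym (toℚ.coeff-map f i)) (≡.trans (Q.at e i) (toℚ.coeff-map g i)))

unit-ℚ : ∀ p → p ≡.≢ ℚ.0ℚ → ∃[ p' ] Q.C p Q.* Q.C p' Q.≈ Q.1#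
unit-ℚ p p≢0 = (ℚ.1/ p) {{nz}} , Q.trans (Q.sym (Q.C-* p _)) (Q.C-cong (ℚ.*-inverseʳ p {{nz}}))
  where
  nz : ℚ.NonZero p
  nz = ℚ.≢-nonZero p≢0

-- From maximality at every prime to an integral basis.

module Lattice {n : ℕ} {f : List ℤ} (f-monic : Z.Monic n f) where
  open Order f-monic using (ℤ[θ]; Maximal; C-regular; ≈⇒≋)
  open Homogenisation ℤ[θ]
  private module R = Ring ℤ[θ]
            using (*-comm; *-cong; *-congʳ; *-congˡ; *-identityʳ; *-identityˡ; +-cong; 0#; 1#; ^-congˡ
                  ; ^-distrib-*; _*_; _+_; _:*_; _:+_; _:=_; _^_; _∎; _∣_; _≈_; begin_; refl; reflexive; solve
                  ; step-≈-⟩; step-≡-⟨; step-≡-⟩; sym; trans; zeroˡ)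

  rescale : List ℤ → List (List ℤ) → List (List ℤ)
  rescale N []       = []
  rescale N (c ∷ cs) = c R.* N R.^ suc (length cs) ∷ rescale N cs

  private
    length-rescale : ∀ N cs → length (rescale N cs) ≡ length cs
    length-rescale N []       = ≡.refl
    length-rescale N (c ∷ cs) = cong suc (length-rescale N cs)

  -- If γ / (q N) is integral, so is its multiple γ / q; the coefficients absorb the powers of N.
  homogeneous-rescale : ∀ q N γ cs → homogeneous (q R.* N) γ cs R.≈ homogeneous q γ (rescale N cs)
  homogeneous-rescale q N γ []       = R.refl
  homogeneous-rescale q N γ (c ∷ cs) = R.+-cong (R.begin
    c R.* (q R.* N) R.^ suc l                          R.≈⟨ R.*-congˡ {c} (R.^-distrib-* q N (suc l)) ⟩
    c R.* (q R.^ suc l R.* N R.^ suc l)                R.≈⟨ R.solve 3 (λ c x y → c R.:* (x R.:* y) R.:= c R.:* y R.:* x) R.refl c (q R.^ suc l) (N R.^ suc l) ⟩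
    c R.* N R.^ suc l R.* q R.^ suc l                  R.≡⟨ cong (λ k → c R.* N R.^ suc l R.* q R.^ suc k) (length-rescale N cs) ⟨
    c R.* N R.^ suc l R.* q R.^ suc (length (rescale N cs)) R.∎) (R.*-congˡ {γ} (homogeneous-rescale q N γ cs))
    where l = length cs

  homogeneous-scale : ∀ q N γ cs → homogeneous (N R.* q) (γ R.* q) cs R.≈ homogeneous N γ cs R.* q R.^ length cs
  homogeneous-scale q N γ []       = R.sym (R.*-identityˡ R.1#)
  homogeneous-scale q N γ (c ∷ cs) = R.begin
    c R.* (N R.* q) R.^ suc l R.+ γ R.* q R.* homogeneous (N R.* q) (γ R.* q) cs
      R.≈⟨ R.+-cong (R.*-congˡ {c} (R.^-distrib-* N q (suc l))) (R.*-congˡ {γ R.* q} (homogeneous-scale q N γ cs)) ⟩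
    c R.* (N R.^ suc l R.* (q R.* q R.^ l)) R.+ γ R.* q R.* (E R.* q R.^ l)
      R.≈⟨ R.solve 6 (λ c m q p g e → c R.:* (m R.:* (q R.:* p)) R.:+ g R.:* q R.:* (e R.:* p) R.:= (c R.:* m R.:+ g R.:* e) R.:* (q R.:* p)) R.refl c (N R.^ suc l) q (q R.^ l) γ E ⟩
    (c R.* N R.^ suc l R.+ γ R.* E) R.* q R.^ suc l R.∎
    where
    l = length cs
    E = homogeneous N γ cs

  homogeneous-cong : ∀ {N N' γ γ'} cs → N R.≈ N' → γ R.≈ γ' → homogeneous N γ cs R.≈ homogeneous N' γ' cs
  homogeneous-cong []       e e' = R.refl
  homogeneous-cong (c ∷ cs) e e' = R.+-cong (R.*-congˡ {c} (R.^-congˡ (suc (length cs)) e)) (R.*-cong e' (homogeneous-cong cs e e'))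

  module _ (maximal-everywhere : ∀ q → Prime q → Maximal q) where
    private
      C-* : ∀ x y → Z.C (x ℤ.* y) R.≈ Z.C x R.* Z.C y
      C-* x y = ≈⇒≋ (Z.C-* x y)

    -- The prime factors of N, with multiplicity, are removed one by one: γ / q is integral, so γ =
    -- q γ' by maximality at q. The form for γ' and the remaining product vanishes too, once a power
    -- of q is cancelled.
    divides-by-primes : ∀ ps → All Prime ps → ∀ γ cs → homogeneous (Z.C (+ product ps)) γ cs R.≈ R.0# → Z.C (+ product ps) R.∣ γ
    divides-by-primes []       []              γ cs e = γ , R.*-identityʳ γ
    divides-by-primes (q ∷ ps) (q-prime ∷ pps) γ cs e = proj₁ β , (R.begin
      proj₁ β R.* Z.C (+ (q ℕ.* product ps))     R.≈⟨ R.*-congˡ {proj₁ β} C-qN ⟩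
      proj₁ β R.* (Cq R.* CN)                    R.≈⟨ R.solve 3 (λ b q m → b R.:* (q R.:* m) R.:= (b R.:* m) R.:* q) R.refl (proj₁ β) Cq CN ⟩
      proj₁ β R.* CN R.* Cq                      R.≈⟨ R.*-congʳ {Cq} (proj₂ β) ⟩
      γ' R.* Cq                                  R.≈⟨ γ'q≈γ ⟩
      γ                                          R.∎)
      where
      Cq = Z.C (+ q)
      CN = Z.C (+ product ps)
      C-qN : Z.C (+ (q ℕ.* product ps)) R.≈ Cq R.* CN
      C-qN = R.trans (R.reflexive (cong Z.C (ℤ.pos-* q (product ps)))) (C-* (+ q) (+ product ps))
      q∣γ : Cq R.∣ γ
      q∣γ = maximal-everywhere q q-prime γ (rescale CN cs)
        (R.trans (R.sym (homogeneous-rescale Cq CN γ cs)) (R.trans (homogeneous-cong cs (R.sym C-qN) R.refl) e))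
      γ' = _∣ʳ_.quotient q∣γ
      γ'q≈γ : γ' R.* Cq R.≈ γ
      γ'q≈γ = _∣ʳ_.equality q∣γ
      q≢0 : + q ≡.≢ 0ℤ
      q≢0 q≡0 = ℕ.≢-nonZero⁻¹ q {{prime⇒nonZero q-prime}} (ℤ.+-injective q≡0)
      relation : homogeneous CN γ' cs R.≈ R.0#
      relation = Dedekind.cancel-^ ℤ[θ] Cq (C-regular (+ q) q≢0) (length cs) _ _ (R.begin
        homogeneous CN γ' cs R.* Cq R.^ length cs         R.≈⟨ R.sym (homogeneous-scale Cq CN γ' cs) ⟩
        homogeneous (CN R.* Cq) (γ' R.* Cq) cs            R.≈⟨ homogeneous-cong cs (R.trans (R.*-comm CN Cq) (R.sym C-qN)) γ'q≈γ ⟩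
        homogeneous (Z.C (+ (q ℕ.* product ps))) γ cs     R.≈⟨ e ⟩
        R.0#                                              R.≈⟨ R.sym (R.zeroˡ (Cq R.^ length cs)) ⟩
        R.0# R.* Cq R.^ length cs                         R.∎)
      divisor = divides-by-primes ps pps γ' cs relation
      β : ∃[ β ] β R.* CN R.≈ γ'
      β = _∣ʳ_.quotient divisor , _∣ʳ_.equality divisor

    divides-integral : ∀ N → N ≡.≢ 0 → ∀ γ cs → homogeneous (Z.C (+ N)) γ cs R.≈ R.0# → Z.C (+ N) R.∣ γ
    divides-integral N N≢0 γ cs e = ≡.subst (λ k → Z.C (+ k) R.∣ γ) (≡.sym factors-product)
      (divides-by-primes (factors fac) (factorsPrime fac) γ cs (≡.subst (λ k → homogeneous (Z.C (+ k)) γ cs R.≈ R.0#) factors-product e))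
      where
      open PrimeFactorisation
      fac = factorise N {{ℕ.≢-nonZero N≢0}}
      factors-product : N ≡ product (factors fac)
      factors-product = isFactorisation fac

module Rearrangement {c ℓ : Level} (R : CommutativeRing c ℓ) where
  open Ring R
    using (*-assoc; *-cong; *-congʳ; *-congˡ; *-identityˡ; +-cong; -_; -‿cong; 1#; :-_; _*_; _+_; _:*_; _:+_
          ; _:-_; _:=_; _∎; _≈_; begin_; refl; solve; step-≈-⟩; sym; trans)

  horner-step : ∀ i n p x v → i * (n * p) + n * x * (p * v) ≈ n * p * (i + x * v)
  horner-step = solve 5 (λ i n p x v → i :* (n :* p) :+ n :* x :* (p :* v) := n :* p :* (i :+ x :* v)) refl

  quadratic-power : ∀ {γ s t θ B C} → γ * γ ≈ s + t * γ → s * θ ≈ B → t * θ ≈ C → γ * (γ * θ) ≈ B + γ * C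
  quadratic-power {γ} {s} {t} {θ} {B} {C} γ² sθ tθ = begin
    γ * (γ * θ)               ≈⟨ sym (*-assoc γ γ θ) ⟩
    γ * γ * θ                 ≈⟨ *-congʳ γ² ⟩
    (s + t * γ) * θ           ≈⟨ solve 4 (λ s t γ θ → (s :+ t :* γ) :* θ := s :* θ :+ γ :* (t :* θ)) refl s t γ θ ⟩
    s * θ + γ * (t * θ)       ≈⟨ +-cong sθ (*-congˡ tθ) ⟩
    B + γ * C                 ∎

  -- Here p stands for 1 / q. The constant coefficient carries q² and the linear one q, so dividing
  -- by q² leaves a monic equation for p H free of denominators.
  divided-square : ∀ {H q p W S} → H * H ≈ - (q * q * W) + q * S * H → q * p ≈ 1# → (p * H) * (p * H) ≈ - W + S * (p * H)
  divided-square {H} {q} {p} {W} {S} H² qp≈1 = begin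
    (p * H) * (p * H)                                       ≈⟨ solve 2 (λ p H → (p :* H) :* (p :* H) := p :* p :* (H :* H)) refl p H ⟩
    p * p * (H * H)                                         ≈⟨ *-congˡ H² ⟩
    p * p * (- (q * q * W) + q * S * H)
      ≈⟨ solve 5 (λ p q W S H → p :* p :* (:- (q :* q :* W) :+ q :* S :* H) := :- ((q :* p) :* ((q :* p) :* W)) :+ (q :* p) :* (S :* (p :* H))) refl p q W S H ⟩
    - ((q * p) * ((q * p) * W)) + (q * p) * (S * (p * H))   ≈⟨ +-cong (-‿cong (one (trans (*-congʳ qp≈1) (*-identityˡ W)))) (trans (*-congʳ qp≈1) (*-identityˡ _)) ⟩
    - W + S * (p * H)                                       ∎
    where
    one : ∀ {x y} → x ≈ y → (q * p) * x ≈ y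
    one e = trans (*-cong qp≈1 e) (*-identityˡ _)

  extract-factor : ∀ b x v s → b * (x * v) + x * s ≈ x * (b * v + s)
  extract-factor = solve 4 (λ b x v s → b :* (x :* v) :+ x :* s := x :* (b :* v :+ s)) refl

module NumberField {n : ℕ} {f : List ℤ} (f-monic : Z.Monic n f) (f′ : List ℤ) (f′≈f : f′ Z.≈ f) where
  open Order f-monic using (ℤ[θ]; ^-agree; Maximal)
  open Homogenisation ℤ[θ]
  open Lattice f-monic using (divides-integral)
  private
    module R = Ring ℤ[θ]
      using (0#; _*_; _^_; _∣_; _≈_; sym)
    module K₀ = Quotient Q.polynomialRing toℚ.⟦ f ⟧
      using (_≋_; mod; quotientRing)

  infix 4 _≈ᴷ_
  -- `f′` is the modulus as the statement writes it, `f` a coefficientwise equal polynomial to which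
  -- the preceding theory applies.
  _≈ᴷ_ : List ℚ → List ℚ → Set
  α ≈ᴷ β = toℚ[X] f′ ℚ[X].∣ (α ℚ[X].+ (ℚ[X].- β))

  private
    to : ∀ {x y} → x K₀.≋ y → x ≈ᴷ y
    to (K₀.mod (t , e)) = t , Q.at (Q.trans (Q.*-congˡ {t} (toℚ.⟦⟧-cong f′≈f)) e)

    from : ∀ {x y} → x ≈ᴷ y → x K₀.≋ y
    from (t , e) = K₀.mod (t , Q.trans (Q.*-congˡ {t} (toℚ.⟦⟧-cong (Z.sym f′≈f))) (Q.coeffwise e))

  open ReplaceEquality K₀.quotientRing _≈ᴷ_ to from public renaming (replacedRing to K)
  module K = Ring K
    using (*-assoc; *-comm; *-cong; *-congʳ; *-congˡ; *-identityʳ; *-identityˡ; +-cong; +-congʳ; +-congˡ; -_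
          ; -‿cong; 0#; 1#; _*_; _+_; _^_; _∎; _≈_; begin_; eval; refl; step-≈-⟩; step-≡-⟨; step-≡-⟩; sym; trans
          ; zeroʳ; ι)
  open Rearrangement K using (horner-step; extract-factor)
  open SemiringSum (CommutativeRing.semiring K) using (sum; sum-cong-≋)

  fromQ : Hom Q.polynomialRing K
  fromQ = replaceHom ∘ᴴ quotientHom Q.polynomialRing toℚ.⟦ f ⟧

  fromZ : Hom Z.polynomialRing K
  fromZ = fromQ ∘ᴴ toℚ.mapHom

  open Hom fromZ using () renaming (⟦_⟧ to φ; *-homo to φ-*; +-homo to φ-+; 1-homo to φ-1; 0-homo to φ-0; ^-homo to φ-^; ⟦⟧-cong to φ-congZ)

  φ-cong : ∀ {x y} → x R.≈ y → φ x K.≈ φ y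
  φ-cong {x} {y} (Quotient.mod (t , e)) = to {φ x} {φ y} (K₀.mod (toℚ.⟦ t ⟧ , Q.trans (Q.sym (toℚ.*-homo t f))
    (Q.trans (toℚ.⟦⟧-cong e) (Q.trans (toℚ.+-homo x (Z.- y)) (Q.+-congˡ {toℚ.⟦ x ⟧} (toℚ.neg-homo y))))))

  -- Division by the monic f stays within ℤ[x]. Over ℚ the remainder of x - y is a multiple of f of
  -- degree below n, hence zero, and ℤ[x] embeds in ℚ[x].
  φ-injective : ∀ x y → φ x K.≈ φ y → x R.≈ y
  φ-injective x y e = Quotient.mod (w , Z.sym (Z.trans division-e (Z.trans (Z.+-congˡ {f Z.* w} r≈0) (Z.trans (Z.+-identityʳ (f Z.* w)) (Z.*-comm f w)))))
    where
    x-y = x Z.+ Z.- y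
    division = Z.divide f-monic x-y
    w = proj₁ division
    r = proj₁ (proj₂ division)
    division-e : x-y Z.≈ f Z.* w Z.+ r
    division-e = proj₁ (proj₂ (proj₂ division))
    d₀ = K₀._≋_.difference (from {φ x} {φ y} e)
    t = _∣ʳ_.quotient d₀
    r≈0 : r Z.≈ []
    r≈0 = toℚ-injective r [] (Q.remainder-unique (toℚ.map-Top f-monic) (t Q.+ Q.- toℚ.⟦ w ⟧) toℚ.⟦ r ⟧ (Q.begin
      toℚ.⟦ f ⟧ Q.* (t Q.+ Q.- toℚ.⟦ w ⟧)
        Q.≈⟨ Q.solve 3 (λ f t w → f Q.:* (t Q.:- w) Q.:= t Q.:* f Q.:- f Q.:* w) Q.refl toℚ.⟦ f ⟧ t toℚ.⟦ w ⟧ ⟩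
      t Q.* toℚ.⟦ f ⟧ Q.+ Q.- (toℚ.⟦ f ⟧ Q.* toℚ.⟦ w ⟧)
        Q.≈⟨ Q.+-cong (Q.trans (_∣ʳ_.equality d₀) toℚ-x-y) (Q.-‿cong (Q.sym (toℚ.*-homo f w))) ⟩
      toℚ.⟦ x-y ⟧ Q.+ Q.- toℚ.⟦ f Z.* w ⟧
        Q.≈⟨ Q.+-congʳ { Q.- toℚ.⟦ f Z.* w ⟧} (Q.trans (toℚ.⟦⟧-cong division-e) (toℚ.+-homo (f Z.* w) r)) ⟩
      toℚ.⟦ f Z.* w ⟧ Q.+ toℚ.⟦ r ⟧ Q.+ Q.- toℚ.⟦ f Z.* w ⟧
        Q.≈⟨ Q.solve 2 (λ u r → u Q.:+ r Q.:- u Q.:= r) Q.refl toℚ.⟦ f Z.* w ⟧ toℚ.⟦ r ⟧ ⟩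
      toℚ.⟦ r ⟧ Q.∎) (toℚ.map-Top (proj₂ (proj₂ (proj₂ division)))))
      where
      toℚ-x-y : toℚ.⟦ x ⟧ Q.+ Q.- toℚ.⟦ y ⟧ Q.≈ toℚ.⟦ x-y ⟧
      toℚ-x-y = Q.sym (Q.trans (toℚ.+-homo x (Z.- y)) (Q.+-congˡ {toℚ.⟦ x ⟧} (toℚ.neg-homo y)))

  open Integrality (ℚ[X]/ toℚ[X] f′) using (Integral; combination; IsℤBasis)
  open RawSemiringDefs (RawRing.rawSemiring (ℚ[X]/ toℚ[X] f′)) using () renaming (_^_ to _^ᴷ_)

  φ-C : ∀ a → φ (Z.C a) K.≈ K.ι a
  φ-C a = ≡.subst (λ z → φ (Z.C z) K.≈ K.ι a) (ℤ'-ι a) (Hom.ι-homo (fromZ ∘ᴴ constantHom ℤ.+-*-commutativeRing) a)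

  -- Lists may carry trailing zeros, whereas `homogeneous` reads the degree off the length. The
  -- coefficients below degree k are therefore cut or padded to length exactly k.
  lower : ℕ → List ℤ → List ℤ
  lower zero    g       = []
  lower (suc k) []      = 0ℤ ∷ lower k []
  lower (suc k) (a ∷ g) = a ∷ lower k g

  private
    length-lower : ∀ k g → length (map Z.C (lower k g)) ≡ k
    length-lower zero    g       = ≡.refl
    length-lower (suc k) []      = cong suc (length-lower k [])
    length-lower (suc k) (a ∷ g) = cong suc (length-lower k g)

  -- Horner's scheme for Nᵏ g(α) with γ = N α; a root α of g thus becomes a zero of the homogenised
  -- form.
  homogeneous-eval : ∀ N γ α → φ γ K.≈ φ N K.* α → ∀ k g → Z.Top k g 1ℤ →
                     φ (homogeneous N γ (map Z.C (lower k g))) K.≈ φ N K.^ k K.* K.eval g α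
  homogeneous-eval N γ α e zero    g       (t , z) = K.begin
    φ Z.1#                                    K.≈⟨ φ-1 ⟩
    K.1#                                      K.≈⟨ K.sym {K.eval g α} {K.1#} (K.trans {K.eval g α} {K.eval Z.1# α} {K.1#}
                                                     (Integral.eval-cong K α g Z.1# (Z.coeffwise λ { zero → t ; (suc i) → z (suc i) (s≤s z≤n) })) (Hom.1-homo (evalHom K α))) ⟩
    K.eval g α                                K.≈⟨ K.sym {K.1# K.* K.eval g α} {K.eval g α} (K.*-identityˡ (K.eval g α)) ⟩
    K.1# K.* K.eval g α                       K.∎
  homogeneous-eval N γ α e (suc k) []      (() , z)
  homogeneous-eval N γ α e (suc k) (a ∷ g) (t , z) = K.begin
    φ (Z.C a Z.* N R.^ suc l Z.+ γ Z.* H)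
      K.≈⟨ φ-+ (Z.C a Z.* N R.^ suc l) (γ Z.* H) ⟩
    φ (Z.C a Z.* N R.^ suc l) K.+ φ (γ Z.* H)
      K.≈⟨ K.+-cong {φ (Z.C a Z.* N R.^ suc l)} {K.ι a K.* φ N K.^ suc k} {φ (γ Z.* H)} {φ N K.* α K.* (φ N K.^ k K.* K.eval g α)} first second ⟩
    K.ι a K.* φ N K.^ suc k K.+ φ N K.* α K.* (φ N K.^ k K.* K.eval g α)
      K.≈⟨ horner-step (K.ι a) (φ N) (φ N K.^ k) α (K.eval g α) ⟩
    φ N K.^ suc k K.* K.eval (a ∷ g) α K.∎
    where
    cs = map Z.C (lower k g)
    l = length cs
    H = homogeneous N γ cs
    first : φ (Z.C a Z.* N R.^ suc l) K.≈ K.ι a K.* φ N K.^ suc k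
    first = K.begin
      φ (Z.C a Z.* N R.^ suc l)               K.≈⟨ φ-* (Z.C a) (N R.^ suc l) ⟩
      φ (Z.C a) K.* φ (N R.^ suc l)           K.≡⟨ cong (λ z → φ (Z.C a) K.* φ z) (≡.trans (^-agree N (suc l)) (cong (λ i → N Z.^ suc i) (length-lower k g))) ⟩
      φ (Z.C a) K.* φ (N Z.^ suc k)           K.≈⟨ K.*-cong {φ (Z.C a)} {K.ι a} {φ (N Z.^ suc k)} {φ N K.^ suc k} (φ-C a) (φ-^ N (suc k)) ⟩
      K.ι a K.* φ N K.^ suc k                 K.∎
    second : φ (γ Z.* H) K.≈ φ N K.* α K.* (φ N K.^ k K.* K.eval g α)
    second = K.begin
      φ (γ Z.* H)                             K.≈⟨ φ-* γ H ⟩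
      φ γ K.* φ H                             K.≈⟨ K.*-cong {φ γ} {φ N K.* α} {φ H} {φ N K.^ k K.* K.eval g α} e (homogeneous-eval N γ α e k g (t , λ i k<i → z (suc i) (s≤s k<i))) ⟩
      φ N K.* α K.* (φ N K.^ k K.* K.eval g α) K.∎

  toList : ∀ {k} → (Fin k → ℤ) → List ℤ
  toList {zero}  a = []
  toList {suc k} a = a zero ∷ toList (λ i → a (suc i))

  toList-Top : ∀ {k} (a : Fin k → ℤ) → Z.Top k (toList a) 0ℤ
  toList-Top {zero}  a = Z.Top-[]
  toList-Top {suc k} a = Z.Top-∷ (a zero) (toList-Top (λ i → a (suc i)))

  coeff-toList : ∀ {k} (a : Fin k → ℤ) i → Z.coeff (toList a) (toℕ i) ≡ a i
  coeff-toList a zero    = ≡.refl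
  coeff-toList a (suc i) = coeff-toList (λ i → a (suc i)) i

  toList-coeff : ∀ k r → Z.Top k r 0ℤ → toList {k} (λ i → Z.coeff r (toℕ i)) Z.≈ r
  toList-coeff zero    r       (t , z) = Z.coeffwise λ { zero → ≡.sym t ; (suc i) → ≡.sym (z (suc i) (s≤s z≤n)) }
  toList-coeff (suc k) []      _       = Z.trans (Z.∷-cong ≡.refl (toList-coeff k [] Z.Top-[])) Z.0∷-≈[]
  toList-coeff (suc k) (a ∷ r) (t , z) = Z.∷-cong ≡.refl (toList-coeff k r (t , λ i k<i → z (suc i) (s≤s k<i)))

  combination-φ : ∀ {k} (a : Fin k → ℤ) → combination a (λ i → ℚ[X].X ^ᴷ toℕ i) K.≈ φ (toList a)
  combination-φ {zero}  a = K.sym {φ []} {K.0#} φ-0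
  combination-φ {suc k} a = K.begin
    K.ι (a zero) K.* K.1# K.+ sum (λ i → K.ι (a (suc i)) K.* (θ K.* θ K.^ toℕ i))
      K.≈⟨ K.+-cong {K.ι (a zero) K.* K.1#} {K.ι (a zero)} {sum (λ i → K.ι (a (suc i)) K.* (θ K.* θ K.^ toℕ i))} {θ K.* φ rest}
             (K.*-identityʳ (K.ι (a zero))) (K.trans {sum (λ i → K.ι (a (suc i)) K.* (θ K.* θ K.^ toℕ i))} {θ K.* combination (λ i → a (suc i)) (λ i → θ ^ᴷ toℕ i)} {θ K.* φ rest}
               (pull k (λ i → K.ι (a (suc i))) (λ i → θ K.^ toℕ i))
               (K.*-congˡ {θ} {combination (λ i → a (suc i)) (λ i → θ ^ᴷ toℕ i)} {φ rest} (combination-φ (λ i → a (suc i))))) ⟩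
    K.ι (a zero) K.+ θ K.* φ rest
      K.≈⟨ K.+-cong {K.ι (a zero)} {φ (Z.C (a zero))} {θ K.* φ rest} {φ (Z.X Z.* rest)}
             (K.sym {φ (Z.C (a zero))} {K.ι (a zero)} (φ-C (a zero))) (K.sym {φ (Z.X Z.* rest)} {θ K.* φ rest} (φ-* Z.X rest)) ⟩
    φ (Z.C (a zero)) K.+ φ (Z.X Z.* rest)
      K.≈⟨ K.sym {φ (Z.C (a zero) Z.+ Z.X Z.* rest)} {φ (Z.C (a zero)) K.+ φ (Z.X Z.* rest)} (φ-+ (Z.C (a zero)) (Z.X Z.* rest)) ⟩
    φ (Z.C (a zero) Z.+ Z.X Z.* rest)
      K.≈⟨ φ-congZ (Z.sym (Z.∷-as-sum (a zero) rest)) ⟩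
    φ (a zero ∷ rest) K.∎
    where
    θ = ℚ[X].X
    rest = toList (λ i → a (suc i))
    pull : ∀ k (b v : Fin k → List ℚ) → sum (λ i → b i K.* (θ K.* v i)) K.≈ θ K.* sum (λ i → b i K.* v i)
    pull zero    b v = K.sym {θ K.* K.0#} {K.0#} (K.zeroʳ θ)
    pull (suc k) b v = K.begin
      b zero K.* (θ K.* v zero) K.+ sum (λ i → b (suc i) K.* (θ K.* v (suc i)))
        K.≈⟨ K.+-congˡ {b zero K.* (θ K.* v zero)} {sum (λ i → b (suc i) K.* (θ K.* v (suc i)))} {θ K.* sum (λ i → b (suc i) K.* v (suc i))}
               (pull k (λ i → b (suc i)) (λ i → v (suc i))) ⟩
      b zero K.* (θ K.* v zero) K.+ θ K.* sum (λ i → b (suc i) K.* v (suc i))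
        K.≈⟨ extract-factor (b zero) θ (v zero) (sum (λ i → b (suc i) K.* v (suc i))) ⟩
      θ K.* (b zero K.* v zero K.+ sum (λ i → b (suc i) K.* v (suc i))) K.∎

  φ-combination : ∀ P → ∃[ a ] φ P K.≈ combination {n} a (λ i → ℚ[X].X ^ᴷ toℕ i)
  φ-combination P = (λ i → Z.coeff r (toℕ i)) , (K.begin
    φ P                                    K.≈⟨ φ-cong {P} {r} (Quotient.mod (w , P-r)) ⟩
    φ r                                    K.≈⟨ φ-congZ (Z.sym (toList-coeff n r (proj₂ (proj₂ (proj₂ division))))) ⟩
    φ (toList {n} (λ i → Z.coeff r (toℕ i)))
      K.≈⟨ K.sym {combination {n} (λ i → Z.coeff r (toℕ i)) (λ i → ℚ[X].X ^ᴷ toℕ i)} {φ (toList {n} (λ i → Z.coeff r (toℕ i)))} (combination-φ {n} (λ i → Z.coeff r (toℕ i))) ⟩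
    combination {n} (λ i → Z.coeff r (toℕ i)) (λ i → ℚ[X].X ^ᴷ toℕ i) K.∎)
    where
    division = Z.divide f-monic P
    w = proj₁ division
    r = proj₁ (proj₂ division)
    P-r : w Z.* f Z.≈ P Z.+ Z.- r
    P-r = Z.trans (Z.solve 3 (λ w f r → w Z.:* f Z.:= (f Z.:* w Z.:+ r) Z.:- r) Z.refl w f r) (Z.+-congʳ {Z.- r} (Z.sym (proj₁ (proj₂ (proj₂ division)))))

  -- Multiplication by P preserves the lattice spanned by the powers of θ. A monic polynomial in P
  -- annihilates that lattice, and 0 < n ensures that 1 is among its generators.
  φ-integral : 0 ℕ.< n → ∀ P → Integral (φ P)
  φ-integral 0<n P = proj₁ result , proj₁ (proj₂ result) , monic (proj₁ (proj₂ (proj₂ result))) , kills n 0<n (proj₁ (proj₂ result)) (proj₂ (proj₂ (proj₂ result)))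
    where
    v : ∀ {k} → Fin k → List ℚ
    v j = ℚ[X].X ^ᴷ toℕ j
    result = Integral.finite⇒annihilated K (φ P) (v {n}) (λ j → proj₁ (φ-combination (P Z.* Z.X Z.^ toℕ j))) (λ j → K.begin
      φ P K.* ℚ[X].X K.^ toℕ j             K.≈⟨ K.*-congˡ {φ P} {ℚ[X].X K.^ toℕ j} {φ (Z.X Z.^ toℕ j)} (K.sym {φ (Z.X Z.^ toℕ j)} {ℚ[X].X K.^ toℕ j} (φ-^ Z.X (toℕ j))) ⟩
      φ P K.* φ (Z.X Z.^ toℕ j)            K.≈⟨ K.sym {φ (P Z.* Z.X Z.^ toℕ j)} {φ P K.* φ (Z.X Z.^ toℕ j)} (φ-* P (Z.X Z.^ toℕ j)) ⟩
      φ (P Z.* Z.X Z.^ toℕ j)              K.≈⟨ proj₂ (φ-combination (P Z.* Z.X Z.^ toℕ j)) ⟩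
      combination {n} (proj₁ (φ-combination (P Z.* Z.X Z.^ toℕ j))) (v {n}) K.∎)
    monic : ∀ {k G} → Z.Monic k G → ℤ[X].MonicOfDegree k G
    monic (t , z) = t , z
    kills : ∀ k → 0 ℕ.< k → ∀ G → (∀ (j : Fin k) → K.eval G (φ P) K.* v j K.≈ K.0#) → K.eval G (φ P) K.≈ K.0#
    kills (suc k) _ G h = K.trans {K.eval G (φ P)} {K.eval G (φ P) K.* K.1#} {K.0#}
      (K.sym {K.eval G (φ P) K.* K.1#} {K.eval G (φ P)} (K.*-identityʳ (K.eval G (φ P)))) (h zero)

  independent : ∀ a → combination {n} a (λ i → ℚ[X].X ^ᴷ toℕ i) K.≈ K.0# → ∀ i → a i ≡ 0ℤ
  independent a e i = ≡.trans (≡.sym (coeff-toList a i)) (Z.at toList≈0 (toℕ i))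
    where
    f∣ : f Z.∣ toList a
    f∣ = Quotient.≋0⇒∣ Z.polynomialRing f (φ-injective (toList a) [] (K.trans {φ (toList a)} {combination {n} a (λ i → ℚ[X].X ^ᴷ toℕ i)} {φ []}
           (K.sym {combination {n} a (λ i → ℚ[X].X ^ᴷ toℕ i)} {φ (toList a)} (combination-φ a)) (K.trans {combination {n} a (λ i → ℚ[X].X ^ᴷ toℕ i)} {K.0#} {φ []} e (K.sym {φ []} {K.0#} φ-0))))
    toList≈0 : toList a Z.≈ []
    toList≈0 = Z.remainder-unique f-monic (_∣ʳ_.quotient f∣) (toList a) (Z.trans (Z.*-comm f (_∣ʳ_.quotient f∣)) (_∣ʳ_.equality f∣)) (toList-Top a)

  module _ (maximal-everywhere : ∀ q → Prime q → Maximal q) where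

    -- Clearing denominators writes α = γ / N with γ in ℤ[θ]. By injectivity of φ the monic equation
    -- of α becomes a vanishing form in ℤ[θ], and maximality at the primes of N gives N ∣ γ there.
    integral⇒φ : ∀ α → Integral α → ∃[ P ] α K.≈ φ P
    integral⇒φ α (k , g , (t , z) , root) = β , (K.begin
      α                                    K.≈⟨ K.sym {Q.C p' K.* (φ CN K.* α)} {α} (unit-cancel α) ⟩
      Q.C p' K.* (φ CN K.* α)              K.≈⟨ K.*-congˡ {Q.C p'} {φ CN K.* α} {φ CN K.* φ β} (K.begin
        φ CN K.* α                             K.≈⟨ K.sym {φ γ} {φ CN K.* α} φγ ⟩
        φ γ                                    K.≈⟨ φ-cong (R.sym (_∣ʳ_.equality N∣γ)) ⟩
        φ (β R.* CN)                           K.≈⟨ φ-* β CN ⟩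
        φ β K.* φ CN                           K.≈⟨ K.*-comm (φ β) (φ CN) ⟩
        φ CN K.* φ β                           K.∎) ⟩
      Q.C p' K.* (φ CN K.* φ β)            K.≈⟨ unit-cancel (φ β) ⟩
      φ β                                  K.∎)
      where
      cleared = clear-denominators α
      N = proj₁ cleared
      γ = proj₁ (proj₂ cleared)
      N≢0 : N ≡.≢ 0
      N≢0 = proj₁ (proj₂ (proj₂ cleared))
      CN : List ℤ
      CN = Z.C (+ N)
      φγ : φ γ K.≈ φ CN K.* α
      φγ = Hom.⟦⟧-cong fromQ (Q.sym (proj₂ (proj₂ (proj₂ cleared))))
      inverse = unit-ℚ (+ N ℚ./ 1) (λ e → N≢0 (ℤ.+-injective (/1-injective e)))
      p' = proj₁ inverse
      unit-cancel : ∀ x → Q.C p' K.* (φ CN K.* x) K.≈ x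
      unit-cancel x = Hom.⟦⟧-cong fromQ {Q.C p' Q.* (toℚ.⟦ CN ⟧ Q.* x)} {x} (Q.begin
        Q.C p' Q.* (toℚ.⟦ CN ⟧ Q.* x)          Q.≈⟨ Q.solve 3 (λ p c x → p Q.:* (c Q.:* x) Q.:= (c Q.:* p) Q.:* x) Q.refl (Q.C p') toℚ.⟦ CN ⟧ x ⟩
        toℚ.⟦ CN ⟧ Q.* Q.C p' Q.* x            Q.≈⟨ Q.*-congʳ {x} (proj₂ inverse) ⟩
        Q.1# Q.* x                             Q.≈⟨ Q.*-identityˡ x ⟩
        x                                      Q.∎)
      cs = map Z.C (lower k g)
      relation : homogeneous CN γ cs R.≈ R.0#
      relation = φ-injective (homogeneous CN γ cs) [] (K.begin
        φ (homogeneous CN γ cs)                K.≈⟨ homogeneous-eval CN γ α φγ k g (t , z) ⟩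
        φ CN K.^ k K.* K.eval g α              K.≈⟨ K.*-congˡ {φ CN K.^ k} {K.eval g α} {K.0#} root ⟩
        φ CN K.^ k K.* K.0#                    K.≈⟨ K.zeroʳ (φ CN K.^ k) ⟩
        K.0#                                   K.≈⟨ K.sym {φ []} {K.0#} φ-0 ⟩
        φ []                                   K.∎)
      N∣γ : CN R.∣ γ
      N∣γ = divides-integral maximal-everywhere N N≢0 γ cs relation
      β = _∣ʳ_.quotient N∣γ

    isℤBasis : 0 ℕ.< n → IsℤBasis Integral {n} (λ i → ℚ[X].X ^ᴷ toℕ i)
    isℤBasis 0<n = record
      { members = λ i → power-integral (toℕ i)
      ; spanning = λ α α-integral → let P , α≈φP = integral⇒φ α α-integral ; a , e = φ-combination P in
          a , K.trans {α} {φ P} {combination {n} a (λ i → ℚ[X].X ^ᴷ toℕ i)} α≈φP e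
      ; independent = independent
      }
      where
      power-integral : ∀ j → Integral (ℚ[X].X ^ᴷ j)
      power-integral j = let k , g , monic , root = φ-integral 0<n (Z.X Z.^ j) in
        k , g , monic , K.trans {K.eval g (ℚ[X].X ^ᴷ j)} {K.eval g (φ (Z.X Z.^ j))} {K.0#}
          (eval-congʳ g {ℚ[X].X ^ᴷ j} {φ (Z.X Z.^ j)} (K.sym {φ (Z.X Z.^ j)} {ℚ[X].X ^ᴷ j} (φ-^ Z.X j))) root
        where
        eval-congʳ : ∀ g {x y} → x K.≈ y → K.eval g x K.≈ K.eval g y
        eval-congʳ []      e = K.refl {K.0#}
        eval-congʳ (a ∷ g) {x} {y} e = K.+-congˡ {K.ι a} {x K.* K.eval g x} {y K.* K.eval g y}
          (K.*-cong {x} {y} {K.eval g x} {K.eval g y} e (eval-congʳ g {x} {y} e))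

-- Irreducibility by Eisenstein's criterion.

module TrailingCoefficient {c ℓ : Level} (A : CommutativeRing c ℓ) where
  open PolyTheory A
    using (*-assoc; X; X*-∷; _*_; _^_; at; coeff; trans)
  private module A = Ring A
            using (0#; _≈_; refl; trans)

  coeff-X^*-below : ∀ k f i → i ℕ.< k → coeff (X ^ k * f) i A.≈ A.0#
  coeff-X^*-below (suc k) f i i<k = A.trans (at (trans (*-assoc X (X ^ k) f) (X*-∷ (X ^ k * f))) i) (go i i<k)
    where
    go : ∀ i → i ℕ.< suc k → coeff (A.0# ∷ X ^ k * f) i A.≈ A.0#
    go zero    _         = A.refl
    go (suc i) (s≤s i<k) = coeff-X^*-below k f i i<k

degree : ∀ P → P Z.≈ [] ⊎ (∃[ k ] ∃[ a ] Z.Top k P a × a ≡.≢ 0ℤ)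
degree [] = inj₁ Z.refl
degree (a ∷ P) with degree P | a ℤ.≟ 0ℤ
... | inj₂ (k , p , top , p≢0) | _       = inj₂ (suc k , p , Z.Top-∷ a top , p≢0)
... | inj₁ P≈0                 | yes a≡0 = inj₁ (Z.trans (Z.∷-cong a≡0 P≈0) Z.0∷-≈[])
... | inj₁ P≈0                 | no  a≢0 = inj₂ (0 , a , Z.Top-cong (Z.∷-cong ≡.refl (Z.sym P≈0)) ≡.refl (Z.Top-C a) , a≢0)

Top-unique : ∀ {k l P a b} → Z.Top k P a → Z.Top l P b → a ≡.≢ 0ℤ → b ≡.≢ 0ℤ → k ≡ l
Top-unique {k} {l} (t , z) (t' , z') a≢0 b≢0 with ℕ.<-cmp k l
... | tri< k<l _ _ = contradiction (≡.trans (≡.sym t') (z l k<l)) b≢0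
... | tri≈ _ k≡l _ = k≡l
... | tri> _ _ l<k = contradiction (≡.trans (≡.sym t) (z' k l<k)) a≢0

module Eisenstein {n : ℕ} {f : List ℤ} (f-monic : Z.Monic n f) (0<n : 0 ℕ.< n) {q : ℕ} (q-prime : Prime q)
                  (f≈Xⁿ : CommutativeRing._≈_ (Modular.polynomialRing q) f (Ring._^_ (Modular.polynomialRing q) (Modular.X q) n))
                  (q²∤f₀ : ¬ (+ q ℤ.* + q ℤ.∣ Z.coeff f 0)) where
  private
    module 𝔽 = Modular q
      using (*-assoc; *-comm; *-cong; *-congʳ; *-congˡ; *-identityˡ; C; Monic-X^; Top; Top-*; Top-C; Top-cong; X
            ; X*-∷; ^-homo-*; _*_; _:*_; _:=_; _^_; _∎; _≈_; above; at; begin_; coeff; coeff-X^*; coeff₀-*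
            ; leading; refl; solve; step-≈-⟩; step-≡-⟨; step-≡-⟩; sym; trans; ℤ/q; ∣⇒≈0; ∷-cong; ≈0⇒∣)
    module ℤ/q = Ring 𝔽.ℤ/q
      using (*-identityˡ; _∎; _≈_; begin_; reflexive; step-≈-⟩; step-≡-⟨; step-≡-⟩; sym; trans)
    open Reduction q using (reduce; *-agree; coeff-agree)
    open TrailingCoefficient 𝔽.ℤ/q using (coeff-X^*-below)

  -- The x-adic order of P modulo q. In the first alternative it is infinite and, as in Gauss's
  -- lemma, a factor q can be split off.
  order : ∀ P → (∃[ T ] P Z.≈ Z.C (+ q) Z.* T) ⊎ (∃[ i ] ∃[ P₁ ] P 𝔽.≈ 𝔽.X 𝔽.^ i 𝔽.* P₁ × ¬ (+ q ℤ.∣ 𝔽.coeff P₁ 0))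
  order [] = inj₁ ([] , Z.sym (Z.zeroʳ (Z.C (+ q))))
  order (a ∷ P) = go (+ q ℤ.∣? a) (order P)
    where
    go : Dec (+ q ℤ.∣ a) → (∃[ T ] P Z.≈ Z.C (+ q) Z.* T) ⊎ (∃[ i ] ∃[ P₁ ] P 𝔽.≈ 𝔽.X 𝔽.^ i 𝔽.* P₁ × ¬ (+ q ℤ.∣ 𝔽.coeff P₁ 0)) →
         (∃[ T ] (a ∷ P) Z.≈ Z.C (+ q) Z.* T) ⊎ (∃[ i ] ∃[ P₁ ] (a ∷ P) 𝔽.≈ 𝔽.X 𝔽.^ i 𝔽.* P₁ × ¬ (+ q ℤ.∣ 𝔽.coeff P₁ 0))
    go (no q∤a) _ = inj₂ (0 , a ∷ P , 𝔽.sym (𝔽.*-identityˡ (a ∷ P)) , q∤a)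
    go (yes (ℤ.divides t a≡tq)) (inj₁ (T , e)) = inj₁ (t ∷ T , (Z.begin
      a ∷ P                                            Z.≈⟨ Z.∷-as-sum a P ⟩
      Z.C a Z.+ Z.X Z.* P                              Z.≈⟨ Z.+-cong (Z.trans (Z.C-cong (≡.trans a≡tq (ℤ.*-comm t (+ q)))) (Z.C-* (+ q) t)) (Z.*-congˡ {Z.X} e) ⟩
      Z.C (+ q) Z.* Z.C t Z.+ Z.X Z.* (Z.C (+ q) Z.* T) Z.≈⟨ Z.solve 4 (λ q t x T → q Z.:* t Z.:+ x Z.:* (q Z.:* T) Z.:= q Z.:* (t Z.:+ x Z.:* T)) Z.refl (Z.C (+ q)) (Z.C t) Z.X T ⟩
      Z.C (+ q) Z.* (Z.C t Z.+ Z.X Z.* T)              Z.≈⟨ Z.*-congˡ {Z.C (+ q)} (Z.sym (Z.∷-as-sum t T)) ⟩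
      Z.C (+ q) Z.* (t ∷ T)                            Z.∎))
    go (yes q∣a) (inj₂ (i , P₁ , e , q∤)) = inj₂ (suc i , P₁ , (𝔽.begin
      a ∷ P                                            𝔽.≈⟨ 𝔽.∷-cong (𝔽.∣⇒≈0 q∣a) e ⟩
      0ℤ ∷ 𝔽.X 𝔽.^ i 𝔽.* P₁                            𝔽.≈⟨ 𝔽.sym (𝔽.X*-∷ (𝔽.X 𝔽.^ i 𝔽.* P₁)) ⟩
      𝔽.X 𝔽.* (𝔽.X 𝔽.^ i 𝔽.* P₁)                       𝔽.≈⟨ 𝔽.sym (𝔽.*-assoc 𝔽.X (𝔽.X 𝔽.^ i) P₁) ⟩
      𝔽.X 𝔽.^ suc i 𝔽.* P₁                             𝔽.∎) , q∤)

  private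
    mod-q : ∀ {x y} → x ℤ/q.≈ y → + q ℤ.∣ x → + q ℤ.∣ y
    mod-q {x} {y} e q∣x = 𝔽.≈0⇒∣ (ℤ/q.trans (ℤ/q.sym e) (𝔽.∣⇒≈0 q∣x))

    coeff₀-* : ∀ A B → Z.coeff (A Z.* B) 0 ≡ Z.coeff A 0 ℤ.* Z.coeff B 0
    coeff₀-* = Z.coeff₀-*

  Constant : List ℤ → Set
  Constant A = ∃[ a ] Z.Top 0 A a × a ≡.≢ 0ℤ

  module Primitive (N : ℤ) (N≢0 : N ≡.≢ 0ℤ) (A B : List ℤ) (e : Z.C N Z.* f Z.≈ A Z.* B)
                   (i j : ℕ) (A₁ B₁ : List ℤ) (A≈ : A 𝔽.≈ 𝔽.X 𝔽.^ i 𝔽.* A₁) (B≈ : B 𝔽.≈ 𝔽.X 𝔽.^ j 𝔽.* B₁)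
                   (q∤A₁ : ¬ (+ q ℤ.∣ 𝔽.coeff A₁ 0)) (q∤B₁ : ¬ (+ q ℤ.∣ 𝔽.coeff B₁ 0)) where
    private
      AB≈ : 𝔽.X 𝔽.^ (i ℕ.+ j) 𝔽.* (A₁ 𝔽.* B₁) 𝔽.≈ 𝔽.X 𝔽.^ n 𝔽.* 𝔽.C N
      AB≈ = 𝔽.begin
        𝔽.X 𝔽.^ (i ℕ.+ j) 𝔽.* (A₁ 𝔽.* B₁)                     𝔽.≈⟨ 𝔽.*-congʳ {A₁ 𝔽.* B₁} (𝔽.^-homo-* 𝔽.X i j) ⟩
        𝔽.X 𝔽.^ i 𝔽.* 𝔽.X 𝔽.^ j 𝔽.* (A₁ 𝔽.* B₁)               𝔽.≈⟨ 𝔽.solve 4 (λ x y a b → x 𝔽.:* y 𝔽.:* (a 𝔽.:* b) 𝔽.:= (x 𝔽.:* a) 𝔽.:* (y 𝔽.:* b)) 𝔽.refl (𝔽.X 𝔽.^ i) (𝔽.X 𝔽.^ j) A₁ B₁ ⟩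
        𝔽.X 𝔽.^ i 𝔽.* A₁ 𝔽.* (𝔽.X 𝔽.^ j 𝔽.* B₁)               𝔽.≈⟨ 𝔽.sym (𝔽.*-cong A≈ B≈) ⟩
        A 𝔽.* B                                               𝔽.≡⟨ *-agree A B ⟩
        A Z.* B                                               𝔽.≈⟨ reduce (Z.sym e) ⟩
        Z.C N Z.* f                                           𝔽.≡⟨ *-agree (Z.C N) f ⟨
        𝔽.C N 𝔽.* f                                           𝔽.≈⟨ 𝔽.trans (𝔽.*-congˡ {𝔽.C N} f≈Xⁿ) (𝔽.*-comm (𝔽.C N) (𝔽.X 𝔽.^ n)) ⟩
        𝔽.X 𝔽.^ n 𝔽.* 𝔽.C N                                   𝔽.∎

      q∤lowest : ¬ (+ q ℤ.∣ 𝔽.coeff (𝔽.X 𝔽.^ n 𝔽.* 𝔽.C N) (i ℕ.+ j))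
      q∤lowest d = [ q∤A₁ , q∤B₁ ]′ (prime∣* q-prime (𝔽.coeff A₁ 0) (𝔽.coeff B₁ 0) (mod-q (𝔽.coeff₀-* A₁ B₁)
        (mod-q (ℤ/q.trans (ℤ/q.sym (𝔽.at AB≈ (i ℕ.+ j))) (≡.subst (λ k → 𝔽.coeff (𝔽.X 𝔽.^ (i ℕ.+ j) 𝔽.* (A₁ 𝔽.* B₁)) k ℤ/q.≈ 𝔽.coeff (A₁ 𝔽.* B₁) 0)
          (ℕ.+-identityʳ (i ℕ.+ j)) (𝔽.coeff-X^* (i ℕ.+ j) (A₁ 𝔽.* B₁) 0))) d)))

      NXⁿ-top : 𝔽.Top n (𝔽.X 𝔽.^ n 𝔽.* 𝔽.C N) N
      NXⁿ-top = 𝔽.Top-cong 𝔽.refl (ℤ/q.*-identityˡ N)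
        (≡.subst (λ k → 𝔽.Top k (𝔽.X 𝔽.^ n 𝔽.* 𝔽.C N) (1ℤ ℤ.* N)) (ℕ.+-identityʳ n) (𝔽.Top-* (𝔽.X 𝔽.^ n) (𝔽.C N) (𝔽.Monic-X^ n) (𝔽.Top-C N)))

      -- The coefficient of A B in degree i + j is A₁(0) B₁(0), nonzero modulo q, while N xⁿ has no
      -- coefficient outside degree n.
      i+j≡n : i ℕ.+ j ≡ n
      i+j≡n = ℕ.≤-antisym
        (ℕ.≮⇒≥ (λ gt → q∤lowest (𝔽.≈0⇒∣ (𝔽.above NXⁿ-top (i ℕ.+ j) gt))))
        (ℕ.≮⇒≥ (λ lt → q∤lowest (𝔽.≈0⇒∣ (coeff-X^*-below n (𝔽.C N) (i ℕ.+ j) lt))))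

      q∤N : ¬ (+ q ℤ.∣ N)
      q∤N q∣N = q∤lowest (≡.subst (λ k → + q ℤ.∣ 𝔽.coeff (𝔽.X 𝔽.^ n 𝔽.* 𝔽.C N) k) (≡.sym i+j≡n) (mod-q (ℤ/q.sym (𝔽.leading NXⁿ-top)) q∣N))

      Nf-top : Z.Top n (A Z.* B) N
      Nf-top = Z.Top-cong e (ℤ.*-identityʳ N) (Z.Top-* (Z.C N) f (Z.Top-C N) f-monic)

      order≤degree : ∀ {P k p i P₁} → Z.Top k P p → P 𝔽.≈ 𝔽.X 𝔽.^ i 𝔽.* P₁ → ¬ (+ q ℤ.∣ 𝔽.coeff P₁ 0) → i ℕ.≤ k
      order≤degree {P} {k} {p} {i} {P₁} (_ , z) e q∤ = ℕ.≮⇒≥ λ k<i → q∤ (𝔽.≈0⇒∣ (ℤ/q.begin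
        𝔽.coeff P₁ 0                            ℤ/q.≈⟨ ℤ/q.sym (𝔽.coeff-X^* i P₁ 0) ⟩
        𝔽.coeff (𝔽.X 𝔽.^ i 𝔽.* P₁) (i ℕ.+ 0)    ℤ/q.≈⟨ ℤ/q.sym (𝔽.at e (i ℕ.+ 0)) ⟩
        𝔽.coeff P (i ℕ.+ 0)                     ℤ/q.≡⟨ coeff-agree P (i ℕ.+ 0) ⟩
        Z.coeff P (i ℕ.+ 0)                     ℤ/q.≡⟨ z (i ℕ.+ 0) (ℕ.<-≤-trans k<i (ℕ.m≤m+n i 0)) ⟩
        0ℤ                                      ℤ/q.∎))

      q∣constant-term : ∀ {P i P₁} → 0 ℕ.< i → P 𝔽.≈ 𝔽.X 𝔽.^ i 𝔽.* P₁ → + q ℤ.∣ Z.coeff P 0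
      q∣constant-term {P} {i} {P₁} 0<i e = 𝔽.≈0⇒∣ (ℤ/q.trans (ℤ/q.reflexive (≡.sym (coeff-agree P 0)))
        (ℤ/q.trans (𝔽.at e 0) (coeff-X^*-below i P₁ 0 0<i)))

      -- Both constant terms would be divisible by q, hence q² ∣ N f₀; since q ∤ N this contradicts
      -- q² ∤ f₀.
      not-both-positive : 0 ℕ.< i → 0 ℕ.< j → ⊥
      not-both-positive 0<i 0<j = q∤f₀-quotient q∣f₀
        where
        q∣A₀ = q∣constant-term 0<i A≈
        q∣B₀ = q∣constant-term 0<j B≈
        s = ℤ._∣_.quotient q∣A₀
        t = ℤ._∣_.quotient q∣B₀
        f₀ = Z.coeff f 0
        Nf₀ : N ℤ.* f₀ ≡ s ℤ.* t ℤ.* + q ℤ.* + q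
        Nf₀ = ≡.trans (≡.sym (coeff₀-* (Z.C N) f)) (≡.trans (Z.at e 0) (≡.trans (coeff₀-* A B) (≡.trans (≡.cong₂ ℤ._*_ (ℤ._∣_.equality q∣A₀) (ℤ._∣_.equality q∣B₀))
          (ℤ'.solve 3 (λ s t q → (s ℤ'.:* q) ℤ'.:* (t ℤ'.:* q) ℤ'.:= s ℤ'.:* t ℤ'.:* q ℤ'.:* q) ≡.refl s t (+ q)))))
        q∣f₀ : + q ℤ.∣ f₀
        q∣f₀ = [ (λ d → contradiction d q∤N) , (λ d → d) ]′ (prime∣* q-prime N f₀ (ℤ.divides (s ℤ.* t ℤ.* + q) Nf₀))
        q∤f₀-quotient : ¬ (+ q ℤ.∣ f₀)
        q∤f₀-quotient (ℤ.divides u f₀≡) = q²∤f₀ (≡.subst (+ q ℤ.* + q ℤ.∣_) (≡.sym f₀≡) (ℤ.*-monoˡ-∣ (+ q) q∣u))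
          where
          Nu : N ℤ.* u ≡ s ℤ.* t ℤ.* + q
          Nu = ℤ.*-cancelʳ-≡ _ _ (+ q) {{ℤ.≢-nonZero (λ z → ℕ.≢-nonZero⁻¹ q {{prime⇒nonZero q-prime}} (ℤ.+-injective z))}}
                 (≡.trans (ℤ.*-assoc N u (+ q)) (≡.trans (cong (N ℤ.*_) (≡.sym f₀≡)) Nf₀))
          q∣u : + q ℤ.∣ u
          q∣u = [ (λ d → contradiction d q∤N) , (λ d → d) ]′ (prime∣* q-prime N u (ℤ.divides (s ℤ.* t) Nu))

      A≉0 : ∀ {A B} → A Z.* B Z.≈ Z.C N Z.* f → ¬ (A Z.≈ [])
      A≉0 {A} {B} e A≈0 = N≢0 (≡.trans (≡.sym (ℤ.*-identityʳ N)) (≡.trans (≡.sym (Z.leading (Z.Top-* (Z.C N) f (Z.Top-C N) f-monic)))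
        (Z.at (Z.trans (Z.sym e) (Z.trans (Z.*-congʳ {B} A≈0) (Z.zeroˡ B))) n)))

      squeeze : ∀ {x y i j} → x ℕ.+ y ≡ i ℕ.+ j → i ℕ.≤ x → j ℕ.≤ y → x ≡ i × y ≡ j
      squeeze {x} {y} {i} {j} s i≤x j≤y = x≡i , ℕ.+-cancelˡ-≡ x y j (≡.trans s (cong (ℕ._+ j) (≡.sym x≡i)))
        where
        x≡i : x ≡ i
        x≡i = ℕ.≤-antisym (ℕ.+-cancelʳ-≤ y x i (ℕ.≤-trans (ℕ.≤-reflexive s) (ℕ.+-monoʳ-≤ i j≤y))) i≤x

    -- From i ≤ deg A, j ≤ deg B and deg A + deg B = n = i + j the degrees are i and j, which cannot
    -- both be positive.
    conclusion : Constant A ⊎ Constant B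
    conclusion =
      [ (λ A≈0 → contradiction A≈0 (A≉0 (Z.sym e)))
      , (λ { (x , a , A-top , a≢0) →
      [ (λ B≈0 → contradiction B≈0 (A≉0 (Z.trans (Z.*-comm B A) (Z.sym e))))
      , (λ { (y , b , B-top , b≢0) → compare x y a b A-top B-top a≢0 b≢0 })
      ]′ (degree B) })
      ]′ (degree A)
      where
      compare : ∀ x y a b → Z.Top x A a → Z.Top y B b → a ≡.≢ 0ℤ → b ≡.≢ 0ℤ → Constant A ⊎ Constant B
      compare x y a b A-top B-top a≢0 b≢0 = cases x y A-top B-top (proj₁ both) (proj₂ both)
        where
        ab≢0 : a ℤ.* b ≡.≢ 0ℤ
        ab≢0 ab≡0 = [ a≢0 , b≢0 ]′ (ℤ.i*j≡0⇒i≡0∨j≡0 a ab≡0)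
        x+y≡n : x ℕ.+ y ≡ n
        x+y≡n = Top-unique (Z.Top-* A B A-top B-top) Nf-top ab≢0 N≢0
        both = squeeze (≡.trans x+y≡n (≡.sym i+j≡n)) (order≤degree A-top A≈ q∤A₁) (order≤degree B-top B≈ q∤B₁)
        cases : ∀ x y → Z.Top x A a → Z.Top y B b → x ≡ i → y ≡ j → Constant A ⊎ Constant B
        cases zero    y       t t' _      _      = inj₁ (a , t , a≢0)
        cases (suc x) zero    t t' _      _      = inj₂ (b , t' , b≢0)
        cases (suc x) (suc y) t t' x≡i y≡j = ⊥-elim (not-both-positive (≡.subst (0 ℕ.<_) x≡i (s≤s z≤n)) (≡.subst (0 ℕ.<_) y≡j (s≤s z≤n)))

  private
    q≢0 : + q ≡.≢ 0ℤ
    q≢0 e = ℕ.≢-nonZero⁻¹ q {{prime⇒nonZero q-prime}} (ℤ.+-injective e)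

    remove-q : ∀ N A' B → Z.C N Z.* f Z.≈ Z.C (+ q) Z.* A' Z.* B → ∃[ N' ] N ≡ N' ℤ.* + q × Z.C N' Z.* f Z.≈ A' Z.* B
    remove-q N A' B e = N' , N≡ , cancel
      where
      -- f is monic, so N is the coefficient of N f = q A' B in degree n, and its quotient by q is
      -- read off A' B.
      N' = Z.coeff (A' Z.* B) n
      e' : Z.C N Z.* f Z.≈ Z.C (+ q) Z.* (A' Z.* B)
      e' = Z.trans e (Z.*-assoc (Z.C (+ q)) A' B)
      N≡ : N ≡ N' ℤ.* + q
      N≡ = ≡.trans (≡.sym (ℤ.*-identityʳ N)) (≡.trans (≡.sym (Z.leading (Z.Top-* (Z.C N) f (Z.Top-C N) f-monic)))
        (≡.trans (Z.at e' n) (≡.trans (Z.coeff-C* (+ q) (A' Z.* B) n) (ℤ.*-comm (+ q) N'))))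
      cancel : Z.C N' Z.* f Z.≈ A' Z.* B
      cancel = Z.coeffwise λ i → ℤ.*-cancelˡ-≡ (+ q) _ _ {{ℤ.≢-nonZero q≢0}} (≡.trans (≡.sym (Z.coeff-C* (+ q) (Z.C N' Z.* f) i))
        (≡.trans (Z.at (Z.trans (Z.sym (Z.*-assoc (Z.C (+ q)) (Z.C N') f)) (Z.trans (Z.*-congʳ {f} (Z.trans (Z.sym (Z.C-* (+ q) N')) (Z.C-cong (≡.trans (ℤ.*-comm (+ q) N') (≡.sym N≡))))) e')) i)
          (Z.coeff-C* (+ q) (A' Z.* B) i)))

    Constant-C* : ∀ {A A'} → A Z.≈ Z.C (+ q) Z.* A' → Constant A' → Constant A
    Constant-C* {A} {A'} e (a , t , a≢0) = + q ℤ.* a , Z.Top-cong (Z.sym e) ≡.refl (Z.Top-* (Z.C (+ q)) A' (Z.Top-C (+ q)) t) ,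
      λ qa≡0 → [ q≢0 , a≢0 ]′ (ℤ.i*j≡0⇒i≡0∨j≡0 (+ q) qa≡0)

    smaller : ∀ {N N' k} → N ≡ N' ℤ.* + q → N ≡.≢ 0ℤ → ∣ N ∣ ℕ.≤ suc k → ∣ N' ∣ ℕ.≤ k × N' ≡.≢ 0ℤ
    smaller {N} {N'} {k} N≡ N≢0 N≤ = ℕ.≤-pred (ℕ.<-≤-trans N'<N N≤) , N'≢0
      where
      N'≢0 : N' ≡.≢ 0ℤ
      N'≢0 e = N≢0 (≡.trans N≡ (≡.trans (cong (ℤ._* + q) e) (ℤ.*-zeroˡ (+ q))))
      instance
        nz : ℕ.NonZero ∣ N' ∣
        nz = ℕ.≢-nonZero (λ e → N'≢0 (ℤ.∣i∣≡0⇒i≡0 e))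
      N'<N : ∣ N' ∣ ℕ.< ∣ N ∣
      N'<N = ≡.subst (∣ N' ∣ ℕ.<_) (≡.sym (≡.trans (cong ∣_∣ N≡) (ℤ.abs-* N' (+ q)))) (ℕ.m<m*n ∣ N' ∣ q (prime>1 q-prime))

  -- Gauss and Eisenstein together: factors divisible by q are divided out,
  -- and primitive ones are compared with x ^ n modulo q.
  factors-constant : ∀ k N A B → ∣ N ∣ ℕ.≤ k → N ≡.≢ 0ℤ → Z.C N Z.* f Z.≈ A Z.* B → Constant A ⊎ Constant B
  factors-constant zero    N A B N≤0 N≢0 e = contradiction (ℤ.∣i∣≡0⇒i≡0 (ℕ.n≤0⇒n≡0 N≤0)) N≢0
  factors-constant (suc k) N A B N≤k N≢0 e = go (order A) (order B)
    where
    go : (∃[ T ] A Z.≈ Z.C (+ q) Z.* T) ⊎ (∃[ i ] ∃[ P₁ ] A 𝔽.≈ 𝔽.X 𝔽.^ i 𝔽.* P₁ × ¬ (+ q ℤ.∣ 𝔽.coeff P₁ 0)) →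
         (∃[ T ] B Z.≈ Z.C (+ q) Z.* T) ⊎ (∃[ i ] ∃[ P₁ ] B 𝔽.≈ 𝔽.X 𝔽.^ i 𝔽.* P₁ × ¬ (+ q ℤ.∣ 𝔽.coeff P₁ 0)) → Constant A ⊎ Constant B
    go (inj₁ (A' , A≈)) _ =
      let N' , N≡ , e' = remove-q N A' B (Z.trans e (Z.*-congʳ {B} A≈))
          N'≤k , N'≢0 = smaller N≡ N≢0 N≤k
      in [ (λ c → inj₁ (Constant-C* A≈ c)) , inj₂ ]′ (factors-constant k N' A' B N'≤k N'≢0 e')
    go (inj₂ _) (inj₁ (B' , B≈)) =
      let N' , N≡ , e' = remove-q N B' A (Z.trans e (Z.trans (Z.*-comm A B) (Z.*-congʳ {A} B≈)))
          N'≤k , N'≢0 = smaller N≡ N≢0 N≤k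
      in [ inj₁ , (λ c → inj₂ (Constant-C* B≈ c)) ]′ (factors-constant k N' A B' N'≤k N'≢0 (Z.trans e' (Z.*-comm B' A)))
    go (inj₂ (i , A₁ , A≈ , q∤A₁)) (inj₂ (j , B₁ , B≈ , q∤B₁)) = Primitive.conclusion N N≢0 A B e i j A₁ B₁ A≈ B≈ q∤A₁ q∤B₁

  constant⇒unit : ∀ N x A → Q.C (+ N ℚ./ 1) Q.* x Q.≈ toℚ.⟦ A ⟧ → Constant A → x ℚ[X].∣ ℚ[X].1#
  constant⇒unit N x A e (a , t , a≢0) = Q.C p Q.* CN , Q.at (Q.begin
    Q.C p Q.* CN Q.* x              Q.≈⟨ Q.*-assoc (Q.C p) CN x ⟩
    Q.C p Q.* (CN Q.* x)            Q.≈⟨ Q.*-congˡ {Q.C p} (Q.trans e (toℚ.⟦⟧-cong A≈a)) ⟩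
    Q.C p Q.* Q.C (a ℚ./ 1)         Q.≈⟨ Q.*-comm (Q.C p) (Q.C (a ℚ./ 1)) ⟩
    Q.C (a ℚ./ 1) Q.* Q.C p         Q.≈⟨ proj₂ inverse ⟩
    Q.1#                            Q.∎)
    where
    CN = Q.C (+ N ℚ./ 1)
    inverse = unit-ℚ (a ℚ./ 1) (λ e → a≢0 (/1-injective e))
    p = proj₁ inverse
    A≈a : A Z.≈ Z.C a
    A≈a = Z.coeffwise λ { zero → Z.leading t ; (suc i) → Z.above t (suc i) (s≤s z≤n) }

  irreducible : ∀ f′ → f′ Z.≈ f → ℚ[X].Irreducible (toℚ[X] f′)
  irreducible f′ f′≈f = record { p∤1 = not-unit ; split-∣1 = λ {x} {y} e → splits x y (Q.trans (toℚ.⟦⟧-cong (Z.sym f′≈f)) (Q.coeffwise e)) }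
    where
    not-unit : ¬ (toℚ[X] f′ ℚ[X].∣ ℚ[X].1#)
    not-unit (w , e) = contradiction (Q.at (Q.remainder-unique (toℚ.map-Top f-monic) w Q.1#
      (Q.trans (Q.*-comm toℚ.⟦ f ⟧ w) (Q.trans (Q.*-congˡ {w} (toℚ.⟦⟧-cong (Z.sym f′≈f))) (Q.coeffwise e)))
      (Q.Top-raise 0<n (Q.Top-C ℚ.1ℚ))) 0) λ ()

    splits : ∀ x y → toℚ.⟦ f ⟧ Q.≈ x Q.* y → x ℚ[X].∣ ℚ[X].1# ⊎ y ℚ[X].∣ ℚ[X].1#
    splits x y e = [ (λ c → inj₁ (constant⇒unit N₁ x A (proj₂ (proj₂ (proj₂ cx))) c)) , (λ c → inj₂ (constant⇒unit N₂ y B (proj₂ (proj₂ (proj₂ cy))) c)) ]′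
      (factors-constant ∣ + N₁ ℤ.* + N₂ ∣ (+ N₁ ℤ.* + N₂) A B ℕ.≤-refl N≢0 (toℚ-injective (Z.C (+ N₁ ℤ.* + N₂) Z.* f) (A Z.* B) (Q.begin
        toℚ.⟦ Z.C (+ N₁ ℤ.* + N₂) Z.* f ⟧        Q.≈⟨ toℚ.⟦⟧-cong (Z.*-congʳ {f} (Z.C-* (+ N₁) (+ N₂))) ⟩
        toℚ.⟦ Z.C (+ N₁) Z.* Z.C (+ N₂) Z.* f ⟧  Q.≈⟨ Q.trans (toℚ.*-homo (Z.C (+ N₁) Z.* Z.C (+ N₂)) f) (Q.*-cong (toℚ.*-homo (Z.C (+ N₁)) (Z.C (+ N₂))) e) ⟩
        C₁ Q.* C₂ Q.* (x Q.* y)                  Q.≈⟨ Q.solve 4 (λ a b x y → a Q.:* b Q.:* (x Q.:* y) Q.:= (a Q.:* x) Q.:* (b Q.:* y)) Q.refl C₁ C₂ x y ⟩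
        C₁ Q.* x Q.* (C₂ Q.* y)                  Q.≈⟨ Q.*-cong (proj₂ (proj₂ (proj₂ cx))) (proj₂ (proj₂ (proj₂ cy))) ⟩
        toℚ.⟦ A ⟧ Q.* toℚ.⟦ B ⟧                  Q.≈⟨ Q.sym (toℚ.*-homo A B) ⟩
        toℚ.⟦ A Z.* B ⟧                          Q.∎)))
      where
      cx = clear-denominators x
      cy = clear-denominators y
      N₁ = proj₁ cx
      N₂ = proj₁ cy
      A = proj₁ (proj₂ cx)
      B = proj₁ (proj₂ cy)
      C₁ = Q.C (+ N₁ ℚ./ 1)
      C₂ = Q.C (+ N₂ ℚ./ 1)
      N≢0 : + N₁ ℤ.* + N₂ ≡.≢ 0ℤ
      N≢0 e = [ (λ z → proj₁ (proj₂ (proj₂ cx)) (ℤ.+-injective z)) , (λ z → proj₁ (proj₂ (proj₂ cy)) (ℤ.+-injective z)) ]′ (ℤ.i*j≡0⇒i≡0∨j≡0 (+ N₁) e)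

-- Failure of maximality at a bad prime.

module QuadraticIntegral {c ℓ : Level} (K : CommutativeRing c ℓ) where
  open Ring K
    using (*-congˡ; +-assoc; +-cong; +-congˡ; +-identityˡ; 0#; Carrier; _*_; _+_; _:*_; _:=_; _≈_; eval; refl
          ; reflexive; semiring; solve; sym; trans; zeroˡ; ι)
  open Integral K using (δ; δ-sum; finite⇒annihilated)
  open SemiringSum semiring using (sum; sum-cong-≋; *-distribˡ-sum)

  sum-splitAt : ∀ m {n} (f : Fin (m ℕ.+ n) → Carrier) → sum f ≈ sum (λ i → f (i Fin.↑ˡ n)) + sum (λ j → f (m Fin.↑ʳ j))
  sum-splitAt zero    f = sym (+-identityˡ _)
  sum-splitAt (suc m) f = trans (+-congˡ (sum-splitAt m (λ i → f (suc i)))) (sym (+-assoc _ _ _))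

  module _ (γ : Carrier) {n : ℕ} (v : Fin n → Carrier) (b c : Fin n → Fin n → ℤ)
           (γ²v : ∀ j → γ * (γ * v j) ≈ sum (λ i → ι (b j i) * v i) + γ * sum (λ i → ι (c j i) * v i)) where
    private
      both : Fin n ⊎ Fin n → Carrier
      both = [ v , (λ j → γ * v j) ]′

      row : Fin n ⊎ Fin n → Fin n ⊎ Fin n → ℤ
      row (inj₁ j) = [ (λ _ → 0ℤ) , δ γ j ]′
      row (inj₂ j) = [ b j , c j ]′

      pull : ∀ {m} (a : Fin m → ℤ) (u : Fin m → Carrier) → sum (λ i → ι (a i) * (γ * u i)) ≈ γ * sum (λ i → ι (a i) * u i)
      pull a u = trans (sum-cong-≋ (λ i → solve 3 (λ a γ u → a :* (γ :* u) := γ :* (a :* u)) refl (ι (a i)) γ (u i)))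
        (sym (*-distribˡ-sum γ (λ i → ι (a i) * u i)))

      zero-sum : ∀ {m} (u : Fin m → Carrier) → sum (λ i → ι 0ℤ * u i) ≈ 0#
      zero-sum {zero}  u = refl
      zero-sum {suc m} u = trans (+-cong (zeroˡ _) (zero-sum (λ i → u (suc i)))) (+-identityˡ 0#)

      rows : ∀ x → γ * both x ≈ sum (λ i → ι (row x (inj₁ i)) * v i) + sum (λ i → ι (row x (inj₂ i)) * (γ * v i))
      rows (inj₁ j) = sym (trans (+-cong (zero-sum v) (trans (pull (δ γ j) v) (*-congˡ (δ-sum γ j v)))) (+-identityˡ _))
      rows (inj₂ j) = trans (γ²v j) (+-congˡ (sym (pull (c j) v)))

      A : Fin (n ℕ.+ n) → Fin (n ℕ.+ n) → ℤ
      A i k = row (Fin.splitAt n i) (Fin.splitAt n k)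

      u : Fin (n ℕ.+ n) → Carrier
      u k = both (Fin.splitAt n k)

      relation : ∀ i → γ * u i ≈ sum (λ k → ι (A i k) * u k)
      relation i = trans (rows x) (sym (trans (sum-splitAt n (λ k → ι (A i k) * u k)) (+-cong
        (sum-cong-≋ (λ j → reflexive (cong (λ y → ι (row x y) * both y) (Fin.splitAt-↑ˡ n j n))))
        (sum-cong-≋ (λ j → reflexive (cong (λ y → ι (row x y) * both y) (Fin.splitAt-↑ʳ n n j)))))))
        where x = Fin.splitAt n i

    -- The lattice generated by the v j together with the γ v j is stable under γ: the first kind is
    -- sent to the second, and the quadratic relation handles the second. The determinant trick then
    -- applies to these 2 n generators.
    quadratic⇒annihilated : ∃[ e ] ∃[ G ] Z.Monic e G × (∀ j → eval G γ * v j ≈ 0#)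
    quadratic⇒annihilated = e , G , monic , λ j → ≡.subst (λ y → eval G γ * both y ≈ 0#) (Fin.splitAt-↑ˡ n j n) (kills (j Fin.↑ˡ n))
      where
      annihilated = finite⇒annihilated γ u A relation
      e = proj₁ annihilated
      G = proj₁ (proj₂ annihilated)
      monic = proj₁ (proj₂ (proj₂ annihilated))
      kills = proj₂ (proj₂ (proj₂ annihilated))

module QuadraticInNumberField {n : ℕ} {f : List ℤ} (f-monic : Z.Monic n f) (f′ : List ℤ) (f′≈f : f′ Z.≈ f) (0<n : 0 ℕ.< n) where
  open NumberField f-monic f′ f′≈f using (module K; K; fromZ; φ-combination)
  open Hom fromZ using () renaming (⟦_⟧ to φ; *-homo to φ-*; ^-homo to φ-^)
  open Integrality (ℚ[X]/ toℚ[X] f′) using (Integral; combination)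

  quadratic⇒integral : ∀ γ S T → γ K.* γ K.≈ φ S K.+ φ T K.* γ → Integral γ
  quadratic⇒integral γ S T γ² = proj₁ result , proj₁ (proj₂ result) , monic (proj₁ (proj₂ (proj₂ result))) ,
    kills n 0<n (proj₁ (proj₂ result)) (proj₂ (proj₂ (proj₂ result)))
    where
    v : ∀ {k} → Fin k → List ℚ
    v j = ℚ[X].X K.^ toℕ j
    times : ∀ P j → φ P K.* ℚ[X].X K.^ j K.≈ combination {n} (proj₁ (φ-combination (P Z.* Z.X Z.^ j))) v
    times P j = K.begin
      φ P K.* ℚ[X].X K.^ j                 K.≈⟨ K.*-congˡ {φ P} {ℚ[X].X K.^ j} {φ (Z.X Z.^ j)} (K.sym {φ (Z.X Z.^ j)} {ℚ[X].X K.^ j} (φ-^ Z.X j)) ⟩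
      φ P K.* φ (Z.X Z.^ j)                K.≈⟨ K.sym {φ (P Z.* Z.X Z.^ j)} {φ P K.* φ (Z.X Z.^ j)} (φ-* P (Z.X Z.^ j)) ⟩
      φ (P Z.* Z.X Z.^ j)                  K.≈⟨ proj₂ (φ-combination (P Z.* Z.X Z.^ j)) ⟩
      combination {n} (proj₁ (φ-combination (P Z.* Z.X Z.^ j))) v K.∎
    coefficients : List ℤ → Fin n → Fin n → ℤ
    coefficients P j = proj₁ (φ-combination (P Z.* Z.X Z.^ toℕ j))
    result = QuadraticIntegral.quadratic⇒annihilated K γ (v {n}) (coefficients S) (coefficients T)
      (λ j → Rearrangement.quadratic-power K {γ} {φ S} {φ T} {v j} {combination {n} (coefficients S j) v} {combination {n} (coefficients T j) v}
        γ² (times S (toℕ j)) (times T (toℕ j)))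
    monic : ∀ {k G} → Z.Monic k G → ℤ[X].MonicOfDegree k G
    monic (t , z) = t , z
    kills : ∀ k → 0 ℕ.< k → ∀ G → (∀ (j : Fin k) → K.eval G γ K.* v j K.≈ K.0#) → K.eval G γ K.≈ K.0#
    kills (suc k) _ G h = K.trans {K.eval G γ} {K.eval G γ K.* K.1#} {K.0#}
      (K.sym {K.eval G γ K.* K.1#} {K.eval G γ} (K.*-identityʳ (K.eval G γ))) (h zero)

module NonMaximal (b M : ℤ) (n-1 : ℕ) {q : ℕ} (q-prime : Prime q) (μ : ℤ) (M≡μq² : M ≡ μ ℤ.* + q ℤ.* + q)
                  (n' : ℕ) (n≡qn' : suc n-1 ≡ q ℕ.^ 1 ℕ.* n') where
  open LocalCases b M n-1 using (F; F-monic; ℤ[θ]; ≈⇒≋; ∣⇒≋0)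
  open PrimeDividingM b M n-1 q-prime μ M≡μq² 1 n' n≡qn' using (g; g-monic; s; h; defect; E; expansion)

  module _ (c₁ : ℤ) (defect≡c₁q² : defect ≡ c₁ ℤ.* + q ℤ.* + q) (f′ : List ℤ) (f′≈F : f′ Z.≈ F) where
    open NumberField F-monic f′ f′≈F using (K; module K; fromZ; fromQ; φ-cong; φ-injective; toList; combination-φ)
    open Hom fromZ using () renaming (⟦_⟧ to φ; *-homo to φ-*; +-homo to φ-+; neg-homo to φ-neg)
    open Integrality (ℚ[X]/ toℚ[X] f′) using (Integral)
    private
      module R = Ring ℤ[θ]
        using (*-congʳ; *-congˡ; +-congʳ; +-identityˡ; -_; 0#; :-_; _*_; _+_; _:*_; _:+_; _:-_; _:=_; _∎; _≈_
              ; begin_; refl; solve; step-≈-⟩; trans)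
      n = suc n-1
      r = q ℕ.^ 1
      Cq W g' : List ℤ
      Cq = Z.C (+ q)
      W = Z.C c₁ Z.+ E
      g' = g Z.^ ℕ.pred (ℕ.pred r)

      1<r : 1 ℕ.< r
      1<r = ≡.subst (1 ℕ.<_) (≡.sym (ℕ.*-identityʳ q)) (prime>1 q-prime)

      gh : g R.* h R.≈ R.- (Cq R.* Cq R.* W)
      gh = R.begin
        g R.* h                                        R.≈⟨ R.solve 2 (λ x y → x R.:= (x R.:+ y) R.:- y) R.refl (g R.* h) (Cq R.* Cq R.* W) ⟩
        (g R.* h R.+ Cq R.* Cq R.* W) R.+ R.- (Cq R.* Cq R.* W) R.≈⟨ R.+-congʳ {R.- (Cq R.* Cq R.* W)} (R.trans (≈⇒≋ (Z.sym F≈)) (∣⇒≋0 (Z.1# , Z.*-identityˡ F))) ⟩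
        R.0# R.+ R.- (Cq R.* Cq R.* W)                 R.≈⟨ R.+-identityˡ (R.- (Cq R.* Cq R.* W)) ⟩
        R.- (Cq R.* Cq R.* W)                          R.∎
        where
        F≈ : F Z.≈ g Z.* h Z.+ Cq Z.* Cq Z.* W
        F≈ = Z.trans expansion (Z.+-congˡ {g Z.* h} (Z.trans
          (Z.+-congʳ {Cq Z.* (Cq Z.* E)} (Z.trans (Z.C-cong defect≡c₁q²) (Z.trans (Z.C-* (c₁ ℤ.* + q) (+ q)) (Z.*-congʳ {Cq} (Z.C-* c₁ (+ q))))))
          (Z.solve 3 (λ c q E → c Z.:* q Z.:* q Z.:+ q Z.:* (q Z.:* E) Z.:= q Z.:* q Z.:* (c Z.:+ E)) Z.refl (Z.C c₁) Cq E)))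

      -- As q ≥ 2, h = g g' + q s with g' = g^(q-2). Multiplying by h and using g h = - q² W gives a
      -- quadratic equation whose coefficients carry the powers of q required for h / q.
      h² : h R.* h R.≈ R.- (Cq R.* Cq R.* (W R.* g')) R.+ Cq R.* s R.* h
      h² = R.begin
        h R.* h                                        R.≈⟨ R.*-congˡ {h} (≈⇒≋ (Z.+-congʳ {Cq Z.* s} (g^ (ℕ.pred r) (ℕ.pred-mono-≤ 1<r)))) ⟩
        h R.* (g R.* g' R.+ Cq R.* s)                  R.≈⟨ R.solve 5 (λ h g g' q s → h R.:* (g R.:* g' R.:+ q R.:* s) R.:= (g R.:* h) R.:* g' R.:+ q R.:* s R.:* h) R.refl h g g' Cq s ⟩
        g R.* h R.* g' R.+ Cq R.* s R.* h              R.≈⟨ R.+-congʳ {Cq R.* s R.* h} (R.*-congʳ {g'} gh) ⟩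
        R.- (Cq R.* Cq R.* W) R.* g' R.+ Cq R.* s R.* h R.≈⟨ R.+-congʳ {Cq R.* s R.* h} (R.solve 3 (λ q W g' → R.:- (q R.:* q R.:* W) R.:* g' R.:= R.:- (q R.:* q R.:* (W R.:* g'))) R.refl Cq W g') ⟩
        R.- (Cq R.* Cq R.* (W R.* g')) R.+ Cq R.* s R.* h R.∎
        where
        g^ : ∀ k → 0 ℕ.< k → g Z.^ k Z.≈ g Z.* g Z.^ ℕ.pred k
        g^ (suc k) _ = Z.refl

      q≢0 : + q ℚ./ 1 ≡.≢ ℚ.0ℚ
      q≢0 e = ℕ.≢-nonZero⁻¹ q {{prime⇒nonZero q-prime}} (ℤ.+-injective (/1-injective e))

      inverse = unit-ℚ (+ q ℚ./ 1) q≢0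
      p : List ℚ
      p = Q.C (proj₁ inverse)

      qp≈1 : φ Cq K.* p K.≈ K.1#
      qp≈1 = Hom.⟦⟧-cong fromQ {toℚ.⟦ Cq ⟧ Q.* p} {Q.1#} (proj₂ inverse)

    γ : List ℚ
    γ = p K.* φ h

    γ-integral : Integral γ
    γ-integral = QuadraticInNumberField.quadratic⇒integral F-monic f′ f′≈F (s≤s z≤n) γ (Z.- (W Z.* g')) s
      (K.trans {γ K.* γ} {K.- φ (W Z.* g') K.+ φ s K.* γ} {φ (Z.- (W Z.* g')) K.+ φ s K.* γ}
        (Rearrangement.divided-square K {φ h} {φ Cq} {p} {φ (W Z.* g')} {φ s} φh² qp≈1)
        (K.+-congʳ {φ s K.* γ} {K.- φ (W Z.* g')} {φ (Z.- (W Z.* g'))} (K.sym {φ (Z.- (W Z.* g'))} {K.- φ (W Z.* g')} (φ-neg (W Z.* g')))))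
      where
      X₁ X₂ : List ℤ
      X₁ = Cq Z.* Cq Z.* (W Z.* g')
      X₂ = Cq Z.* s Z.* h
      φ₃ : ∀ x y z → φ (x Z.* y Z.* z) K.≈ φ x K.* φ y K.* φ z
      φ₃ x y z = K.trans {φ (x Z.* y Z.* z)} {φ (x Z.* y) K.* φ z} {φ x K.* φ y K.* φ z} (φ-* (x Z.* y) z)
        (K.*-congʳ {φ z} {φ (x Z.* y)} {φ x K.* φ y} (φ-* x y))
      φh² : φ h K.* φ h K.≈ K.- (φ Cq K.* φ Cq K.* φ (W Z.* g')) K.+ φ Cq K.* φ s K.* φ h
      φh² = K.begin
        φ h K.* φ h                    K.≈⟨ K.sym {φ (h Z.* h)} {φ h K.* φ h} (φ-* h h) ⟩
        φ (h Z.* h)                    K.≈⟨ φ-cong {h Z.* h} {Z.- X₁ Z.+ X₂} h² ⟩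
        φ (Z.- X₁ Z.+ X₂)              K.≈⟨ φ-+ (Z.- X₁) X₂ ⟩
        φ (Z.- X₁) K.+ φ X₂
          K.≈⟨ K.+-cong {φ (Z.- X₁)} {K.- (φ Cq K.* φ Cq K.* φ (W Z.* g'))} {φ X₂} {φ Cq K.* φ s K.* φ h}
                 (K.trans {φ (Z.- X₁)} {K.- φ X₁} {K.- (φ Cq K.* φ Cq K.* φ (W Z.* g'))} (φ-neg X₁)
                   (K.-‿cong {φ X₁} {φ Cq K.* φ Cq K.* φ (W Z.* g')} (φ₃ Cq Cq (W Z.* g')))) (φ₃ Cq s h) ⟩
        K.- (φ Cq K.* φ Cq K.* φ (W Z.* g')) K.+ φ Cq K.* φ s K.* φ h K.∎

    -- If h / q were in ℤ[θ], then f would divide h modulo q. But h reduces to g^(q-1), a monic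
    -- polynomial of degree (q - 1) n' < n.
    γ∉ℤ[θ] : ∀ P → ¬ (γ K.≈ φ P)
    γ∉ℤ[θ] P γ≈φP = 𝔽1≉0 (ℤ/q.trans (ℤ/q.sym (𝔽.leading top)) (𝔽.at g^≈0 (ℕ.pred r ℕ.* n')))
      where
      module 𝔽 = Modular q
        using (*-comm; *-congʳ; +-congˡ; +-identityʳ; -0#≈0#; -‿cong; 0#; C≈0; Monic; Monic-^; Top-raise; _*_
              ; _^_; _∎; _≈_; at; begin_; leading; remainder-unique; step-≈-⟩; sym; trans; zeroˡ; ℤ/q; ≈0⇒∣)
      module ℤ/q = Ring 𝔽.ℤ/q
        using (_≈_; sym; trans)
      open Reduction q using (reduce; reduce-Top)
      open Hom (reductionHom q)
        using (*-homo; +-homo; ^-homo; neg-homo)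
      𝔽1≉0 : ¬ (1ℤ ℤ/q.≈ 0ℤ)
      𝔽1≉0 e = prime∤1 q-prime (𝔽.≈0⇒∣ e)
      h≈qP : h R.≈ Cq Z.* P
      h≈qP = φ-injective h (Cq Z.* P) (K.begin
        φ h                      K.≈⟨ K.sym {K.1# K.* φ h} {φ h} (K.*-identityˡ (φ h)) ⟩
        K.1# K.* φ h             K.≈⟨ K.*-congʳ {φ h} {K.1#} {φ Cq K.* p} (K.sym {φ Cq K.* p} {K.1#} qp≈1) ⟩
        φ Cq K.* p K.* φ h       K.≈⟨ K.*-assoc (φ Cq) p (φ h) ⟩
        φ Cq K.* γ               K.≈⟨ K.*-congˡ {φ Cq} {γ} {φ P} γ≈φP ⟩
        φ Cq K.* φ P             K.≈⟨ K.sym {φ (Cq Z.* P)} {φ Cq K.* φ P} (φ-* Cq P) ⟩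
        φ (Cq Z.* P)             K.∎)
      difference = Quotient._≋_.difference h≈qP
      w = _∣ʳ_.quotient difference
      drop-q : ∀ T → Cq Z.* T 𝔽.≈ 𝔽.0#
      drop-q T = 𝔽.trans (*-homo Cq T) (𝔽.trans (𝔽.*-congʳ {T} (𝔽.C≈0 ℤ.∣-refl)) (𝔽.zeroˡ T))
      drop+ : ∀ x y → y 𝔽.≈ 𝔽.0# → x Z.+ y 𝔽.≈ x
      drop+ x y y≈0 = 𝔽.trans (+-homo x y) (𝔽.trans (𝔽.+-congˡ {x} y≈0) (𝔽.+-identityʳ x))
      h≈ : h 𝔽.≈ g 𝔽.^ ℕ.pred r
      h≈ = 𝔽.trans (drop+ (g Z.^ ℕ.pred r) (Cq Z.* s) (drop-q s)) (^-homo g (ℕ.pred r))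
      Fw : F 𝔽.* w 𝔽.≈ g 𝔽.^ ℕ.pred r
      Fw = 𝔽.begin
        F 𝔽.* w                        𝔽.≈⟨ 𝔽.*-comm F w ⟩
        w 𝔽.* F                        𝔽.≈⟨ 𝔽.sym (*-homo w F) ⟩
        w Z.* F                        𝔽.≈⟨ reduce (_∣ʳ_.equality difference) ⟩
        h Z.+ Z.- (Cq Z.* P)           𝔽.≈⟨ drop+ h (Z.- (Cq Z.* P)) (𝔽.trans (neg-homo (Cq Z.* P)) (𝔽.trans (𝔽.-‿cong (drop-q P)) 𝔽.-0#≈0#)) ⟩
        h                              𝔽.≈⟨ h≈ ⟩
        g 𝔽.^ ℕ.pred r                 𝔽.∎
      top : 𝔽.Monic (ℕ.pred r ℕ.* n') (g 𝔽.^ ℕ.pred r)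
      top = 𝔽.Monic-^ g (ℕ.pred r) (reduce-Top g-monic)
      smaller : ℕ.pred r ℕ.* n' ℕ.< n
      smaller = ≡.subst (ℕ.pred r ℕ.* n' ℕ.<_) (≡.sym n≡qn') (go r n' (ℕ.<-trans (s≤s z≤n) 1<r) (≡.subst (0 ℕ.<_) n≡qn' (s≤s z≤n)))
        where
        go : ∀ Q n' → 0 ℕ.< Q → 0 ℕ.< Q ℕ.* n' → ℕ.pred Q ℕ.* n' ℕ.< Q ℕ.* n'
        go (suc Q) zero     _ lt = contradiction (≡.subst (0 ℕ.<_) (ℕ.*-zeroʳ (suc Q)) lt) λ ()
        go (suc Q) (suc n') _ lt = ℕ.m<n+m (Q ℕ.* suc n') (s≤s z≤n)
      g^≈0 : g 𝔽.^ ℕ.pred r 𝔽.≈ []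
      g^≈0 = 𝔽.remainder-unique (reduce-Top F-monic) w (g 𝔽.^ ℕ.pred r) Fw (𝔽.Top-raise smaller top)

    not-monogenic : ¬ Monogenic f′
    not-monogenic monogenic = γ∉ℤ[θ] (toList (proj₁ spanned))
      (K.trans {γ} {combination (proj₁ spanned) (λ i → ℚ[X].X K.^ toℕ i)} {φ (toList (proj₁ spanned))} (proj₂ spanned) (combination-φ (proj₁ spanned)))
      where
      open Monogenic monogenic
      open Integrality (ℚ[X]/ toℚ[X] f′) using (combination; module IsℤBasis)
      spanned = IsℤBasis.spanning powerBasis γ γ-integral

-- The polynomial and the discriminant of the statement.

ℱ≈F : ∀ n-1 b m → ℱ (suc n-1) b m Z.≈ LocalCases.F (+ b) (m ℤ.^ 2) n-1
ℱ≈F n-1 b m = Z.+-cong (Z.reflexive (^-agree Z.X (suc n-1))) (Z.*-congˡ {Z.C (+ b)} (sum≈U (suc n-1)))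
  where
  open Sums Z.polynomialRing using (U)
  z = Z.C (m ℤ.^ 2) Z.* Z.X
  ^-agree : ∀ x k → x ℤ[X].^ k ≡ x Z.^ k
  ^-agree x zero    = ≡.refl
  ^-agree x (suc k) = cong (x Z.*_) (^-agree x k)
  sum≈U : ∀ k → ℤ[X].sum {k} (λ i → z ℤ[X].^ (k ℕ.∸ suc (toℕ i))) Z.≈ U k z Z.1#
  sum≈U zero    = Z.refl
  sum≈U (suc k) = Z.+-cong (Z.reflexive (^-agree z k)) (Z.trans (sum≈U k) (Z.sym (Z.*-identityˡ (U k z Z.1#))))

constant-term : ∀ b M n-1 → Z.coeff (LocalCases.F b M n-1) 0 ≡ b
constant-term b M n-1 = begin
  Z.coeff (Z.X Z.^ n Z.+ Z.C b Z.* U n z Z.1#) 0           ≡⟨ Z.coeff-+ (Z.X Z.^ n) (Z.C b Z.* U n z Z.1#) 0 ⟩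
  Z.coeff (Z.X Z.^ n) 0 ℤ.+ Z.coeff (Z.C b Z.* U n z Z.1#) 0
    ≡⟨ ≡.cong₂ ℤ._+_ (≡.trans (Z.coeff₀-* Z.X (Z.X Z.^ n-1)) (ℤ.*-zeroˡ (Z.coeff (Z.X Z.^ n-1) 0))) (Z.coeff₀-* (Z.C b) (U n z Z.1#)) ⟩
  0ℤ ℤ.+ b ℤ.* Z.coeff (U n z Z.1#) 0                      ≡⟨ ≡.trans (ℤ.+-identityˡ (b ℤ.* Z.coeff (U n z Z.1#) 0)) (cong (b ℤ.*_) U₀) ⟩
  b ℤ.* 1ℤ                                                 ≡⟨ ℤ.*-identityʳ b ⟩
  b                                                        ∎
  where
  open ≡.≡-Reasoning
  open Sums Z.polynomialRing using (U; U-head)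
  n = suc n-1
  z = Z.C M Z.* Z.X
  z₀ : Z.coeff z 0 ≡ 0ℤ
  z₀ = ≡.trans (Z.coeff-C* M Z.X 0) (ℤ.*-zeroʳ M)
  U₀ : Z.coeff (U n z Z.1#) 0 ≡ 1ℤ
  U₀ = ≡.trans (Z.at (U-head n-1 z) 0) (≡.trans (Z.coeff-+ Z.1# (z Z.* U n-1 z Z.1#) 0)
    (cong (λ t → 1ℤ ℤ.+ t) (≡.trans (Z.coeff₀-* z (U n-1 z Z.1#)) (≡.trans (cong (ℤ._* Z.coeff (U n-1 z Z.1#) 0) z₀) (ℤ.*-zeroˡ (Z.coeff (U n-1 z Z.1#) 0))))))

module _ (n-1 b : ℕ) (m : ℤ) where
  private
    module I = Family ℤ.+-*-commutativeRing (+ b) (m ℤ.^ 2) n-1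
      using (Discriminant; N; a; a-w; discriminant-formula; s; w; y)
    n = suc n-1
    y' = + b ℤ.* m ℤ.^ (2 ℕ.* n)

    y≡ : I.y ≡ y'
    y≡ = cong (+ b ℤ.*_) (≡.trans (ℤ'-^ (m ℤ.^ 2) n) (ℤ.^-*-assoc m 2 n))
    N≡ : I.N ≡ + n
    N≡ = ℤ'-ι (+ n)

    denominator≡ : 𝒟-denominator n b m ≡ (I.a ℤ.- I.w) ℤ.* (I.a ℤ.- I.w)
    denominator≡ = ≡.sym (≡.trans (≡.cong₂ ℤ._*_ root root) (cong (u ℤ.*_) (≡.sym (ℤ.*-identityʳ u))))
      where
      u = 1ℤ ℤ.+ y' ℤ.* + n
      root : I.a ℤ.- I.w ≡ u
      root = ≡.trans I.a-w (≡.cong₂ (λ y N → 1ℤ ℤ.+ y ℤ.* N) y≡ N≡)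

    numerator≡ : 𝒟-numerator n b m ≡ (I.a ℤ.- I.w) ℤ.* ((I.a ℤ.- I.w) ℤ.* I.Discriminant)
    numerator≡ = ≡.sym (begin
      (I.a ℤ.- I.w) ℤ.* ((I.a ℤ.- I.w) ℤ.* I.Discriminant)    ≡⟨ I.discriminant-formula ⟩
      I.s ℤ.* I.w ℤ'.^ n ℤ.+ I.y ℤ.* (I.a ℤ.* I.a ℤ'.^ n)      ≡⟨ ≡.cong₂ ℤ._+_ first second ⟩
      (+ n) ℤ.^ n ℤ.* (1ℤ ℤ.- y') ℤ.^ (n ℕ.+ 1) ℤ.+ y' ℤ.* (+ (n ℕ.+ 1)) ℤ.^ (n ℕ.+ 1) ∎)
      where
      open ≡.≡-Reasoning
      power-suc : ∀ x k → x ℤ.* x ℤ'.^ k ≡ x ℤ.^ (k ℕ.+ 1)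
      power-suc x k = ≡.trans (cong (x ℤ.*_) (ℤ'-^ x k)) (cong (x ℤ.^_) (ℕ.+-comm 1 k))
      s≡ : I.s ≡ 1ℤ ℤ.- y'
      s≡ = cong (λ y → 1ℤ ℤ.- y) y≡
      move : ∀ s p r → s ℤ.* (p ℤ.* r) ≡ p ℤ.* (s ℤ.* r)
      move s p r = ℤ'.solve 3 (λ s p r → s ℤ'.:* (p ℤ'.:* r) ℤ'.:= p ℤ'.:* (s ℤ'.:* r)) ≡.refl s p r
      first : I.s ℤ.* I.w ℤ'.^ n ≡ (+ n) ℤ.^ n ℤ.* (1ℤ ℤ.- y') ℤ.^ (n ℕ.+ 1)
      first = begin
        I.s ℤ.* I.w ℤ'.^ n                       ≡⟨ cong (I.s ℤ.*_) (ℤ'.^-distrib-* I.N I.s n) ⟩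
        I.s ℤ.* (I.N ℤ'.^ n ℤ.* I.s ℤ'.^ n)      ≡⟨ move I.s (I.N ℤ'.^ n) (I.s ℤ'.^ n) ⟩
        I.N ℤ'.^ n ℤ.* (I.s ℤ.* I.s ℤ'.^ n)      ≡⟨ ≡.cong₂ ℤ._*_ (≡.trans (ℤ'-^ I.N n) (cong (ℤ._^ n) N≡)) (≡.trans (power-suc I.s n) (cong (ℤ._^ (n ℕ.+ 1)) s≡)) ⟩
        (+ n) ℤ.^ n ℤ.* (1ℤ ℤ.- y') ℤ.^ (n ℕ.+ 1) ∎
      a≡ : I.a ≡ + (n ℕ.+ 1)
      a≡ = ≡.trans (cong (λ N → 1ℤ ℤ.+ N) N≡) (cong +_ (ℕ.+-comm 1 n))
      second : I.y ℤ.* (I.a ℤ.* I.a ℤ'.^ n) ≡ y' ℤ.* (+ (n ℕ.+ 1)) ℤ.^ (n ℕ.+ 1)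
      second = ≡.cong₂ ℤ._*_ y≡ (≡.trans (power-suc I.a n) (cong (ℤ._^ (n ℕ.+ 1)) a≡))

  -- Multiplied by (a - w)², which is the nonzero denominator, both sides give the numerator, the
  -- division in 𝒟 being exact.
  𝒟≡Discriminant : 𝒟 n b m ≡ I.Discriminant
  𝒟≡Discriminant = ℤ.*-cancelʳ-≡ (𝒟 n b m) I.Discriminant (𝒟-denominator n b m) {{𝒟-denominator-nonZero n b m}} (begin
    𝒟 n b m ℤ.* 𝒟-denominator n b m                               ≡⟨ 𝒟-exact n b m ⟩
    𝒟-numerator n b m                                             ≡⟨ numerator≡ ⟩
    (I.a ℤ.- I.w) ℤ.* ((I.a ℤ.- I.w) ℤ.* I.Discriminant)          ≡⟨ rearrange (I.a ℤ.- I.w) I.Discriminant ⟩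
    I.Discriminant ℤ.* ((I.a ℤ.- I.w) ℤ.* (I.a ℤ.- I.w))          ≡⟨ cong (I.Discriminant ℤ.*_) denominator≡ ⟨
    I.Discriminant ℤ.* 𝒟-denominator n b m                        ∎)
    where
    open ≡.≡-Reasoning
    rearrange : ∀ u D → u ℤ.* (u ℤ.* D) ≡ D ℤ.* (u ℤ.* u)
    rearrange u D = ℤ'.solve 2 (λ u D → u ℤ'.:* (u ℤ'.:* D) ℤ'.:= D ℤ'.:* (u ℤ'.:* u)) ≡.refl u D

maxExponent-divides : ∀ k p z → p ℕ.^ maxExponent k p z ℕ.∣ z
maxExponent-divides zero    p z = ℕ.1∣ z
maxExponent-divides (suc k) p z with p ℕ.^ suc k ℕ.∣? z
... | yes d = d
... | no  _ = maxExponent-divides k p z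

module _ {p : ℕ} (p-prime : Prime p) where
  prime∣ℕ^ : ∀ x k → p ℕ.∣ x ℕ.^ k → p ℕ.∣ x
  prime∣ℕ^ x zero    d = contradiction (ℕ.∣⇒≤ d) (ℕ.<⇒≱ (prime>1 p-prime))
  prime∣ℕ^ x (suc k) d = [ (λ p∣x → p∣x) , prime∣ℕ^ x k ]′ (euclidsLemma x (x ℕ.^ k) p-prime d)

  prime-power-cancel : ∀ {l} → ¬ p ℕ.∣ l → ∀ e k → p ℕ.^ e ℕ.∣ l ℕ.* k → p ℕ.^ e ℕ.∣ k
  prime-power-cancel {l} p∤l zero    k _ = ℕ.1∣ k
  prime-power-cancel {l} p∤l (suc e) k d with euclidsLemma l k p-prime (ℕ.∣-trans (ℕ.m∣m*n (p ℕ.^ e)) d)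
  ... | inj₁ p∣l = contradiction p∣l p∤l
  ... | inj₂ (divides k' ≡.refl) = ≡.subst (p ℕ.^ suc e ℕ.∣_) (ℕ.*-comm p k') (ℕ.*-monoʳ-∣ p
    (prime-power-cancel p∤l e k' (ℕ.*-cancelˡ-∣ p {{prime⇒nonZero p-prime}} (≡.subst (p ℕ.^ suc e ℕ.∣_) shuffle d))))
    where
    shuffle : l ℕ.* (k' ℕ.* p) ≡ p ℕ.* (l ℕ.* k')
    shuffle = ≡.trans (≡.sym (ℕ.*-assoc l k' p)) (ℕ.*-comm (l ℕ.* k') p)

  prime∣prime : ∀ {r} → Prime r → p ℕ.∣ r → p ≡ r
  prime∣prime r-prime p∣r = [ (λ p≡1 → contradiction (prime>1 p-prime) (ℕ.≤⇒≯ (ℕ.≤-reflexive p≡1))) , (λ p≡r → p≡r) ]′ (prime⇒irreducible r-prime p∣r)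

  prime∤powers : ∀ (e : ℕ → ℕ) ps → All Prime ps → All (λ r → ¬ p ≡ r) ps → ¬ p ℕ.∣ product (map (λ r → r ℕ.^ e r) ps)
  prime∤powers e []       _              _             d = ℕ.<⇒≱ (prime>1 p-prime) (ℕ.∣⇒≤ d)
  prime∤powers e (r ∷ ps) (r-prime ∷ pps) (p≢r ∷ p∉ps) d =
    [ (λ p∣rᵉ → p≢r (prime∣prime r-prime (prime∣ℕ^ r (e r) p∣rᵉ))) , prime∤powers e ps pps p∉ps ]′ (euclidsLemma (r ℕ.^ e r) _ p-prime d)

prime-powers-divide : ∀ (e : ℕ → ℕ) z ps → All Prime ps → Unique ps → (∀ p → p ℕ.^ e p ℕ.∣ z) → product (map (λ r → r ℕ.^ e r) ps) ℕ.∣ z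
prime-powers-divide e z []       _               _             _  = ℕ.1∣ z
prime-powers-divide e z (p ∷ ps) (p-prime ∷ pps) (p∉ps ∷ uniq) p^∣z
  with divides k z≡kP ← prime-powers-divide e z ps pps uniq p^∣z =
  ≡.subst (p ℕ.^ e p ℕ.* P ℕ.∣_) (≡.sym z≡kP) (ℕ.*-monoˡ-∣ P (prime-power-cancel p-prime {P} (prime∤powers p-prime e ps pps p∉ps) (e p) k
    (≡.subst (p ℕ.^ e p ℕ.∣_) (≡.trans z≡kP (ℕ.*-comm k P)) (p^∣z p))))
  where P = product (map (λ r → r ℕ.^ e r) ps)

-- The part removed from 𝒟 is a product of powers of primes dividing b m. None of them is q, so q²
-- survives in the quotient d.
square-divides-d : ∀ n b m {q} → Prime q → ¬ q ℕ.∣ ∣ + b ℤ.* m ∣ → + q ℤ.* + q ℤ.∣ 𝒟 n b m → q ℕ.* q ℕ.∣ d n b m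
square-divides-d n b m {q} q-prime q∤bm q²∣𝒟 = ≡.subst (ℕ._∣ d n b m) q^2 (prime-power-cancel q-prime {part z 𝒟'} q∤part 2 (d n b m)
  (≡.subst₂ ℕ._∣_ (≡.trans (ℤ.abs-* (+ q) (+ q)) (≡.sym q^2)) (≡.sym (ℕ.m*[n/m]≡n {part z 𝒟'} {∣ 𝒟' ∣} {{part-nonZero z 𝒟'}} part∣𝒟)) (ℤ.∣⇒∣ᵤ q²∣𝒟)))
  where
  z = + b ℤ.* m
  𝒟' = 𝒟 n b m
  q^2 : q ℕ.^ 2 ≡ q ℕ.* q
  q^2 = cong (q ℕ.*_) (ℕ.*-identityʳ q)
  divisors : All (PrimeDivisor z) (primeDivisors z)
  divisors = all-filter (primeDivisor? z) (upTo (suc ∣ z ∣))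
  primes : All Prime (primeDivisors z)
  primes = All.map proj₁ divisors
  part∣𝒟 : part z 𝒟' ℕ.∣ ∣ 𝒟' ∣
  part∣𝒟 = prime-powers-divide (λ p → ν p 𝒟') (∣ 𝒟' ∣) (primeDivisors z) primes
    (Unique.filter⁺ (primeDivisor? z) (Unique.upTo⁺ (suc ∣ z ∣))) (λ p → maxExponent-divides (∣ 𝒟' ∣) p (∣ 𝒟' ∣))
  q∤part : ¬ q ℕ.∣ part z 𝒟'
  q∤part = prime∤powers q-prime (λ p → ν p 𝒟') (primeDivisors z) primes (All.map (λ { (_ , r∣z) ≡.refl → q∤bm r∣z }) divisors)

-- Fermat's congruence and the Wieferich condition.

module Fermat {p : ℕ} (p-prime : Prime p) where
  open ℤ' using (_^_)
  private
    p>0 : 0 ℕ.< p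
    p>0 = ℕ.<-trans (s≤s z≤n) (prime>1 p-prime)

    frobenius-ℤ : ∀ x y → ∃[ s ] (x ℤ.+ y) ^ p ≡ x ^ p ℤ.+ y ^ p ℤ.+ + p ℤ.* (x ℤ.* s)
    frobenius-ℤ x y = let s , e = Frobenius.frobenius ℤ.+-*-commutativeRing p-prime x y in
      s , ≡.trans e (cong (λ k → x ^ p ℤ.+ y ^ p ℤ.+ k ℤ.* (x ℤ.* s)) (ℤ'-ι (+ p)))

    0^ : ∀ k → 0 ℕ.< k → 0ℤ ^ k ≡ 0ℤ
    0^ (suc k) _ = ℤ.*-zeroˡ (0ℤ ^ k)

    fermat-ℕ : ∀ n → + p ℤ.∣ (+ n) ^ p ℤ.- + n
    fermat-ℕ zero    = ℤ.divides 0ℤ (≡.trans (≡.cong (ℤ._- 0ℤ) (0^ p p>0)) (≡.sym (ℤ.*-zeroˡ (+ p))))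
    fermat-ℕ (suc n) = ≡.subst (+ p ℤ.∣_) (≡.sym eq) (ℤ.∣m∣n⇒∣m+n (fermat-ℕ n) (ℤ.∣m⇒∣m*n (1ℤ ℤ.* s) ℤ.∣-refl))
      where
      s = proj₁ (frobenius-ℤ 1ℤ (+ n))
      eq : (1ℤ ℤ.+ + n) ^ p ℤ.- (1ℤ ℤ.+ + n) ≡ ((+ n) ^ p ℤ.- + n) ℤ.+ + p ℤ.* (1ℤ ℤ.* s)
      eq = ≡.trans (cong (ℤ._- (1ℤ ℤ.+ + n)) (≡.trans (proj₂ (frobenius-ℤ 1ℤ (+ n))) (cong (λ o → o ℤ.+ (+ n) ^ p ℤ.+ + p ℤ.* (1ℤ ℤ.* s)) (ℤ'.1^n≈1 p))))
        (ℤ'.solve 3 (λ N n r → (ℤ'.con 1ℤ ℤ'.:+ N ℤ'.:+ r) ℤ'.:- (ℤ'.con 1ℤ ℤ'.:+ n) ℤ'.:= (N ℤ'.:- n) ℤ'.:+ r) ≡.refl ((+ n) ^ p) (+ n) (+ p ℤ.* (1ℤ ℤ.* s)))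

  fermat : ∀ x → + p ℤ.∣ x ^ p ℤ.- x
  fermat (+ n)    = fermat-ℕ n
  -- Frobenius applied to x + (-x) = 0 gives (-x)^p ≡ - x^p modulo p for every p, 2 included.
  fermat -[1+ n ] = ≡.subst (+ p ℤ.∣_) eq (ℤ.∣m⇒∣-m (ℤ.∣m∣n⇒∣m+n (fermat-ℕ (suc n)) (ℤ.∣m⇒∣m*n (x ℤ.* s) ℤ.∣-refl)))
    where
    x y : ℤ
    x = + suc n
    y = -[1+ n ]
    s = proj₁ (frobenius-ℤ x y)
    sum≡0 : x ^ p ℤ.+ y ^ p ℤ.+ + p ℤ.* (x ℤ.* s) ≡ 0ℤ
    sum≡0 = ≡.trans (≡.sym (proj₂ (frobenius-ℤ x y))) (≡.trans (cong (_^ p) (ℤ.+-inverseʳ x)) (0^ p p>0))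
    rearrange : ∀ X Y r x → ℤ.- (X ℤ.- x ℤ.+ r) ≡ Y ℤ.- (ℤ.- x) ℤ.- (X ℤ.+ Y ℤ.+ r)
    rearrange = ℤ'.solve 4 (λ X Y r x → ℤ'.:- (X ℤ'.:- x ℤ'.:+ r) ℤ'.:= Y ℤ'.:- (ℤ'.:- x) ℤ'.:- (X ℤ'.:+ Y ℤ'.:+ r)) ≡.refl
    eq : ℤ.- (x ^ p ℤ.- x ℤ.+ + p ℤ.* (x ℤ.* s)) ≡ y ^ p ℤ.- y
    eq = ≡.trans (rearrange (x ^ p) (y ^ p) (+ p ℤ.* (x ℤ.* s)) x)
      (≡.trans (cong (λ z → y ^ p ℤ.- y ℤ.- z) sum≡0) (ℤ.+-identityʳ _))

  power-step : ∀ x k → x ^ (p ℕ.^ suc k) ≡ (x ^ (p ℕ.^ k)) ^ p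
  power-step x k = ≡.trans (cong (x ^_) (ℕ.*-comm p (p ℕ.^ k))) (≡.sym (ℤ'.^-assocʳ x (p ℕ.^ k) p))

  fermat-^ : ∀ x k → + p ℤ.∣ x ^ (p ℕ.^ k) ℤ.- x
  fermat-^ x zero    = ℤ.divides 0ℤ (≡.trans (cong (ℤ._- x) (ℤ.*-identityʳ x)) (≡.trans (ℤ.+-inverseʳ x) (≡.sym (ℤ.*-zeroˡ (+ p)))))
  fermat-^ x (suc k) = ≡.subst (λ z → + p ℤ.∣ z ℤ.- x) (≡.sym (power-step x k)) (≡.subst (+ p ℤ.∣_) (telescope (X ^ p) X x) (ℤ.∣m∣n⇒∣m+n (fermat X) (fermat-^ x k)))
    where
    X = x ^ (p ℕ.^ k)
    telescope : ∀ a b c → (a ℤ.- b) ℤ.+ (b ℤ.- c) ≡ a ℤ.- c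
    telescope = ℤ'.solve 3 (λ a b c → (a ℤ'.:- b) ℤ'.:+ (b ℤ'.:- c) ℤ'.:= a ℤ'.:- c) ≡.refl

  -- Expand (t p + x)^p: the correction term of `frobenius` is p times a multiple of t p, and (t
  -- p)^p contains p² because p ≥ 2.
  power-lift : ∀ X x → + p ℤ.∣ X ℤ.- x → + p ℤ.* + p ℤ.∣ X ^ p ℤ.- x ^ p
  power-lift X x (ℤ.divides t e) = ≡.subst (+ p ℤ.* + p ℤ.∣_) (≡.sym eq)
    (ℤ.∣m∣n⇒∣m+n (square p (prime>1 p-prime)) (ℤ.divides (t ℤ.* s) (ℤ'.solve 3 (λ p t s → p ℤ'.:* (t ℤ'.:* p ℤ'.:* s) ℤ'.:= t ℤ'.:* s ℤ'.:* (p ℤ'.:* p)) ≡.refl (+ p) t s)))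
    where
    s = proj₁ (frobenius-ℤ (t ℤ.* + p) x)
    square : ∀ k → 1 ℕ.< k → + p ℤ.* + p ℤ.∣ (t ℤ.* + p) ^ k
    square (suc zero)    (s≤s ())
    square (suc (suc k)) _ = ℤ.divides (t ℤ.* t ℤ.* (t ℤ.* + p) ^ k)
      (ℤ'.solve 3 (λ p t r → (t ℤ'.:* p) ℤ'.:* ((t ℤ'.:* p) ℤ'.:* r) ℤ'.:= t ℤ'.:* t ℤ'.:* r ℤ'.:* (p ℤ'.:* p)) ≡.refl (+ p) t ((t ℤ.* + p) ^ k))
    eq : X ^ p ℤ.- x ^ p ≡ (t ℤ.* + p) ^ p ℤ.+ + p ℤ.* (t ℤ.* + p ℤ.* s)
    eq = ≡.trans (cong (λ z → z ^ p ℤ.- x ^ p) (≡.trans (ℤ'.solve 2 (λ X x → X ℤ'.:= (X ℤ'.:- x) ℤ'.:+ x) ≡.refl X x) (cong (ℤ._+ x) e)))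
      (≡.trans (cong (ℤ._- x ^ p) (proj₂ (frobenius-ℤ (t ℤ.* + p) x)))
        (ℤ'.solve 3 (λ a b c → (a ℤ'.:+ b ℤ'.:+ c) ℤ'.:- b ℤ'.:= a ℤ'.:+ c) ≡.refl ((t ℤ.* + p) ^ p) (x ^ p) (+ p ℤ.* (t ℤ.* + p ℤ.* s))))

  -- The obstruction at a prime dividing gcd (n , m). In the form (-b)^p + b it treats p = 2 and odd
  -- p alike.
  Bad : ℕ → Set
  Bad b = + p ℤ.* + p ℤ.∣ (ℤ.- + b) ^ p ℤ.+ + b

  defect-divisible : ∀ b k → + p ℤ.∣ (ℤ.- + b) ^ (p ℕ.^ k) ℤ.+ + b
  defect-divisible b k = ≡.subst (λ z → + p ℤ.∣ (ℤ.- + b) ^ (p ℕ.^ k) ℤ.+ z) (ℤ.neg-involutive (+ b)) (fermat-^ (ℤ.- + b) k)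

  -- Fermat gives x^(p^k) ≡ x modulo p, and taking p-th powers lifts this to p². So the exponents
  -- p^(k+1) and p yield the same residue modulo p².
  defect⇒Bad : ∀ b k → + p ℤ.* + p ℤ.∣ (ℤ.- + b) ^ (p ℕ.^ suc k) ℤ.+ + b → Bad b
  defect⇒Bad b k d = ≡.subst (+ p ℤ.* + p ℤ.∣_) (cancel (X ^ p) (x ^ p) (+ b)) (ℤ.∣m∣n⇒∣m-n
    (≡.subst (λ z → + p ℤ.* + p ℤ.∣ z ℤ.+ + b) (power-step x k) d) (power-lift X x (fermat-^ x k)))
    where
    x = ℤ.- + b
    X = x ^ (p ℕ.^ k)
    cancel : ∀ a c b → (a ℤ.+ b) ℤ.- (a ℤ.- c) ≡ c ℤ.+ b
    cancel = ℤ'.solve 3 (λ a c b → (a ℤ'.:+ b) ℤ'.:- (a ℤ'.:- c) ℤ'.:= c ℤ'.:+ b) ≡.refl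

  Bad⇒ℕ : ∀ {b N} → ∣ (ℤ.- + b) ^ p ℤ.+ + b ∣ ≡ b ℕ.* N → ¬ p ℕ.∣ b → Bad b → p ℕ.^ 2 ℕ.∣ N
  Bad⇒ℕ {b} {N} e p∤b bad = prime-power-cancel p-prime p∤b 2 N (≡.subst₂ ℕ._∣_ (≡.trans (ℤ.abs-* (+ p) (+ p)) (cong (p ℕ.*_) (≡.sym (ℕ.*-identityʳ p)))) e (ℤ.∣⇒∣ᵤ bad))

  ℕ⇒Bad : ∀ {b N} → ∣ (ℤ.- + b) ^ p ℤ.+ + b ∣ ≡ b ℕ.* N → p ℕ.^ 2 ℕ.∣ N → Bad b
  ℕ⇒Bad {b} {N} e d = ℤ.∣ᵤ⇒∣ (≡.subst₂ ℕ._∣_ (≡.sym (≡.trans (ℤ.abs-* (+ p) (+ p)) (cong (p ℕ.*_) (≡.sym (ℕ.*-identityʳ p))))) (≡.sym e) (ℕ.∣n⇒∣m*n b d))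

  module _ (p-odd : ¬ 2 ℕ.∣ p) where
    private
      neg-square : ∀ x → (ℤ.- x) ^ 2 ≡ x ^ 2
      neg-square = ℤ'.solve 1 (λ x → (ℤ'.:- x) ℤ'.:* ((ℤ'.:- x) ℤ'.:* ℤ'.con 1ℤ) ℤ'.:= x ℤ'.:* (x ℤ'.:* ℤ'.con 1ℤ)) ≡.refl

      p≡1+2k : ∃[ k ] p ≡ suc (2 ℕ.* k)
      p≡1+2k = p ℕ./ 2 , ≡.trans (ℕ.m≡m%n+[m/n]*n p 2) (≡.cong₂ ℕ._+_ (remainder (p ℕ.% 2) (ℕ.m%n<n p 2) (λ e → p-odd (ℕ.m%n≡0⇒n∣m p 2 e))) (ℕ.*-comm (p ℕ./ 2) 2))
        where
        remainder : ∀ r → r ℕ.< 2 → ¬ r ≡ 0 → r ≡ 1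
        remainder zero          _   r≢0 = contradiction ≡.refl r≢0
        remainder (suc zero)    _   _   = ≡.refl
        remainder (suc (suc r)) (s≤s (s≤s ())) _

      neg-odd : ∀ k x → (ℤ.- x) ^ suc (2 ℕ.* k) ≡ ℤ.- (x ^ suc (2 ℕ.* k))
      neg-odd k x = ≡.trans (cong ((ℤ.- x) ℤ.*_) (≡.trans (≡.sym (ℤ'.^-assocʳ (ℤ.- x) 2 k)) (≡.trans (cong (_^ k) (neg-square x)) (ℤ'.^-assocʳ x 2 k))))
        (≡.sym (ℤ.neg-distribˡ-* x (x ^ (2 ℕ.* k))))

    defect-odd : ∀ b → ∣ (ℤ.- + b) ^ p ℤ.+ + b ∣ ≡ b ℕ.* ∣ (+ b) ℤ.^ (p ℕ.∸ 1) ℤ.- 1ℤ ∣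
    defect-odd b = begin
      ∣ (ℤ.- + b) ^ p ℤ.+ + b ∣                        ≡⟨ cong (λ k → ∣ (ℤ.- + b) ^ k ℤ.+ + b ∣) p≡ ⟩
      ∣ (ℤ.- + b) ^ suc (2 ℕ.* k) ℤ.+ + b ∣            ≡⟨ cong (λ z → ∣ z ℤ.+ + b ∣) (neg-odd k (+ b)) ⟩
      ∣ ℤ.- (+ b ℤ.* (+ b) ^ (2 ℕ.* k)) ℤ.+ + b ∣      ≡⟨ cong ∣_∣ (factor (+ b) ((+ b) ^ (2 ℕ.* k))) ⟩
      ∣ ℤ.- (+ b ℤ.* ((+ b) ^ (2 ℕ.* k) ℤ.- 1ℤ)) ∣     ≡⟨ ≡.trans (ℤ.∣-i∣≡∣i∣ (+ b ℤ.* ((+ b) ^ (2 ℕ.* k) ℤ.- 1ℤ))) (ℤ.abs-* (+ b) ((+ b) ^ (2 ℕ.* k) ℤ.- 1ℤ)) ⟩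
      b ℕ.* ∣ (+ b) ^ (2 ℕ.* k) ℤ.- 1ℤ ∣               ≡⟨ cong (λ z → b ℕ.* ∣ z ℤ.- 1ℤ ∣) (≡.trans (ℤ'-^ (+ b) (2 ℕ.* k)) (cong (λ k → (+ b) ℤ.^ (k ℕ.∸ 1)) (≡.sym p≡))) ⟩
      b ℕ.* ∣ (+ b) ℤ.^ (p ℕ.∸ 1) ℤ.- 1ℤ ∣             ∎
      where
      open ≡.≡-Reasoning
      k = proj₁ p≡1+2k
      p≡ = proj₂ p≡1+2k
      factor : ∀ b c → ℤ.- (b ℤ.* c) ℤ.+ b ≡ ℤ.- (b ℤ.* (c ℤ.- 1ℤ))
      factor = ℤ'.solve 2 (λ b c → ℤ'.:- (b ℤ'.:* c) ℤ'.:+ b ℤ'.:= ℤ'.:- (b ℤ'.:* (c ℤ'.:- ℤ'.con 1ℤ))) ≡.refl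

    Bad⇒Wieferich : ∀ {b} → ¬ p ℕ.∣ b → Bad b → WieferichPrime b p
    Bad⇒Wieferich {b} p∤b bad = p-prime , Bad⇒ℕ {b} (defect-odd b) p∤b bad

    Wieferich⇒Bad : ∀ {b} → WieferichPrime b p → Bad b
    Wieferich⇒Bad {b} (_ , d) = ℕ⇒Bad {b} (defect-odd b) d

module _ (2-prime : Prime 2) where
  open Fermat 2-prime
    using (Bad; Bad⇒ℕ; ℕ⇒Bad)
  private
    defect-2 : ∀ b → ∣ (ℤ.- + b) ℤ'.^ 2 ℤ.+ + b ∣ ≡ b ℕ.* suc b
    defect-2 b = ≡.trans (cong ∣_∣ (factor (+ b))) (ℤ.abs-* (+ b) (+ suc b))
      where
      factor : ∀ x → (ℤ.- x) ℤ'.^ 2 ℤ.+ x ≡ x ℤ.* (1ℤ ℤ.+ x)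
      factor = ℤ'.solve 1 (λ x → (ℤ'.:- x) ℤ'.:* ((ℤ'.:- x) ℤ'.:* ℤ'.con 1ℤ) ℤ'.:+ x ℤ'.:= x ℤ'.:* (ℤ'.con 1ℤ ℤ'.:+ x)) ≡.refl

  -- The defect at 2 is b (b + 1), so for odd b it is bad when 4 ∣ b + 1; together with 4 ∣ b - 1
  -- this would give 4 ∣ 2.
  Bad-2⇒≢1 : ∀ {b} → 0 ℕ.< b → ¬ 2 ℕ.∣ b → Bad b → ¬ (+ b ≡ 1ℤ [mod 4 ])
  Bad-2⇒≢1 {suc c} _ b-odd bad 4∣c = contradiction (ℕ.∣⇒≤ 4∣2) λ { (s≤s (s≤s ())) }
    where
    4∣2 : 4 ℕ.∣ 2
    4∣2 = ℕ.∣m+n∣m⇒∣n (≡.subst (4 ℕ.∣_) (ℕ.+-comm 2 c) (Bad⇒ℕ {suc c} {suc (suc c)} (defect-2 (suc c)) b-odd bad)) 4∣c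

  -- The residues 0 and 2 modulo 4 contradict b odd, and the residue 3 makes 4 divide b + 1.
  ¬Bad-2⇒≡1 : ∀ {b} → ¬ 2 ℕ.∣ b → ¬ Bad b → + b ≡ 1ℤ [mod 4 ]
  ¬Bad-2⇒≡1 {b} b-odd ¬bad = go (b ℕ.% 4) (ℕ.m%n<n b 4) (ℕ.m≡m%n+[m/n]*n b 4)
    where
    k = b ℕ./ 4
    2∣k*4 : 2 ℕ.∣ k ℕ.* 4
    2∣k*4 = ℕ.∣n⇒∣m*n k (divides 2 ≡.refl)
    go : ∀ r → r ℕ.< 4 → b ≡ r ℕ.+ k ℕ.* 4 → + b ≡ 1ℤ [mod 4 ]
    go 0 _ e = contradiction (≡.subst (2 ℕ.∣_) (≡.sym e) 2∣k*4) b-odd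
    go 1 _ e = ≡.subst (λ b → + b ≡ 1ℤ [mod 4 ]) (≡.sym e) (divides k ≡.refl)
    go 2 _ e = contradiction (≡.subst (2 ℕ.∣_) (≡.sym e) (ℕ.∣m∣n⇒∣m+n ℕ.∣-refl 2∣k*4)) b-odd
    go 3 _ e = contradiction (ℕ⇒Bad {b} {suc b} (defect-2 b) (divides (suc k) (cong suc e))) ¬bad
    go (suc (suc (suc (suc r)))) (s≤s (s≤s (s≤s (s≤s ())))) _

-- The two implications.

split-power : ∀ {q} → Prime q → ∀ k n → n ℕ.≤ k → 0 ℕ.< n → ∃[ e ] ∃[ n' ] n ≡ q ℕ.^ e ℕ.* n' × ¬ q ℕ.∣ n'
split-power q-prime zero    n n≤0 0<n = contradiction 0<n (ℕ.≤⇒≯ n≤0)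
split-power {q} q-prime (suc k) n n≤k 0<n with q ℕ.∣? n
... | no  q∤n = 0 , n , ≡.sym (ℕ.+-identityʳ n) , q∤n
... | yes (divides t ≡.refl) with split-power q-prime k t (ℕ.≤-pred (ℕ.<-≤-trans t<tq n≤k)) 0<t
  where
  0<t : 0 ℕ.< t
  0<t = ℕ.n≢0⇒n>0 λ { ≡.refl → contradiction 0<n λ () }
  t<tq : t ℕ.< t ℕ.* q
  t<tq = ℕ.m<m*n t q {{ℕ.>-nonZero 0<t}} (prime>1 q-prime)
...   | e , n' , t≡ , q∤n' = suc e , n' , ≡.trans (ℕ.*-comm t q) (≡.trans (cong (q ℕ.*_) t≡) (≡.sym (ℕ.*-assoc q (q ℕ.^ e) n'))) , q∤n'

prime-divisor : ∀ n → 2 ≤ n → ∃[ p ] Prime p × p ℕ.∣ n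
prime-divisor n 2≤n = go (factors fac) (isFactorisation fac) (factorsPrime fac)
  where
  open PrimeFactorisation
  fac = factorise n {{ℕ.>-nonZero (ℕ.<-trans (s≤s z≤n) 2≤n)}}
  go : ∀ ps → n ≡ product ps → All Prime ps → ∃[ p ] Prime p × p ℕ.∣ n
  go []       n≡1 _             = contradiction (≡.subst (2 ≤_) n≡1 2≤n) λ { (s≤s ()) }
  go (p ∷ ps) n≡  (p-prime ∷ _) = p , p-prime , ≡.subst (p ℕ.∣_) (≡.sym n≡) (ℕ.m∣m*n (product ps))

module Proof (n-1 b : ℕ) (m : ℤ) (2≤n-1 : 2 ≤ n-1) (2≤b : 2 ≤ b)
             (b⊥m : gcd b (∣ m ∣) ≡ 1) (b-squarefree : Squarefree b) (d-squarefree : Squarefree (d (suc n-1) b m)) where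
  private
    n = suc n-1
    M = m ℤ.^ 2
  open LocalCases (+ b) M n-1 using (F; F-monic; Maximal; module I)

  f′≈F : ℱ n b m Z.≈ F
  f′≈F = ℱ≈F n-1 b m

  not-both : ∀ {q} → Prime q → q ℕ.∣ b → q ℕ.∣ ∣ m ∣ → ⊥
  not-both q-prime q∣b q∣m = ℕ.<⇒≱ (prime>1 q-prime) (ℕ.∣⇒≤ (≡.subst (_ ℕ.∣_) b⊥m (ℕ.gcd-greatest q∣b q∣m)))

  M-factor : ∀ {q} → q ℕ.∣ ∣ m ∣ → ∃[ μ ] M ≡ μ ℤ.* + q ℤ.* + q
  M-factor {q} q∣m = t ℤ.* t , ≡.trans (cong (ℤ._^ 2) (ℤ._∣_.equality q∣m'))
    (ℤ'.solve 2 (λ t q → (t ℤ'.:* q) ℤ'.:* ((t ℤ'.:* q) ℤ'.:* ℤ'.con 1ℤ) ℤ'.:= (t ℤ'.:* t) ℤ'.:* q ℤ'.:* q) ≡.refl t (+ q))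
    where
    q∣m' : + q ℤ.∣ m
    q∣m' = ℤ.∣ᵤ⇒∣ q∣m
    t = ℤ._∣_.quotient q∣m'

  module _ {q : ℕ} (q-prime : Prime q) where
    open Fermat q-prime using (Bad; defect-divisible; defect⇒Bad)
    private
      square-factor : ∀ {x u} → x ≡ u ℤ.* + q → + q ℤ.∣ u → + q ℤ.* + q ℤ.∣ x
      square-factor x≡ q∣u = ≡.subst (+ q ℤ.* + q ℤ.∣_) (≡.sym x≡) (ℤ.*-monoˡ-∣ (+ q) q∣u)

      q²∤b : ¬ (+ q ℤ.* + q ℤ.∣ + b)
      q²∤b q²∣b = ℕ.<⇒≢ (prime>1 q-prime) (≡.sym (b-squarefree q (≡.subst (ℕ._∣ b) (ℤ.abs-* (+ q) (+ q)) (ℤ.∣⇒∣ᵤ q²∣b))))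

    module DividingB (q∣b : q ℕ.∣ b) where
      q∣b' : + q ℤ.∣ + b
      q∣b' = ℤ.∣ᵤ⇒∣ q∣b
      open PrimeDividingB (+ b) M n-1 q-prime (ℤ._∣_.quotient q∣b') (ℤ._∣_.equality q∣b')
        (λ q∣β → q²∤b (square-factor (ℤ._∣_.equality q∣b') q∣β)) public using (F≈Xⁿ; maximal-at-divisor-of-b)

    irreducible : q ℕ.∣ b → ℚ[X].Irreducible (toℚ[X] (ℱ n b m))
    irreducible q∣b = Eisenstein.irreducible F-monic (s≤s z≤n) q-prime (DividingB.F≈Xⁿ q∣b)
      (λ q²∣F₀ → q²∤b (≡.subst (+ q ℤ.* + q ℤ.∣_) (constant-term (+ b) M n-1) q²∣F₀)) (ℱ n b m) f′≈F

    maximal-dividing-m : ¬ q ℕ.∣ b → q ℕ.∣ ∣ m ∣ → (q ℕ.∣ n → ¬ Bad b) → Maximal q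
    maximal-dividing-m q∤b q∣m not-bad = go (split-power q-prime n n ℕ.≤-refl (s≤s z≤n))
      where
      go : ∃[ k ] ∃[ n' ] n ≡ q ℕ.^ k ℕ.* n' × ¬ q ℕ.∣ n' → Maximal q
      go (k , n' , n≡ , q∤n') = PrimeDividingM.maximal-at-divisor-of-M (+ b) M n-1 q-prime (proj₁ (M-factor q∣m)) (proj₂ (M-factor q∣m)) k n' n≡
        (λ d → q∤b (ℤ.∣⇒∣ᵤ d)) q∤n' (ℤ._∣_.quotient defect) (ℤ._∣_.equality defect) (good k n≡ defect)
        where
        defect = defect-divisible b k
        good : ∀ k → n ≡ q ℕ.^ k ℕ.* n' → (δ : + q ℤ.∣ (ℤ.- + b) ℤ'.^ (q ℕ.^ k) ℤ.+ + b) → k ≡ 0 ⊎ ¬ (+ q ℤ.∣ ℤ._∣_.quotient δ)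
        good zero    _  _ = inj₁ ≡.refl
        -- A positive k means q ∣ n, and q² ∣ (-b)^(q^k) + b with k ≥ 1 would imply the same for the
        -- exponent q.
        good (suc k) n≡ δ = inj₂ λ q∣c₀ → not-bad
          (≡.subst (q ℕ.∣_) (≡.sym n≡) (ℕ.∣m⇒∣m*n n' (ℕ.m∣m*n (q ℕ.^ k))))
          (defect⇒Bad b k (square-factor (ℤ._∣_.equality δ) q∣c₀))

    maximal-coprime : ¬ q ℕ.∣ b → ¬ q ℕ.∣ ∣ m ∣ → Maximal q
    maximal-coprime q∤b q∤m = go (+ q ℤ.∣? I.Discriminant)
      where
      q∤b' : ¬ (+ q ℤ.∣ + b)
      q∤b' d = q∤b (ℤ.∣⇒∣ᵤ d)
      q∤M : ¬ (+ q ℤ.∣ M)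
      q∤M d = q∤m (ℤ.∣⇒∣ᵤ (prime∣^ q-prime m 2 d))
      q∤bm : ¬ q ℕ.∣ ∣ + b ℤ.* m ∣
      q∤bm d = [ q∤b , q∤m ]′ (euclidsLemma b (∣ m ∣) q-prime (≡.subst (q ℕ.∣_) (ℤ.abs-* (+ b) m) d))
      q²∤disc : ¬ (+ q ℤ.* + q ℤ.∣ I.Discriminant)
      q²∤disc d' = ℕ.<⇒≢ (prime>1 q-prime) (≡.sym (d-squarefree q (square-divides-d n b m q-prime q∤bm
        (≡.subst (+ q ℤ.* + q ℤ.∣_) (≡.sym (𝒟≡Discriminant n-1 b m)) d'))))
      go : Dec (+ q ℤ.∣ I.Discriminant) → Maximal q
      go (no  q∤disc) = LocalCases.AtPrime.maximal-at-nondivisor (+ b) M n-1 q-prime 2≤n-1 q∤b' q∤disc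
      go (yes q∣disc) = SimpleDivisor.maximal-at-simple-divisor (+ b) M n-1 2≤n-1 q-prime q∤b' q∤M q∣disc q²∤disc

    maximal-everywhere : (q ℕ.∣ n → q ℕ.∣ ∣ m ∣ → ¬ Bad b) → Maximal q
    maximal-everywhere not-bad = go (q ℕ.∣? b) (q ℕ.∣? ∣ m ∣)
      where
      go : Dec (q ℕ.∣ b) → Dec (q ℕ.∣ ∣ m ∣) → Maximal q
      go (yes q∣b) _         = DividingB.maximal-at-divisor-of-b q∣b
      go (no  q∤b) (yes q∣m) = maximal-dividing-m q∤b q∣m (λ q∣n → not-bad q∣n q∣m)
      go (no  q∤b) (no  q∤m) = maximal-coprime q∤b q∤m

    monogenic⇒¬Bad : Monogenic (ℱ n b m) → q ℕ.∣ n → q ℕ.∣ ∣ m ∣ → ¬ Bad b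
    monogenic⇒¬Bad monogenic (divides n' n≡) q∣m bad = NonMaximal.not-monogenic (+ b) M n-1 q-prime (proj₁ (M-factor q∣m)) (proj₂ (M-factor q∣m))
      n' (≡.trans n≡ (≡.trans (ℕ.*-comm n' q) (cong (ℕ._* n') (≡.sym (ℕ.*-identityʳ q))))) c₁ defect≡ (ℱ n b m) f′≈F monogenic
      where
      c₁ = ℤ._∣_.quotient bad
      defect≡ : (ℤ.- + b) ℤ'.^ (q ℕ.^ 1) ℤ.+ + b ≡ c₁ ℤ.* + q ℤ.* + q
      defect≡ = ≡.trans (cong (λ k → (ℤ.- + b) ℤ'.^ k ℤ.+ + b) (ℕ.*-identityʳ q)) (≡.trans (ℤ._∣_.equality bad) (≡.sym (ℤ.*-assoc c₁ (+ q) (+ q))))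

  all-good⇒monogenic : (∀ q (q-prime : Prime q) → q ℕ.∣ n → q ℕ.∣ ∣ m ∣ → ¬ Fermat.Bad q-prime b) → Monogenic (ℱ n b m)
  all-good⇒monogenic good = record
    { degree = n
    ; monic = Z.leading ℱ-monic , Z.above ℱ-monic
    ; irreducible = let p , p-prime , p∣b = prime-divisor b 2≤b in irreducible p-prime p∣b
    ; powerBasis = NumberField.isℤBasis F-monic (ℱ n b m) f′≈F (λ q q-prime → maximal-everywhere q-prime (good q q-prime)) (s≤s z≤n)
    }
    where
    ℱ-monic : Z.Monic n (ℱ n b m)
    ℱ-monic = Z.Top-cong (Z.sym f′≈F) ≡.refl F-monic

  WieferichConditions : Set
  WieferichConditions = (∀ p → Prime p → ¬ (2 ℕ.∣ p) → p ℕ.∣ gcd n (∣ m ∣) → ¬ WieferichPrime b p)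
                      × (2 ℕ.∣ gcd n (∣ m ∣) → + b ≡ 1ℤ [mod 4 ])

  private
    to-gcd : ∀ {q} → q ℕ.∣ gcd n (∣ m ∣) → q ℕ.∣ n × q ℕ.∣ ∣ m ∣
    to-gcd d = ℕ.∣-trans d (ℕ.gcd[m,n]∣m n (∣ m ∣)) , ℕ.∣-trans d (ℕ.gcd[m,n]∣n n (∣ m ∣))

  monogenic⇒conditions : Monogenic (ℱ n b m) → WieferichConditions
  monogenic⇒conditions monogenic =
    (λ p p-prime p-odd p∣gcd wieferich → monogenic⇒¬Bad p-prime monogenic (proj₁ (to-gcd p∣gcd)) (proj₂ (to-gcd p∣gcd))
      (Fermat.Wieferich⇒Bad p-prime p-odd wieferich)) ,
    (λ 2∣gcd → ¬Bad-2⇒≡1 prime[2] (λ 2∣b → not-both prime[2] 2∣b (proj₂ (to-gcd 2∣gcd)))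
      (monogenic⇒¬Bad prime[2] monogenic (proj₁ (to-gcd 2∣gcd)) (proj₂ (to-gcd 2∣gcd))))

  conditions⇒monogenic : WieferichConditions → Monogenic (ℱ n b m)
  conditions⇒monogenic (odd-good , two-good) = all-good⇒monogenic good
    where
    good : ∀ q (q-prime : Prime q) → q ℕ.∣ n → q ℕ.∣ ∣ m ∣ → ¬ Fermat.Bad q-prime b
    good q q-prime q∣n q∣m bad = go (2 ℕ.∣? q)
      where
      q∤b : ¬ q ℕ.∣ b
      q∤b q∣b = not-both q-prime q∣b q∣m
      at-two : ∀ {q} (q-prime : Prime q) → 2 ≡ q → q ℕ.∣ gcd n (∣ m ∣) → ¬ q ℕ.∣ b → ¬ Fermat.Bad q-prime b
      at-two q-prime ≡.refl 2∣gcd 2∤b bad = Bad-2⇒≢1 q-prime (ℕ.<-trans (s≤s z≤n) 2≤b) 2∤b bad (two-good 2∣gcd)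
      go : Dec (2 ℕ.∣ q) → ⊥
      go (no  q-odd) = odd-good q q-prime q-odd (ℕ.gcd-greatest q∣n q∣m) (Fermat.Bad⇒Wieferich q-prime q-odd q∤b bad)
      go (yes 2∣q)   = at-two q-prime (prime∣prime prime[2] q-prime 2∣q) (ℕ.gcd-greatest q∣n q∣m) q∤b bad

open import Data.Nat.Divisibility using (_∣_)

theorem1p3 : (n b : ℕ) (m : ℤ) →
    3 ≤ n → 2 ≤ ∣ m ∣ → 2 ≤ b →
    gcd b (∣ m ∣) ≡ 1 →
    Squarefree b →
    Squarefree (d n b m) →
    Monogenic (ℱ n b m)
    ⇔
    ( (∀ p → Prime p → ¬ (2 ∣ p) → p ∣ gcd n (∣ m ∣) → ¬ WieferichPrime b p)
    × (2 ∣ gcd n (∣ m ∣) → + b ≡ 1ℤ [mod 4 ]) )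
theorem1p3 (suc n-1) b m (s≤s 2≤n-1) _ 2≤b b⊥m b-squarefree d-squarefree = mk⇔ monogenic⇒conditions conditions⇒monogenic
  where open Proof n-1 b m 2≤n-1 2≤b b⊥m b-squarefree d-squarefree using (monogenic⇒conditions; conditions⇒monogenic)
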